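{- For all real $t>0$, the functions $A(t) = -t^2 \phi_0(i/t) - \frac{36}{\pi^2}\psi_I(it)$ and $B(t) = -t^2\phi_0(i/t) + \frac{36}{\pi^2}\psi_I(it)$ satisfy $$A(t) < 0 \qquad\text{and}\qquad B(t) > 0 .$$
   Context: Let $z$ be a complex variable in the upper half plane and put $q = e^{\pi i z}$ (so that $q^{1/4}$ is understood as $e^{\pi i z/4}$, and so on). Let $\sigma_\alpha(n) = \sum_{d\mid n} d^\alpha$. Define the Eisenstein series $$E_2(z) = 1 - 24\sum_{n=1}^\infty \sigma_1(n) q^{2n},\quad E_4(z) = 1 + 240\sum_{n=1}^\infty \sigma_3(n) q^{2n},\quad E_6(z) = 1 - 504\sum_{n=1}^\infty \sigma_5(n) q^{2n},$$ and the Jacobi thetanull functions $$\theta_2(z) = \sum_{n=-\infty}^\infty q^{(n+1/2)^2},\quad \theta_3(z) = \sum_{n=-\infty}^\infty q^{n^2},\quad \theta_4(z) = \sum_{n=-\infty}^\infty (-1)^n q^{n^2}.$$ Define $$\phi_0(z) = 1728\,\frac{(E_2(z)E_4(z) - E_6(z))^2}{E_4(z)^3 - E_6(z)^2},$$ $$\psi_I(z) = 128\left(\frac{\theta_3(z)^4+\theta_4(z)^4}{\theta_2(z)^8} + \frac{\theta_4(z)^4 - \theta_2(z)^4}{\theta_3(z)^8}\right).$$ On the positive imaginary axis these functions take real values, so $A(t)$ and $B(t)$ are real for $t>0$. -}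

module Defs where

open import Data.Integer.Base as ℤ using (ℤ; +_; -[1+_])
open import Data.List.Base using (applyUpTo; filter; map)
open import Data.Nat.Base as ℕ using (ℕ; zero; suc; _!)
open import Data.Nat.Divisibility using (_∣?_)
open import Data.Nat.ListAction using (sum)
open import Data.Nat.Properties as ℕₚ using (_!≢0)
open import Data.Product.Base using (Σ-syntax; ∃-syntax; _×_; _,_)
open import Data.Rational.Base as ℚ using (ℚ; 0ℚ; 1ℚ; ½; _/_; ∣_∣; Positive; positive; 1/_)
open import Data.Rational.Properties as ℚₚ
open import Data.Rational.Solver using (module +-*-Solver)
open import Data.Sum.Base using (_⊎_)
open import Function.Base using (_∘_)
open import Relation.Binary.PropositionalEquality using (_≡_; refl; sym; trans; cong; cong₂; subst)

infix  4 _<ℝ_ _≈ℝ_ _≈ℂ_ _⟶_ _⇓_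
infixl 6 _+ℝ_ _-ℝ_ _+ℂ_ _⊕_ _⊖_
infixl 7 _*ℝ_ _*ℂ_ _⊗_ _⊘_
infix  8 -ℝ_ ⊖_
infixr 9 _↑_

-- Real numbers: Cauchy sequences of rationals.  The modulus of
-- convergence is part of the data, as in constructive analysis.

IsCauchy : (ℕ → ℚ) → Set
IsCauchy x = ∀ ε → 0ℚ ℚ.< ε →
  ∃[ N ] (∀ m n → N ℕ.≤ m → N ℕ.≤ n → ∣ x m ℚ.- x n ∣ ℚ.< ε)

record ℝ : Set where
  constructor mkℝ
  field
    seq    : ℕ → ℚ
    cauchy : IsCauchy seq

open ℝ public

_≈ℝ_ : ℝ → ℝ → Set
x ≈ℝ y = ∀ ε → 0ℚ ℚ.< ε →
  ∃[ N ] (∀ n → N ℕ.≤ n → ∣ seq x n ℚ.- seq y n ∣ ℚ.< ε)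

_<ℝ_ : ℝ → ℝ → Set
x <ℝ y = ∃[ ε ] (0ℚ ℚ.< ε ×
  ∃[ N ] (∀ n → N ℕ.≤ n → seq x n ℚ.+ ε ℚ.≤ seq y n))

private
  half-pos : ∀ {ε} → 0ℚ ℚ.< ε → 0ℚ ℚ.< ε ℚ.* ½
  half-pos {ε} 0<ε = positive⁻¹ (ε ℚ.* ½) {{pos*pos⇒pos ε {{positive 0<ε}} ½}}

  half+half : ∀ ε → ε ℚ.* ½ ℚ.+ ε ℚ.* ½ ≡ ε
  half+half ε = trans (sym (ℚₚ.*-distribˡ-+ ε ½ ½)) (ℚₚ.*-identityʳ ε)

  abstract
    +-lemma : ∀ a b c d → (a ℚ.+ b) ℚ.- (c ℚ.+ d) ≡ (a ℚ.- c) ℚ.+ (b ℚ.- d)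
    +-lemma = solve 4 (λ a b c d → (a :+ b) :- (c :+ d) := (a :- c) :+ (b :- d)) refl
      where open +-*-Solver

    neg-lemma : ∀ a b → ℚ.- a ℚ.- ℚ.- b ≡ ℚ.- (a ℚ.- b)
    neg-lemma = solve 2 (λ a b → (:- a) :- (:- b) := :- (a :- b)) refl
      where open +-*-Solver

    *-lemma : ∀ a b c d → a ℚ.* b ℚ.- c ℚ.* d ≡ a ℚ.* (b ℚ.- d) ℚ.+ d ℚ.* (a ℚ.- c)
    *-lemma = solve 4 (λ a b c d → a :* b :- c :* d := a :* (b :- d) :+ d :* (a :- c)) refl
      where open +-*-Solver

    split-lemma : ∀ a b → a ≡ (a ℚ.- b) ℚ.+ b
    split-lemma = solve 2 (λ a b → a := (a :- b) :+ b) refl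
      where open +-*-Solver

  const-cauchy : ∀ r → IsCauchy (λ _ → r)
  const-cauchy r ε 0<ε = 0 , λ _ _ _ _ →
    subst (ℚ._< ε) (sym (cong ∣_∣ (ℚₚ.+-inverseʳ r))) 0<ε

  +-cauchy : ∀ {x y} → IsCauchy x → IsCauchy y → IsCauchy (λ n → x n ℚ.+ y n)
  +-cauchy {x} {y} cx cy ε 0<ε with cx (ε ℚ.* ½) (half-pos 0<ε) | cy (ε ℚ.* ½) (half-pos 0<ε)
  ... | M , p | N , q = M ℕ.⊔ N , λ m n hm hn → begin-strict
    ∣ (x m ℚ.+ y m) ℚ.- (x n ℚ.+ y n) ∣    ≡⟨ cong ∣_∣ (+-lemma (x m) (y m) (x n) (y n)) ⟩
    ∣ (x m ℚ.- x n) ℚ.+ (y m ℚ.- y n) ∣    ≤⟨ ∣p+q∣≤∣p∣+∣q∣ (x m ℚ.- x n) (y m ℚ.- y n) ⟩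
    ∣ x m ℚ.- x n ∣ ℚ.+ ∣ y m ℚ.- y n ∣    <⟨ ℚₚ.+-mono-<
      (p m n (ℕₚ.m⊔n≤o⇒m≤o M N hm) (ℕₚ.m⊔n≤o⇒m≤o M N hn))
      (q m n (ℕₚ.m⊔n≤o⇒n≤o M N hm) (ℕₚ.m⊔n≤o⇒n≤o M N hn)) ⟩
    ε ℚ.* ½ ℚ.+ ε ℚ.* ½                    ≡⟨ half+half ε ⟩
    ε                                      ∎
    where open ≤-Reasoning

  neg-cauchy : ∀ {x} → IsCauchy x → IsCauchy (λ n → ℚ.- x n)
  neg-cauchy {x} cx ε 0<ε with cx ε 0<ε
  ... | N , p = N , λ m n hm hn → subst (ℚ._< ε)
    (sym (trans (cong ∣_∣ (neg-lemma (x m) (x n))) (∣-p∣≡∣p∣ (x m ℚ.- x n)))) (p m n hm hn)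

  bounded : ∀ {x} → IsCauchy x →
    ∃[ B ] (0ℚ ℚ.< B × ∃[ N ] (∀ n → N ℕ.≤ n → ∣ x n ∣ ℚ.≤ B))
  bounded {x} cx with cx 1ℚ (positive⁻¹ 1ℚ)
  ... | N , p = 1ℚ ℚ.+ ∣ x N ∣
              , ℚₚ.+-mono-<-≤ (positive⁻¹ 1ℚ) (0≤∣p∣ (x N))
              , N , λ n hn → begin
    ∣ x n ∣                            ≡⟨ cong ∣_∣ (split-lemma (x n) (x N)) ⟩
    ∣ (x n ℚ.- x N) ℚ.+ x N ∣          ≤⟨ ∣p+q∣≤∣p∣+∣q∣ (x n ℚ.- x N) (x N) ⟩
    ∣ x n ℚ.- x N ∣ ℚ.+ ∣ x N ∣        ≤⟨ ℚₚ.+-monoˡ-≤ ∣ x N ∣ (<⇒≤ (p n N hn ℕₚ.≤-refl)) ⟩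
    1ℚ ℚ.+ ∣ x N ∣                     ∎
    where open ≤-Reasoning

  scale : ∀ {B ε} → 0ℚ ℚ.< B → 0ℚ ℚ.< ε →
    ∃[ δ ] (0ℚ ℚ.< δ × B ℚ.* δ ≡ ε)
  scale {B} {ε} 0<B 0<ε = (1/ B) ℚ.* ε
    , positive⁻¹ _ {{pos*pos⇒pos (1/ B) {{1/pos⇒pos B}} ε}}
    , trans (sym (ℚₚ.*-assoc B (1/ B) ε))
        (trans (cong (ℚ._* ε) (ℚₚ.*-inverseʳ B)) (ℚₚ.*-identityˡ ε))
    where
    instance
      _ = positive 0<B
      _ = positive 0<ε
      _ = pos⇒nonZero B

  product-bound : ∀ {B δ} a b → 0ℚ ℚ.< B → ∣ a ∣ ℚ.≤ B → ∣ b ∣ ℚ.< δ →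
    ∣ a ℚ.* b ∣ ℚ.< B ℚ.* δ
  product-bound {B} {δ} a b 0<B a≤B b<δ = begin-strict
    ∣ a ℚ.* b ∣        ≡⟨ ∣p*q∣≡∣p∣*∣q∣ a b ⟩
    ∣ a ∣ ℚ.* ∣ b ∣    ≤⟨ *-monoʳ-≤-nonNeg ∣ b ∣ {{∣-∣-nonNeg b}} a≤B ⟩
    B ℚ.* ∣ b ∣        <⟨ *-monoʳ-<-pos B {{positive 0<B}} b<δ ⟩
    B ℚ.* δ            ∎
    where open ≤-Reasoning

  *-cauchy : ∀ {x y} → IsCauchy x → IsCauchy y → IsCauchy (λ n → x n ℚ.* y n)
  *-cauchy {x} {y} cx cy ε 0<ε
    with bounded cx | bounded cy
  ... | B , 0<B , K , bx | C , 0<C , L , by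
    with scale 0<B (half-pos 0<ε) | scale 0<C (half-pos 0<ε)
  ... | δ , 0<δ , Bδ | η , 0<η , Cη
    with cy δ 0<δ | cx η 0<η
  ... | M , p | N , q = (K ℕ.⊔ L) ℕ.⊔ (M ℕ.⊔ N) , λ m n hm hn →
    let hKm = ℕₚ.m⊔n≤o⇒m≤o K L (ℕₚ.m⊔n≤o⇒m≤o (K ℕ.⊔ L) (M ℕ.⊔ N) hm)
        hLn = ℕₚ.m⊔n≤o⇒n≤o K L (ℕₚ.m⊔n≤o⇒m≤o (K ℕ.⊔ L) (M ℕ.⊔ N) hn)
        hm′ = ℕₚ.m⊔n≤o⇒n≤o (K ℕ.⊔ L) (M ℕ.⊔ N) hm
        hn′ = ℕₚ.m⊔n≤o⇒n≤o (K ℕ.⊔ L) (M ℕ.⊔ N) hn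
    in begin-strict
    ∣ x m ℚ.* y m ℚ.- x n ℚ.* y n ∣
      ≡⟨ cong ∣_∣ (*-lemma (x m) (y m) (x n) (y n)) ⟩
    ∣ x m ℚ.* (y m ℚ.- y n) ℚ.+ y n ℚ.* (x m ℚ.- x n) ∣
      ≤⟨ ∣p+q∣≤∣p∣+∣q∣ (x m ℚ.* (y m ℚ.- y n)) (y n ℚ.* (x m ℚ.- x n)) ⟩
    ∣ x m ℚ.* (y m ℚ.- y n) ∣ ℚ.+ ∣ y n ℚ.* (x m ℚ.- x n) ∣
      <⟨ ℚₚ.+-mono-<
           (product-bound (x m) (y m ℚ.- y n) 0<B (bx m hKm)
             (p m n (ℕₚ.m⊔n≤o⇒m≤o M N hm′) (ℕₚ.m⊔n≤o⇒m≤o M N hn′)))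
           (product-bound (y n) (x m ℚ.- x n) 0<C (by n hLn)
             (q m n (ℕₚ.m⊔n≤o⇒n≤o M N hm′) (ℕₚ.m⊔n≤o⇒n≤o M N hn′))) ⟩
    B ℚ.* δ ℚ.+ C ℚ.* η
      ≡⟨ cong₂ ℚ._+_ Bδ Cη ⟩
    ε ℚ.* ½ ℚ.+ ε ℚ.* ½
      ≡⟨ half+half ε ⟩
    ε ∎
    where open ≤-Reasoning

fromℚ : ℚ → ℝ
fromℚ r = mkℝ (λ _ → r) (const-cauchy r)

0ℝ : ℝ
0ℝ = fromℚ 0ℚ

_+ℝ_ _*ℝ_ : ℝ → ℝ → ℝ
x +ℝ y = mkℝ (λ n → seq x n ℚ.+ seq y n) (+-cauchy {seq x} {seq y} (cauchy x) (cauchy y))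
x *ℝ y = mkℝ (λ n → seq x n ℚ.* seq y n) (*-cauchy {seq x} {seq y} (cauchy x) (cauchy y))

-ℝ_ : ℝ → ℝ
-ℝ x = mkℝ (λ n → ℚ.- seq x n) (neg-cauchy {seq x} (cauchy x))

_-ℝ_ : ℝ → ℝ → ℝ
x -ℝ y = x +ℝ (-ℝ y)

record ℂ : Set where
  constructor _+i_
  field
    re : ℝ
    im : ℝ

open ℂ public

fromℝ : ℝ → ℂ
fromℝ x = x +i 0ℝ

_≈ℂ_ : ℂ → ℂ → Set
z ≈ℂ w = (re z ≈ℝ re w) × (im z ≈ℝ im w)

_+ℂ_ _*ℂ_ : ℂ → ℂ → ℂ
z +ℂ w = (re z +ℝ re w) +i (im z +ℝ im w)
z *ℂ w = (re z *ℝ re w -ℝ im z *ℝ im w) +i (re z *ℝ im w +ℝ im z *ℝ re w)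

-ℂ_ : ℂ → ℂ
-ℂ z = (-ℝ re z) +i (-ℝ im z)

-- Apartness from zero, the constructive form of "z ≠ 0".
NonZeroℝ : ℝ → Set
NonZeroℝ x = (x <ℝ 0ℝ) ⊎ (0ℝ <ℝ x)

NonZeroℂ : ℂ → Set
NonZeroℂ z = NonZeroℝ (re z) ⊎ NonZeroℝ (im z)

∣_-_∣<_ : ℝ → ℝ → ℚ → Set
∣ x - y ∣< ε = (x -ℝ y <ℝ fromℚ ε) × (y -ℝ x <ℝ fromℚ ε)

_⟶_ : (ℕ → ℂ) → ℂ → Set
s ⟶ l = ∀ ε → 0ℚ ℚ.< ε → ∃[ N ] (∀ n → N ℕ.≤ n →
  (∣ re (s n) - re l ∣< ε) × (∣ im (s n) - im l ∣< ε))

partialSum : (ℕ → ℂ) → ℕ → ℂ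
partialSum f zero    = fromℝ 0ℝ
partialSum f (suc n) = partialSum f n +ℂ f n

HasSum : (ℕ → ℂ) → ℂ → Set
HasSum f s = partialSum f ⟶ s

-- Possibly undefined complex quantities.  An infinite series or a quotient
-- need not denote a number, so an expression is interpreted by the
-- predicate "the expression is defined and its value is w".  Apart from
-- the zeroth power, each operation below has a value only if all its
-- arguments have one.
-- Limits are unique and division requires a nonzero divisor, so each
-- expression has at most one value up to _≈ℂ_.

Partialℂ : Set₁
Partialℂ = ℂ → Set

-- The quantity is defined and equals the real number x.
_⇓_ : Partialℂ → ℝ → Set
P ⇓ x = P (fromℝ x)

complex : ℂ → Partialℂ
complex z w = w ≈ℂ z

real : ℝ → Partialℂ
real x = complex (fromℝ x)

rat : ℚ → Partialℂ
rat r = real (fromℚ r)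

nat : ℕ → Partialℂ
nat n = rat (+ n / 1)

𝕚 : Partialℂ
𝕚 = complex (0ℝ +i fromℚ 1ℚ)

_⊕_ _⊗_ _⊘_ : Partialℂ → Partialℂ → Partialℂ
(P ⊕ Q) w = ∃[ u ] ∃[ v ] (P u × Q v × w ≈ℂ u +ℂ v)
(P ⊗ Q) w = ∃[ u ] ∃[ v ] (P u × Q v × w ≈ℂ u *ℂ v)
(P ⊘ Q) w = ∃[ u ] ∃[ v ] (P u × Q v × NonZeroℂ v × w *ℂ v ≈ℂ u)

⊖_ : Partialℂ → Partialℂ
(⊖ P) w = ∃[ u ] (P u × w ≈ℂ -ℂ u)

_⊖_ : Partialℂ → Partialℂ → Partialℂ
P ⊖ Q = P ⊕ (⊖ Q)

_↑_ : Partialℂ → ℕ → Partialℂ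
P ↑ zero  = nat 1
P ↑ suc n = P ⊗ P ↑ n

Σ₀ : (ℕ → Partialℂ) → Partialℂ
Σ₀ P s = Σ[ f ∈ (ℕ → ℂ) ] ((∀ n → P n (f n)) × HasSum f s)

Σ₁ : (ℕ → Partialℂ) → Partialℂ
Σ₁ P = Σ₀ (P ∘ suc)

-- Both one-sided series are required to converge.
Σℤ : (ℤ → Partialℂ) → Partialℂ
Σℤ P = Σ₀ (λ n → P (+ n)) ⊕ Σ₀ (λ n → P -[1+ n ])

exp : Partialℂ → Partialℂ
exp P = Σ₀ λ k → rat (_/_ (+ 1) (k !) {{k !≢0}}) ⊗ P ↑ k

-- The Leibniz series π = 4 (1 - 1/3 + 1/5 - …).
π : Partialℂ
π = nat 4 ⊗ Σ₀ λ k → (⊖ nat 1) ↑ k ⊗ rat (+ 1 / suc (2 ℕ.* k))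

-- The candidate divisors are 1, …, n, so the value at 0 is not meaningful.
σ : ℕ → ℕ → ℕ
σ α n = sum (map (ℕ._^ α) (filter (_∣? n) (applyUpTo suc n)))

-- q^r = e^{πirz}, which fixes the branch for fractional r.
q^ : ℚ → Partialℂ → Partialℂ
q^ r z = exp (π ⊗ 𝕚 ⊗ rat r ⊗ z)

-- These are the usual functions for z in the upper half plane.  No such
-- restriction is imposed: elsewhere the defining series decide whether
-- there is a value.
E₂ E₄ E₆ θ₂ θ₃ θ₄ φ₀ ψI : Partialℂ → Partialℂ

E₂ z = nat 1 ⊖ nat 24  ⊗ Σ₁ (λ n → nat (σ 1 n) ⊗ q^ (+ (2 ℕ.* n) / 1) z)
E₄ z = nat 1 ⊕ nat 240 ⊗ Σ₁ (λ n → nat (σ 3 n) ⊗ q^ (+ (2 ℕ.* n) / 1) z)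
E₆ z = nat 1 ⊖ nat 504 ⊗ Σ₁ (λ n → nat (σ 5 n) ⊗ q^ (+ (2 ℕ.* n) / 1) z)

θ₂ z = Σℤ λ n → q^ ((n / 1 ℚ.+ ½) ℚ.* (n / 1 ℚ.+ ½)) z
θ₃ z = Σℤ λ n → q^ ((n ℤ.* n) / 1) z
θ₄ z = Σℤ λ n → (⊖ nat 1) ↑ ℤ.∣ n ∣ ⊗ q^ ((n ℤ.* n) / 1) z

φ₀ z = nat 1728 ⊗ ((E₂ z ⊗ E₄ z ⊖ E₆ z) ↑ 2 ⊘ (E₄ z ↑ 3 ⊖ E₆ z ↑ 2))

ψI z = nat 128 ⊗ ( (θ₃ z ↑ 4 ⊕ θ₄ z ↑ 4) ⊘ θ₂ z ↑ 8
                 ⊕ (θ₄ z ↑ 4 ⊖ θ₂ z ↑ 4) ⊘ θ₃ z ↑ 8 )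

A B : ℝ → Partialℂ

A t = ⊖ (real t ↑ 2 ⊗ φ₀ (𝕚 ⊘ real t)) ⊖ nat 36 ⊘ π ↑ 2 ⊗ ψI (𝕚 ⊗ real t)
B t = ⊖ (real t ↑ 2 ⊗ φ₀ (𝕚 ⊘ real t)) ⊕ nat 36 ⊘ π ↑ 2 ⊗ ψI (𝕚 ⊗ real t)

{-# OPTIONS --safe #-}

-- Everything follows from φ₀(i/t) ≥ 0, ψ_I(it) > 0 and π²t²φ₀(i/t) < 36ψ_I(it).
-- The partial fractions of π coth πy, compared with its q-expansion coefficient by
-- coefficient in y, give the Lipschitz formulas, and interchanging the resulting
-- lattice sums gives the behaviour of E₂, E₄, E₆ under t ↦ 1/t.  For the theta
-- constants, substituting m = n + d in a product of two Gaussian sums gives the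
-- duplication formulas, and with them Jacobi's identity θ₂⁴ + θ₄⁴ = θ₃⁴.
-- If πt ≥ 3, then φ₀(i/t) is expressed through q = e^{-πt} ≤ 1/20 and the two sides are
-- compared as power series in q with controlled error.  If πt ≤ 3.002, then φ₀(i/t) is at most
-- a multiple of e^{-2π/t}, while ψ_I(it) is bounded below by the duplication formulas
-- when πt ≤ 3/2 and by numerical bounds on finitely many intervals otherwise.

module Submission where

open import Algebra.Structures using (IsCommutativeRing)
open import Data.Bool.Base as Bool using (Bool; true; false; if_then_else_; _∧_)
open import Data.Empty using (⊥-elim)
open import Data.Fin.Base using (Fin; zero; suc)
open import Data.Integer.Base as ℤ using (ℤ; +_; -[1+_])
import Data.Integer.Properties as ℤₚ
open import Data.List.Base using (List; []; _∷_; applyUpTo; filter; map; take; drop)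
open import Data.Nat.Base as ℕ using (ℕ; zero; suc; _!)
open import Data.Nat.Divisibility using (_∣?_; divides; ∣⇒≤)
import Data.Nat.DivMod as DivMod
import Data.Nat.ListAction as ListAction
import Data.Nat.Properties as ℕₚ
open import Data.Product.Base using (Σ; Σ-syntax; ∃-syntax; _×_; _,_; proj₁; proj₂)
open import Data.Rational.Base as ℚ using (ℚ; 0ℚ; 1ℚ; positive; fromℚᵘ)
import Data.Rational.Properties as ℚₚ
open import Data.Rational.Unnormalised.Base as ℚᵘ using (ℚᵘ; mkℚᵘ; 0ℚᵘ; 1ℚᵘ; _≃_; *≡*; *<*)
import Data.Rational.Unnormalised.Properties as ℚᵘₚ
open import Data.Sum.Base using (_⊎_; inj₁; inj₂; [_,_]′)
open import Data.Vec.Base as Vec using (Vec; []; _∷_; lookup)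
import Defs
open import Relation.Binary.PropositionalEquality as ≡ using (_≡_)
open import Relation.Nullary using (¬_; yes; no; Dec; does)
open import Relation.Nullary.Decidable using (True; toWitness)

-- The order of the reals is only constructive. The two ranges of πt overlap because cotransitivity,
-- not a comparison with one threshold, has to decide between them when the conclusion is strict;
-- weak inequalities are negations and may be split classically. Neither calculus nor complex
-- analysis enters. The argument runs over axioms for a complete ordered field; uniqueness of the
-- coefficients of an asymptotic expansion replaces differentiation, and rearranged double sums
-- replace Poisson summation. Since π is Leibniz's series, even its link with the exponential has to
-- be derived, through the duplication formula of coth. For large t the obstacle is cancellation: as
-- series in q, 36ψ_I(it) and π²t²φ₀(i/t) agree in their q⁻² and q⁻¹ terms, so constant terms decide
-- the sign, and πt ≥ 3 controls the part that involves t explicitly. For small t both sides are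
-- exponentially small, but at different rates, so that crude constants suffice once they hold
-- uniformly down to t = 0; the doubling t ↦ 2t provides this uniformity.

record OrderedField : Set₁ where
  infix  4 _≈_ _<_ _≤_
  infixl 6 _+_
  infixl 7 _*_
  infix  8 -_
  field
    F       : Set
    _≈_ _<_ : F → F → Set
    _+_ _*_ : F → F → F
    -_      : F → F
    ι       : ℚᵘ → F
    isCommutativeRing : IsCommutativeRing _≈_ _+_ _*_ -_ (ι 0ℚᵘ) (ι 1ℚᵘ)
    <-resp   : ∀ {x y u v} → x ≈ u → y ≈ v → x < y → u < v
    <-irrefl : ∀ {x} → ¬ (x < x)
    <-cotrans : ∀ {x y} → x < y → ∀ z → x < z ⊎ z < y
    <-trans  : ∀ {x y z} → x < y → y < z → x < z
    +-mono-<ˡ : ∀ {x y} z → x < y → z + x < z + y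
    *-pos    : ∀ {x y} → ι 0ℚᵘ < x → ι 0ℚᵘ < y → ι 0ℚᵘ < x * y
    tight    : ∀ {x y} → ¬ (x < y) → ¬ (y < x) → x ≈ y
    inv      : ∀ x → ι 0ℚᵘ < x → F
    inv-r    : ∀ x (p : ι 0ℚᵘ < x) → x * inv x p ≈ ι 1ℚᵘ
    inv-pos  : ∀ x (p : ι 0ℚᵘ < x) → ι 0ℚᵘ < inv x p
    ι-cong   : ∀ {p q} → p ≃ q → ι p ≈ ι q
    ι-+      : ∀ p q → ι (p ℚᵘ.+ q) ≈ ι p + ι q
    ι-*      : ∀ p q → ι (p ℚᵘ.* q) ≈ ι p * ι q
    ι-neg    : ∀ p → ι (ℚᵘ.- p) ≈ - ι p
    ι-<      : ∀ {p q} → p ℚᵘ.< q → ι p < ι q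
    archimedean : ∀ x → ∃[ n ] x < ι (mkℚᵘ (+ n) 0)

  -- Being a negation, ≤ is stable, so a proof of it may distinguish cases classically.
  _≤_ : F → F → Set
  x ≤ y = ¬ (y < x)

  -- Plays the role of |x| ≤ c. A pair of negations, it composes by ring identities and never needs
  -- the sign of x.
  Bnd : F → F → Set
  Bnd c x = (- c ≤ x) × (x ≤ c)

  -- Indices are shifted by one throughout: the n-th positive integer is `ν n` = n + 1, with
  -- reciprocal `ε n`.
  ν : ℕ → F
  ν n = ι (mkℚᵘ (+ suc n) 0)

record RealField : Set₁ where
  field orderedField : OrderedField
  open OrderedField orderedField
  field
    -- Only sequences with Cauchy rate C/(n + 1) are completed, which is all that telescoping bounds
    -- produce. The rate to the limit may have a larger constant D, as the construction by Cauchy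
    -- sequences loses a little.
    complete : ∀ (s : ℕ → F) C →
      (∀ m n → n ℕ.≤ m → Bnd C (ν n * (s m + - s n))) →
      Σ[ l ∈ F ] Σ[ D ∈ F ] (∀ n → Bnd D (ν n * (s n + - l)))

-- Commutative ring identities and their decision by normalisation.

module Ring (R : OrderedField) where
  open OrderedField R public hiding (isCommutativeRing)
  open IsCommutativeRing (OrderedField.isCommutativeRing R) public
    using (+-cong; *-cong; -‿cong; +-assoc; +-comm; +-identityˡ; +-identityʳ;
           *-assoc; *-comm; *-identityˡ; *-identityʳ; distribˡ; distribʳ;
           zeroˡ; zeroʳ; -‿inverseʳ; -‿inverseˡ; refl; sym; trans; setoid)
  open import Relation.Binary.Reasoning.Setoid setoid

  infixl 6 _-_
  infixr 9 _^_

  _-_ : F → F → F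
  x - y = x + - y

  0# 1# : F
  0# = ι 0ℚᵘ
  1# = ι 1ℚᵘ

  _^_ : F → ℕ → F
  x ^ zero  = 1#
  x ^ suc n = x * x ^ n

  ^-+ : ∀ x m n → x ^ (m ℕ.+ n) ≈ x ^ m * x ^ n
  ^-+ x zero    n = sym (*-identityˡ _)
  ^-+ x (suc m) n = trans (*-cong refl (^-+ x m n)) (sym (*-assoc x _ _))

  ^-cong : ∀ {x y} n → x ≈ y → x ^ n ≈ y ^ n
  ^-cong zero    e = refl
  ^-cong (suc n) e = *-cong e (^-cong n e)

  1^ : ∀ n → 1# ^ n ≈ 1#
  1^ zero    = refl
  1^ (suc n) = trans (*-identityˡ _) (1^ n)

  private
    interchange : ∀ a b c d → (a * b) * (c * d) ≈ (a * c) * (b * d)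
    interchange a b c d = begin
      (a * b) * (c * d) ≈⟨ *-assoc a b _ ⟩
      a * (b * (c * d)) ≈⟨ *-cong refl (sym (*-assoc b c d)) ⟩
      a * ((b * c) * d) ≈⟨ *-cong refl (*-cong (*-comm b c) refl) ⟩
      a * ((c * b) * d) ≈⟨ *-cong refl (*-assoc c b d) ⟩
      a * (c * (b * d)) ≈⟨ sym (*-assoc a c _) ⟩
      (a * c) * (b * d) ∎

    +-interchange : ∀ a b c d → (a + b) + (c + d) ≈ (a + c) + (b + d)
    +-interchange a b c d = begin
      (a + b) + (c + d) ≈⟨ +-assoc a b _ ⟩
      a + (b + (c + d)) ≈⟨ +-cong refl (sym (+-assoc b c d)) ⟩
      a + ((b + c) + d) ≈⟨ +-cong refl (+-cong (+-comm b c) refl) ⟩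
      a + ((c + b) + d) ≈⟨ +-cong refl (+-assoc c b d) ⟩
      a + (c + (b + d)) ≈⟨ sym (+-assoc a c _) ⟩
      (a + c) + (b + d) ∎

  -- A sparse polynomial normaliser with unnormalised rational coefficients.

  infixl 6 _:+_ _:-_
  infixl 7 _:*_
  infix  8 :-_
  infixr 9 _:^_

  data Expr (n : ℕ) : Set where
    var       : Fin n → Expr n
    con       : ℚᵘ → Expr n
    _:+_ _:*_ : Expr n → Expr n → Expr n
    :-_       : Expr n → Expr n
    _:^_      : Expr n → ℕ → Expr n

  _:-_ : ∀ {n} → Expr n → Expr n → Expr n
  a :- b = a :+ :- b

  ⟦_⟧ : ∀ {n} → Expr n → Vec F n → F
  ⟦ var i ⟧  ρ = lookup ρ i
  ⟦ con c ⟧  ρ = ι c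
  ⟦ a :+ b ⟧ ρ = ⟦ a ⟧ ρ + ⟦ b ⟧ ρ
  ⟦ a :* b ⟧ ρ = ⟦ a ⟧ ρ * ⟦ b ⟧ ρ
  ⟦ :- a ⟧   ρ = - ⟦ a ⟧ ρ
  ⟦ a :^ k ⟧ ρ = ⟦ a ⟧ ρ ^ k

  Poly : ℕ → Set
  Poly n = List (ℚᵘ × Vec ℕ n)

  private
    -- Only `same` carries evidence. Merging two terms is sound only for equal monomials, whereas a
    -- wrong order could at worst prevent cancellation and make `solve` fail.
    data Cmp {n} (u v : Vec ℕ n) : Set where
      before after : Cmp u v
      same         : u ≡ v → Cmp u v

    compareMon : ∀ {n} (u v : Vec ℕ n) → Cmp u v
    compareMon []      []      = same ≡.refl
    compareMon (a ∷ u) (b ∷ v) with a ℕₚ.≟ b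
    ... | no  _ = if b ℕ.<ᵇ a then before else after
    ... | yes ≡.refl with compareMon u v
    ...   | before      = before
    ...   | after       = after
    ...   | same ≡.refl = same ≡.refl

    add : ∀ {n} → Poly n → Poly n → Poly n
    add []            q = q
    add {n} ((c , u) ∷ p) q = go q
      module Add where
      go : Poly n → Poly n
      go [] = (c , u) ∷ p
      go ((d , v) ∷ q) with compareMon u v
      ... | before = (c , u) ∷ add p ((d , v) ∷ q)
      ... | after  = (d , v) ∷ go q
      ... | same _ = (c ℚᵘ.+ d , u) ∷ add p q

    mulMon : ∀ {n} → ℚᵘ × Vec ℕ n → Poly n → Poly n
    mulMon m       []            = []
    mulMon (c , u) ((d , v) ∷ q) = (c ℚᵘ.* d , Vec.zipWith ℕ._+_ u v) ∷ mulMon (c , u) q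

    mul : ∀ {n} → Poly n → Poly n → Poly n
    mul []      q = []
    mul (m ∷ p) q = add (mulMon m q) (mul p q)

    neg : ∀ {n} → Poly n → Poly n
    neg []            = []
    neg ((c , u) ∷ p) = (ℚᵘ.- c , u) ∷ neg p

    unit : ∀ {n} → Fin n → Vec ℕ n
    unit zero    = 1 ∷ Vec.replicate _ 0
    unit (suc i) = 0 ∷ unit i

    pow : ∀ {n} → Poly n → ℕ → Poly n
    pow p zero          = (1ℚᵘ , Vec.replicate _ 0) ∷ []
    pow p (suc zero)    = p
    pow p (suc (suc k)) = mul p (pow p (suc k))

    norm : ∀ {n} → Expr n → Poly n
    norm (var i)  = (1ℚᵘ , unit i) ∷ []
    norm (con c)  = (c , Vec.replicate _ 0) ∷ []
    norm (a :+ b) = add (norm a) (norm b)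
    norm (a :* b) = mul (norm a) (norm b)
    norm (:- a)   = neg (norm a)
    norm (a :^ k) = pow (norm a) k

    isZero : ∀ {n} → Poly n → Bool
    isZero []                       = true
    isZero ((mkℚᵘ (+ zero) _ , _) ∷ p) = isZero p
    isZero (_ ∷ p)                  = false

    evalMon : ∀ {n} → Vec ℕ n → Vec F n → F
    evalMon []      []      = 1#
    evalMon (k ∷ u) (x ∷ ρ) = x ^ k * evalMon u ρ

    eval : ∀ {n} → Poly n → Vec F n → F
    eval []            ρ = 0#
    eval ((c , u) ∷ p) ρ = ι c * evalMon u ρ + eval p ρ

    evalMon-0 : ∀ {n} (ρ : Vec F n) → evalMon (Vec.replicate n 0) ρ ≈ 1#
    evalMon-0 []      = refl
    evalMon-0 (x ∷ ρ) = trans (*-identityˡ _) (evalMon-0 ρ)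

    evalMon-unit : ∀ {n} (i : Fin n) ρ → evalMon (unit i) ρ ≈ lookup ρ i
    evalMon-unit zero    (x ∷ ρ) = trans (*-cong (*-identityʳ x) (evalMon-0 ρ)) (*-identityʳ x)
    evalMon-unit (suc i) (x ∷ ρ) = trans (*-identityˡ _) (evalMon-unit i ρ)

    evalMon-+ : ∀ {n} (u v : Vec ℕ n) ρ →
      evalMon (Vec.zipWith ℕ._+_ u v) ρ ≈ evalMon u ρ * evalMon v ρ
    evalMon-+ []      []      []      = sym (*-identityˡ _)
    evalMon-+ (a ∷ u) (b ∷ v) (x ∷ ρ) =
      trans (*-cong (^-+ x a b) (evalMon-+ u v ρ)) (interchange _ _ _ _)

    add-sound : ∀ {n} (p q : Poly n) ρ → eval (add p q) ρ ≈ eval p ρ + eval q ρ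
    add-sound []                q ρ = sym (+-identityˡ _)
    add-sound {n} ((c , u) ∷ p) q ρ = go-sound q
      where
      go-sound : ∀ q → eval (Add.go c u p q q) ρ ≈ eval ((c , u) ∷ p) ρ + eval q ρ
      go-sound q = aux q q
        where
        -- The local function keeps the original second argument of `add` as a module parameter
        -- while it descends, so the induction needs a separate `q₀`.
        aux : ∀ q₀ q → eval (Add.go c u p q₀ q) ρ ≈ eval ((c , u) ∷ p) ρ + eval q ρ
        aux q₀ [] = sym (+-identityʳ _)
        aux q₀ ((d , v) ∷ q) with compareMon u v
        ... | before = trans (+-cong refl (add-sound p ((d , v) ∷ q) ρ)) (sym (+-assoc _ _ _))
        ... | after  = begin
          ι d * evalMon v ρ + eval (Add.go c u p q₀ q) ρ   ≈⟨ +-cong refl (aux q₀ q) ⟩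
          ι d * evalMon v ρ + (eval ((c , u) ∷ p) ρ + eval q ρ) ≈⟨ sym (+-assoc _ _ _) ⟩
          (ι d * evalMon v ρ + eval ((c , u) ∷ p) ρ) + eval q ρ ≈⟨ +-cong (+-comm _ _) refl ⟩
          (eval ((c , u) ∷ p) ρ + ι d * evalMon v ρ) + eval q ρ ≈⟨ +-assoc _ _ _ ⟩
          eval ((c , u) ∷ p) ρ + (ι d * evalMon v ρ + eval q ρ) ∎
        ... | same ≡.refl = begin
          ι (c ℚᵘ.+ d) * evalMon u ρ + eval (add p q) ρ
            ≈⟨ +-cong (trans (*-cong (ι-+ c d) refl) (distribʳ _ _ _)) (add-sound p q ρ) ⟩
          (ι c * evalMon u ρ + ι d * evalMon u ρ) + (eval p ρ + eval q ρ)
            ≈⟨ +-interchange _ _ _ _ ⟩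
          eval ((c , u) ∷ p) ρ + eval ((d , u) ∷ q) ρ ∎

    mulMon-sound : ∀ {n} c (u : Vec ℕ n) q ρ →
      eval (mulMon (c , u) q) ρ ≈ (ι c * evalMon u ρ) * eval q ρ
    mulMon-sound c u []            ρ = sym (zeroʳ _)
    mulMon-sound c u ((d , v) ∷ q) ρ = trans
      (+-cong (trans (*-cong (ι-* c d) (evalMon-+ u v ρ)) (interchange _ _ _ _)) (mulMon-sound c u q ρ))
      (sym (distribˡ _ _ _))

    mul-sound : ∀ {n} (p q : Poly n) ρ → eval (mul p q) ρ ≈ eval p ρ * eval q ρ
    mul-sound []            q ρ = sym (zeroˡ _)
    mul-sound ((c , u) ∷ p) q ρ = trans (add-sound (mulMon (c , u) q) (mul p q) ρ)
      (trans (+-cong (mulMon-sound c u q ρ) (mul-sound p q ρ)) (sym (distribʳ _ _ _)))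

    neg-unique : ∀ {x y} → x + y ≈ 0# → y ≈ - x
    neg-unique {x} {y} e = begin
      y             ≈⟨ sym (+-identityˡ y) ⟩
      0# + y        ≈⟨ +-cong (sym (-‿inverseˡ x)) refl ⟩
      (- x + x) + y ≈⟨ +-assoc _ _ _ ⟩
      - x + (x + y) ≈⟨ +-cong refl e ⟩
      - x + 0#      ≈⟨ +-identityʳ _ ⟩
      - x           ∎

    neg-sound : ∀ {n} (p : Poly n) ρ → eval (neg p) ρ ≈ - eval p ρ
    neg-sound p ρ = neg-unique (lemma p)
      where
      lemma : ∀ p → eval p ρ + eval (neg p) ρ ≈ 0#
      lemma []            = +-identityˡ _
      lemma ((c , u) ∷ p) = trans (+-interchange _ _ _ _) (trans (+-cong
        (trans (sym (distribʳ _ _ _)) (trans (*-cong (trans (+-cong refl (ι-neg c)) (-‿inverseʳ _)) refl) (zeroˡ _)))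
        (lemma p)) (+-identityˡ _))

    pow-sound : ∀ {n} (p : Poly n) k ρ → eval (pow p k) ρ ≈ eval p ρ ^ k
    pow-sound p zero          ρ = trans (+-identityʳ _) (trans (*-identityˡ _) (evalMon-0 ρ))
    pow-sound p (suc zero)    ρ = sym (*-identityʳ _)
    pow-sound p (suc (suc k)) ρ = trans (mul-sound p (pow p (suc k)) ρ) (*-cong refl (pow-sound p (suc k) ρ))

    norm-sound : ∀ {n} (e : Expr n) ρ → eval (norm e) ρ ≈ ⟦ e ⟧ ρ
    norm-sound (var i)  ρ = trans (+-identityʳ _) (trans (*-identityˡ _) (evalMon-unit i ρ))
    norm-sound (con c)  ρ = trans (+-identityʳ _) (trans (*-cong refl (evalMon-0 ρ)) (*-identityʳ _))
    norm-sound (a :+ b) ρ = trans (add-sound (norm a) _ ρ) (+-cong (norm-sound a ρ) (norm-sound b ρ))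
    norm-sound (a :* b) ρ = trans (mul-sound (norm a) _ ρ) (*-cong (norm-sound a ρ) (norm-sound b ρ))
    norm-sound (:- a)   ρ = trans (neg-sound (norm a) ρ) (-‿cong (norm-sound a ρ))
    norm-sound (a :^ k) ρ = trans (pow-sound (norm a) k ρ) (^-cong k (norm-sound a ρ))

    isZero-sound : ∀ {n} (p : Poly n) → Bool.T (isZero p) → ∀ ρ → eval p ρ ≈ 0#
    isZero-sound []                            t ρ = refl
    isZero-sound ((mkℚᵘ (+ zero) _ , _) ∷ p) t ρ = trans (+-cong
      (trans (*-cong (ι-cong (*≡* ≡.refl)) refl) (zeroˡ _)) (isZero-sound p t ρ)) (+-identityˡ _)

  Fun : ℕ → Set → Set → Set
  Fun zero    A B = B
  Fun (suc n) A B = A → Fun n A B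

  apply : ∀ {n A B} → Fun n A B → Vec A n → B
  apply f []       = f
  apply f (x ∷ xs) = apply (f x) xs

  All : ∀ n → (Vec F n → Set) → Set
  All zero    P = P []
  All (suc n) P = ∀ x → All n (λ ρ → P (x ∷ ρ))

  curry : ∀ n {P : Vec F n → Set} → (∀ ρ → P ρ) → All n P
  curry zero    f = f []
  curry (suc n) f = λ x → curry n (λ ρ → f (x ∷ ρ))

  vars : ∀ n → Vec (Expr n) n
  vars n = Vec.tabulate var

  infix 4 _:=_
  _:=_ : ∀ {n} → Expr n → Expr n → Expr n × Expr n
  _:=_ = _,_

  solve : ∀ n (f : Fun n (Expr n) (Expr n × Expr n)) →
    {_ : Bool.T (isZero (norm (proj₁ (apply f (vars n)) :- proj₂ (apply f (vars n)))))} →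
    All n (λ ρ → ⟦ proj₁ (apply f (vars n)) ⟧ ρ ≈ ⟦ proj₂ (apply f (vars n)) ⟧ ρ)
  solve n f {t} = curry n λ ρ → let a = proj₁ (apply f (vars n)); b = proj₂ (apply f (vars n)) in begin
    ⟦ a ⟧ ρ                              ≈⟨ sym (+-identityʳ _) ⟩
    ⟦ a ⟧ ρ + 0#                         ≈⟨ +-cong refl (sym (-‿inverseˡ _)) ⟩
    ⟦ a ⟧ ρ + (- ⟦ b ⟧ ρ + ⟦ b ⟧ ρ)      ≈⟨ sym (+-assoc _ _ _) ⟩
    ⟦ a :- b ⟧ ρ + ⟦ b ⟧ ρ               ≈⟨ +-cong (trans (sym (norm-sound (a :- b) ρ)) (isZero-sound (norm (a :- b)) t ρ)) refl ⟩
    0# + ⟦ b ⟧ ρ                         ≈⟨ +-identityˡ _ ⟩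
    ⟦ b ⟧ ρ                              ∎

-- Order, inverses and two-sided bounds.

module Order (R : OrderedField) where

  open Ring R public

  infix 10 #_
  #_ : ℕ → F
  # n = ι (mkℚᵘ (+ n) 0)

  k : ∀ {n} → ℕ → Expr n
  k n = con (mkℚᵘ (+ n) 0)

  ≈-reflexive : ∀ {x y} → x ≡.≡ y → x ≈ y
  ≈-reflexive ≡.refl = refl

  ½ : F
  ½ = ι (mkℚᵘ (+ 1) 1)

  :½ : ∀ {n} → Expr n
  :½ = con (mkℚᵘ (+ 1) 1)

  by-cases : ∀ {P : Set} {x y} → (P → x ≤ y) → (¬ P → x ≤ y) → x ≤ y
  by-cases f g y<x = g (λ p → f p y<x) y<x

  <⇒≤ : ∀ {x y} → x < y → x ≤ y
  <⇒≤ p q = <-irrefl (<-trans p q)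

  ≈⇒≤ : ∀ {x y} → x ≈ y → x ≤ y
  ≈⇒≤ e p = <-irrefl (<-resp refl e p)

  ≤-refl : ∀ {x} → x ≤ x
  ≤-refl = <-irrefl

  ≤-trans : ∀ {x y z} → x ≤ y → y ≤ z → x ≤ z
  ≤-trans {y = y} p q z<x = [ q , p ]′ (<-cotrans z<x y)

  <-≤-trans : ∀ {x y z} → x < y → y ≤ z → x < z
  <-≤-trans {z = z} p q = [ (λ a → a) , (λ a → ⊥-elim (q a)) ]′ (<-cotrans p z)

  ≤-<-trans : ∀ {x y z} → x ≤ y → y < z → x < z
  ≤-<-trans {x} p q = [ (λ a → ⊥-elim (p a)) , (λ a → a) ]′ (<-cotrans q x)

  ≤-antisym : ∀ {x y} → x ≤ y → y ≤ x → x ≈ y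
  ≤-antisym p q = tight q p

  ≤-resp : ∀ {x y u v} → x ≈ u → y ≈ v → x ≤ y → u ≤ v
  ≤-resp e f p q = p (<-resp (sym f) (sym e) q)

  ≤-cases : ∀ x y {u v} → (x ≤ y → u ≤ v) → (y ≤ x → u ≤ v) → u ≤ v
  ≤-cases x y f g = by-cases {x < y} (λ p → f (<⇒≤ p)) g

  ι-≤ : ∀ {p q} → p ℚᵘ.≤ q → ι p ≤ ι q
  ι-≤ {p} {q} p≤q with q ℚᵘₚ.<? p
  ... | yes q<p = ⊥-elim (ℚᵘₚ.<⇒≱ q<p p≤q)
  ... | no  q≮p = aux p q p≤q
    where
    aux : ∀ p q → p ℚᵘ.≤ q → ι p ≤ ι q
    aux p q p≤q with p ℚᵘₚ.<? q
    ... | yes p<q = <⇒≤ (ι-< p<q)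
    ... | no  p≮q = ≈⇒≤ (ι-cong (ℚᵘₚ.≤-antisym p≤q (ℚᵘₚ.≮⇒≥ p≮q)))

  num≤ : ∀ {p q} {_ : True (p ℚᵘₚ.≤? q)} → ι p ≤ ι q
  num≤ {p} {q} {t} = ι-≤ (toWitness t)

  num< : ∀ {p q} {_ : True (p ℚᵘₚ.<? q)} → ι p < ι q
  num< {p} {q} {t} = ι-< (toWitness t)

  pos-# : ∀ n → 0# < # suc n
  pos-# n = ι-< (ℚᵘ.*<* (ℤ.+<+ (ℕ.s≤s ℕ.z≤n)))

  nn-ι : ∀ n d → 0# ≤ ι (mkℚᵘ (+ n) d)
  nn-ι n d = ι-≤ (ℚᵘₚ.nonNegative⁻¹ (mkℚᵘ (+ n) d))

  nn-# : ∀ n → 0# ≤ # n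
  nn-# n = nn-ι n 0

  +-mono-<ʳ : ∀ {x y} z → x < y → x + z < y + z
  +-mono-<ʳ z p = <-resp (+-comm _ _) (+-comm _ _) (+-mono-<ˡ z p)

  by-pos : ∀ {x y e} → 0# < e → y - x ≈ e → x < y
  by-pos {x} {y} p q = <-resp (solve 1 (λ x → x :+ k 0 := x) x) (solve 2 (λ x y → x :+ (y :- x) := y) x y)
    (+-mono-<ˡ x (<-resp refl (sym q) p))

  pos-sub : ∀ {x y} → x < y → 0# < y - x
  pos-sub {x} {y} p = <-resp (-‿inverseʳ x) refl (+-mono-<ʳ (- x) p)

  by-nn : ∀ {x y e} → 0# ≤ e → y - x ≈ e → x ≤ y
  by-nn {x} {y} p q y<x = p (<-resp (trans (solve 2 (λ x y → y :+ :- x := y :- x) x y) q) (-‿inverseʳ x) (+-mono-<ʳ (- x) y<x))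

  nn-sub : ∀ {x y} → x ≤ y → 0# ≤ y - x
  nn-sub {x} {y} p q = p (by-pos (<-resp refl refl (pos-sub q)) (solve 2 (λ x y → x :- y := k 0 :- (y :- x)) x y))

  pos-+-nn : ∀ {x y} → 0# < x → 0# ≤ y → 0# < x + y
  pos-+-nn {x} {y} p q = <-≤-trans p (by-nn q (solve 2 (λ x y → x :+ y :- x := y) x y))

  nn-+ : ∀ {x y} → 0# ≤ x → 0# ≤ y → 0# ≤ x + y
  nn-+ {x} {y} p q = ≤-trans p (by-nn q (solve 2 (λ x y → x :+ y :- x := y) x y))

  nn-* : ∀ {x y} → 0# ≤ x → 0# ≤ y → 0# ≤ x * y
  nn-* {x} {y} p q = by-cases {0# < x}
    (λ p′ → by-cases {0# < y} (λ q′ → <⇒≤ (*-pos p′ q′))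
      (λ y≤0 → ≈⇒≤ (sym (trans (*-cong refl (≤-antisym y≤0 q)) (zeroʳ x)))))
    (λ x≤0 → ≈⇒≤ (sym (trans (*-cong (≤-antisym x≤0 p) refl) (zeroˡ y))))

  nn-neg : ∀ {x} → x ≤ 0# → 0# ≤ - x
  nn-neg {x} p = ≤-resp refl (solve 1 (λ x → k 0 :- x := :- x) x) (nn-sub p)

  nn-² : ∀ x → 0# ≤ x * x
  nn-² x = ≤-cases 0# x (λ p → nn-* p p)
    (λ p → ≤-resp refl (solve 1 (λ x → (:- x) :* (:- x) := x :* x) x) (nn-* (nn-neg p) (nn-neg p)))

  nn-^ : ∀ {x} n → 0# ≤ x → 0# ≤ x ^ n
  nn-^ zero    p = num≤
  nn-^ (suc n) p = nn-* p (nn-^ n p)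

  pos-^ : ∀ {x} n → 0# < x → 0# < x ^ n
  pos-^ zero    p = num<
  pos-^ (suc n) p = *-pos p (pos-^ n p)

  +-mono-≤ : ∀ {x y u v} → x ≤ y → u ≤ v → x + u ≤ y + v
  +-mono-≤ {x} {y} {u} {v} p q = by-nn (nn-+ (nn-sub p) (nn-sub q))
    (solve 4 (λ x y u v → y :+ v :- (x :+ u) := (y :- x) :+ (v :- u)) x y u v)

  neg-mono : ∀ {x y} → x ≤ y → - y ≤ - x
  neg-mono {x} {y} p = by-nn (nn-sub p) (solve 2 (λ x y → :- x :- :- y := y :- x) x y)

  *-monoʳ : ∀ {x y} z → 0# ≤ z → x ≤ y → x * z ≤ y * z
  *-monoʳ {x} {y} z p q = by-nn (nn-* (nn-sub q) p) (solve 3 (λ x y z → y :* z :- x :* z := (y :- x) :* z) x y z)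

  *-monoˡ : ∀ {x y} z → 0# ≤ z → x ≤ y → z * x ≤ z * y
  *-monoˡ {x} {y} z p q = ≤-resp (*-comm _ _) (*-comm _ _) (*-monoʳ z p q)

  *-mono : ∀ {x y u v} → 0# ≤ x → 0# ≤ u → x ≤ y → u ≤ v → x * u ≤ y * v
  *-mono {x} {y} {u} {v} p q r s = ≤-trans (*-monoʳ u q r) (*-monoˡ y (≤-trans p r) s)

  *-mono-<ˡ : ∀ {x y} z → 0# < z → x < y → z * x < z * y
  *-mono-<ˡ {x} {y} z p q = by-pos (*-pos p (pos-sub q)) (solve 3 (λ x y z → z :* y :- z :* x := z :* (y :- x)) x y z)

  ^-mono : ∀ {x y} n → 0# ≤ x → x ≤ y → x ^ n ≤ y ^ n
  ^-mono zero    p q = ≤-refl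
  ^-mono (suc n) p q = *-mono p (nn-^ n p) q (^-mono n p q)

  inv-l : ∀ x (p : 0# < x) → inv x p * x ≈ 1#
  inv-l x p = trans (*-comm _ _) (inv-r x p)

  inv-cancel : ∀ {x y} (p : 0# < x) → inv x p * (x * y) ≈ y
  inv-cancel {x} {y} p = trans (sym (*-assoc _ _ _)) (trans (*-cong (inv-l x p) refl) (*-identityˡ y))

  pos-cancel : ∀ {x y} → 0# < x → 0# < x * y → 0# < y
  pos-cancel {x} {y} p q = <-resp refl (inv-cancel p) (*-pos (inv-pos x p) q)

  nn-cancel : ∀ {x y} → 0# < x → 0# ≤ x * y → 0# ≤ y
  nn-cancel {x} {y} p q = ≤-resp refl (inv-cancel p) (nn-* (<⇒≤ (inv-pos x p)) q)

  cancel-≤ : ∀ {x y z} → 0# < z → z * x ≤ z * y → x ≤ y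
  cancel-≤ {x} {y} {z} p q = by-nn (nn-cancel {z} {y - x} p (≤-resp refl (solve 3 (λ x y z → z :* y :- z :* x := z :* (y :- x)) x y z) (nn-sub q))) refl

  cancel-≈ : ∀ {x y z} → 0# < z → z * x ≈ z * y → x ≈ y
  cancel-≈ p e = trans (sym (inv-cancel p)) (trans (*-cong refl e) (inv-cancel p))

  inv-unique : ∀ {x y} (p : 0# < x) → x * y ≈ 1# → y ≈ inv x p
  inv-unique {x} p e = cancel-≈ p (trans e (sym (inv-r x p)))

  inv-cong : ∀ {x y} (p : 0# < x) (q : 0# < y) → x ≈ y → inv x p ≈ inv y q
  inv-cong p q e = inv-unique q (trans (*-cong (sym e) refl) (inv-r _ p))

  inv-anti : ∀ {x y} (p : 0# < x) (q : 0# < y) → x ≤ y → inv y q ≤ inv x p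
  inv-anti {x} {y} p q x≤y = by-nn (nn-* (nn-* (<⇒≤ (inv-pos x p)) (<⇒≤ (inv-pos y q))) (nn-sub x≤y)) (begin
    a - b                       ≈⟨ solve 2 (λ a b → a :- b := a :* k 1 :- b :* k 1) a b ⟩
    a * 1# - b * 1#             ≈⟨ +-cong (*-cong refl (sym (inv-r y q))) (-‿cong (*-cong refl (sym (inv-r x p)))) ⟩
    a * (y * b) - b * (x * a)   ≈⟨ solve 4 (λ a b x y → a :* (y :* b) :- b :* (x :* a) := a :* b :* (y :- x)) a b x y ⟩
    a * b * (y - x)             ∎)
    where
    open import Relation.Binary.Reasoning.Setoid setoid
    a = inv x p
    b = inv y q

  inv-* : ∀ {x y} (p : 0# < x) (q : 0# < y) → inv (x * y) (*-pos p q) ≈ inv x p * inv y q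
  inv-* {x} {y} p q = sym (inv-unique (*-pos p q) (trans
    (solve 4 (λ x y a b → (x :* y) :* (a :* b) := (x :* a) :* (y :* b)) x y (inv x p) (inv y q))
    (trans (*-cong (inv-r x p) (inv-r y q)) (*-identityˡ _))))

  #-+ : ∀ m n → # (m ℕ.+ n) ≈ # m + # n
  #-+ m n = trans (ι-cong (*≡* (≡.cong (ℤ._* + 1) (≡.sym (≡.cong₂ ℤ._+_ (ℤₚ.*-identityʳ (+ m)) (ℤₚ.*-identityʳ (+ n))))))) (ι-+ _ _)

  #-* : ∀ m n → # (m ℕ.* n) ≈ # m * # n
  #-* m n = trans (ι-cong (*≡* (≡.cong (ℤ._* + 1) (ℤₚ.pos-* m n)))) (ι-* _ _)

  #-≤ : ∀ {m n} → m ℕ.≤ n → # m ≤ # n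
  #-≤ {m} {n} p = ι-≤ (ℚᵘ.*≤* (≡.subst₂ ℤ._≤_ (≡.sym (ℤₚ.*-identityʳ (+ m))) (≡.sym (ℤₚ.*-identityʳ (+ n))) (ℤ.+≤+ p)))

  #-suc : ∀ n → # suc n ≈ # n + 1#
  #-suc n = trans (#-+ 1 n) (+-comm _ _)

  ε : ℕ → F
  ε n = ι (mkℚᵘ (+ 1) n)

  ε-pos : ∀ n → 0# < ε n
  ε-pos n = ι-< (ℚᵘ.*<* (ℤ.+<+ (ℕ.s≤s ℕ.z≤n)))

  ν*ε : ∀ n → ν n * ε n ≈ 1#
  ν*ε n = trans (sym (ι-* _ _)) (ι-cong (*≡* (≡.cong +_ (≡.trans (ℕₚ.*-identityʳ _) (≡.trans (ℕₚ.*-identityʳ _) (≡.sym (≡.trans (ℕₚ.*-identityˡ _) (≡.cong suc (ℕₚ.+-identityʳ _)))))))))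

  ε-anti : ∀ {m n} → m ℕ.≤ n → ε n ≤ ε m
  ε-anti {m} {n} p = by-nn (nn-* (nn-* (<⇒≤ (ε-pos m)) (<⇒≤ (ε-pos n))) (nn-sub (#-≤ (ℕ.s≤s p)))) (trans (trans
    (solve 2 (λ a b → a :- b := k 1 :* a :- k 1 :* b) (ε m) (ε n))
    (+-cong (*-cong (sym (ν*ε n)) refl) (-‿cong (*-cong (sym (ν*ε m)) refl))))
    (solve 4 (λ a b x y → y :* b :* a :- x :* a :* b := a :* b :* (y :- x)) (ε m) (ε n) (ν m) (ν n)))

  arch-≤0 : ∀ {x C} → (∀ n → ν n * x ≤ C) → x ≤ 0#
  arch-≤0 {x} {C} h 0<x with archimedean (C * inv x 0<x)
  ... | N , lt = h N (<-resp
    (trans (solve 3 (λ x c i → x :* (c :* i) := c :* (x :* i)) x C (inv x 0<x)) (trans (*-cong refl (inv-r x 0<x)) (*-identityʳ C)))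
    (*-comm _ _)
    (*-mono-<ˡ x 0<x (<-resp refl (sym (#-suc N)) (<-≤-trans lt (by-nn {e = 1#} num≤ (solve 1 (λ x → x :+ k 1 :- x := k 1) (# N)))))))

  Bnd-resp : ∀ {c d x y} → c ≈ d → x ≈ y → Bnd c x → Bnd d y
  Bnd-resp e f (p , q) = ≤-resp (-‿cong e) f p , ≤-resp f e q

  Bnd-mono : ∀ {c d x} → c ≤ d → Bnd c x → Bnd d x
  Bnd-mono e (p , q) = ≤-trans (neg-mono e) p , ≤-trans q e

  Bnd-nn : ∀ {c x} → Bnd c x → 0# ≤ c
  Bnd-nn {c} {x} (p , q) = nn-cancel {# 2} num< (≤-resp refl
    (solve 2 (λ c x → (x :- :- c) :+ (c :- x) := k 2 :* c) c x) (nn-+ (nn-sub p) (nn-sub q)))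

  Bnd-refl : ∀ {x} → 0# ≤ x → Bnd x x
  Bnd-refl {x} p = by-nn (nn-+ p p) (solve 1 (λ x → x :- :- x := x :+ x) x) , ≤-refl

  Bnd-of : ∀ {c x} → 0# ≤ x → x ≤ c → Bnd c x
  Bnd-of p q = Bnd-mono q (Bnd-refl p)

  Bnd-+ : ∀ {c d x y} → Bnd c x → Bnd d y → Bnd (c + d) (x + y)
  Bnd-+ {c} {d} (p , q) (r , s) = ≤-resp (solve 2 (λ c d → :- c :+ :- d := :- (c :+ d)) c d) refl (+-mono-≤ p r) , +-mono-≤ q s

  Bnd-neg : ∀ {c x} → Bnd c x → Bnd c (- x)
  Bnd-neg {c} {x} (p , q) = neg-mono q , ≤-resp refl (solve 1 (λ c → :- :- c := c) c) (neg-mono p)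

  Bnd-- : ∀ {c d x y} → Bnd c x → Bnd d y → Bnd (c + d) (x - y)
  Bnd-- p q = Bnd-+ p (Bnd-neg q)

  -- No signs are distinguished: cd + xy and cd - xy are each half a sum of two products of the
  -- non-negative numbers c ± x and d ± y.
  Bnd-* : ∀ {c d x y} → Bnd c x → Bnd d y → Bnd (c * d) (x * y)
  Bnd-* {c} {d} {x} {y} (p , q) (r , s) =
    by-nn (nn-* (nn-ι 1 1) (nn-+ (nn-* (nn-sub p) (nn-sub r)) (nn-* (nn-sub q) (nn-sub s))))
      (solve 4 (λ c d x y → x :* y :- :- (c :* d) := :½ :* ((x :- :- c) :* (y :- :- d) :+ (c :- x) :* (d :- y))) c d x y) ,
    by-nn (nn-* (nn-ι 1 1) (nn-+ (nn-* (nn-sub p) (nn-sub s)) (nn-* (nn-sub q) (nn-sub r))))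
      (solve 4 (λ c d x y → c :* d :- x :* y := :½ :* ((x :- :- c) :* (d :- y) :+ (c :- x) :* (y :- :- d))) c d x y)

  Bnd-cancel : ∀ {c x z} → 0# < z → Bnd (z * c) (z * x) → Bnd c x
  Bnd-cancel {c} {x} {z} p (q , r) = cancel-≤ p (≤-resp (solve 2 (λ z c → :- (z :* c) := z :* :- c) z c) refl q) , cancel-≤ p r

  Bnd-^ : ∀ {c x} n → Bnd c x → Bnd (c ^ n) (x ^ n)
  Bnd-^ zero    p = Bnd-refl num≤
  Bnd-^ (suc n) p = Bnd-* p (Bnd-^ n p)

  Bnd-0 : ∀ {c x} → c ≈ 0# → Bnd c x → x ≈ 0#
  Bnd-0 e (p , q) = ≤-antisym (≤-resp refl e q) (≤-resp (trans (-‿cong e) (sym (trans (sym (-‿inverseʳ 0#)) (+-identityˡ _)))) refl p)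

  Bnd-swap : ∀ {c x y} → Bnd c (x - y) → Bnd c (y - x)
  Bnd-swap {c} {x} {y} p = Bnd-resp refl (solve 2 (λ x y → :- (x :- y) := y :- x) x y) (Bnd-neg p)

  absBound : ∀ x → ∃[ n ] Bnd (# n) x
  absBound x with archimedean x | archimedean (- x)
  ... | m , p | n , q = m ℕ.+ n ,
    by-nn (nn-+ (nn-sub (<⇒≤ q)) (nn-# m)) (trans (+-cong refl (-‿cong (-‿cong (#-+ m n)))) (solve 3 (λ x m n → x :- :- (m :+ n) := (n :- :- x) :+ m) x (# m) (# n))) ,
    by-nn (nn-+ (nn-sub (<⇒≤ p)) (nn-# n)) (trans (+-cong (#-+ m n) refl) (solve 3 (λ x m n → m :+ n :- x := (m :- x) :+ n) x (# m) (# n)))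

  nn-ν : ∀ n → 0# ≤ ν n
  nn-ν n = nn-# (suc n)

  rate : ∀ {C x} n → Bnd (C * ε n) x → Bnd C (ν n * x)
  rate {C} n b = Bnd-resp (trans (solve 3 (λ v C e → v :* (C :* e) := (v :* e) :* C) (ν n) C (ε n)) (trans (*-cong (ν*ε n) refl) (*-identityˡ C))) refl
    (Bnd-* (Bnd-refl (nn-ν n)) b)

  unrate : ∀ {C x} n → Bnd C (ν n * x) → Bnd (C * ε n) x
  unrate {C} {x} n b = Bnd-resp refl (trans (solve 3 (λ v x e → v :* x :* e := v :* e :* x) (ν n) x (ε n)) (trans (*-cong (ν*ε n) refl) (*-identityˡ x)))
    (Bnd-* b (Bnd-refl (<⇒≤ (ε-pos n))))

-- Finite sums, limits with a rate, absolutely convergent series.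

module Limits (R : RealField) where

  open Order (RealField.orderedField R) public
  open RealField R public using (complete)
  open import Relation.Binary.Reasoning.Setoid setoid

  infix 4 _⟶_

  sum : (ℕ → F) → ℕ → F
  sum f zero    = 0#
  sum f (suc n) = sum f n + f n

  sum-cong< : ∀ {f g} n → (∀ i → i ℕ.< n → f i ≈ g i) → sum f n ≈ sum g n
  sum-cong< zero    e = refl
  sum-cong< (suc n) e = +-cong (sum-cong< n λ i p → e i (ℕₚ.m≤n⇒m≤1+n p)) (e n ℕₚ.≤-refl)

  sum-cong : ∀ {f g} n → (∀ i → f i ≈ g i) → sum f n ≈ sum g n
  sum-cong n e = sum-cong< n λ i _ → e i

  sum-0 : ∀ n → sum (λ _ → 0#) n ≈ 0#
  sum-0 zero    = refl
  sum-0 (suc n) = trans (+-identityʳ _) (sum-0 n)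

  sum-+ : ∀ f g n → sum (λ i → f i + g i) n ≈ sum f n + sum g n
  sum-+ f g zero    = sym (+-identityˡ _)
  sum-+ f g (suc n) = trans (+-cong (sum-+ f g n) refl)
    (solve 4 (λ a b c d → (a :+ b) :+ (c :+ d) := (a :+ c) :+ (b :+ d)) (sum f n) (sum g n) (f n) (g n))

  sum-*ˡ : ∀ c f n → sum (λ i → c * f i) n ≈ c * sum f n
  sum-*ˡ c f zero    = sym (zeroʳ c)
  sum-*ˡ c f (suc n) = trans (+-cong (sum-*ˡ c f n) refl) (sym (distribˡ _ _ _))

  sum-*ʳ : ∀ c f n → sum (λ i → f i * c) n ≈ sum f n * c
  sum-*ʳ c f n = trans (sum-cong n λ i → *-comm _ _) (trans (sum-*ˡ c f n) (*-comm _ _))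

  sum-neg : ∀ f n → sum (λ i → - f i) n ≈ - sum f n
  sum-neg f zero    = sym (trans (sym (+-identityˡ _)) (-‿inverseʳ 0#))
  sum-neg f (suc n) = trans (+-cong (sum-neg f n) refl) (solve 2 (λ a b → :- a :+ :- b := :- (a :+ b)) (sum f n) (f n))

  sum-- : ∀ f g n → sum (λ i → f i - g i) n ≈ sum f n - sum g n
  sum-- f g n = trans (sum-+ f _ n) (+-cong refl (sum-neg g n))

  sum-head : ∀ f n → sum f (suc n) ≈ f 0 + sum (λ i → f (suc i)) n
  sum-head f zero    = +-comm _ _
  sum-head f (suc n) = trans (+-cong (sum-head f n) refl) (+-assoc _ _ _)

  sum-swap : ∀ (f : ℕ → ℕ → F) m n → sum (λ i → sum (f i) n) m ≈ sum (λ j → sum (λ i → f i j) m) n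
  sum-swap f zero    n = sym (sum-0 n)
  sum-swap f (suc m) n = trans (+-cong (sum-swap f m n) refl) (sym (sum-+ _ (f m) n))

  sum-mono : ∀ {f g} n → (∀ i → f i ≤ g i) → sum f n ≤ sum g n
  sum-mono zero    h = ≤-refl
  sum-mono (suc n) h = +-mono-≤ (sum-mono n h) (h n)

  nn-sum : ∀ {f} n → (∀ i → 0# ≤ f i) → 0# ≤ sum f n
  nn-sum n h = ≤-trans (≈⇒≤ (sym (sum-0 n))) (sum-mono n h)

  Bnd-sum< : ∀ {f g} n → (∀ i → i ℕ.< n → Bnd (g i) (f i)) → Bnd (sum g n) (sum f n)
  Bnd-sum< zero    h = Bnd-refl ≤-refl
  Bnd-sum< (suc n) h = Bnd-+ (Bnd-sum< n λ i p → h i (ℕₚ.m≤n⇒m≤1+n p)) (h n ℕₚ.≤-refl)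

  Bnd-sum : ∀ {f g} n → (∀ i → Bnd (g i) (f i)) → Bnd (sum g n) (sum f n)
  Bnd-sum n h = Bnd-sum< n λ i _ → h i

  -- A limit carries a rate O(1/(n+1)), so that sums and products of limits need no choice of moduli.
  _⟶_ : (ℕ → F) → F → Set
  s ⟶ l = Σ[ C ∈ F ] (∀ n → Bnd C (ν n * (s n - l)))

  ⟶-≤ : ∀ {s t l m} → s ⟶ l → t ⟶ m → (∀ n → s n ≤ t n) → l ≤ m
  ⟶-≤ {s} {t} {l} {m} (C , p) (D , q) h = by-nn (≤-resp refl (solve 2 (λ l m → :- (l :- m) := m :- l) l m) (nn-neg (arch-≤0 {C = C + D} λ n →
    by-nn (nn-+ (nn-+ (nn-sub (proj₁ (p n))) (nn-sub (proj₂ (q n)))) (nn-* (nn-ν n) (nn-sub (h n))))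
     (solve 7 (λ v l m C D s t → C :+ D :- v :* (l :- m) := (v :* (s :- l) :- :- C) :+ (D :- v :* (t :- m)) :+ v :* (t :- s)) (ν n) l m C D (s n) (t n))))) refl

  ⟶-unique : ∀ {s l m} → s ⟶ l → s ⟶ m → l ≈ m
  ⟶-unique p q = ≤-antisym (⟶-≤ p q λ _ → ≤-refl) (⟶-≤ q p λ _ → ≤-refl)

  ⟶-cong : ∀ {s t l m} → (∀ n → s n ≈ t n) → l ≈ m → s ⟶ l → t ⟶ m
  ⟶-cong e f (C , p) = C , λ n → Bnd-resp refl (*-cong refl (+-cong (e n) (-‿cong f))) (p n)

  ⟶-const : ∀ c → (λ _ → c) ⟶ c
  ⟶-const c = 0# , λ n → Bnd-resp refl (sym (trans (*-cong refl (-‿inverseʳ c)) (zeroʳ _))) (Bnd-refl ≤-refl)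

  ⟶-+ : ∀ {s t l m} → s ⟶ l → t ⟶ m → (λ n → s n + t n) ⟶ l + m
  ⟶-+ {s} {t} {l} {m} (C , p) (D , q) = C + D , λ n → Bnd-resp refl
    (solve 5 (λ v s t l m → v :* (s :- l) :+ v :* (t :- m) := v :* (s :+ t :- (l :+ m))) (ν n) (s n) (t n) l m) (Bnd-+ (p n) (q n))

  ⟶-neg : ∀ {s l} → s ⟶ l → (λ n → - s n) ⟶ - l
  ⟶-neg {s} {l} (C , p) = C , λ n → Bnd-resp refl (solve 3 (λ v s l → :- (v :* (s :- l)) := v :* (:- s :- :- l)) (ν n) (s n) l) (Bnd-neg (p n))

  ⟶-- : ∀ {s t l m} → s ⟶ l → t ⟶ m → (λ n → s n - t n) ⟶ l - m
  ⟶-- p q = ⟶-+ p (⟶-neg q)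

  ε≤1 : ∀ n → ε n ≤ 1#
  ε≤1 n = ε-anti {0} {n} ℕ.z≤n

  1≤ν : ∀ n → 1# ≤ ν n
  1≤ν n = #-≤ (ℕ.s≤s ℕ.z≤n)

  weaken : ∀ {C x} n → Bnd C (ν n * x) → Bnd C x
  weaken {C} n b = Bnd-mono (≤-trans (*-monoˡ C (Bnd-nn b) (ε≤1 n)) (≈⇒≤ (*-identityʳ C))) (unrate n b)

  ⟶-* : ∀ {s t l m} → s ⟶ l → t ⟶ m → (λ n → s n * t n) ⟶ l * m
  ⟶-* {s} {t} {l} {m} (C , p) (D , q) with absBound l | absBound m
  ... | L , bl | M , bm = C * D + C * # M + # L * D , λ n → Bnd-resp refl
    (solve 5 (λ v s t l m → v :* (s :- l) :* (t :- m) :+ v :* (s :- l) :* m :+ l :* (v :* (t :- m)) := v :* (s :* t :- (l :* m))) (ν n) (s n) (t n) l m)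
    (Bnd-+ (Bnd-+ (Bnd-* (p n) (weaken n (q n))) (Bnd-* (p n) bm)) (Bnd-* bl (q n)))

  ⟶-*ˡ : ∀ {s l} c → s ⟶ l → (λ n → c * s n) ⟶ c * l
  ⟶-*ˡ c p = ⟶-* (⟶-const c) p

  ⟶-close : ∀ {s t l} C → (∀ n → Bnd (C * ε n) (t n - s n)) → s ⟶ l → t ⟶ l
  ⟶-close {s} {t} {l} C h (D , p) = C + D , λ n → Bnd-resp refl
    (solve 4 (λ v s t l → v :* (t :- s) :+ v :* (s :- l) := v :* (t :- l)) (ν n) (s n) (t n) l) (Bnd-+ (rate n (h n)) (p n))

  ⟶-0 : ∀ {s} C → (∀ n → Bnd (C * ε n) (s n)) → s ⟶ 0#
  ⟶-0 {s} C h = ⟶-close C (λ n → Bnd-resp refl (solve 1 (λ s → s := s :- k 0) (s n)) (h n)) (⟶-const 0#)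

  ⟶-sub : ∀ {s l} (φ : ℕ → ℕ) → (∀ n → n ℕ.≤ φ n) → s ⟶ l → (λ n → s (φ n)) ⟶ l
  ⟶-sub {s} {l} φ h (C , p) = C , λ n → rate n (Bnd-mono (*-monoˡ C (Bnd-nn (p 0)) (ε-anti (h n))) (unrate (φ n) (p (φ n))))

  Series : (ℕ → F) → F → Set
  Series f s = sum f ⟶ s

  Series-cong : ∀ {f g s} → (∀ n → f n ≈ g n) → Series f s → Series g s
  Series-cong e = ⟶-cong (λ n → sum-cong n e) refl

  Series-+ : ∀ {f g s t} → Series f s → Series g t → Series (λ n → f n + g n) (s + t)
  Series-+ p q = ⟶-cong (λ n → sym (sum-+ _ _ n)) refl (⟶-+ p q)

  Series-*ˡ : ∀ {f s} c → Series f s → Series (λ n → c * f n) (c * s)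
  Series-*ˡ c p = ⟶-cong (λ n → sym (sum-*ˡ c _ n)) refl (⟶-*ˡ c p)

  Series-neg : ∀ {f s} → Series f s → Series (λ n → - f n) (- s)
  Series-neg p = ⟶-cong (λ n → sym (sum-neg _ n)) refl (⟶-neg p)

  Series-- : ∀ {f g s t} → Series f s → Series g t → Series (λ n → f n - g n) (s - t)
  Series-- p q = Series-+ p (Series-neg q)

  Series-mono : ∀ {f g s t} → Series f s → Series g t → (∀ n → f n ≤ g n) → s ≤ t
  Series-mono p q h = ⟶-≤ p q λ n → sum-mono n h

  Series-nn : ∀ {f s} → Series f s → (∀ n → 0# ≤ f n) → 0# ≤ s
  Series-nn p h = ⟶-≤ (⟶-const 0#) p λ n → nn-sum n h

  Series-tail : ∀ {f s} → Series f s → Series (λ n → f (suc n)) (s - f 0)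
  Series-tail {f} {s} p = ⟶-cong (λ n → trans (+-cong (sum-head f n) refl) (solve 2 (λ a b → a :+ b :- a := b) (f 0) (sum (λ i → f (suc i)) n))) refl
    (⟶-- (⟶-sub suc ℕₚ.n≤1+n p) (⟶-const (f 0)))

  -- δ n = 1/((n+1)(n+2)), the telescoping gauge for absolute convergence.
  δ : ℕ → F
  δ n = ε n * ε (suc n)

  δ-pos : ∀ n → 0# < δ n
  δ-pos n = *-pos (ε-pos n) (ε-pos (suc n))

  δ-telescopes : ∀ n → δ n ≈ ε n - ε (suc n)
  δ-telescopes n = begin
    ε n * ε (suc n)
      ≈⟨ solve 2 (λ a b → a :* b := (a :* b) :* k 1) (ε n) (ε (suc n)) ⟩
    (ε n * ε (suc n)) * 1#
      ≈⟨ *-cong refl (trans (solve 1 (λ x → k 1 := x :+ k 1 :- x) (ν n)) (+-cong (sym (#-suc (suc n))) refl)) ⟩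
    (ε n * ε (suc n)) * (ν (suc n) - ν n)
      ≈⟨ solve 4 (λ a b x y → a :* b :* (y :- x) := y :* b :* a :- x :* a :* b) (ε n) (ε (suc n)) (ν n) (ν (suc n)) ⟩
    ν (suc n) * ε (suc n) * ε n - ν n * ε n * ε (suc n)
      ≈⟨ +-cong (trans (*-cong (ν*ε (suc n)) refl) (*-identityˡ _)) (-‿cong (trans (*-cong (ν*ε n) refl) (*-identityˡ _))) ⟩
    ε n - ε (suc n) ∎

  -- Converts quadratic decay, the form in which estimates arise, into the telescoping gauge; it
  -- amounts to n + 2 ≤ 2(n + 1).
  ε²≤2δ : ∀ n → ε n * ε n ≤ # 2 * δ n
  ε²≤2δ n = ≤-resp refl (solve 2 (λ a b → a :* (k 2 :* b) := k 2 :* (a :* b)) (ε n) (ε (suc n)))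
    (*-monoˡ (ε n) (<⇒≤ (ε-pos n)) (cancel-≤ (pos-# n) (≤-trans (≈⇒≤ (ν*ε n)) (cancel-≤ (pos-# (suc n)) (≤-trans
     (≤-trans (≈⇒≤ (*-identityʳ _)) (≤-trans (≈⇒≤ (#-suc (suc n))) (by-nn {e = # n} (nn-# n) (trans (+-cong (*-cong refl (#-suc n)) (-‿cong (+-cong (#-suc n) refl))) (solve 1 (λ n → k 2 :* (n :+ k 1) :- (n :+ k 1 :+ k 1) := n) (# n))))))
     (≈⇒≤ (trans (solve 1 (λ a → k 2 :* a := k 1 :* (k 2 :* a)) (ν n)) (trans (*-cong (sym (ν*ε (suc n))) refl) (solve 3 (λ v e a → (v :* e) :* (k 2 :* a) := v :* (a :* (k 2 :* e))) (ν (suc n)) (ε (suc n)) (ν n))))))))))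

  sum-δ : ∀ n → sum δ n ≈ 1# - ε n
  sum-δ zero    = sym (-‿inverseʳ 1#)
  sum-δ (suc n) = trans (+-cong (sum-δ n) (δ-telescopes n)) (solve 2 (λ a b → k 1 :- a :+ (a :- b) := k 1 :- b) (ε n) (ε (suc n)))

  Dom : F → (ℕ → F) → Set
  Dom C f = ∀ n → Bnd (C * δ n) (f n)

  Dom-nn : ∀ {C f} → Dom C f → 0# ≤ C
  Dom-nn d = nn-cancel (δ-pos 0) (≤-resp refl (*-comm _ _) (Bnd-nn (d 0)))

  private
    dom-block : ∀ {C f} → Dom C f → ∀ n j → Bnd (C * (ε n - ε (j ℕ.+ n))) (sum f (j ℕ.+ n) - sum f n)
    dom-block {C} {f} d n zero    = Bnd-resp (solve 2 (λ C e → k 0 := C :* (e :- e)) C (ε n)) (solve 1 (λ s → k 0 := s :- s) (sum f n)) (Bnd-refl ≤-refl)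
    dom-block {C} {f} d n (suc j) = Bnd-resp
      (trans (+-cong refl (*-cong refl (δ-telescopes (j ℕ.+ n)))) (solve 4 (λ C a b c → C :* (a :- b) :+ C :* (b :- c) := C :* (a :- c)) C (ε n) (ε (j ℕ.+ n)) (ε (suc j ℕ.+ n))))
      (solve 3 (λ a b c → a :- b :+ c := a :+ c :- b) (sum f (j ℕ.+ n)) (sum f n) (f (j ℕ.+ n)))
      (Bnd-+ (dom-block d n j) (d (j ℕ.+ n)))

    dom-block≤ : ∀ {C f} → Dom C f → ∀ m n → n ℕ.≤ m → Bnd (C * ε n) (sum f m - sum f n)
    dom-block≤ {C} {f} d m n p = ≡.subst (λ m → Bnd (C * ε n) (sum f m - sum f n)) (ℕₚ.m∸n+n≡m p)
      (Bnd-mono (*-monoˡ C (Dom-nn d) (by-nn (<⇒≤ (ε-pos (m ℕ.∸ n ℕ.+ n))) (solve 2 (λ a b → a :- (a :- b) := b) (ε n) (ε (m ℕ.∸ n ℕ.+ n))))) (dom-block d n (m ℕ.∸ n)))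

  dom-conv : ∀ {C f} → Dom C f → Σ[ s ∈ F ] Series f s
  dom-conv {C} {f} d = complete (sum f) C λ m n p → rate n (dom-block≤ d m n p)

  dom-tail : ∀ {C f s} → Dom C f → Series f s → ∀ n → Bnd (C * ε n) (s - sum f n)
  dom-tail {C} {f} {s} d p n =
    ⟶-≤ (⟶-const _) lim (λ j → proj₁ (dom-block≤ d (j ℕ.+ n) n (ℕₚ.m≤n+m n j))) ,
    ⟶-≤ lim (⟶-const _) (λ j → proj₂ (dom-block≤ d (j ℕ.+ n) n (ℕₚ.m≤n+m n j)))
    where
    lim : (λ j → sum f (j ℕ.+ n) - sum f n) ⟶ s - sum f n
    lim = ⟶-- (⟶-sub (ℕ._+ n) (λ j → ℕₚ.m≤m+n j n) p) (⟶-const _)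

  dom-bound : ∀ {C f s} → Dom C f → Series f s → Bnd C s
  dom-bound {C} {f} {s} d p = Bnd-resp (*-identityʳ C) (solve 1 (λ s → s :- k 0 := s) s) (dom-tail d p 0)

  sum-const : ∀ c n → sum (λ _ → c) n ≈ # n * c
  sum-const c zero    = sym (zeroˡ c)
  sum-const c (suc n) = trans (+-cong (sum-const c n) refl) (trans (solve 2 (λ c n → n :* c :+ c := (n :+ k 1) :* c) c (# n)) (*-cong (sym (#-suc n)) refl))

  -- Cutting row m at N loses at most C · `δ m` · `ε N`, and the `δ m` add up to less than 1.
  square-rows : ∀ {C r} (f : ℕ → ℕ → F) → (∀ m n → Bnd (C * δ m * δ n) (f m n)) → (∀ m → Series (f m) (r m)) →
    ∀ N → Bnd (C * ε N) (sum r N - sum (λ m → sum (f m) N) N)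
  square-rows {C} {r} f d rows N = Bnd-mono
    (≤-trans (≈⇒≤ (trans (sum-cong N λ m → solve 3 (λ C a e → C :* a :* e := C :* e :* a) C (δ m) (ε N)) (trans (sum-*ˡ (C * ε N) δ N) (*-cong refl (sum-δ N)))))
      (≤-trans (*-monoˡ _ (nn-* nnC (<⇒≤ (ε-pos N))) (by-nn (<⇒≤ (ε-pos N)) (solve 1 (λ e → k 1 :- (k 1 :- e) := e) (ε N)))) (≈⇒≤ (*-identityʳ _))))
    (Bnd-resp refl (sum-- r _ N) (Bnd-sum N λ m → dom-tail (d m) (rows m) N))
    where
    nnC : 0# ≤ C
    nnC = nn-cancel (*-pos (δ-pos 0) (δ-pos 0)) (≤-resp refl (solve 3 (λ C a b → C :* a :* b := a :* b :* C) C (δ 0) (δ 0)) (Bnd-nn (d 0 0)))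

  -- The square partial sums mediate between the two orders of summation.
  fubini : ∀ {C r c L} (f : ℕ → ℕ → F) → (∀ m n → Bnd (C * δ m * δ n) (f m n)) →
    (∀ m → Series (f m) (r m)) → (∀ n → Series (λ m → f m n) (c n)) →
    Series r L → Series c L
  fubini {C} f d rows cols p =
    ⟶-close C (λ N → square-rows (λ n m → f m n) (λ n m → Bnd-resp (solve 3 (λ C a b → C :* a :* b := C :* b :* a) C (δ m) (δ n)) refl (d m n)) cols N)
      (⟶-cong (λ N → sum-swap f N N) refl (⟶-close C (λ N → Bnd-swap (square-rows f d rows N)) p))

  ⟶-eventually : ∀ {s l e} → s ⟶ l → 0# < e → ∃[ N ] (∀ n → N ℕ.≤ n → s n - l < e × l - s n < e)
  ⟶-eventually {s} {l} {e} (C , h) e>0 = N , λ n hn →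
      ≤-<-trans (proj₂ (unrate n (h n))) (small n hn) ,
      ≤-<-trans (proj₂ (Bnd-swap {x = s n} {y = l} (unrate n (h n)))) (small n hn)
    where
    a = archimedean (C * inv e e>0)
    N = proj₁ a
    small : ∀ n → N ℕ.≤ n → C * ε n < e
    small n hn = <-resp ≈C refl′ (*-mono-<ˡ (ε n * e) (*-pos (ε-pos n) e>0) (<-≤-trans (proj₂ a) (#-≤ (ℕₚ.m≤n⇒m≤1+n hn))))
      where
      ≈C : ε n * e * (C * inv e e>0) ≈ C * ε n
      ≈C = trans (solve 4 (λ h e c i → h :* e :* (c :* i) := c :* h :* (e :* i)) (ε n) e C (inv e e>0)) (trans (*-cong refl (inv-r e e>0)) (*-identityʳ _))
      refl′ : ε n * e * ν n ≈ e
      refl′ = trans (solve 3 (λ h e v → h :* e :* v := v :* h :* e) (ε n) e (ν n)) (trans (*-cong (ν*ε n) refl) (*-identityˡ e))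

-- The exponential function.

module Exponential (R : RealField) where

  open Limits R public
  open import Relation.Binary.Reasoning.Setoid setoid

  ≤-sum : ∀ {f} → (∀ i → 0# ≤ f i) → ∀ {i} n → i ℕ.< n → f i ≤ sum f n
  ≤-sum {f} h {i} (suc n) p with ℕₚ.m≤n⇒m<n∨m≡n (ℕ.s≤s⁻¹ p)
  ... | inj₁ q      = ≤-trans (≤-sum h n q) (by-nn (h n) (solve 2 (λ a b → a :+ b :- a := b) (sum f n) (f n)))
  ... | inj₂ ≡.refl = by-nn (nn-sum n h) (solve 2 (λ a b → a :+ b :- b := a) (sum f n) (f n))

  Series-drop : ∀ {f s} n → Series f s → Series (λ i → f (n ℕ.+ i)) (s - sum f n)
  Series-drop {f} {s} zero    p = ⟶-cong (λ _ → refl) (solve 1 (λ s → s := s :- k 0) s) p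
  Series-drop {f} {s} (suc n) p = ⟶-cong
    (λ m → sum-cong m λ i → ≈-reflexive (≡.cong f (ℕₚ.+-suc n i)))
    (trans (solve 3 (λ s a b → s :- a :- b := s :- (a :+ b)) s (sum f n) (f (n ℕ.+ 0))) (+-cong refl (-‿cong (+-cong refl (≈-reflexive (≡.cong f (ℕₚ.+-identityʳ n)))))))
    (Series-tail (Series-drop n p))

  ≤-Series : ∀ {f s} → (∀ i → 0# ≤ f i) → Series f s → ∀ n → sum f n ≤ s
  ≤-Series {f} {s} h p n = by-nn (Series-nn (Series-drop n p) (λ i → h _)) refl

  eterm : F → ℕ → F
  eterm x zero    = 1#
  eterm x (suc n) = eterm x n * (x * ε n)

  eterm-rec : ∀ x n → # suc n * eterm x (suc n) ≈ x * eterm x n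
  eterm-rec x n = trans (solve 4 (λ v e x t → v :* (t :* (x :* e)) := v :* e :* (x :* t)) (ν n) (ε n) x (eterm x n)) (trans (*-cong (ν*ε n) refl) (*-identityˡ _))

  eterm-cong : ∀ {x y} n → x ≈ y → eterm x n ≈ eterm y n
  eterm-cong zero    e = refl
  eterm-cong (suc n) e = *-cong (eterm-cong n e) (*-cong e refl)

  eterm-^ : ∀ x n → # (n !) * eterm x n ≈ x ^ n
  eterm-^ x zero    = *-identityˡ _
  eterm-^ x (suc n) = trans (*-cong (#-* (suc n) (n !)) refl) (trans
    (solve 3 (λ a b c → a :* b :* c := b :* (a :* c)) (# suc n) (# (n !)) (eterm x (suc n)))
    (trans (*-cong refl (eterm-rec x n)) (trans (solve 3 (λ a b c → a :* (b :* c) := b :* (a :* c)) (# (n !)) x (eterm x n)) (*-cong refl (eterm-^ x n)))))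

  eterm-nn : ∀ {x} n → 0# ≤ x → 0# ≤ eterm x n
  eterm-nn zero    p = num≤
  eterm-nn (suc n) p = nn-* (eterm-nn n p) (nn-* p (<⇒≤ (ε-pos n)))

  eterm-bnd : ∀ {h x} n → Bnd h x → Bnd (eterm h n) (eterm x n)
  eterm-bnd zero    b = Bnd-refl num≤
  eterm-bnd (suc n) b = Bnd-* (eterm-bnd n b) (Bnd-* b (Bnd-refl (<⇒≤ (ε-pos n))))

  -- The maximum of (n + 1)(n + 2)/2ⁿ is 3, attained at n = 1 and n = 2; this is why the first cases
  -- are separate.
  ½^≤3δ : ∀ n → ½ ^ n ≤ # 3 * δ n
  ½^≤3δ zero          = ≤-trans num≤ (≈⇒≤ (trans (ι-* (mkℚᵘ (+ 3) 0) (mkℚᵘ (+ 1) 0 ℚᵘ.* mkℚᵘ (+ 1) 1)) (*-cong refl (ι-* _ _))))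
  ½^≤3δ (suc zero)    = ≤-trans (≈⇒≤ (*-identityʳ ½)) (≤-trans (num≤ {q = mkℚᵘ (+ 3) 0 ℚᵘ.* (mkℚᵘ (+ 1) 1 ℚᵘ.* mkℚᵘ (+ 1) 2)}) (≈⇒≤ (trans (ι-* _ _) (*-cong refl (ι-* _ _)))))
  ½^≤3δ (suc (suc n)) = ≤-trans (*-monoˡ ½ (nn-ι 1 1) (½^≤3δ (suc n))) (≤-resp
    (solve 2 (λ a b → k 3 :* b :* (:½ :* a) := :½ :* (k 3 :* (a :* b))) (ε (suc n)) (ε (suc (suc n))))
    (solve 2 (λ a b → k 3 :* b :* a := k 3 :* (b :* a)) (ε (3 ℕ.+ n)) (ε (2 ℕ.+ n)))
    (*-monoˡ (# 3 * ε (suc (suc n))) (nn-* num≤ (<⇒≤ (ε-pos (2 ℕ.+ n)))) step))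
    where
    step : ½ * ε (suc n) ≤ ε (3 ℕ.+ n)
    step = cancel-≤ (pos-# (suc n)) (≤-trans (≈⇒≤ (trans (solve 2 (λ v e → v :* (:½ :* e) := :½ :* (v :* e)) (ν (suc n)) (ε (suc n))) (*-cong refl (ν*ε (suc n)))))
      (cancel-≤ (pos-# (3 ℕ.+ n)) (≤-trans
        (≤-trans (≈⇒≤ (*-cong (#-+ 4 n) refl)) (≤-trans (by-nn (nn-* (nn-ι 1 1) (nn-# n)) (solve 1 (λ n → (k 2 :+ n) :- (k 4 :+ n) :* (:½ :* k 1) := :½ :* n) (# n))) (≈⇒≤ (sym (#-+ 2 n)))))
        (≈⇒≤ (trans (trans (sym (*-identityʳ _)) (*-cong refl (sym (ν*ε (3 ℕ.+ n))))) (solve 3 (λ a v e → a :* (v :* e) := v :* (a :* e)) (ν (suc n)) (ν (3 ℕ.+ n)) (ε (3 ℕ.+ n))))))))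

  Geo : F → (ℕ → F) → Set
  Geo A f = ∀ n → Bnd (A * ½ ^ n) (f n)

  geo-nn : ∀ {A f} → Geo A f → 0# ≤ A
  geo-nn g = nn-cancel {1#} num< (≤-resp refl (*-comm _ _) (Bnd-nn (g 0)))

  geo-dom : ∀ {A f} → Geo A f → Dom (A * # 3) f
  geo-dom {A} g n = Bnd-mono (≤-trans (*-monoˡ A (geo-nn g) (½^≤3δ n)) (≈⇒≤ (sym (*-assoc _ _ _)))) (g n)

  geo-block : ∀ {A f} → Geo A f → ∀ n j → Bnd (# 2 * A * ½ ^ n) (sum f (j ℕ.+ n) - sum f n)
  geo-block {A} {f} g n j = Bnd-mono
    (by-nn (nn-* (nn-* num≤ (geo-nn g)) (nn-^ (j ℕ.+ n) (nn-ι 1 1))) (solve 3 (λ A a b → k 2 :* A :* a :- k 2 :* A :* (a :- b) := k 2 :* A :* b) A (½ ^ n) (½ ^ (j ℕ.+ n)))) (go j)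
    where
    go : ∀ j → Bnd (# 2 * A * (½ ^ n - ½ ^ (j ℕ.+ n))) (sum f (j ℕ.+ n) - sum f n)
    go zero    = Bnd-resp (solve 2 (λ C e → k 0 := k 2 :* C :* (e :- e)) A (½ ^ n)) (solve 1 (λ s → k 0 := s :- s) (sum f n)) (Bnd-refl ≤-refl)
    go (suc j) = Bnd-resp
      (solve 3 (λ A a b → k 2 :* A :* (a :- b) :+ A :* b := k 2 :* A :* (a :- :½ :* b)) A (½ ^ n) (½ ^ (j ℕ.+ n)))
      (solve 3 (λ a b c → a :- b :+ c := a :+ c :- b) (sum f (j ℕ.+ n)) (sum f n) (f (j ℕ.+ n)))
      (Bnd-+ (go j) (g (j ℕ.+ n)))

  private
    majorant : ℕ → ℕ → F
    majorant M n = # 2 ^ n * eterm (# M) n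

    majorant-nn : ∀ M n → 0# ≤ majorant M n
    majorant-nn M n = nn-* (nn-^ n num≤) (eterm-nn n (nn-# M))

    majorant-dec : ∀ M n → 2 ℕ.* M ℕ.≤ suc n → majorant M (suc n) ≤ majorant M n
    majorant-dec M n p = ≤-resp
      (solve 4 (λ a t m e → a :* t :* (k 2 :* m :* e) := (k 2 :* a) :* (t :* (m :* e))) (# 2 ^ n) (eterm (# M) n) (# M) (ε n)) (*-identityʳ _)
      (*-monoˡ (majorant M n) (majorant-nn M n) (≤-trans (*-monoʳ (ε n) (<⇒≤ (ε-pos n)) (≤-trans (≈⇒≤ (sym (#-* 2 M))) (#-≤ p))) (≈⇒≤ (ν*ε n))))

    majorant-bound : ∀ M n → majorant M n ≤ sum (majorant M) (suc (2 ℕ.* M))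
    majorant-bound M n with n ℕₚ.≤? 2 ℕ.* M
    ... | yes p = ≤-sum (majorant-nn M) (suc (2 ℕ.* M)) (ℕ.s≤s p)
    majorant-bound M zero    | no q = ⊥-elim (q ℕ.z≤n)
    majorant-bound M (suc n) | no q = ≤-trans (majorant-dec M n (ℕₚ.<⇒≤ (ℕₚ.≰⇒> q))) (majorant-bound M n)

  -- For |x| ≤ M the numbers (2M)ⁿ/n! decrease once n + 1 ≥ 2M, so the sum of the first 2M + 1 of
  -- them bounds them all; dividing by 2ⁿ leaves geometric decay.
  eterm-geo : ∀ x → Σ[ A ∈ F ] Geo A (eterm x)
  eterm-geo x with absBound x
  ... | M , b = sum (majorant M) (suc (2 ℕ.* M)) , λ n → Bnd-mono
    (≤-trans (≈⇒≤ (trans (sym (*-identityˡ _)) (trans (*-cong (sym (trans (sym (^-*-comm n)) (1^ n))) refl) (solve 3 (λ a b c → (b :* a) :* c := b :* c :* a) (½ ^ n) (# 2 ^ n) (eterm (# M) n)))))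
      (*-monoʳ (½ ^ n) (nn-^ n (nn-ι 1 1)) (majorant-bound M n)))
    (eterm-bnd n b)
    where
    ^-*-comm : ∀ n → 1# ^ n ≈ # 2 ^ n * ½ ^ n
    ^-*-comm zero    = sym (*-identityˡ _)
    ^-*-comm (suc n) = trans (*-cong refl (^-*-comm n)) (solve 2 (λ a b → k 1 :* (a :* b) := k 2 :* a :* (:½ :* b)) (# 2 ^ n) (½ ^ n))

  private
    eterm-conv : ∀ x → Σ[ s ∈ F ] Series (eterm x) s
    eterm-conv x = dom-conv (geo-dom (proj₂ (eterm-geo x)))

  abstract
    E : F → F
    E x = proj₁ (eterm-conv x)

    E-series : ∀ x → Series (eterm x) (E x)
    E-series x = proj₂ (eterm-conv x)

  E-cong : ∀ {x y} → x ≈ y → E x ≈ E y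
  E-cong {x} {y} e = ⟶-unique (Series-cong (λ n → eterm-cong n e) (E-series x)) (E-series y)

  private
    cauchy-diagonal : ∀ (f g : ℕ → F) N →
      sum (λ n → sum (λ i → f i * g (n ℕ.∸ i)) (suc n)) N ≈ sum (λ i → f i * sum g (N ℕ.∸ i)) N
    cauchy-diagonal f g zero    = refl
    cauchy-diagonal f g (suc N) = begin
      sum (λ n → sum (λ i → f i * g (n ℕ.∸ i)) (suc n)) N + sum (λ i → f i * g (N ℕ.∸ i)) (suc N)
        ≈⟨ +-cong (trans (cauchy-diagonal f g N) (trans (sym (+-identityʳ _)) (+-cong refl (sym last)))) refl ⟩
      sum (λ i → f i * sum g (N ℕ.∸ i)) (suc N) + sum (λ i → f i * g (N ℕ.∸ i)) (suc N)
        ≈⟨ sym (sum-+ _ _ (suc N)) ⟩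
      sum (λ i → f i * sum g (N ℕ.∸ i) + f i * g (N ℕ.∸ i)) (suc N)
        ≈⟨ sum-cong< (suc N) (λ i p → trans (sym (distribˡ _ _ _)) (*-cong refl (≈-reflexive (≡.cong (sum g) (≡.sym (ℕₚ.+-∸-assoc 1 (ℕ.s≤s⁻¹ p))))))) ⟩
      sum (λ i → f i * sum g (suc N ℕ.∸ i)) (suc N) ∎
      where
      last : f N * sum g (N ℕ.∸ N) ≈ 0#
      last = trans (*-cong refl (≈-reflexive (≡.cong (sum g) (ℕₚ.n∸n≡0 N)))) (zeroʳ _)

    conv : F → F → ℕ → F
    conv x y n = sum (λ i → eterm x i * eterm y (n ℕ.∸ i)) (suc n)

    -- Writing n + 1 as i + (n + 1 - i) in the i-th summand lowers one of the two factors. Since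
    -- `eterm (x + y)` obeys the same recurrence, this yields the binomial theorem without binomial
    -- coefficients.
    conv-rec : ∀ x y n → # suc n * conv x y (suc n) ≈ (x + y) * conv x y n
    conv-rec x y n = begin
      # suc n * conv x y (suc n)
        ≈⟨ sym (sum-*ˡ _ _ (suc (suc n))) ⟩
      sum (λ i → # suc n * (a i * b (suc n ℕ.∸ i))) (suc (suc n))
        ≈⟨ sum-cong< (suc (suc n)) (λ i p → trans (*-cong (trans (≈-reflexive (≡.cong #_ (≡.sym (ℕₚ.m+[n∸m]≡n (ℕ.s≤s⁻¹ p))))) (#-+ i _)) refl)
            (solve 4 (λ p q a b → (p :+ q) :* (a :* b) := p :* a :* b :+ a :* (q :* b)) (# i) (# (suc n ℕ.∸ i)) (a i) (b (suc n ℕ.∸ i)))) ⟩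
      sum (λ i → # i * a i * b (suc n ℕ.∸ i) + a i * (# (suc n ℕ.∸ i) * b (suc n ℕ.∸ i))) (suc (suc n))
        ≈⟨ sum-+ _ _ (suc (suc n)) ⟩
      sum (λ i → # i * a i * b (suc n ℕ.∸ i)) (suc (suc n)) + sum (λ i → a i * (# (suc n ℕ.∸ i) * b (suc n ℕ.∸ i))) (suc (suc n))
        ≈⟨ +-cong left right ⟩
      x * conv x y n + y * conv x y n
        ≈⟨ sym (distribʳ _ _ _) ⟩
      (x + y) * conv x y n ∎
      where
      a = eterm x
      b = eterm y
      left : sum (λ i → # i * a i * b (suc n ℕ.∸ i)) (suc (suc n)) ≈ x * conv x y n
      left = trans (sum-head _ (suc n)) (trans (+-cong (trans (*-cong (zeroˡ _) refl) (zeroˡ _)) refl) (trans (+-identityˡ _)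
        (trans (sum-cong (suc n) (λ i → trans (*-cong (eterm-rec x i) refl) (*-assoc _ _ _))) (sum-*ˡ x _ (suc n)))))
      right : sum (λ i → a i * (# (suc n ℕ.∸ i) * b (suc n ℕ.∸ i))) (suc (suc n)) ≈ y * conv x y n
      right = trans (+-cong refl (trans (*-cong refl (trans (*-cong (≈-reflexive (≡.cong #_ (ℕₚ.n∸n≡0 n))) refl) (zeroˡ _))) (zeroʳ _))) (trans (+-identityʳ _)
        (trans (sum-cong< (suc n) (λ i p → trans
            (*-cong refl (≈-reflexive (≡.cong (λ m → # m * b m) (ℕₚ.+-∸-assoc 1 (ℕ.s≤s⁻¹ p)))))
            (trans (*-cong refl (eterm-rec y (n ℕ.∸ i))) (solve 3 (λ a y b → a :* (y :* b) := y :* (a :* b)) (a i) y (b (n ℕ.∸ i))))))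
          (sum-*ˡ y _ (suc n))))

    eterm-+ : ∀ x y n → eterm (x + y) n ≈ conv x y n
    eterm-+ x y zero    = solve 0 (k 1 := k 0 :+ k 1 :* k 1)
    eterm-+ x y (suc n) = cancel-≈ (pos-# n) (trans (eterm-rec (x + y) n) (trans (*-cong refl (eterm-+ x y n)) (sym (conv-rec x y n))))

  -- The partial product is a sum over a square, the partial sum for x + y over a triangle. Each of
  -- the N rows misses O(2⁻ᴺ), and N · 2⁻ᴺ is O(1/N).
  E-+ : ∀ x y → E (x + y) ≈ E x * E y
  E-+ x y = ⟶-unique (E-series (x + y)) (⟶-close (# 6 * A * B) close (⟶-* (E-series x) (E-series y)))
    where
    A = proj₁ (eterm-geo x)
    B = proj₁ (eterm-geo y)
    gA = proj₂ (eterm-geo x)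
    gB = proj₂ (eterm-geo y)
    S = sum (eterm y)
    term : ∀ N i → i ℕ.< N → Bnd (# 2 * A * B * ½ ^ N) (eterm x i * (S N - S (N ℕ.∸ i)))
    term N i p = Bnd-resp
      (trans (solve 4 (λ A B a b → A :* a :* (k 2 :* B :* b) := k 2 :* A :* B :* (a :* b)) A B (½ ^ i) (½ ^ (N ℕ.∸ i)))
        (*-cong refl (trans (sym (^-+ ½ i (N ℕ.∸ i))) (≈-reflexive (≡.cong (½ ^_) (ℕₚ.m+[n∸m]≡n (ℕₚ.<⇒≤ p)))))))
      refl
      (Bnd-* (gA i) (≡.subst (λ m → Bnd (# 2 * B * ½ ^ (N ℕ.∸ i)) (S m - S (N ℕ.∸ i))) (ℕₚ.m+[n∸m]≡n (ℕₚ.<⇒≤ p)) (geo-block gB (N ℕ.∸ i) i)))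
    small : ∀ N → # N * ½ ^ N ≤ # 3 * ε N
    small N = ≤-trans (*-monoˡ (# N) (nn-# N) (½^≤3δ N)) (≤-trans
      (≈⇒≤ (solve 3 (λ n a b → n :* (k 3 :* (a :* b)) := k 3 :* a :* (n :* b)) (# N) (ε N) (ε (suc N))))
      (≤-trans (*-monoˡ (# 3 * ε N) (nn-* num≤ (<⇒≤ (ε-pos N))) (≤-trans (*-monoʳ (ε (suc N)) (<⇒≤ (ε-pos (suc N))) (#-≤ (ℕₚ.m≤n+m N 2))) (≈⇒≤ (ν*ε (suc N))))) (≈⇒≤ (*-identityʳ _))))
    close : ∀ N → Bnd (# 6 * A * B * ε N) (sum (eterm (x + y)) N - sum (eterm x) N * S N)
    close N = Bnd-swap (Bnd-mono
      (≤-trans (≈⇒≤ (trans (sum-const _ N) (solve 4 (λ n h A B → n :* (k 2 :* A :* B :* h) := k 2 :* A :* B :* (n :* h)) (# N) (½ ^ N) A B)))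
        (≤-trans (*-monoˡ (# 2 * A * B) (nn-* (nn-* num≤ (geo-nn gA)) (geo-nn gB)) (small N)) (≈⇒≤ (solve 3 (λ A B e → k 2 :* A :* B :* (k 3 :* e) := k 6 :* A :* B :* e) A B (ε N)))))
      (Bnd-resp refl (trans (sum-cong N λ i → solve 3 (λ e a b → e :* (a :- b) := e :* a :- e :* b) (eterm x i) (S N) (S (N ℕ.∸ i)))
          (trans (sum-- _ _ N) (+-cong (sum-*ʳ (S N) _ N) (-‿cong (trans (sym (cauchy-diagonal (eterm x) (eterm y) N)) (sum-cong N λ n → sym (eterm-+ x y n)))))))
        (Bnd-sum< N (term N))))

  E-0 : E 0# ≈ 1#
  E-0 = ⟶-unique (E-series 0#) (⟶-close 1# (λ n → aux n) (⟶-const 1#))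
    where
    part : ∀ n → sum (eterm 0#) (suc n) ≈ 1#
    part n = trans (sum-head _ n) (trans (+-cong refl (trans (sum-cong n λ i → trans (*-cong refl (zeroˡ _)) (zeroʳ _)) (sum-0 n))) (+-identityʳ _))
    aux : ∀ n → Bnd (1# * ε n) (sum (eterm 0#) n - 1#)
    aux zero    = by-nn {e = 0#} ≤-refl (solve 1 (λ e → (k 0 :- k 1) :- :- (k 1 :* k 1) := k 0) 1#) , by-nn (nn-# 2) (solve 0 (k 1 :* k 1 :- (k 0 :- k 1) := k 2))
    aux (suc n) = Bnd-mono (nn-* num≤ (<⇒≤ (ε-pos (suc n)))) (Bnd-resp refl (sym (trans (+-cong (part n) refl) (-‿inverseʳ _))) (Bnd-refl ≤-refl))

  E-neg : ∀ x → E x * E (- x) ≈ 1#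
  E-neg x = trans (sym (E-+ x (- x))) (trans (E-cong (-‿inverseʳ x)) E-0)

  E-nat : ∀ n x → E (# n * x) ≈ E x ^ n
  E-nat zero    x = trans (E-cong (zeroˡ x)) E-0
  E-nat (suc n) x = trans (E-cong (trans (*-cong (#-+ 1 n) refl) (solve 2 (λ n x → (k 1 :+ n) :* x := x :+ n :* x) (# n) x))) (trans (E-+ x _) (*-cong refl (E-nat n x)))

  -- Strict positivity needs a witness: with n above `E (- x)`, the value `E x` cannot lie below
  -- 1/(n + 1), since the product of the two is 1.
  E-pos : ∀ x → 0# < E x
  E-pos x with archimedean (E (- x))
  ... | n , p with <-cotrans (ε-pos n) (E x)
  ...   | inj₁ q = q
  ...   | inj₂ q = ⊥-elim (<-irrefl (<-≤-trans (≤-<-trans (≈⇒≤ (sym (E-neg x))) (≤-<-trans (*-monoʳ (E (- x)) (nn (- x)) (<⇒≤ q)) (*-mono-<ˡ (ε n) (ε-pos n) (<-≤-trans p (#-≤ (ℕₚ.n≤1+n n)))))) (≈⇒≤ (trans (*-comm _ _) (ν*ε n)))))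
    where
    nn : ∀ x → 0# ≤ E x
    nn x = ≤-resp refl (trans (sym (E-+ _ _)) (E-cong (solve 1 (λ x → :½ :* x :+ :½ :* x := x) x))) (nn-² (E (½ * x)))

  nn-E : ∀ x → 0# ≤ E x
  nn-E x = <⇒≤ (E-pos x)

  E≥sum : ∀ {x} n → 0# ≤ x → sum (eterm x) n ≤ E x
  E≥sum {x} n p = ≤-Series (λ i → eterm-nn i p) (E-series x) n

  E≥eterm : ∀ {x} n → 0# ≤ x → eterm x n ≤ E x
  E≥eterm n p = ≤-trans (≤-sum (λ i → eterm-nn i p) (suc n) ℕₚ.≤-refl) (E≥sum (suc n) p)

  1≤E : ∀ {x} → 0# ≤ x → 1# ≤ E x
  1≤E p = E≥eterm 0 p

  E-mono : ∀ {x y} → x ≤ y → E x ≤ E y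
  E-mono {x} {y} p = ≤-trans (≤-trans (≈⇒≤ (sym (*-identityʳ _))) (*-monoˡ (E x) (nn-E x) (1≤E (nn-sub p))))
    (≈⇒≤ (trans (sym (E-+ _ _)) (E-cong (solve 2 (λ x y → x :+ (y :- x) := y) x y))))

  E≤1 : ∀ {x} → 0# ≤ x → E (- x) ≤ 1#
  E≤1 {x} p = ≤-trans (E-mono (by-nn p (solve 1 (λ x → k 0 :- :- x := x) x))) (≈⇒≤ E-0)

  ^*E-neg : ∀ {x} n → 0# ≤ x → x ^ n * E (- x) ≤ # (n !)
  ^*E-neg {x} n p = ≤-trans (*-monoʳ (E (- x)) (nn-E _) (≤-trans (≈⇒≤ (sym (eterm-^ x n))) (*-monoˡ (# (n !)) (nn-# (n !)) (E≥eterm n p))))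
    (≈⇒≤ (trans (*-assoc _ _ _) (trans (*-cong refl (E-neg x)) (*-identityʳ _))))

  E-taylor : ∀ {h x} n → h ≤ 1# → Bnd h x → Bnd (h ^ n * E 1#) (E x - sum (eterm x) n)
  E-taylor {h} {x} n h≤1 b =
    ⟶-≤ (⟶-neg lim) (Series-drop n (E-series x)) (λ m → proj₁ (fin m)) ,
    ⟶-≤ (Series-drop n (E-series x)) lim (λ m → proj₂ (fin m))
    where
    lim : (λ m → h ^ n * sum (eterm 1#) m) ⟶ h ^ n * E 1#
    lim = ⟶-*ˡ _ (E-series 1#)
    nnh = Bnd-nn b
    low : ∀ j → eterm h j ≤ h ^ j
    low zero    = ≤-refl
    low (suc j) = ≤-trans (*-mono (eterm-nn j nnh) (nn-* nnh (<⇒≤ (ε-pos j))) (low j) (≤-trans (*-monoˡ h nnh (ε≤1 j)) (≈⇒≤ (*-identityʳ h)))) (≈⇒≤ (*-comm _ _))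
    term : ∀ i → eterm h (n ℕ.+ i) ≤ h ^ n * eterm 1# i
    term zero    = ≡.subst (λ m → eterm h m ≤ h ^ n * 1#) (≡.sym (ℕₚ.+-identityʳ n)) (≤-trans (low n) (≈⇒≤ (sym (*-identityʳ _))))
    term (suc i) = ≡.subst (λ m → eterm h m ≤ h ^ n * eterm 1# (suc i)) (≡.sym (ℕₚ.+-suc n i))
      (≤-trans (*-mono (eterm-nn (n ℕ.+ i) nnh) (nn-* nnh (<⇒≤ (ε-pos _))) (term i) (*-mono nnh (<⇒≤ (ε-pos _)) h≤1 (ε-anti (ℕₚ.m≤n+m i n)))) (≈⇒≤ (*-assoc _ _ _)))
    fin : ∀ m → Bnd (h ^ n * sum (eterm 1#) m) (sum (λ i → eterm x (n ℕ.+ i)) m)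
    fin m = Bnd-mono (≤-trans (sum-mono m term) (≈⇒≤ (sum-*ˡ _ _ m))) (Bnd-sum m λ i → eterm-bnd (n ℕ.+ i) b)

-- A product formula for two partial fraction series.

module PartialFractionSums (R : RealField) where

  open Exponential R public
  open import Relation.Binary.Reasoning.Setoid setoid
  open import Data.Integer.Base using (_⊖_)

  -- ρ j = 1/(j + ½)
  ρ : ℤ → F
  ρ (+ n)    = ι (mkℚᵘ (+ 2) (n ℕ.+ n))
  ρ -[1+ n ] = - ρ (+ n)

  K : ℕ → F
  K n = # n + ½

  #-double : ∀ n → # suc (n ℕ.+ n) ≈ # n + # n + 1#
  #-double n = trans (#-suc _) (+-cong (#-+ n n) refl)

  ρ≈2ε : ∀ n → ρ (+ n) ≈ # 2 * ε (n ℕ.+ n)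
  ρ≈2ε n = trans (ι-cong (*≡* (≡.cong +_ (≡.cong (2 ℕ.*_) (ℕₚ.*-identityˡ (suc (n ℕ.+ n))))))) (ι-* (mkℚᵘ (+ 2) 0) (mkℚᵘ (+ 1) (n ℕ.+ n)))

  K*ρ : ∀ n → K n * ρ (+ n) ≈ 1#
  K*ρ n = begin
    K n * ρ (+ n)                          ≈⟨ *-cong refl (ρ≈2ε n) ⟩
    K n * (# 2 * ε (n ℕ.+ n))              ≈⟨ solve 2 (λ n e → (n :+ :½) :* (k 2 :* e) := (n :+ n :+ k 1) :* e) (# n) (ε (n ℕ.+ n)) ⟩
    (# n + # n + 1#) * ε (n ℕ.+ n)         ≈⟨ *-cong (sym (#-double n)) refl ⟩
    ν (n ℕ.+ n) * ε (n ℕ.+ n)              ≈⟨ ν*ε _ ⟩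
    1# ∎

  private
    neg-* : ∀ x y → (- x) * (- y) ≈ x * y
    neg-* = solve 2 (λ x y → (:- x) :* (:- y) := x :* y)

  ρ-⊖ : ∀ m n → (# m - # n + ½) * ρ (m ⊖ n) ≈ 1#
  ρ-⊖ m       zero    = trans (*-cong (solve 1 (λ m → m :- k 0 :+ :½ := m :+ :½) (# m)) refl) (K*ρ m)
  ρ-⊖ zero    (suc n) = trans (*-cong (trans (+-cong (+-cong refl (-‿cong (#-suc n))) refl) (solve 1 (λ m → k 0 :- (m :+ k 1) :+ :½ := :- (m :+ :½)) (# n))) refl) (trans (neg-* _ _) (K*ρ n))
  ρ-⊖ (suc m) (suc n) = trans (*-cong
    (trans (+-cong (+-cong (#-suc m) (-‿cong (#-suc n))) refl) (solve 2 (λ m n → m :+ k 1 :- (n :+ k 1) :+ :½ := m :- n :+ :½) (# m) (# n)))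
    (≈-reflexive (≡.cong ρ (ℤₚ.[1+m]⊖[1+n]≡m⊖n m n)))) (ρ-⊖ m n)

  ρ-nn : ∀ n → 0# ≤ ρ (+ n)
  ρ-nn n = nn-ι 2 _

  ρ≤2ε : ∀ n → ρ (+ n) ≤ # 2 * ε n
  ρ≤2ε n = ≤-trans (≈⇒≤ (ρ≈2ε n))
    (*-monoˡ (# 2) num≤ (ε-anti (ℕₚ.m≤m+n n n)))

  ρ-anti : ∀ {m n} → m ℕ.≤ n → ρ (+ n) ≤ ρ (+ m)
  ρ-anti {m} {n} p = cancel-≤ {z = K m} (<-≤-trans (num< {q = mkℚᵘ (+ 1) 1}) (by-nn (nn-# m) (solve 1 (λ m → m :+ :½ :- :½ := m) (# m))))
    (≤-trans (*-monoʳ _ (ρ-nn n) (+-mono-≤ (#-≤ p) ≤-refl)) (≈⇒≤ (trans (K*ρ n) (sym (K*ρ m)))))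

  telescope : ∀ (g : ℕ → F) n → sum (λ i → g (suc i) - g i) n ≈ g n - g 0
  telescope g zero    = sym (-‿inverseʳ _)
  telescope g (suc n) = trans (+-cong (telescope g n) refl) (solve 3 (λ a b c → a :- b :+ (c :- a) := c :- b) (g n) (g 0) (g (suc n)))

  private
    ⊖-shift : ∀ M n → sum (λ j → ρ (j ⊖ suc M) - ρ (j ⊖ M)) n ≈ ρ (0 ⊖ suc M) - ρ (n ⊖ suc M)
    ⊖-shift M n = trans (sum-cong n (λ j → trans (+-cong refl (-‿cong (≈-reflexive (≡.cong ρ (≡.sym (ℤₚ.[1+m]⊖[1+n]≡m⊖n j M))))))
        (solve 2 (λ a b → a :- b := :- (b :- a)) (ρ (j ⊖ suc M)) (ρ (suc j ⊖ suc M)))))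
      (trans (sum-neg _ n) (trans (-‿cong (telescope (λ j → ρ (j ⊖ suc M)) n)) (solve 2 (λ a b → :- (a :- b) := b :- a) (ρ (n ⊖ suc M)) (ρ (0 ⊖ suc M)))))

    +-shift : ∀ M n → sum (λ j → ρ (+ (j ℕ.+ suc M)) - ρ (+ (j ℕ.+ M))) n ≈ ρ (+ (n ℕ.+ M)) - ρ (+ M)
    +-shift M n = trans (sum-cong n (λ j → +-cong (≈-reflexive (≡.cong (λ i → ρ (+ i)) (ℕₚ.+-suc j M))) refl)) (telescope (λ j → ρ (+ (j ℕ.+ M))) n)

    -- The sum of 1/(j+½-M) - 1/(j+½+M) over j < N, which the shift M → M+1 nearly preserves.
    W : ℕ → ℕ → F
    W N M = sum (λ j → ρ (j ⊖ M) - ρ (+ (j ℕ.+ M))) N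

    W-suc : ∀ N M → W N (suc M) ≈ W N M - (ρ (N ⊖ suc M) + ρ (+ (N ℕ.+ M)))
    W-suc N M = begin
      W N (suc M)
        ≈⟨ sum-cong N (λ j → solve 4 (λ a b c d → a :- c := (b :- d) :+ ((a :- b) :- (c :- d))) (ρ (j ⊖ suc M)) (ρ (j ⊖ M)) (ρ (+ (j ℕ.+ suc M))) (ρ (+ (j ℕ.+ M)))) ⟩
      sum (λ j → (ρ (j ⊖ M) - ρ (+ (j ℕ.+ M))) + ((ρ (j ⊖ suc M) - ρ (j ⊖ M)) - (ρ (+ (j ℕ.+ suc M)) - ρ (+ (j ℕ.+ M))))) N
        ≈⟨ trans (sum-+ _ _ N) (+-cong refl (trans (sum-- _ _ N) (+-cong (⊖-shift M N) (-‿cong (+-shift M N))))) ⟩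
      W N M + ((- ρ (+ M) - ρ (N ⊖ suc M)) - (ρ (+ (N ℕ.+ M)) - ρ (+ M)))
        ≈⟨ solve 4 (λ w a b c → w :+ ((:- a :- b) :- (c :- a)) := w :- (b :+ c)) (W N M) (ρ (+ M)) (ρ (N ⊖ suc M)) (ρ (+ (N ℕ.+ M))) ⟩
      W N M - (ρ (N ⊖ suc M) + ρ (+ (N ℕ.+ M))) ∎

    W-bound : ∀ N D M → M ℕ.+ D ℕ.≤ N → Bnd (# 2 * # M * ρ (+ D)) (W N M)
    W-bound N D zero    p = Bnd-resp (solve 1 (λ r → k 0 := k 2 :* k 0 :* r) (ρ (+ D)))
      (sym (trans (sum-cong N λ j → trans (+-cong refl (-‿cong (≈-reflexive (≡.cong (λ i → ρ (+ i)) (ℕₚ.+-identityʳ j))))) (-‿inverseʳ _)) (sum-0 N))) (Bnd-refl ≤-refl)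
    W-bound N D (suc M) p = Bnd-resp
      (trans (solve 2 (λ m r → k 2 :* m :* r :+ (r :+ r) := k 2 :* (m :+ k 1) :* r) (# M) (ρ (+ D))) (*-cong (*-cong refl (sym (#-suc M))) refl))
      (sym (W-suc N M))
      (Bnd-- (W-bound N D M (ℕₚ.<⇒≤ p)) (Bnd-+
        (≡.subst (λ i → Bnd (ρ (+ D)) (ρ i)) (≡.sym (ℤₚ.⊖-≥ (ℕₚ.m+n≤o⇒m≤o (suc M) p))) (Bnd-of (ρ-nn (N ℕ.∸ suc M)) (ρ-anti (≡.subst (ℕ._≤ N ℕ.∸ suc M) (ℕₚ.m+n∸m≡n (suc M) D) (ℕₚ.∸-monoˡ-≤ (suc M) p)))))
        (Bnd-of (ρ-nn (N ℕ.+ M)) (ρ-anti (ℕₚ.≤-trans (ℕₚ.m+n≤o⇒n≤o (suc M) p) (ℕₚ.m≤m+n N M))))))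

    -- The analogous sum over integers j ≤ N of 1/(j-K) - 1/(j+K), K = κ+½, corrected at j = 0.
    X : ℕ → ℕ → F
    X N κ = sum (λ j → ρ (j ⊖ suc κ) - ρ (+ (j ℕ.+ κ))) (suc N) + ρ (+ κ)

    X-suc : ∀ N κ → X N (suc κ) ≈ X N κ - (ρ (suc N ⊖ suc (suc κ)) + ρ (+ (suc N ℕ.+ κ)))
    X-suc N κ = begin
      sum (λ j → ρ (j ⊖ suc (suc κ)) - ρ (+ (j ℕ.+ suc κ))) (suc N) + ρ (+ suc κ)
        ≈⟨ +-cong (sum-cong (suc N) (λ j → solve 4 (λ a b c d → a :- c := (b :- d) :+ ((a :- b) :- (c :- d))) (ρ (j ⊖ suc (suc κ))) (ρ (j ⊖ suc κ)) (ρ (+ (j ℕ.+ suc κ))) (ρ (+ (j ℕ.+ κ))))) refl ⟩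
      sum (λ j → (ρ (j ⊖ suc κ) - ρ (+ (j ℕ.+ κ))) + ((ρ (j ⊖ suc (suc κ)) - ρ (j ⊖ suc κ)) - (ρ (+ (j ℕ.+ suc κ)) - ρ (+ (j ℕ.+ κ))))) (suc N) + ρ (+ suc κ)
        ≈⟨ +-cong (trans (sum-+ _ _ (suc N)) (+-cong refl (trans (sum-- _ _ (suc N)) (+-cong (⊖-shift (suc κ) (suc N)) (-‿cong (+-shift κ (suc N))))))) refl ⟩
      sum (λ j → ρ (j ⊖ suc κ) - ρ (+ (j ℕ.+ κ))) (suc N) + ((- ρ (+ suc κ) - ρ (suc N ⊖ suc (suc κ))) - (ρ (+ (suc N ℕ.+ κ)) - ρ (+ κ))) + ρ (+ suc κ)
        ≈⟨ solve 5 (λ w a b c d → w :+ ((:- a :- b) :- (c :- d)) :+ a := w :+ d :- (b :+ c)) (sum (λ j → ρ (j ⊖ suc κ) - ρ (+ (j ℕ.+ κ))) (suc N)) (ρ (+ suc κ)) (ρ (suc N ⊖ suc (suc κ))) (ρ (+ (suc N ℕ.+ κ))) (ρ (+ κ)) ⟩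
      X N κ - (ρ (suc N ⊖ suc (suc κ)) + ρ (+ (suc N ℕ.+ κ))) ∎

    X-bound : ∀ N D κ → κ ℕ.+ D ℕ.≤ N → Bnd (# 2 * K κ * ρ (+ D)) (X N κ)
    X-bound N D zero    p = Bnd-resp (solve 1 (λ r → r := k 2 :* (k 0 :+ :½) :* r) (ρ (+ D)))
      (sym (trans (+-cong (trans (sum-cong (suc N) (λ j → +-cong refl (-‿cong (≈-reflexive (≡.cong (λ i → ρ (+ i)) (ℕₚ.+-identityʳ j)))))) (⊖-shift 0 (suc N))) refl)
        (solve 2 (λ a b → :- a :- b :+ a := :- b) (ρ (+ 0)) (ρ (+ N)))))
      (Bnd-neg (Bnd-of (ρ-nn N) (ρ-anti p)))
    X-bound N D (suc κ) p = Bnd-resp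
      (trans (solve 2 (λ m r → k 2 :* (m :+ :½) :* r :+ (r :+ r) := k 2 :* ((m :+ k 1) :+ :½) :* r) (# κ) (ρ (+ D))) (*-cong (*-cong refl (+-cong (sym (#-suc κ)) refl)) refl))
      (sym (X-suc N κ))
      (Bnd-- (X-bound N D κ (ℕₚ.<⇒≤ p)) (Bnd-+
        (≡.subst (λ i → Bnd (ρ (+ D)) (ρ i)) (≡.sym (≡.trans (ℤₚ.[1+m]⊖[1+n]≡m⊖n N (suc κ)) (ℤₚ.⊖-≥ (ℕₚ.m+n≤o⇒m≤o (suc κ) p)))) (Bnd-of (ρ-nn (N ℕ.∸ suc κ)) (ρ-anti (≡.subst (ℕ._≤ N ℕ.∸ suc κ) (ℕₚ.m+n∸m≡n (suc κ) D) (ℕₚ.∸-monoˡ-≤ (suc κ) p)))))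
        (Bnd-of (ρ-nn (suc N ℕ.+ κ)) (ρ-anti (ℕₚ.≤-trans (ℕₚ.m+n≤o⇒n≤o (suc κ) p) (ℕₚ.≤-trans (ℕₚ.n≤1+n N) (ℕₚ.m≤m+n (suc N) κ)))))))

  -- If m + 1 + j = N, then `ε m * ε j` is (`ε m` + `ε j`) · `ε N`. One use extracts the factor
  -- `ε N`; a second bounds the remaining mixed sum by 2, like the sum of squares.
  Σε²ε : ∀ N → sum (λ m → ε m * ε m * ε (N ℕ.∸ suc m)) N ≤ # 4 * ε N
  Σε²ε N = ≤-trans (≈⇒≤ (trans (sum-cong< N split) (trans (sum-*ʳ (ε N) _ N) (*-comm _ _))))
    (≤-trans (*-monoˡ (ε N) (<⇒≤ (ε-pos N)) (≤-trans (≈⇒≤ (trans (sum-+ _ _ N) (+-cong refl (trans (sum-cong< N pair) (sum-*ʳ (ε N) _ N)))))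
      (≤-trans (+-mono-≤ sq (≤-trans (*-monoʳ (ε N) (<⇒≤ (ε-pos N)) (≤-trans (sum-mono N (λ m → +-mono-≤ (ε≤1 m) (ε≤1 (N ℕ.∸ suc m)))) (≈⇒≤ (twice N)))) cnt)) (≈⇒≤ (solve 0 (k 2 :+ k 2 := k 4))))))
      (≈⇒≤ (*-comm _ _)))
    where
    pair : ∀ m → m ℕ.< N → ε m * ε (N ℕ.∸ suc m) ≈ (ε m + ε (N ℕ.∸ suc m)) * ε N
    pair m p = begin
      ε m * ε j                                 ≈⟨ trans (sym (*-identityʳ _)) (*-cong refl (sym (ν*ε N))) ⟩
      ε m * ε j * (ν N * ε N)                   ≈⟨ *-cong refl (*-cong (trans (≈-reflexive (≡.cong #_ (≡.cong suc (≡.trans (≡.sym (ℕₚ.m+[n∸m]≡n p)) (≡.sym (ℕₚ.+-suc m j)))))) (#-+ (suc m) (suc j))) refl) ⟩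
      ε m * ε j * ((ν m + ν j) * ε N)           ≈⟨ solve 5 (λ a b x y e → a :* b :* ((x :+ y) :* e) := ((x :* a) :* b :+ (y :* b) :* a) :* e) (ε m) (ε j) (ν m) (ν j) (ε N) ⟩
      ((ν m * ε m) * ε j + (ν j * ε j) * ε m) * ε N ≈⟨ *-cong (+-cong (*-cong (ν*ε m) refl) (*-cong (ν*ε j) refl)) refl ⟩
      (1# * ε j + 1# * ε m) * ε N               ≈⟨ solve 3 (λ a b e → (k 1 :* b :+ k 1 :* a) :* e := (a :+ b) :* e) (ε m) (ε j) (ε N) ⟩
      (ε m + ε j) * ε N ∎
      where j = N ℕ.∸ suc m
    split : ∀ m → m ℕ.< N → ε m * ε m * ε (N ℕ.∸ suc m) ≈ (ε m * ε m + ε m * ε (N ℕ.∸ suc m)) * ε N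
    split m p = trans (*-assoc _ _ _) (trans (*-cong refl (pair m p)) (solve 3 (λ a b e → a :* ((a :+ b) :* e) := (a :* a :+ a :* b) :* e) (ε m) (ε (N ℕ.∸ suc m)) (ε N)))
    sq : sum (λ m → ε m * ε m) N ≤ # 2
    sq = ≤-trans (sum-mono N ε²≤2δ) (≤-trans (≈⇒≤ (trans (sum-*ˡ _ δ N) (*-cong refl (sum-δ N)))) (by-nn (nn-* (nn-# 2) (<⇒≤ (ε-pos N))) (solve 1 (λ e → k 2 :- k 2 :* (k 1 :- e) := k 2 :* e) (ε N))))
    twice : ∀ n → sum (λ _ → 1# + 1#) n ≈ # n * # 2
    twice zero    = sym (zeroˡ _)
    twice (suc n) = trans (+-cong (twice n) refl) (trans (solve 1 (λ n → n :* k 2 :+ (k 1 :+ k 1) := (n :+ k 1) :* k 2) (# n)) (*-cong (sym (#-suc n)) refl))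
    cnt : # N * # 2 * ε N ≤ # 2
    cnt = ≤-trans (≈⇒≤ (solve 2 (λ n e → n :* k 2 :* e := k 2 :* (n :* e)) (# N) (ε N))) (≤-trans (*-monoˡ (# 2) num≤ (≤-trans (*-monoʳ (ε N) (<⇒≤ (ε-pos N)) (#-≤ (ℕₚ.n≤1+n N))) (≈⇒≤ (ν*ε N)))) (≈⇒≤ (*-identityʳ _)))

  -- The range starts at -1/16 and not at 0 in order to contain the parameter at which both series
  -- reduce to Leibniz's series.
  module PartialFractions (s : F) (hs : ι (mkℚᵘ -[1+ 0 ] 15) ≤ s) where

    private
      :s0 : ∀ {n} → Expr n
      :s0 = con (mkℚᵘ -[1+ 0 ] 15)

      M-low : ∀ m → ½ * (ν m * ν m) ≤ ν m * ν m + s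
      M-low m = by-nn (nn-+ (nn-+ (nn-sub hs) (nn-* (nn-ι 1 1) (nn-+ (nn-² (# m)) (nn-* num≤ (nn-# m))))) (num≤ {q = mkℚᵘ (+ 7) 15}))
        (trans (+-cong (+-cong (*-cong (#-suc m) (#-suc m)) refl) (-‿cong (*-cong refl (*-cong (#-suc m) (#-suc m)))))
          (solve 2 (λ m s → (m :+ k 1) :* (m :+ k 1) :+ s :- :½ :* ((m :+ k 1) :* (m :+ k 1)) := (s :- :s0) :+ :½ :* (m :* m :+ k 2 :* m) :+ con (mkℚᵘ (+ 7) 15)) (# m) s))

      K-low : ∀ m → ι (mkℚᵘ (+ 1) 5) * (ν m * ν m) ≤ K m * K m + s
      K-low m = by-nn (nn-+ (nn-+ (nn-sub hs) (nn-+ (nn-* (nn-ι 5 5) (nn-² (# m))) (nn-* (nn-ι 2 2) (nn-# m)))) (num≤ {q = mkℚᵘ (+ 1) 47}))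
        (trans (+-cong refl (-‿cong (*-cong refl (*-cong (#-suc m) (#-suc m)))))
          (solve 2 (λ m s → (m :+ :½) :* (m :+ :½) :+ s :- con (mkℚᵘ (+ 1) 5) :* ((m :+ k 1) :* (m :+ k 1)) := (s :- :s0) :+ (con (mkℚᵘ (+ 5) 5) :* (m :* m) :+ con (mkℚᵘ (+ 2) 2) :* m) :+ con (mkℚᵘ (+ 1) 47)) (# m) s))

    M-pos : ∀ m → 0# < ν m * ν m + s
    M-pos m = <-≤-trans (*-pos (num< {q = mkℚᵘ (+ 1) 1}) (*-pos (pos-# m) (pos-# m))) (M-low m)

    K-pos : ∀ m → 0# < K m * K m + s
    K-pos m = <-≤-trans (*-pos (num< {q = mkℚᵘ (+ 1) 5}) (*-pos (pos-# m) (pos-# m))) (K-low m)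

    a h : ℕ → F
    a m = inv (ν m * ν m + s) (M-pos m)
    h m = inv (K m * K m + s) (K-pos m)

    private
      inv-bound : ∀ {x c d} m (p : 0# < x) → d * c ≈ 1# → 0# ≤ c → d * (ν m * ν m) ≤ x → inv x p ≤ c * (ε m * ε m)
      inv-bound {x} {c} {d} m p dc c≥0 q = cancel-≤ p (≤-trans (≈⇒≤ (inv-r x p)) (≤-trans (≈⇒≤ (sym (begin
        d * (ν m * ν m) * (c * (ε m * ε m))         ≈⟨ solve 4 (λ d v c e → d :* (v :* v) :* (c :* (e :* e)) := (d :* c) :* ((v :* e) :* (v :* e))) d (ν m) c (ε m) ⟩
        (d * c) * ((ν m * ε m) * (ν m * ε m))       ≈⟨ *-cong dc (*-cong (ν*ε m) (ν*ε m)) ⟩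
        1# * (1# * 1#)                              ≈⟨ solve 0 (k 1 :* (k 1 :* k 1) := k 1) ⟩
        1# ∎))) (*-monoʳ _ (nn-* c≥0 (nn-² (ε m))) q)))

    a-nn : ∀ m → 0# ≤ a m
    a-nn m = <⇒≤ (inv-pos _ (M-pos m))

    h-nn : ∀ m → 0# ≤ h m
    h-nn m = <⇒≤ (inv-pos _ (K-pos m))

    a-bound : ∀ m → a m ≤ # 2 * (ε m * ε m)
    a-bound m = inv-bound m (M-pos m) (solve 0 (:½ :* k 2 := k 1)) num≤ (M-low m)

    h-bound : ∀ m → h m ≤ # 6 * (ε m * ε m)
    h-bound m = inv-bound m (K-pos m) (solve 0 (con (mkℚᵘ (+ 1) 5) :* k 6 := k 1)) num≤ (K-low m)

    dom-ε² : ∀ {c f} → 0# ≤ c → (∀ m → 0# ≤ f m) → (∀ m → f m ≤ c * (ε m * ε m)) → Dom (c * # 2) f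
    dom-ε² {c} c≥0 p q m = Bnd-of (p m) (≤-trans (q m) (≤-trans (*-monoˡ c c≥0 (ε²≤2δ m)) (≈⇒≤ (sym (*-assoc _ _ _)))))

    a-dom : Dom (# 2 * # 2) a
    a-dom = dom-ε² num≤ a-nn a-bound

    h-dom : Dom (# 6 * # 2) h
    h-dom = dom-ε² num≤ h-nn h-bound

    abstract
      A H : F
      A = proj₁ (dom-conv a-dom)
      H = proj₁ (dom-conv h-dom)

      A-series : Series a A
      A-series = proj₂ (dom-conv a-dom)

      H-series : Series h H
      H-series = proj₂ (dom-conv h-dom)

    z : ℕ → F
    z j = ρ (+ j) * ρ (+ j)

    private
      -- Twice the partial fraction decomposition of 1/((m²+s)(K²+s)).
      pf : ∀ m j → # 2 * (a m * h j) ≈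
        a m * (ε m * (ρ (j ⊖ suc m) - ρ (+ (j ℕ.+ suc m)))) + h j * (ρ (+ j) * (ρ (suc m ⊖ suc j) - ρ (+ (suc m ℕ.+ j))))
      pf m j = sym (begin
        A′ * (e * (r₁ - ρ (+ (j ℕ.+ suc m)))) + H′ * (rⱼ * (ρ (suc m ⊖ suc j) - ρ (+ (suc m ℕ.+ j))))
          ≈⟨ +-cong refl (*-cong refl (*-cong refl (+-cong r₃≈-r₁ (-‿cong (≈-reflexive (≡.cong (λ i → ρ (+ i)) (ℕₚ.+-comm (suc m) j))))))) ⟩
        A′ * (e * (r₁ - r₂)) + H′ * (rⱼ * (- r₁ - r₂))
          ≈⟨ solve 6 (λ a h e f r q → a :* (e :* (r :- q)) :+ h :* (f :* (:- r :- q)) := a :* e :* (r :- q) :- h :* f :* (r :+ q)) A′ H′ e rⱼ r₁ r₂ ⟩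
        A′ * e * (r₁ - r₂) - H′ * rⱼ * (r₁ + r₂)
          ≈⟨ +-cong (*-cong refl (trans (+-cong (*1 e₂) (-‿cong (*1 e₁))) (solve 4 (λ p r q t → p :* (q :* t) :- t :* (r :* p) := p :* t :* (q :- r)) r₁ P Q r₂)))
                    (-‿cong (*-cong refl (trans (+-cong (*1 e₂) (*1 e₁)) (solve 4 (λ p r q t → p :* (q :* t) :+ t :* (r :* p) := p :* t :* (q :+ r)) r₁ P Q r₂)))) ⟩
        A′ * e * (r₁ * r₂ * (Q - P)) - H′ * rⱼ * (r₁ * r₂ * (Q + P))
          ≈⟨ solve 8 (λ a h e f r q m x → a :* e :* (r :* q :* ((x :+ m :+ :½) :- (x :- m :+ :½))) :- h :* f :* (r :* q :* ((x :+ m :+ :½) :+ (x :- m :+ :½)))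
               := k 2 :* r :* q :* (a :* (m :* e) :- h :* ((x :+ :½) :* f))) A′ H′ e rⱼ r₁ r₂ M (# j) ⟩
        # 2 * r₁ * r₂ * (A′ * (M * e) - H′ * (K j * rⱼ))
          ≈⟨ *-cong refl (+-cong (trans (*-cong refl (ν*ε m)) (trans (*-identityʳ _) (*1 (inv-r _ (K-pos j))))) (-‿cong (trans (*-cong refl (K*ρ j)) (trans (*-identityʳ _) (*1 (inv-r _ (M-pos m))))))) ⟩
        # 2 * r₁ * r₂ * (A′ * ((K j * K j + s) * H′) - H′ * ((M * M + s) * A′))
          ≈⟨ solve 7 (λ a h r q m x s → k 2 :* r :* q :* (a :* (((x :+ :½) :* (x :+ :½) :+ s) :* h) :- h :* ((m :* m :+ s) :* a))
               := k 2 :* (a :* h) :* ((x :- m :+ :½) :* r) :* ((x :+ m :+ :½) :* q)) A′ H′ r₁ r₂ M (# j) s ⟩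
        # 2 * (A′ * H′) * (P * r₁) * (Q * r₂)
          ≈⟨ trans (sym (*1 e₂)) (sym (*1 e₁)) ⟩
        # 2 * (A′ * H′) ∎)
        where
        A′ = a m
        H′ = h j
        M  = ν m
        e  = ε m
        rⱼ = ρ (+ j)
        r₁ = ρ (j ⊖ suc m)
        r₂ = ρ (+ (j ℕ.+ suc m))
        r₃ = ρ (suc m ⊖ suc j)
        P  = # j - M + ½
        Q  = # j + M + ½
        *1 : ∀ {x y} → x ≈ 1# → y ≈ y * x
        *1 e = trans (sym (*-identityʳ _)) (*-cong refl (sym e))
        e₁ : P * r₁ ≈ 1#
        e₁ = ρ-⊖ j (suc m)
        e₂ : Q * r₂ ≈ 1#
        e₂ = trans (*-cong (+-cong (sym (#-+ j (suc m))) refl) refl) (K*ρ (j ℕ.+ suc m))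
        r₃≈-r₁ : r₃ ≈ - r₁
        r₃≈-r₁ = begin
          r₃             ≈⟨ *1 e₁ ⟩
          r₃ * (P * r₁)  ≈⟨ solve 4 (λ r q x m → r :* ((x :- m :+ :½) :* q) := :- (((m :- (x :+ k 1) :+ :½) :* r) :* q)) r₃ r₁ (# j) M ⟩
          - ((M - (# j + 1#) + ½) * r₃ * r₁) ≈⟨ -‿cong (*-cong (trans (*-cong (+-cong (+-cong refl (-‿cong (sym (#-suc j)))) refl) refl) (ρ-⊖ (suc m) (suc j))) refl) ⟩
          - (1# * r₁)    ≈⟨ -‿cong (*-identityˡ r₁) ⟩
          - r₁ ∎

      colsum : ∀ N j → sum (λ m → ρ (suc m ⊖ suc j) - ρ (+ (suc m ℕ.+ j))) N ≈ X N j + ρ (+ j)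
      colsum N j = begin
        S                               ≈⟨ solve 2 (λ s r → s := (:- r :- r :+ s) :+ r :+ r) S (ρ (+ j)) ⟩
        (- ρ (+ j) - ρ (+ j) + S) + ρ (+ j) + ρ (+ j) ≈⟨ +-cong (+-cong (sym (sum-head _ N)) refl) refl ⟩
        X N j + ρ (+ j) ∎
        where S = sum (λ m → ρ (suc m ⊖ suc j) - ρ (+ (suc m ℕ.+ j))) N

      z-h : ∀ j → z j ≈ h j * (1# + s * z j)
      z-h j = begin
        z j                           ≈⟨ trans (sym (*-identityˡ _)) (*-cong (sym (inv-r _ (K-pos j))) refl) ⟩
        (K j * K j + s) * h j * z j   ≈⟨ solve 4 (λ x s h r → (x :* x :+ s) :* h :* (r :* r) := h :* ((x :* r) :* (x :* r) :+ s :* (r :* r))) (K j) s (h j) (ρ (+ j)) ⟩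
        h j * ((K j * ρ (+ j)) * (K j * ρ (+ j)) + s * z j) ≈⟨ *-cong refl (+-cong (trans (*-cong (K*ρ j) (K*ρ j)) (*-identityˡ _)) refl) ⟩
        h j * (1# + s * z j) ∎

      rowTerm colTerm : ℕ → ℕ → F
      rowTerm N m = a m * (ε m * W N (suc m))
      colTerm N j = h j * (ρ (+ j) * X N j)

      -- The truncation of `product` is exact up to the remainders `W` and `X` of the inner sums.
      -- The weights `a m` and `h j` make these remainders small even though a single one with index
      -- near N need not be.
      finite : ∀ N → (1# + # 2 * s * sum a N) * sum h N - sum z N ≈ s * (sum (rowTerm N) N + sum (colTerm N) N)
      finite N = begin
        (1# + # 2 * s * sum a N) * sum h N - sum z N
          ≈⟨ +-cong refl (-‿cong (trans (sum-cong N λ j → trans (z-h j) (solve 3 (λ h s z → h :* (k 1 :+ s :* z) := h :+ s :* (h :* z)) (h j) s (z j))) (trans (sum-+ _ _ N) (+-cong refl (sum-*ˡ s _ N))))) ⟩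
        (1# + # 2 * s * sum a N) * sum h N - (sum h N + s * HZ)
          ≈⟨ solve 4 (λ s a h q → (k 1 :+ k 2 :* s :* a) :* h :- (h :+ s :* q) := s :* (k 2 :* (a :* h) :- q)) s (sum a N) (sum h N) HZ ⟩
        s * (# 2 * (sum a N * sum h N) - HZ)
          ≈⟨ *-cong refl (+-cong double refl) ⟩
        s * (sum (rowTerm N) N + (sum (colTerm N) N + HZ) - HZ)
          ≈⟨ *-cong refl (solve 3 (λ a b c → a :+ (b :+ c) :- c := a :+ b) (sum (rowTerm N) N) (sum (colTerm N) N) HZ) ⟩
        s * (sum (rowTerm N) N + sum (colTerm N) N) ∎
        where
        HZ = sum (λ j → h j * z j) N
        P Q : ℕ → ℕ → F
        P m j = a m * (ε m * (ρ (j ⊖ suc m) - ρ (+ (j ℕ.+ suc m))))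
        Q m j = h j * (ρ (+ j) * (ρ (suc m ⊖ suc j) - ρ (+ (suc m ℕ.+ j))))
        pull : ∀ c d f → sum (λ i → c * (d * f i)) N ≈ c * (d * sum f N)
        pull c d f = trans (sum-*ˡ c _ N) (*-cong refl (sum-*ˡ d f N))
        double : # 2 * (sum a N * sum h N) ≈ sum (rowTerm N) N + (sum (colTerm N) N + HZ)
        double = begin
          # 2 * (sum a N * sum h N)
            ≈⟨ trans (*-cong refl (trans (sym (sum-*ʳ _ a N)) (sum-cong N λ m → sym (sum-*ˡ (a m) h N)))) (trans (sym (sum-*ˡ _ _ N)) (sum-cong N λ m → sym (sum-*ˡ _ _ N))) ⟩
          sum (λ m → sum (λ j → # 2 * (a m * h j)) N) N
            ≈⟨ trans (sum-cong N λ m → trans (sum-cong N (pf m)) (sum-+ (P m) (Q m) N)) (sum-+ _ _ N) ⟩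
          sum (λ m → sum (P m) N) N + sum (λ m → sum (Q m) N) N
            ≈⟨ +-cong (sum-cong N λ m → pull (a m) (ε m) _) (trans (sum-swap Q N N) (sum-cong N λ j → trans (pull (h j) (ρ (+ j)) _) (trans (*-cong refl (*-cong refl (colsum N j)))
                 (solve 3 (λ h r x → h :* (r :* (x :+ r)) := h :* (r :* x) :+ h :* (r :* r)) (h j) (ρ (+ j)) (X N j))))) ⟩
          sum (rowTerm N) N + sum (λ j → colTerm N j + h j * z j) N
            ≈⟨ +-cong refl (sum-+ _ _ N) ⟩
          sum (rowTerm N) N + (sum (colTerm N) N + HZ) ∎

      ρ≤ : ∀ N m → ρ (+ (N ℕ.∸ suc m)) ≤ # 2 * ε (N ℕ.∸ suc m)
      ρ≤ N m = ρ≤2ε _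

      rowBound : ∀ N m → m ℕ.< N → Bnd (# 8 * (ε m * ε m * ε (N ℕ.∸ suc m))) (rowTerm N m)
      rowBound N m p = Bnd-mono
        (≤-trans (≈⇒≤ (trans (solve 4 (λ a e v r → a :* (e :* (k 2 :* v :* r)) := a :* (k 2 :* (v :* e) :* r)) (a m) (ε m) (ν m) r) (*-cong refl (*-cong (trans (*-cong refl (ν*ε m)) (*-identityʳ _)) refl))))
          (≤-trans (*-mono (a-nn m) (nn-* num≤ (ρ-nn (N ℕ.∸ suc m))) (a-bound m) (*-monoˡ (# 2) num≤ (ρ≤ N m))) (≈⇒≤ (solve 2 (λ e f → k 2 :* (e :* e) :* (k 2 :* (k 2 :* f)) := k 8 :* (e :* e :* f)) (ε m) (ε (N ℕ.∸ suc m))))))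
        (Bnd-* (Bnd-refl (a-nn m)) (Bnd-* (Bnd-refl (<⇒≤ (ε-pos m))) (W-bound N (N ℕ.∸ suc m) (suc m) (ℕₚ.≤-reflexive (ℕₚ.m+[n∸m]≡n p)))))
        where r = ρ (+ (N ℕ.∸ suc m))

      colBound : ∀ N m → m ℕ.< N → Bnd (# 24 * (ε m * ε m * ε (N ℕ.∸ suc m))) (colTerm N m)
      colBound N m p = Bnd-mono
        (≤-trans (≈⇒≤ (trans (solve 4 (λ a e v r → a :* (e :* (k 2 :* v :* r)) := a :* (k 2 :* (v :* e) :* r)) (h m) (ρ (+ m)) (K m) r) (*-cong refl (*-cong (trans (*-cong refl (K*ρ m)) (*-identityʳ _)) refl))))
          (≤-trans (*-mono (h-nn m) (nn-* num≤ (ρ-nn (N ℕ.∸ suc m))) (h-bound m) (*-monoˡ (# 2) num≤ (ρ≤ N m))) (≈⇒≤ (solve 2 (λ e f → k 6 :* (e :* e) :* (k 2 :* (k 2 :* f)) := k 24 :* (e :* e :* f)) (ε m) (ε (N ℕ.∸ suc m))))))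
        (Bnd-* (Bnd-refl (h-nn m)) (Bnd-* (Bnd-refl (ρ-nn m)) (X-bound N (N ℕ.∸ suc m) m (ℕₚ.≤-trans (ℕₚ.n≤1+n _) (ℕₚ.≤-reflexive (ℕₚ.m+[n∸m]≡n p))))))
        where r = ρ (+ (N ℕ.∸ suc m))

      small : ∀ N → Bnd (# 128 * ε N) (sum (rowTerm N) N + sum (colTerm N) N)
      small N = Bnd-mono
        (≤-trans (≈⇒≤ (trans (+-cong (sum-*ˡ _ _ N) (sum-*ˡ _ _ N)) (solve 1 (λ x → k 8 :* x :+ k 24 :* x := k 32 :* x) _)))
          (≤-trans (*-monoˡ (# 32) num≤ (Σε²ε N)) (≈⇒≤ (solve 1 (λ e → k 32 :* (k 4 :* e) := k 128 :* e) (ε N)))))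
        (Bnd-+ (Bnd-sum< N (rowBound N)) (Bnd-sum< N (colBound N)))

    -- For s = y² the factors are πy coth πy and π tanh(πy)/(2y), so the dependence on s cancels. As
    -- the closed forms are not yet known, the double product is split into partial fractions and
    -- summed over a square.
    product : Series z ((1# + # 2 * s * A) * H)
    product with absBound s
    ... | S , b = ⟶-close (# S * # 128)
      (λ N → Bnd-swap (Bnd-resp (sym (*-assoc _ _ _)) (sym (finite N)) (Bnd-* b (small N))))
      (⟶-* (⟶-+ (⟶-const 1#) (⟶-*ˡ (# 2 * s) A-series)) H-series)

-- Leibniz's series, and the partial fractions of π coth πy.

module HyperbolicCotangent (R : RealField) where

  open PartialFractionSums R public
  open import Relation.Binary.Reasoning.Setoid setoid

  sum-pairs : ∀ f N → sum f (N ℕ.+ N) ≈ sum (λ i → f (i ℕ.+ i) + f (suc (i ℕ.+ i))) N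
  sum-pairs f zero    = refl
  sum-pairs f (suc N) = trans (≈-reflexive (≡.cong (λ m → sum f (suc m)) (ℕₚ.+-suc N N))) (trans (+-assoc _ _ _) (+-cong (sum-pairs f N) refl))

  parity : ∀ n → ∃[ N ] (n ≡.≡ N ℕ.+ N ⊎ n ≡.≡ suc (N ℕ.+ N))
  parity zero    = 0 , inj₁ ≡.refl
  parity (suc n) with parity n
  ... | N , inj₁ p = N , inj₂ (≡.cong suc p)
  ... | N , inj₂ p = suc N , inj₁ (≡.trans (≡.cong suc p) (≡.cong suc (≡.sym (ℕₚ.+-suc N N))))

  ε-half : ∀ N → ε N ≈ # 2 * ε (suc (N ℕ.+ N))
  ε-half N = cancel-≈ (pos-# N) (trans (ν*ε N) (trans (sym (ν*ε _)) (trans (*-cong (trans (≈-reflexive (≡.cong #_ (≡.cong suc (≡.sym (ℕₚ.+-suc N N))))) (#-+ (suc N) (suc N))) refl) (solve 2 (λ v e → (v :+ v) :* e := v :* (k 2 :* e)) (ν N) (ε (suc (N ℕ.+ N)))))))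

  -- An odd partial sum exceeds an even one by a single term, which the decay hypothesis makes
  -- negligible at the required rate.
  Series-unpair : ∀ {C f l} → (∀ n → Bnd (C * ε n) (f n)) → Series (λ i → f (i ℕ.+ i) + f (suc (i ℕ.+ i))) l → Series f l
  Series-unpair {C} {f} {l} b (D , p) = (D + C) * # 2 , λ n → rate n (go n (parity n))
    where
    nnC : 0# ≤ C
    nnC = nn-cancel (ε-pos 0) (≤-resp refl (*-comm _ _) (Bnd-nn (b 0)))
    even : ∀ N → Bnd (D * ε N) (sum f (N ℕ.+ N) - l)
    even N = Bnd-resp refl (+-cong (sym (sum-pairs f N)) refl) (unrate N (p N))
    widen : ∀ N n x → ε N ≤ # 2 * ε n → Bnd ((D + C) * ε N) x → Bnd ((D + C) * # 2 * ε n) x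
    widen N n x q = Bnd-mono (≤-trans (*-monoˡ (D + C) (nn-+ (Bnd-nn (p 0)) nnC) q) (≈⇒≤ (sym (*-assoc _ _ _))))
    go : ∀ n → ∃[ N ] (n ≡.≡ N ℕ.+ N ⊎ n ≡.≡ suc (N ℕ.+ N)) → Bnd ((D + C) * # 2 * ε n) (sum f n - l)
    go _ (N , inj₁ ≡.refl) = widen N _ _ (≤-trans (≈⇒≤ (ε-half N)) (*-monoˡ (# 2) num≤ (ε-anti (ℕₚ.n≤1+n _))))
      (Bnd-mono (*-monoʳ (ε N) (<⇒≤ (ε-pos N)) (by-nn nnC (solve 2 (λ d c → d :+ c :- d := c) D C))) (even N))
    go _ (N , inj₂ ≡.refl) = widen N _ _ (≈⇒≤ (ε-half N)) (Bnd-resp (sym (distribʳ _ _ _)) (solve 3 (λ a b c → a :- b :+ c := a :+ c :- b) (sum f (N ℕ.+ N)) l (f (N ℕ.+ N)))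
      (Bnd-+ (even N) (Bnd-mono (*-monoˡ C nnC (ε-anti (ℕₚ.m≤m+n N N))) (b _))))

  Series-pair : ∀ {f l} → Series f l → Series (λ i → f (i ℕ.+ i) + f (suc (i ℕ.+ i))) l
  Series-pair {f} p = ⟶-cong (sum-pairs f) refl (⟶-sub (λ n → n ℕ.+ n) (λ n → ℕₚ.m≤m+n n n) p)

  sgn : ℕ → F
  sgn n = (- 1#) ^ n

  sgn-even : ∀ n → sgn (n ℕ.+ n) ≈ 1#
  sgn-even zero    = refl
  sgn-even (suc n) = trans (≈-reflexive (≡.cong (λ m → - 1# * sgn m) (ℕₚ.+-suc n n))) (trans (solve 1 (λ x → :- k 1 :* (:- k 1 :* x) := x) (sgn (n ℕ.+ n))) (sgn-even n))

  sgn-odd : ∀ n → sgn (suc (n ℕ.+ n)) ≈ - 1#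
  sgn-odd n = trans (*-cong refl (sgn-even n)) (*-identityʳ _)

  Bnd-sgn : ∀ n → Bnd 1# (sgn n)
  Bnd-sgn zero    = Bnd-refl num≤
  Bnd-sgn (suc n) = Bnd-resp (*-identityʳ 1#) refl (Bnd-* (Bnd-neg (Bnd-refl num≤)) (Bnd-sgn n))

  leibniz : ℕ → F
  leibniz n = sgn n * ε (n ℕ.+ n)

  private
    -- At s = -1/16 the denominators factor as (j + ¼)(j + ¾) and (m - ¼)(m + ¼), so each term of
    -- `H` and of `A` is a multiple of a difference of two neighbouring Leibniz terms, with the
    -- pairing shifted by one between the two series.
    q : ℚᵘ
    q = mkℚᵘ -[1+ 0 ] 15

    module Q = PartialFractions (ι q) ≤-refl

    n₁ n₃ n₅ : ℕ → F
    n₁ j = # 4 * # j + 1#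
    n₃ j = # 4 * # j + # 3
    n₅ j = # 4 * # j + # 5

    quad : ∀ j i → # (i ℕ.+ ((j ℕ.+ j) ℕ.+ (j ℕ.+ j))) ≈ # 4 * # j + # i
    quad j i = trans (#-+ i _) (trans (+-cong refl (trans (#-+ (j ℕ.+ j) (j ℕ.+ j)) (+-cong (#-+ j j) (#-+ j j)))) (solve 2 (λ x i → i :+ ((x :+ x) :+ (x :+ x)) := k 4 :* x :+ i) (# j) (# i)))

    e₁ : ∀ j → n₁ j * ε ((j ℕ.+ j) ℕ.+ (j ℕ.+ j)) ≈ 1#
    e₁ j = trans (*-cong (sym (quad j 1)) refl) (ν*ε _)

    e₃ : ∀ j → n₃ j * ε (suc (j ℕ.+ j) ℕ.+ suc (j ℕ.+ j)) ≈ 1#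
    e₃ j = trans (*-cong (trans (sym (quad j 3)) (≈-reflexive (≡.cong (λ m → # suc (suc m)) (≡.sym (ℕₚ.+-suc _ _))))) refl) (ν*ε _)

    e₅ : ∀ j → n₅ j * ε (suc (suc (j ℕ.+ j)) ℕ.+ suc (suc (j ℕ.+ j))) ≈ 1#
    e₅ j = trans (*-cong (trans (sym (quad j 5)) (≈-reflexive (≡.cong (λ m → # suc (suc (suc m))) (≡.sym (≡.trans (ℕₚ.+-suc _ _) (≡.cong suc (ℕₚ.+-suc _ _))))))) refl) (ν*ε _)

    even-pair : ∀ j → ι (mkℚᵘ (+ 1) 7) * Q.h j ≈ leibniz (j ℕ.+ j) + leibniz (suc (j ℕ.+ j))
    even-pair j = sym (begin
      leibniz (j ℕ.+ j) + leibniz (suc (j ℕ.+ j))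
        ≈⟨ +-cong (*-cong (sgn-even j) refl) (*-cong (sgn-odd j) refl) ⟩
      1# * u + - 1# * v
        ≈⟨ +-cong (*-cong (sym (e₃ j)) refl) (trans (solve 1 (λ v → :- k 1 :* v := :- (k 1 :* v)) v) (-‿cong (*-cong (sym (e₁ j)) refl))) ⟩
      (n₃ j * v) * u - (n₁ j * u) * v
        ≈⟨ solve 3 (λ x u v → ((k 4 :* x :+ k 3) :* v) :* u :- ((k 4 :* x :+ k 1) :* u) :* v := k 2 :* u :* v :* k 1) (# j) u v ⟩
      # 2 * u * v * 1#
        ≈⟨ *-cong refl (sym (inv-r _ (Q.K-pos j))) ⟩
      # 2 * u * v * ((K j * K j + ι q) * Q.h j)
        ≈⟨ solve 4 (λ x u v h → k 2 :* u :* v :* (((x :+ :½) :* (x :+ :½) :+ con q) :* h) := con (mkℚᵘ (+ 1) 7) :* h :* ((k 4 :* x :+ k 1) :* u) :* ((k 4 :* x :+ k 3) :* v)) (# j) u v (Q.h j) ⟩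
      ι (mkℚᵘ (+ 1) 7) * Q.h j * (n₁ j * u) * (n₃ j * v)
        ≈⟨ *-cong (*-cong refl (e₁ j)) (e₃ j) ⟩
      ι (mkℚᵘ (+ 1) 7) * Q.h j * 1# * 1#
        ≈⟨ solve 1 (λ x → x :* k 1 :* k 1 := x) _ ⟩
      ι (mkℚᵘ (+ 1) 7) * Q.h j ∎)
      where
      u = ε ((j ℕ.+ j) ℕ.+ (j ℕ.+ j))
      v = ε (suc (j ℕ.+ j) ℕ.+ suc (j ℕ.+ j))

    odd-pair : ∀ j → # 2 * ι q * Q.a j ≈ leibniz (suc (j ℕ.+ j)) + leibniz (suc (suc (j ℕ.+ j)))
    odd-pair j = sym (begin
      leibniz (suc (j ℕ.+ j)) + leibniz (suc (suc (j ℕ.+ j)))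
        ≈⟨ +-cong (*-cong (sgn-odd j) refl) (*-cong (trans (*-cong refl (sgn-odd j)) (solve 0 (:- k 1 :* :- k 1 := k 1))) refl) ⟩
      - 1# * u + 1# * v
        ≈⟨ +-cong (trans (solve 1 (λ v → :- k 1 :* v := :- (k 1 :* v)) u) (-‿cong (*-cong (sym (e₅ j)) refl))) (*-cong (sym (e₃ j)) refl) ⟩
      - ((n₅ j * v) * u) + (n₃ j * u) * v
        ≈⟨ solve 3 (λ x u v → :- (((k 4 :* x :+ k 5) :* v) :* u) :+ ((k 4 :* x :+ k 3) :* u) :* v := :- (k 2 :* u :* v :* k 1)) (# j) u v ⟩
      - (# 2 * u * v * 1#)
        ≈⟨ -‿cong (*-cong refl (sym (trans (*-cong (+-cong (*-cong (sym (#-suc j)) (sym (#-suc j))) refl) refl) (inv-r _ (Q.M-pos j))))) ⟩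
      - (# 2 * u * v * (((# j + 1#) * (# j + 1#) + ι q) * Q.a j))
        ≈⟨ solve 4 (λ x u v h → :- (k 2 :* u :* v :* (((x :+ k 1) :* (x :+ k 1) :+ con q) :* h)) := k 2 :* con q :* h :* ((k 4 :* x :+ k 3) :* u) :* ((k 4 :* x :+ k 5) :* v)) (# j) u v (Q.a j) ⟩
      # 2 * ι q * Q.a j * (n₃ j * u) * (n₅ j * v)
        ≈⟨ *-cong (*-cong refl (e₃ j)) (e₅ j) ⟩
      # 2 * ι q * Q.a j * 1# * 1#
        ≈⟨ solve 1 (λ x → x :* k 1 :* k 1 := x) _ ⟩
      # 2 * ι q * Q.a j ∎)
      where
      u = ε (suc (j ℕ.+ j) ℕ.+ suc (j ℕ.+ j))
      v = ε (suc (suc (j ℕ.+ j)) ℕ.+ suc (suc (j ℕ.+ j)))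

  π/4 : F
  π/4 = ι (mkℚᵘ (+ 1) 7) * Q.H

  leibniz-series : Series leibniz π/4
  leibniz-series = Series-unpair {1#} (λ n → Bnd-* (Bnd-sgn n) (Bnd-of (<⇒≤ (ε-pos (n ℕ.+ n))) (ε-anti (ℕₚ.m≤m+n n n))))
    (Series-cong even-pair (Series-*ˡ _ Q.H-series))

  π : F
  π = # 4 * π/4

  private
    1+2qA : 1# + # 2 * ι q * Q.A ≈ π/4
    1+2qA = trans (+-cong refl (⟶-unique (Series-cong odd-pair (Series-*ˡ _ Q.A-series)) (Series-pair (Series-tail leibniz-series))))
      (solve 1 (λ x → k 1 :+ (x :- k 1 :* k 1) := x) π/4)

  module Kernel (s : F) (p : 0# ≤ s) where
    open PartialFractions s (≤-trans num≤ p) public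

    -- The product is independent of s, and at s = -1/16 its factors are π/4 and 8 · π/4.
    product-π : # 2 * ((1# + # 2 * s * A) * H) ≈ π * π
    product-π = trans (*-cong refl (trans (⟶-unique product Q.product) (*-cong 1+2qA refl)))
      (solve 1 (λ h → k 2 :* (con (mkℚᵘ (+ 1) 7) :* h :* h) := (k 4 :* (con (mkℚᵘ (+ 1) 7) :* h)) :* (k 4 :* (con (mkℚᵘ (+ 1) 7) :* h))) Q.H)

  A : ∀ s → 0# ≤ s → F
  A s p = Kernel.A s p

  A-cong : ∀ {s t} (p : 0# ≤ s) (q : 0# ≤ t) → s ≈ t → A s p ≈ A t q
  A-cong {s} {t} p q e = ⟶-unique (Series-cong (λ n → inv-cong (Kernel.M-pos s p n) (Kernel.M-pos t q n) (+-cong refl e)) (Kernel.A-series s p)) (Kernel.A-series t q)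

  A-nn : ∀ s (p : 0# ≤ s) → 0# ≤ A s p
  A-nn s p = Series-nn (Kernel.A-series s p) (Kernel.a-nn s p)

  A≤4 : ∀ s (p : 0# ≤ s) → A s p ≤ # 4
  A≤4 s p = ≤-trans (proj₂ (dom-bound (Kernel.a-dom s p) (Kernel.A-series s p))) (≈⇒≤ (solve 0 (k 2 :* k 2 := k 4)))

  -- In the sum of 4/(n² + 4s), even n give the terms of `A` and odd n those of `H`.
  quarter : ∀ {s t} (p : 0# ≤ s) (q : 0# ≤ t) → t ≈ # 4 * s → # 4 * A t q ≈ A s p + Kernel.H s p
  quarter {s} {t} p q e = ⟶-unique (Series-cong pair (Series-pair (Series-*ˡ (# 4) (Kernel.A-series t q))))
      (⟶-cong (λ _ → refl) (+-comm _ _) (Series-+ (Kernel.H-series s p) (Kernel.A-series s p)))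
    where
    module S = Kernel s p
    module T = Kernel t q
    four : ∀ {x y} (px : 0# < x) (py : 0# < y) → x ≈ # 4 * y → # 4 * inv x px ≈ inv y py
    four {x} {y} px py e = inv-unique py (trans (solve 2 (λ y i → y :* (k 4 :* i) := (k 4 :* y) :* i) y (inv x px)) (trans (*-cong (sym e) refl) (inv-r x px)))
    pair : ∀ j → # 4 * T.a (j ℕ.+ j) + # 4 * T.a (suc (j ℕ.+ j)) ≈ S.h j + S.a j
    pair j = +-cong
      (four (T.M-pos _) (S.K-pos j) (trans (+-cong (*-cong (#-double j) (#-double j)) e) (solve 2 (λ x s → (x :+ x :+ k 1) :* (x :+ x :+ k 1) :+ k 4 :* s := k 4 :* ((x :+ :½) :* (x :+ :½) :+ s)) (# j) s)))
      (four (T.M-pos _) (S.M-pos j) (trans (+-cong (*-cong dbl dbl) e) (solve 2 (λ x s → (x :+ x) :* (x :+ x) :+ k 4 :* s := k 4 :* (x :* x :+ s)) (ν j) s)))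
      where
      dbl : ν (suc (j ℕ.+ j)) ≈ ν j + ν j
      dbl = trans (≈-reflexive (≡.cong (λ m → # suc m) (≡.sym (ℕₚ.+-suc j j)))) (#-+ (suc j) (suc j))

  -- Eliminating `H` between `quarter` and `product-π` leaves a functional equation for `A` alone,
  -- the duplication formula 2 coth 2x coth x = coth² x + 1 in disguise. The zeta values are read
  -- off from it as well.
  A-duplication : ∀ {s t} (p : 0# ≤ s) (q : 0# ≤ t) → t ≈ # 4 * s →
    (1# + # 2 * s * A s p) * (# 8 * A t q - # 2 * A s p) ≈ π * π
  A-duplication {s} {t} p q e = trans (trans (*-cong refl (trans (solve 2 (λ a b → k 8 :* b :- k 2 :* a := k 2 :* (k 4 :* b) :- k 2 :* a) (A s p) (A t q)) (+-cong (*-cong refl (quarter p q e)) refl)))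
      (solve 3 (λ s a h → (k 1 :+ k 2 :* s :* a) :* (k 2 :* (a :+ h) :- k 2 :* a) := k 2 :* ((k 1 :+ k 2 :* s :* a) :* h)) s (A s p) (Kernel.H s p)))
    (Kernel.product-π s p)

  π-nn : 0# ≤ π
  π-nn = nn-* num≤ (nn-* num≤ (Series-nn Q.H-series Q.h-nn))

  π-pos : 0# < π
  π-pos = *-pos num< (*-pos num< (<-≤-trans (inv-pos _ (Q.K-pos 0)) (≤-trans (≈⇒≤ (sym (+-identityˡ _))) (≤-Series Q.h-nn Q.H-series 1))))

  -- c y = π coth (π y)
  c : ∀ y → 0# < y → F
  c y p = inv y p + # 2 * y * A (y * y) (nn-² y)

  c-cong : ∀ {x y} (p : 0# < x) (q : 0# < y) → x ≈ y → c x p ≈ c y q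
  c-cong p q e = +-cong (inv-cong p q e) (*-cong (*-cong refl e) (A-cong (nn-² _) (nn-² _) (*-cong e e)))

  c-pos : ∀ y p → 0# < c y p
  c-pos y p = pos-+-nn (inv-pos y p) (nn-* (nn-* num≤ (<⇒≤ p)) (A-nn (y * y) (nn-² y)))

  double-pos : ∀ {y} → 0# < y → 0# < # 2 * y
  double-pos p = *-pos num< p

  half-pos : ∀ {y} → 0# < y → 0# < ½ * y
  half-pos p = *-pos num< p

  c-duplication : ∀ y p → # 2 * c (# 2 * y) (double-pos p) * c y p ≈ c y p * c y p + π * π
  c-duplication y p = cancel-≈ (*-pos p p) (begin
    y * y * (# 2 * c (# 2 * y) p₂ * c y p)
      ≈⟨ solve 5 (λ y i j a b → y :* y :* (k 2 :* (j :+ k 2 :* (k 2 :* y) :* b) :* (i :+ k 2 :* y :* a)) := ((k 2 :* y) :* j :+ k 8 :* y :* y :* b) :* (y :* i :+ k 2 :* (y :* y) :* a)) y i j a b ⟩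
    ((# 2 * y) * j + # 8 * y * y * b) * (y * i + # 2 * (y * y) * a)
      ≈⟨ *-cong (+-cong (inv-r _ p₂) refl) (+-cong (inv-r _ p) refl) ⟩
    (1# + # 8 * y * y * b) * (1# + # 2 * (y * y) * a)
      ≈⟨ solve 3 (λ y a b → (k 1 :+ k 8 :* y :* y :* b) :* (k 1 :+ k 2 :* (y :* y) :* a) := (k 1 :+ k 2 :* (y :* y) :* a) :* (k 1 :+ k 2 :* (y :* y) :* a) :+ y :* y :* ((k 1 :+ k 2 :* (y :* y) :* a) :* (k 8 :* b :- k 2 :* a))) y a b ⟩
    (1# + # 2 * (y * y) * a) * (1# + # 2 * (y * y) * a) + y * y * ((1# + # 2 * (y * y) * a) * (# 8 * b - # 2 * a))
      ≈⟨ +-cong (*-cong (+-cong (sym (inv-r _ p)) refl) (+-cong (sym (inv-r _ p)) refl)) (*-cong refl (A-duplication (nn-² y) (nn-² (# 2 * y)) (solve 1 (λ y → (k 2 :* y) :* (k 2 :* y) := k 4 :* (y :* y)) y))) ⟩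
    (y * i + # 2 * (y * y) * a) * (y * i + # 2 * (y * y) * a) + y * y * (π * π)
      ≈⟨ solve 4 (λ y i a p → (y :* i :+ k 2 :* (y :* y) :* a) :* (y :* i :+ k 2 :* (y :* y) :* a) :+ y :* y :* (p :* p) := y :* y :* ((i :+ k 2 :* y :* a) :* (i :+ k 2 :* y :* a) :+ p :* p)) y i a π ⟩
    y * y * (c y p * c y p + π * π) ∎)
    where
    p₂ = double-pos p
    i = inv y p
    j = inv (# 2 * y) p₂
    a = A (y * y) (nn-² y)
    b = A ((# 2 * y) * (# 2 * y)) (nn-² _)

  undouble : ∀ y → # 2 * (½ * y) ≈ y
  undouble = solve 1 (λ y → k 2 :* (:½ :* y) := y)

  -- By duplication `c y` is the arithmetic mean of d and π²/d, where d is the value at y/2, and π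
  -- is their geometric mean.
  π≤c : ∀ y p → π ≤ c y p
  π≤c y p = cancel-≤ {z = # 2 * d} (*-pos num< (c-pos _ _)) (by-nn (nn-² (d - π)) (begin
    # 2 * d * c y p - # 2 * d * π
      ≈⟨ +-cong (trans (solve 2 (λ d c → k 2 :* d :* c := k 2 :* c :* d) d (c y p)) (trans (*-cong (*-cong refl (c-cong p _ (sym (undouble y)))) refl) (c-duplication _ (half-pos p)))) refl ⟩
    d * d + π * π - # 2 * d * π
      ≈⟨ solve 2 (λ d p → d :* d :+ p :* p :- k 2 :* d :* p := (d :- p) :* (d :- p)) d π ⟩
    (d - π) * (d - π) ∎))
    where
    d = c (½ * y) (half-pos p)

  private
    e : F → F
    e y = E (# 2 * π * y)

    1≤e : ∀ y → 0# < y → 1# ≤ e y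
    1≤e y p = 1≤E (nn-* (nn-* num≤ π-nn) (<⇒≤ p))

    -- The identity `coth` says that this vanishes. It is O(y) near 0, and doubling y multiplies it
    -- by at most e^{2πy}. After n halvings and n doublings the factors multiply to at most e^{2πy},
    -- so the defect at y is O(2⁻ⁿ) for every n.
    defect : ∀ y → 0# < y → F
    defect y p = c y p * (e y - 1#) - π * (e y + 1#)

    defect-cong : ∀ {x y} (p : 0# < x) (q : 0# < y) → x ≈ y → defect x p ≈ defect y q
    defect-cong p q h = +-cong (*-cong (c-cong p q h) (+-cong e≈ refl)) (-‿cong (*-cong refl (+-cong e≈ refl)))
      where e≈ = E-cong (*-cong refl h)

    e-double : ∀ y → e (# 2 * y) ≈ e y * e y
    e-double y = trans (E-cong (solve 2 (λ p y → k 2 :* p :* (k 2 :* y) := k 2 :* p :* y :+ k 2 :* p :* y) π y)) (E-+ _ _)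

    defect-double : ∀ {D} y p → Bnd D (defect y p) → Bnd (D * e y) (defect (# 2 * y) (double-pos p))
    defect-double {D} y p b = Bnd-cancel {z = # 2 * C} (*-pos num< (c-pos y p)) (Bnd-mono
      (≤-trans (*-monoˡ D (Bnd-nn b) f≤) (≈⇒≤ (solve 3 (λ d c e → d :* (k 2 :* c :* e) := k 2 :* c :* (d :* e)) D C (e y))))
      (Bnd-resp refl identity (Bnd-* b (Bnd-refl f≥0))))
      where
      C = c y p
      f = C * (e y + 1#) - π * (e y - 1#)
      f≥0 : 0# ≤ f
      f≥0 = by-nn (nn-+ (nn-* num≤ (<⇒≤ (c-pos y p))) (nn-* (nn-sub (π≤c y p)) (nn-sub (1≤e y p))))
        (solve 3 (λ c e p → c :* (e :+ k 1) :- p :* (e :- k 1) :- k 0 := k 2 :* c :+ (c :- p) :* (e :- k 1)) C (e y) π)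
      f≤ : f ≤ # 2 * C * e y
      f≤ = by-nn (nn-* (nn-+ (<⇒≤ (c-pos y p)) π-nn) (nn-sub (1≤e y p)))
        (solve 3 (λ c e p → k 2 :* c :* e :- (c :* (e :+ k 1) :- p :* (e :- k 1)) := (c :+ p) :* (e :- k 1)) C (e y) π)
      identity : defect y p * f ≈ # 2 * C * defect (# 2 * y) (double-pos p)
      identity = sym (begin
        # 2 * C * (c (# 2 * y) _ * (e (# 2 * y) - 1#) - π * (e (# 2 * y) + 1#))
          ≈⟨ *-cong refl (+-cong (*-cong refl (+-cong (e-double y) refl)) (-‿cong (*-cong refl (+-cong (e-double y) refl)))) ⟩
        # 2 * C * (c (# 2 * y) _ * (e y * e y - 1#) - π * (e y * e y + 1#))
          ≈⟨ solve 4 (λ c d e p → k 2 :* c :* (d :* (e :* e :- k 1) :- p :* (e :* e :+ k 1)) := (k 2 :* d :* c) :* (e :* e :- k 1) :- k 2 :* c :* p :* (e :* e :+ k 1)) C (c (# 2 * y) _) (e y) π ⟩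
        (# 2 * c (# 2 * y) _ * C) * (e y * e y - 1#) - # 2 * C * π * (e y * e y + 1#)
          ≈⟨ +-cong (*-cong (c-duplication y p) refl) refl ⟩
        (C * C + π * π) * (e y * e y - 1#) - # 2 * C * π * (e y * e y + 1#)
          ≈⟨ solve 3 (λ c e p → (c :* c :+ p :* p) :* (e :* e :- k 1) :- k 2 :* c :* p :* (e :* e :+ k 1) := (c :* (e :- k 1) :- p :* (e :+ k 1)) :* (c :* (e :+ k 1) :- p :* (e :- k 1))) C (e y) π ⟩
        defect y p * f ∎)

    shrink-pos : ∀ {y} n → 0# < y → 0# < ½ ^ n * y
    shrink-pos n p = *-pos (pos-^ n num<) p

    defect-shrink : ∀ {D} n y p → Bnd D (defect (½ ^ n * y) (shrink-pos n p)) → Bnd (D * e y) (defect y p)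
    defect-shrink {D} zero    y p b = Bnd-resp refl (defect-cong _ p (*-identityˡ y))
      (Bnd-mono (≤-trans (≈⇒≤ (sym (*-identityʳ D))) (*-monoˡ D (Bnd-nn b) (1≤e y p))) b)
    defect-shrink {D} (suc n) y p b = Bnd-resp
      (trans (*-assoc _ _ _) (*-cong refl (trans (sym (e-double _)) (E-cong (*-cong refl (undouble y))))))
      (defect-cong _ p (undouble y))
      (defect-double (½ * y) (half-pos p) (defect-shrink n (½ * y) (half-pos p) (Bnd-resp refl (defect-cong _ _ (solve 2 (λ h y → :½ :* h :* y := h :* (:½ :* y)) (½ ^ n) y)) b)))

    small-const : F
    small-const = # 2 * π * (# 2 * π) * E 1# + # 8 * (# 2 * π) * E 1# + π * (# 2 * π) * E 1#

    defect-small : ∀ v p → # 2 * π * v ≤ 1# → v ≤ 1# → Bnd (small-const * v) (defect v p)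
    defect-small v p q v≤1 = Bnd-mono size (Bnd-resp refl split
          (Bnd-- (Bnd-+ (Bnd-* (Bnd-refl (<⇒≤ (inv-pos v p))) (E-taylor 2 q b))
                        (Bnd-* (Bnd-* (Bnd-refl (nn-* num≤ vp)) (Bnd-of (A-nn (v * v) (nn-² v)) (A≤4 (v * v) (nn-² v)))) (E-taylor 1 q b)))
                 (Bnd-* (Bnd-refl π-nn) (E-taylor 1 q b))))
        where
        e1 = nn-E 1#
        tp : 0# ≤ # 2 * π
        tp = nn-* num≤ π-nn
        vp = <⇒≤ p
        i = inv v p
        a = A (v * v) (nn-² v)
        t = # 2 * π * v
        b = Bnd-refl (nn-* tp vp)
        split : i * (E t - sum (eterm t) 2) + # 2 * v * a * (E t - sum (eterm t) 1) - π * (E t - sum (eterm t) 1) ≈ defect v p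
        split = begin
          i * (E t - sum (eterm t) 2) + # 2 * v * a * (E t - sum (eterm t) 1) - π * (E t - sum (eterm t) 1)
            ≈⟨ solve 5 (λ i v a e p → i :* (e :- (k 0 :+ k 1 :+ k 1 :* ((k 2 :* p :* v) :* k 1))) :+ k 2 :* v :* a :* (e :- (k 0 :+ k 1)) :- p :* (e :- (k 0 :+ k 1)) := (i :+ k 2 :* v :* a) :* (e :- k 1) :- p :* (e :+ k 1) :+ k 2 :* p :* (k 1 :- v :* i)) i v a (e v) π ⟩
          defect v p + # 2 * π * (1# - v * i)
            ≈⟨ +-cong refl (trans (*-cong refl (trans (+-cong refl (-‿cong (inv-r v p))) (-‿inverseʳ 1#))) (zeroʳ _)) ⟩
          defect v p + 0#
            ≈⟨ +-identityʳ _ ⟩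
          defect v p ∎
        size : i * (t ^ 2 * E 1#) + # 2 * v * # 4 * (t ^ 1 * E 1#) + π * (t ^ 1 * E 1#) ≤ small-const * v
        size = ≤-trans (+-mono-≤ (+-mono-≤
            (≈⇒≤ (trans (solve 4 (λ i p v x → i :* ((p :* v) :^ 2 :* x) := p :* p :* x :* v :* (v :* i)) i (# 2 * π) v (E 1#)) (trans (*-cong refl (inv-r v p)) (*-identityʳ _))))
            (≤-trans (≈⇒≤ (solve 3 (λ v p x → k 2 :* v :* k 4 :* ((p :* v) :^ 1 :* x) := k 8 :* p :* x :* v :* v) v (# 2 * π) (E 1#))) (≤-trans (*-monoˡ (# 8 * (# 2 * π) * E 1# * v) (nn-* (nn-* (nn-* num≤ tp) e1) vp) v≤1) (≈⇒≤ (*-identityʳ _)))))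
            (≈⇒≤ (solve 3 (λ v p x → p :* ((k 2 :* p :* v) :^ 1 :* x) := p :* (k 2 :* p) :* x :* v) v π (E 1#))))
          (≈⇒≤ (solve 3 (λ p v x → (k 2 :* p) :* (k 2 :* p) :* x :* v :+ k 8 :* (k 2 :* p) :* x :* v :+ p :* (k 2 :* p) :* x :* v := ((k 2 :* p) :* (k 2 :* p) :* x :+ k 8 :* (k 2 :* p) :* x :+ p :* (k 2 :* p) :* x) :* v) π v (E 1#)))

  ½^≤ε : ∀ n → ½ ^ n ≤ # 2 * ε n
  ½^≤ε zero    = ≤-resp refl (ι-* (mkℚᵘ (+ 2) 0) (mkℚᵘ (+ 1) 0)) (num≤ {1ℚᵘ})
  ½^≤ε (suc n) = ≤-trans (*-monoˡ ½ (nn-ι 1 1) (½^≤ε n)) (≤-trans (≈⇒≤ (solve 1 (λ e → :½ :* (k 2 :* e) := e) (ε n))) (≤-trans (≈⇒≤ (ε-half n)) (*-monoˡ (# 2) num≤ (ε-anti (ℕ.s≤s (ℕₚ.m≤m+n n n))))))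

  halving : ∀ y → ∃[ n ] ½ ^ n * y ≤ 1#
  halving y with archimedean y
  ... | n , p = suc (n ℕ.+ n) , ≤-trans (*-monoˡ _ (nn-^ (suc (n ℕ.+ n)) (nn-ι 1 1)) (≤-trans (<⇒≤ p) (#-≤ (ℕₚ.n≤1+n n))))
    (≤-trans (*-monoʳ (ν n) (nn-ν n) (½^≤ε (suc (n ℕ.+ n)))) (≈⇒≤ (trans (*-cong (sym (ε-half n)) refl) (trans (*-comm _ _) (ν*ε n)))))

  private
    defect-0-small : ∀ y p → # 2 * π * y ≤ 1# → y ≤ 1# → defect y p ≈ 0#
    defect-0-small y p q r = ⟶-unique (⟶-const (defect y p)) (⟶-0 (small-const * # 2 * y * e y) λ n → Bnd-mono (size n) (bound n))
      where
      sh : ∀ n → ½ ^ n * y ≤ y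
      sh n = ≤-trans (*-monoʳ y (<⇒≤ p) (≤-trans (^-mono n (nn-ι 1 1) num≤) (≈⇒≤ (1^ n)))) (≈⇒≤ (*-identityˡ y))
      bound : ∀ n → Bnd (small-const * (½ ^ n * y) * e y) (defect y p)
      bound n = defect-shrink n y p (defect-small (½ ^ n * y) (shrink-pos n p) (≤-trans (*-monoˡ (# 2 * π) (nn-* num≤ π-nn) (sh n)) q) (≤-trans (sh n) r))
      size : ∀ n → small-const * (½ ^ n * y) * e y ≤ small-const * # 2 * y * e y * ε n
      size n = ≤-trans (*-monoʳ (e y) (nn-E _) (*-monoˡ small-const small-const-nn (*-monoʳ y (<⇒≤ p) (½^≤ε n))))
        (≈⇒≤ (solve 4 (λ C f y e → C :* (k 2 :* f :* y) :* e := C :* k 2 :* y :* e :* f) small-const (ε n) y (e y)))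
        where
        small-const-nn : 0# ≤ small-const
        small-const-nn = nn-+ (nn-+ (nn-* (nn-* tp tp) e1) (nn-* (nn-* num≤ tp) e1)) (nn-* (nn-* π-nn tp) e1)
          where
          e1 = nn-E 1#
          tp : 0# ≤ # 2 * π
          tp = nn-* num≤ π-nn

    halve-more : ∀ a b x → 0# ≤ x → ½ ^ b * x ≤ 1# → ½ ^ (a ℕ.+ b) * x ≤ 1#
    halve-more zero    b x x≥0 h = h
    halve-more (suc a) b x x≥0 h = ≤-trans (≤-trans (≈⇒≤ (*-assoc ½ (½ ^ (a ℕ.+ b)) x)) (≤-trans (*-monoʳ _ (nn-* (nn-^ (a ℕ.+ b) (nn-ι 1 1)) x≥0) (num≤ {mkℚᵘ (+ 1) 1} {1ℚᵘ})) (≈⇒≤ (*-identityˡ _)))) (halve-more a b x x≥0 h)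

    defect-0 : ∀ y p m n → ½ ^ m * (# 2 * π * y) ≤ 1# → ½ ^ n * y ≤ 1# → defect y p ≈ 0#
    defect-0 y p m n q r = Bnd-0 (zeroˡ (e y)) (defect-shrink (m ℕ.+ n) y p (Bnd-resp refl (sym small) (Bnd-refl ≤-refl)))
      where
      z = ½ ^ (m ℕ.+ n)
      q′ : # 2 * π * (z * y) ≤ 1#
      q′ = ≤-trans (≈⇒≤ (solve 3 (λ p h y → k 2 :* p :* (h :* y) := h :* (k 2 :* p :* y)) π z y))
        (≡.subst (λ j → ½ ^ j * (# 2 * π * y) ≤ 1#) (ℕₚ.+-comm n m) (halve-more n m (# 2 * π * y) (nn-* (nn-* num≤ π-nn) (<⇒≤ p)) q))
      small : defect (z * y) (shrink-pos (m ℕ.+ n) p) ≈ 0#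
      small = defect-0-small (z * y) (shrink-pos (m ℕ.+ n) p) q′ (halve-more m n y (<⇒≤ p) r)

  coth : ∀ y p → c y p * (E (# 2 * π * y) - 1#) ≈ π * (E (# 2 * π * y) + 1#)
  coth y p = trans (solve 2 (λ a b → a := a :- b :+ b) _ (π * (E (# 2 * π * y) + 1#))) (trans (+-cong
    (defect-0 y p (proj₁ h) (proj₁ g) (proj₂ h) (proj₂ g)) refl) (+-identityˡ _))
    where
    h = halving (# 2 * π * y)
    g = halving y

-- Asymptotic expansions, and the zeta values at 2, 4 and 6.

module ZetaValues (R : RealField) where

  open HyperbolicCotangent R public
  open import Relation.Binary.Reasoning.Setoid setoid

  record O (m : ℕ) (f : ℕ → F) : Set where
    constructor _,_
    field
      const : F
      bound : ∀ n → Bnd (const * ε n ^ m) (f n)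

  nn-ε^ : ∀ n m → 0# ≤ ε n ^ m
  nn-ε^ n m = nn-^ m (<⇒≤ (ε-pos n))

  O-cong : ∀ {m f g} → (∀ n → f n ≈ g n) → O m f → O m g
  O-cong e (C , b) = C , λ n → Bnd-resp refl (e n) (b n)

  O-+ : ∀ {m f g} → O m f → O m g → O m (λ n → f n + g n)
  O-+ (C , b) (D , d) = C + D , λ n → Bnd-resp (sym (distribʳ _ _ _)) refl (Bnd-+ (b n) (d n))

  O-neg : ∀ {m f} → O m f → O m (λ n → - f n)
  O-neg (C , b) = C , λ n → Bnd-neg (b n)

  O-- : ∀ {m f g} → O m f → O m g → O m (λ n → f n - g n)
  O-- p q = O-+ p (O-neg q)

  O-* : ∀ {m k f g} → O m f → O k g → O (m ℕ.+ k) (λ n → f n * g n)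
  O-* {m} {k} (C , b) (D , d) = C * D , λ n → Bnd-resp
    (trans (solve 4 (λ C x D y → C :* x :* (D :* y) := C :* D :* (x :* y)) C (ε n ^ m) D (ε n ^ k)) (*-cong refl (sym (^-+ (ε n) m k)))) refl (Bnd-* (b n) (d n))

  O-const : ∀ c → O 0 (λ _ → c)
  O-const c with absBound c
  ... | B , b = # B , λ n → Bnd-resp (sym (*-identityʳ _)) refl b

  O-ε : ∀ m → O m (λ n → ε n ^ m)
  O-ε m = 1# , λ n → Bnd-resp (sym (*-identityˡ _)) refl (Bnd-refl (nn-ε^ n m))

  O-nn : ∀ {m f} → (o : O m f) → 0# ≤ O.const o
  O-nn {m} (C , b) = nn-cancel (pos-^ m (ε-pos 0)) (≤-resp refl (*-comm _ _) (Bnd-nn (b 0)))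

  O-suc : ∀ {m f} → O (suc m) f → O m f
  O-suc {m} o@(C , b) = C , λ n → Bnd-mono (*-monoˡ C (O-nn o) (≤-trans (*-monoʳ _ (nn-ε^ n m) (ε≤1 n)) (≈⇒≤ (*-identityˡ _)))) (b n)

  O-sum : ∀ {m} (f : ℕ → ℕ → F) k → (∀ i → i ℕ.< k → O m (f i)) → O m (λ n → sum (λ i → f i n) k)
  O-sum {m} f zero    h = 0# , λ n → Bnd-resp (sym (zeroˡ _)) refl (Bnd-refl ≤-refl)
  O-sum f (suc k) h = O-+ (O-sum f k λ i p → h i (ℕₚ.m≤n⇒m≤1+n p)) (h k ℕₚ.≤-refl)

  O-0 : ∀ {c} → O 1 (λ _ → c) → c ≈ 0#
  O-0 {c} (C , b) = ⟶-unique (⟶-const c) (⟶-0 C λ n → Bnd-resp (*-cong refl (*-identityʳ _)) refl (b n))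

  O-cancel : ∀ {m f} → O (suc m) (λ n → ε n * f n) → O m f
  O-cancel {m} {f} (C , b) = C , λ n → Bnd-cancel (ε-pos n) (Bnd-resp (solve 3 (λ C e x → C :* (e :* x) := e :* (C :* x)) C (ε n) (ε n ^ m)) refl (b n))

  poly : (ℕ → F) → ℕ → F → F
  poly d m x = sum (λ j → d j * x ^ j) m

  poly-suc : ∀ d m x → poly d (suc m) x ≈ d 0 + x * poly (λ j → d (suc j)) m x
  poly-suc d m x = trans (sum-head _ m) (+-cong (*-identityʳ _) (trans (sum-cong m λ j → solve 3 (λ d x y → d :* (x :* y) := x :* (d :* y)) (d (suc j)) x (x ^ j)) (sum-*ˡ x _ m)))

  -- The substitute for comparing derivatives: along x = 1/(n + 1) → 0 the constant coefficient is a
  -- limit, hence 0, and then a factor x can be divided out.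
  poly-unique : ∀ m d → O m (λ n → poly d m (ε n)) → ∀ j → j ℕ.< m → d j ≈ 0#
  poly-unique (suc m) d o = go
    where
    rest : O 0 (λ n → poly (λ j → d (suc j)) m (ε n))
    rest = O-sum _ m λ j _ → O-* (O-const _) (lower j (O-ε j))
      where
      lower : ∀ k {f} → O k f → O 0 f
      lower zero    p = p
      lower (suc k) p = lower k (O-suc p)
    lower₁ : ∀ m {f} → O (suc m) f → O 1 f
    lower₁ zero    p = p
    lower₁ (suc m) p = lower₁ m (O-suc p)
    d₀ : d 0 ≈ 0#
    d₀ = O-0 (O-cong (λ n → trans (+-cong (poly-suc d m (ε n)) refl) (solve 2 (λ a b → a :+ b :- b := a) (d 0) (ε n * poly (λ j → d (suc j)) m (ε n))))
      (O-- (lower₁ m o) (O-* (O-cong (λ n → *-identityʳ _) (O-ε 1)) rest)))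
    go : ∀ j → j ℕ.< suc m → d j ≈ 0#
    go zero    _ = d₀
    go (suc j) p = poly-unique m (λ j → d (suc j)) (O-cancel (O-cong (λ n → trans (poly-suc d m (ε n)) (trans (+-cong d₀ refl) (+-identityˡ _))) o)) j (ℕ.s≤s⁻¹ p)

  ε^-dom : ∀ m → Dom (# 2) (λ n → ε n ^ suc (suc m))
  ε^-dom m n = Bnd-of (nn-ε^ n (suc (suc m))) (≤-trans (≤-trans (≈⇒≤ (sym (*-assoc _ _ _))) (*-monoˡ (ε n * ε n) (nn-² (ε n)) (≤-trans (^-mono m (<⇒≤ (ε-pos n)) (ε≤1 n)) (≈⇒≤ (1^ m))))) (≤-trans (≈⇒≤ (*-identityʳ _)) (ε²≤2δ n)))

  ζ : ℕ → F
  ζ m = proj₁ (dom-conv (ε^-dom m))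

  ζ-series : ∀ m → Series (λ n → ε n ^ suc (suc m)) (ζ m)
  ζ-series m = proj₂ (dom-conv (ε^-dom m))

  -- ζ m is the zeta value at m + 2.
  A-taylor : ∀ s (p : 0# ≤ s) → Bnd (# 2 * s ^ 3) (A s p - (ζ 0 - s * ζ 2 + s ^ 2 * ζ 4))
  A-taylor s p = dom-bound dom (Series-cong expand (Series-- (Kernel.A-series s p)
      (Series-+ (Series-- (ζ-series 0) (Series-*ˡ s (ζ-series 2))) (Series-*ˡ (s ^ 2) (ζ-series 4)))))
    where
    open Kernel s p using (a; M-pos; a-nn)
    expand : ∀ n → a n - (ε n ^ 2 - s * ε n ^ 4 + s ^ 2 * ε n ^ 6) ≈ - (s ^ 3 * ε n ^ 6 * a n)
    expand n = begin
      a n - (ε n ^ 2 - s * ε n ^ 4 + s ^ 2 * ε n ^ 6)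
        ≈⟨ solve 3 (λ a e s → a :- (e :^ 2 :- s :* e :^ 4 :+ s :^ 2 :* e :^ 6) := k 1 :* k 1 :* a :- (e :^ 2 :- s :* e :^ 4 :+ s :^ 2 :* e :^ 6) :* k 1) (a n) (ε n) s ⟩
      1# * 1# * a n - (ε n ^ 2 - s * ε n ^ 4 + s ^ 2 * ε n ^ 6) * 1#
        ≈⟨ +-cong (*-cong (*-cong (sym (ν*ε n)) (sym (ν*ε n))) refl) (-‿cong (*-cong refl (sym (inv-r _ (M-pos n))))) ⟩
      (ν n * ε n) * (ν n * ε n) * a n - (ε n ^ 2 - s * ε n ^ 4 + s ^ 2 * ε n ^ 6) * ((ν n * ν n + s) * a n)
        ≈⟨ solve 4 (λ a e s v → (v :* e) :* (v :* e) :* a :- (e :^ 2 :- s :* e :^ 4 :+ s :^ 2 :* e :^ 6) :* ((v :* v :+ s) :* a) := :- (s :^ 3 :* e :^ 6 :* a) :+ s :* e :^ 2 :* a :* (((v :* e) :* (v :* e) :- k 1) :- s :* e :^ 2 :* ((v :* e) :* (v :* e) :- k 1))) (a n) (ε n) s (ν n) ⟩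
      - (s ^ 3 * ε n ^ 6 * a n) + s * ε n ^ 2 * a n * (((ν n * ε n) * (ν n * ε n) - 1#) - s * ε n ^ 2 * ((ν n * ε n) * (ν n * ε n) - 1#))
        ≈⟨ +-cong refl (*-cong refl (+-cong vanish (-‿cong (*-cong refl vanish)))) ⟩
      - (s ^ 3 * ε n ^ 6 * a n) + s * ε n ^ 2 * a n * (0# - s * ε n ^ 2 * 0#)
        ≈⟨ solve 3 (λ a e s → :- (s :^ 3 :* e :^ 6 :* a) :+ s :* e :^ 2 :* a :* (k 0 :- s :* e :^ 2 :* k 0) := :- (s :^ 3 :* e :^ 6 :* a)) (a n) (ε n) s ⟩
      - (s ^ 3 * ε n ^ 6 * a n) ∎
      where
      vanish : (ν n * ε n) * (ν n * ε n) - 1# ≈ 0#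
      vanish = trans (+-cong (trans (*-cong (ν*ε n) (ν*ε n)) (*-identityˡ _)) refl) (-‿inverseʳ _)
    a≤1 : ∀ n → a n ≤ 1#
    a≤1 n = ≤-trans (inv-anti num< (M-pos n) (≤-trans (≤-trans (≈⇒≤ (sym (*-identityˡ 1#))) (*-mono num≤ num≤ (1≤ν n) (1≤ν n))) (by-nn p (solve 2 (λ v s → v :+ s :- v := s) (ν n * ν n) s))))
      (≈⇒≤ (trans (sym (*-identityˡ _)) (inv-r 1# num<)))
    dom : Dom (# 2 * s ^ 3) (λ n → - (s ^ 3 * ε n ^ 6 * a n))
    dom n = Bnd-neg (Bnd-of (nn-* (nn-* (nn-^ 3 p) (nn-ε^ n 6)) (a-nn n)) (≤-trans (*-monoˡ _ (nn-* (nn-^ 3 p) (nn-ε^ n 6)) (a≤1 n)) (≤-trans (≈⇒≤ (*-identityʳ _))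
      (≤-trans (*-monoˡ (s ^ 3) (nn-^ 3 p) (proj₂ (ε^-dom 4 n))) (≈⇒≤ (solve 2 (λ s d → s :* (k 2 :* d) := k 2 :* s :* d) (s ^ 3) (δ n)))))))

  private
    -- The coefficients of 1, s and s² in (1 + 2sA(s))(8A(4s) - 2A(s)) - π², where A(s) = ζ(2) -
    -- sζ(4) + s²ζ(6) - ⋯. By `A-duplication` the whole expression is 0.
    coeff : ℕ → F
    coeff 0 = # 6 * ζ 0 - π * π
    coeff 1 = # 12 * ζ 0 * ζ 0 - # 30 * ζ 2
    coeff _ = # 126 * ζ 4 - # 72 * ζ 0 * ζ 2

    coeff-0 : ∀ j → j ℕ.< 3 → coeff j ≈ 0#
    coeff-0 = poly-unique 3 coeff (O-cong (λ n → sym (identity n))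
        (O-neg (O-+ (O-+ (O-* (O-ε 3) (O-const (# 252 * ζ 0 * ζ 4 + # 60 * ζ 2 * ζ 2))) (O-suc (O-* (O-ε 4) (O-const (- (# 252 * ζ 2 * ζ 4)))))) (O-+ (O-* U₃ V₀) (O-* U₀ V₃)))))
      where
      s s₄ r r₄ : ℕ → F
      s n = ε n
      s₄ n = # 4 * ε n
      nn-s : ∀ n → 0# ≤ s n
      nn-s n = <⇒≤ (ε-pos n)
      nn-s₄ : ∀ n → 0# ≤ s₄ n
      nn-s₄ n = nn-* num≤ (nn-s n)
      T : F → F
      T s = ζ 0 - s * ζ 2 + s ^ 2 * ζ 4
      r n = A (s n) (nn-s n) - T (s n)
      r₄ n = A (s₄ n) (nn-s₄ n) - T (s₄ n)
      O-r : O 3 r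
      O-r = # 2 , λ n → A-taylor (s n) (nn-s n)
      O-r₄ : O 3 r₄
      O-r₄ = # 128 , λ n → Bnd-resp (solve 1 (λ e → k 2 :* (k 4 :* e) :^ 3 := k 128 :* e :^ 3) (ε n)) refl (A-taylor (s₄ n) (nn-s₄ n))
      u v : ℕ → F
      u n = # 2 * (ε n * r n) + # 2 * (ε n ^ 3 * ζ 4)
      v n = # 8 * r₄ n - # 2 * r n
      U₃ : O 3 u
      U₃ = O-+ (O-* (O-const (# 2)) (O-suc (O-* (O-cong (λ n → *-identityʳ _) (O-ε 1)) O-r))) (O-* (O-const (# 2)) (O-* (O-ε 3) (O-const (ζ 4))))
      V₃ : O 3 v
      V₃ = O-- (O-* (O-const (# 8)) O-r₄) (O-* (O-const (# 2)) O-r)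
      V₀ : O 0 (λ n → # 6 * ζ 0 - # 30 * ζ 2 * ε n ^ 1 + # 126 * ζ 4 * ε n ^ 2 + v n)
      V₀ = O-+ (O-+ (O-- (O-const _) (O-* (O-const _) (O-suc (O-ε 1)))) (O-* (O-const _) (O-suc (O-suc (O-ε 2))))) (O-suc (O-suc (O-suc V₃)))
      U₀ : O 0 (λ n → 1# + # 2 * ζ 0 * ε n ^ 1 - # 2 * ζ 2 * ε n ^ 2)
      U₀ = O-- (O-+ (O-const _) (O-* (O-const _) (O-suc (O-ε 1)))) (O-* (O-const _) (O-suc (O-suc (O-ε 2))))
      identity : ∀ n → poly coeff 3 (ε n) ≈ - ((ε n ^ 3 * (# 252 * ζ 0 * ζ 4 + # 60 * ζ 2 * ζ 2) + ε n ^ 4 * (- (# 252 * ζ 2 * ζ 4)))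
        + (u n * (# 6 * ζ 0 - # 30 * ζ 2 * ε n ^ 1 + # 126 * ζ 4 * ε n ^ 2 + v n) + (1# + # 2 * ζ 0 * ε n ^ 1 - # 2 * ζ 2 * ε n ^ 2) * v n))
      identity n = begin
        poly coeff 3 (ε n)
          ≈⟨ +-cong (+-cong (+-cong refl (*-cong (+-cong refl (-‿cong (sym dup))) refl)) refl) refl ⟩
        0# + (# 6 * ζ 0 - (1# + # 2 * ε n * A (s n) (nn-s n)) * (# 8 * A (s₄ n) (nn-s₄ n) - # 2 * A (s n) (nn-s n))) * ε n ^ 0 + coeff 1 * ε n ^ 1 + coeff 2 * ε n ^ 2
          ≈⟨ solve 6 (λ e a a₄ z₀ z₂ z₄ →
               let T  = λ s → z₀ :- s :* z₂ :+ s :^ 2 :* z₄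
                   r  = a :- T e
                   r₄ = a₄ :- T (k 4 :* e)
                   u  = k 2 :* (e :* r) :+ k 2 :* (e :^ 3 :* z₄)
                   v  = k 8 :* r₄ :- k 2 :* r
               in k 0 :+ (k 6 :* z₀ :- (k 1 :+ k 2 :* e :* a) :* (k 8 :* a₄ :- k 2 :* a)) :* e :^ 0 :+ (k 12 :* z₀ :* z₀ :- k 30 :* z₂) :* e :^ 1 :+ (k 126 :* z₄ :- k 72 :* z₀ :* z₂) :* e :^ 2
                 := :- ((e :^ 3 :* (k 252 :* z₀ :* z₄ :+ k 60 :* z₂ :* z₂) :+ e :^ 4 :* (:- (k 252 :* z₂ :* z₄))) :+ (u :* (k 6 :* z₀ :- k 30 :* z₂ :* e :^ 1 :+ k 126 :* z₄ :* e :^ 2 :+ v) :+ (k 1 :+ k 2 :* z₀ :* e :^ 1 :- k 2 :* z₂ :* e :^ 2) :* v)))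
               (ε n) (A (s n) (nn-s n)) (A (s₄ n) (nn-s₄ n)) (ζ 0) (ζ 2) (ζ 4) ⟩
        _ ∎
        where
        dup = A-duplication (nn-s n) (nn-s₄ n) refl

  ζ2 : # 6 * ζ 0 ≈ π * π
  ζ2 = trans (solve 2 (λ a b → a := (a :- b) :+ b) (# 6 * ζ 0) (π * π)) (trans (+-cong (coeff-0 0 (ℕ.s≤s ℕ.z≤n)) refl) (+-identityˡ _))

  ζ4 : # 90 * ζ 2 ≈ π ^ 4
  ζ4 = begin
    # 90 * ζ 2  ≈⟨ solve 2 (λ a b → k 90 :* b := (k 6 :* a) :* (k 6 :* a) :- k 3 :* (k 12 :* a :* a :- k 30 :* b)) (ζ 0) (ζ 2) ⟩
    (# 6 * ζ 0) * (# 6 * ζ 0) - # 3 * coeff 1 ≈⟨ +-cong (*-cong ζ2 ζ2) (-‿cong (*-cong refl (coeff-0 1 (ℕ.s≤s (ℕ.s≤s ℕ.z≤n))))) ⟩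
    (π * π) * (π * π) - # 3 * 0# ≈⟨ solve 1 (λ p → (p :* p) :* (p :* p) :- k 3 :* k 0 := p :^ 4) π ⟩
    π ^ 4 ∎

  ζ6 : # 945 * ζ 4 ≈ π ^ 6
  ζ6 = begin
    # 945 * ζ 4  ≈⟨ solve 3 (λ a b c → k 945 :* c := (k 6 :* a) :* (k 90 :* b) :+ con (mkℚᵘ (+ 15) 1) :* (k 126 :* c :- k 72 :* a :* b)) (ζ 0) (ζ 2) (ζ 4) ⟩
    (# 6 * ζ 0) * (# 90 * ζ 2) + ι (mkℚᵘ (+ 15) 1) * coeff 2 ≈⟨ +-cong (*-cong ζ2 ζ4) (*-cong refl (coeff-0 2 (ℕ.s≤s (ℕ.s≤s (ℕ.s≤s ℕ.z≤n))))) ⟩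
    (π * π) * π ^ 4 + ι (mkℚᵘ (+ 15) 1) * 0# ≈⟨ solve 1 (λ p → (p :* p) :* p :^ 4 :+ con (mkℚᵘ (+ 15) 1) :* k 0 := p :^ 6) π ⟩
    π ^ 6 ∎

-- Lipschitz formulas for the exponents 2, 4 and 6.

module LipschitzFormula (R : RealField) where

  open ZetaValues R public
  open import Relation.Binary.Reasoning.Setoid setoid

  Series-Bnd : ∀ {f g s t} → Series f s → Series g t → (∀ n → Bnd (g n) (f n)) → Bnd t s
  Series-Bnd p q h = ⟶-≤ (⟶-neg q) p (λ n → proj₁ (Bnd-sum n h)) , ⟶-≤ p q (λ n → proj₂ (Bnd-sum n h))

  Series-sum : ∀ {f : ℕ → ℕ → F} {s : ℕ → F} k → (∀ j → Series (f j) (s j)) → Series (λ n → sum (λ j → f j n) k) (sum s k)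
  Series-sum zero    h = ⟶-cong (λ n → sym (sum-0 n)) refl (⟶-const 0#)
  Series-sum (suc k) h = Series-+ (Series-sum k h) (h k)

  sq-bound : ∀ {c x} → 0# ≤ c → x * x ≤ c * c → Bnd c x
  sq-bound {c} {x} c≥0 h = ≤-resp refl (solve 1 (λ x → :- :- x := x) x) (neg-mono (below (≤-trans (≈⇒≤ (solve 1 (λ x → (:- x) :* (:- x) := x :* x) x)) h))) , below h
    where
    below : ∀ {x} → x * x ≤ c * c → x ≤ c
    below h c<x = h (≤-<-trans (*-monoˡ c c≥0 (<⇒≤ c<x)) (<-resp (*-comm _ _) refl (*-mono-<ˡ _ (≤-<-trans c≥0 c<x) c<x)))

  -- The real and imaginary parts of (y + i(n+1))⁻ʲ.
  module Lattice (y : F) (p : 0# < y) where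
    private module Ker = Kernel (y * y) (nn-² y)
    open Ker public using (a; a-nn; M-pos; A-series)

    nn-y = <⇒≤ p

    iy : F
    iy = inv y p

    nn-iy : 0# ≤ iy
    nn-iy = <⇒≤ (inv-pos y p)

    zr zi : ℕ → F
    zr n = y * a n
    zi n = - (ν n * a n)

    Re Im : ℕ → ℕ → F
    Re zero    n = 1#
    Re (suc j) n = zr n * Re j n - zi n * Im j n
    Im zero    n = 0#
    Im (suc j) n = zr n * Im j n + zi n * Re j n

    a≤ε² : ∀ n → a n ≤ ε n * ε n
    a≤ε² n = cancel-≤ (M-pos n) (≤-trans (≈⇒≤ (inv-r _ (M-pos n))) (≤-trans (≈⇒≤ (sym (trans (*-cong (ν*ε n) (ν*ε n)) (*-identityˡ 1#))))
      (by-nn (nn-* (nn-² y) (nn-² (ε n))) (solve 3 (λ v e y → (v :* v :+ y :* y) :* (e :* e) :- (v :* e) :* (v :* e) := y :* y :* (e :* e)) (ν n) (ε n) y))))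

    a≤iy² : ∀ n → a n ≤ iy * iy
    a≤iy² n = cancel-≤ (M-pos n) (≤-trans (≈⇒≤ (inv-r _ (M-pos n))) (≤-trans (≈⇒≤ (sym (trans (*-cong (inv-r y p) (inv-r y p)) (*-identityˡ 1#))))
      (by-nn (nn-* (nn-² (ν n)) (nn-² iy)) (solve 3 (λ v e y → (v :* v :+ y :* y) :* (e :* e) :- (y :* e) :* (y :* e) := v :* v :* (e :* e)) (ν n) iy y))))

    z-norm : ∀ n → zr n * zr n + zi n * zi n ≈ a n
    z-norm n = trans (solve 3 (λ y v a → (y :* a) :* (y :* a) :+ (:- (v :* a)) :* (:- (v :* a)) := ((v :* v :+ y :* y) :* a) :* a) y (ν n) (a n)) (trans (*-cong (inv-r _ (M-pos n)) refl) (*-identityˡ _))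

    norm-^ : ∀ j n → Re j n * Re j n + Im j n * Im j n ≈ a n ^ j
    norm-^ zero    n = solve 0 (k 1 :* k 1 :+ k 0 :* k 0 := k 1)
    norm-^ (suc j) n = trans (solve 4 (λ x z r i → (x :* r :- z :* i) :* (x :* r :- z :* i) :+ (x :* i :+ z :* r) :* (x :* i :+ z :* r) := (x :* x :+ z :* z) :* (r :* r :+ i :* i)) (zr n) (zi n) (Re j n) (Im j n)) (*-cong (z-norm n) (norm-^ j n))

    private
      ^-sq : ∀ x m → (x * x) ^ m ≈ x ^ m * x ^ m
      ^-sq x zero    = sym (*-identityˡ _)
      ^-sq x (suc m) = trans (*-cong refl (^-sq x m)) (solve 2 (λ x y → x :* x :* (y :* y) := (x :* y) :* (x :* y)) x (x ^ m))

    a^-bound : ∀ m n → a n ^ suc (suc m) ≤ (ε n * ε n * iy ^ m) * (ε n * ε n * iy ^ m)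
    a^-bound m n = ≤-trans (≈⇒≤ (sym (*-assoc _ _ _))) (≤-trans (*-mono (nn-² (a n)) (nn-^ m (a-nn n)) (*-mono (a-nn n) (a-nn n) (a≤ε² n) (a≤ε² n)) (≤-trans (^-mono m (a-nn n) (a≤iy² n)) (≈⇒≤ (^-sq iy m))))
      (≈⇒≤ (solve 2 (λ e x → e :* e :* (x :* x) := e :* x :* (e :* x)) (ε n * ε n) (iy ^ m))))

    nn-bd : ∀ m n → 0# ≤ ε n * ε n * iy ^ m
    nn-bd m n = nn-* (nn-² (ε n)) (nn-^ m nn-iy)

    Re-bound : ∀ m n → Bnd (ε n * ε n * iy ^ m) (Re (suc (suc m)) n)
    Re-bound m n = sq-bound (nn-bd m n) (≤-trans (≤-trans (by-nn (nn-² (Im (suc (suc m)) n)) (solve 2 (λ a b → a :+ b :- a := b) _ _)) (≈⇒≤ (norm-^ (suc (suc m)) n))) (a^-bound m n))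

    Im-bound : ∀ m n → Bnd (ε n * ε n * iy ^ m) (Im (suc (suc m)) n)
    Im-bound m n = sq-bound (nn-bd m n) (≤-trans (≤-trans (by-nn (nn-² (Re (suc (suc m)) n)) (solve 2 (λ a b → a :+ b :- b := a) _ _)) (≈⇒≤ (norm-^ (suc (suc m)) n))) (a^-bound m n))

    Re-1 : ∀ n → Re 1 n ≈ y * a n
    Re-1 n = solve 2 (λ x z → x :* k 1 :- z :* k 0 := x) (zr n) (zi n)

    Re-dom : ∀ j → Σ[ C ∈ F ] Dom C (Re (suc j))
    Re-dom zero    = y * # 2 , λ n → Bnd-resp refl (sym (Re-1 n)) (Bnd-of (nn-* nn-y (a-nn n)) (≤-trans (*-monoˡ y nn-y (≤-trans (a≤ε² n) (ε²≤2δ n))) (≈⇒≤ (sym (*-assoc _ _ _)))))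
    Re-dom (suc m) = iy ^ m * # 2 , λ n → Bnd-mono (≤-trans (*-monoʳ _ (nn-^ m nn-iy) (ε²≤2δ n)) (≈⇒≤ (solve 2 (λ d x → k 2 :* d :* x := x :* k 2 :* d) (δ n) (iy ^ m)))) (Re-bound m n)

    abstract
      ΣRe : ℕ → F
      ΣRe j = proj₁ (dom-conv (proj₂ (Re-dom j)))

      Re-series : ∀ j → Series (Re (suc j)) (ΣRe j)
      Re-series j = proj₂ (dom-conv (proj₂ (Re-dom j)))

    -- The sum over n ∈ ℤ of (y + in)⁻ʲ⁻¹.
    S : ℕ → F
    S j = iy ^ suc j + # 2 * ΣRe j

    S-0 : S 0 ≈ c y p
    S-0 = +-cong (*-identityʳ iy) (trans (*-cong refl (⟶-unique (Series-cong Re-1 (Re-series 0)) (Series-*ˡ y A-series))) (sym (*-assoc _ _ _)))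

  module Shift (y : F) (p : 0# < y) (h : F) (h≥0 : 0# ≤ h) where
    y′ : F
    y′ = y + h

    p′ : 0# < y′
    p′ = pos-+-nn p h≥0

    private
      module L = Lattice y p
      module L′ = Lattice y′ p′

      iy′≤iy : L′.iy ≤ L.iy
      iy′≤iy = inv-anti p p′ (by-nn h≥0 (solve 2 (λ y h → y :+ h :- y := h) y h))

      zr-shift : ∀ n → L′.zr n ≈ L.zr n - h * (L.zr n * L′.zr n - L.zi n * L′.zi n)
      zr-shift n = begin
        y′ * a′                       ≈⟨ trans (sym (*-identityʳ _)) (*-cong refl (sym (inv-r _ (L.M-pos n)))) ⟩
        y′ * a′ * ((v * v + y * y) * a) ≈⟨ solve 5 (λ y h v a b → (y :+ h) :* b :* ((v :* v :+ y :* y) :* a) := (y :* a) :* ((v :* v :+ (y :+ h) :* (y :+ h)) :* b) :- h :* (y :* a :* ((y :+ h) :* b) :- (:- (v :* a)) :* (:- (v :* b)))) y h v a a′ ⟩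
        (y * a) * ((v * v + y′ * y′) * a′) - h * (L.zr n * L′.zr n - L.zi n * L′.zi n) ≈⟨ +-cong (trans (*-cong refl (inv-r _ (L′.M-pos n))) (*-identityʳ _)) refl ⟩
        L.zr n - h * (L.zr n * L′.zr n - L.zi n * L′.zi n) ∎
        where
        a = L.a n
        a′ = L′.a n
        v = ν n

      zi-shift : ∀ n → L′.zi n ≈ L.zi n - h * (L.zr n * L′.zi n + L.zi n * L′.zr n)
      zi-shift n = begin
        - (v * a′)                       ≈⟨ trans (sym (*-identityʳ _)) (*-cong refl (sym (inv-r _ (L.M-pos n)))) ⟩
        - (v * a′) * ((v * v + y * y) * a) ≈⟨ solve 5 (λ y h v a b → (:- (v :* b)) :* ((v :* v :+ y :* y) :* a) := (:- (v :* a)) :* ((v :* v :+ (y :+ h) :* (y :+ h)) :* b) :- h :* (y :* a :* (:- (v :* b)) :+ (:- (v :* a)) :* ((y :+ h) :* b))) y h v a a′ ⟩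
        - (v * a) * ((v * v + y′ * y′) * a′) - h * (L.zr n * L′.zi n + L.zi n * L′.zr n) ≈⟨ +-cong (trans (*-cong refl (inv-r _ (L′.M-pos n))) (*-identityʳ _)) refl ⟩
        L.zi n - h * (L.zr n * L′.zi n + L.zi n * L′.zr n) ∎
        where
        a = L.a n
        a′ = L′.a n
        v = ν n

      rem : ℕ → ℕ → F
      rem j n = L.Re j n * L′.zr n - L.Im j n * L′.zi n

      rem-step : ∀ j n → rem j n ≈ L.Re (suc j) n - h * rem (suc j) n
      rem-step j n = trans (+-cong (*-cong refl (zr-shift n)) (-‿cong (*-cong refl (zi-shift n))))
        (solve 7 (λ h x z x′ z′ r i → r :* (x :- h :* (x :* x′ :- z :* z′)) :- i :* (z :- h :* (x :* z′ :+ z :* x′)) := (x :* r :- z :* i) :- h :* ((x :* r :- z :* i) :* x′ :- (x :* i :+ z :* r) :* z′)) h (L.zr n) (L.zi n) (L′.zr n) (L′.zi n) (L.Re j n) (L.Im j n))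

      expand : ∀ m n → L′.zr n ≈ sum (λ j → (- h) ^ j * L.Re (suc j) n) m + (- h) ^ m * rem m n
      expand zero    n = solve 2 (λ x z → x := k 0 :+ k 1 :* (k 1 :* x :- k 0 :* z)) (L′.zr n) (L′.zi n)
      expand (suc m) n = trans (expand m n) (trans (+-cong refl (*-cong refl (rem-step m n))) (solve 5 (λ s x h r q → s :+ x :* (r :- h :* q) := s :+ x :* r :+ (:- h) :* x :* q) (sum (λ j → (- h) ^ j * L.Re (suc j) n) m) ((- h) ^ m) h (L.Re (suc m) n) (rem (suc m) n)))

      z′-norm : ∀ n → L′.zr n * L′.zr n + L′.zi n * L′.zi n ≤ L.iy * L.iy
      z′-norm n = ≤-trans (≈⇒≤ (L′.z-norm n)) (≤-trans (L′.a≤iy² n) (*-mono L′.nn-iy L′.nn-iy iy′≤iy iy′≤iy))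

      rem-bound : ∀ n → Bnd (# 2 * L.iy ^ 5 * (ε n * ε n)) (rem 6 n)
      rem-bound n = Bnd-resp (solve 2 (λ e x → e :* x :^ 4 :* x :+ e :* x :^ 4 :* x := k 2 :* x :^ 5 :* e) (ε n * ε n) L.iy) refl
        (Bnd-- (Bnd-* (L.Re-bound 4 n) (sq-bound L.nn-iy (≤-trans (by-nn (nn-² (L′.zi n)) (solve 2 (λ a b → a :+ b :- a := b) _ _)) (z′-norm n))))
               (Bnd-* (L.Im-bound 4 n) (sq-bound L.nn-iy (≤-trans (by-nn (nn-² (L′.zr n)) (solve 2 (λ a b → a :+ b :- b := a) _ _)) (z′-norm n)))))

      iy-shift : L′.iy ≈ L.iy - h * (L.iy * L′.iy)
      iy-shift = begin
        L′.iy                        ≈⟨ trans (sym (*-identityʳ _)) (*-cong refl (sym (inv-r y p))) ⟩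
        L′.iy * (y * L.iy)           ≈⟨ solve 4 (λ y h i j → j :* (y :* i) := i :* ((y :+ h) :* j) :- h :* (i :* j)) y h L.iy L′.iy ⟩
        L.iy * (y′ * L′.iy) - h * (L.iy * L′.iy) ≈⟨ +-cong (trans (*-cong refl (inv-r y′ p′)) (*-identityʳ _)) refl ⟩
        L.iy - h * (L.iy * L′.iy) ∎

      iy-expand : ∀ m → L′.iy ≈ sum (λ j → (- h) ^ j * L.iy ^ suc j) m + (- h) ^ m * (L.iy ^ m * L′.iy)
      iy-expand zero    = solve 1 (λ x → x := k 0 :+ k 1 :* (k 1 :* x)) L′.iy
      iy-expand (suc m) = trans (iy-expand m) (trans (+-cong refl (*-cong refl (*-cong refl iy-shift))) (solve 6 (λ s x h i j q → s :+ x :* (q :* (i :- h :* (i :* j))) := s :+ x :* (i :* q) :+ (:- h) :* x :* (i :* q :* j)) (sum (λ j → (- h) ^ j * L.iy ^ suc j) m) ((- h) ^ m) h L.iy L′.iy (L.iy ^ m)))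

      bnd-h : Bnd (h ^ 6) ((- h) ^ 6)
      bnd-h = Bnd-^ 6 (Bnd-neg (Bnd-refl h≥0))

    -- A Taylor expansion of π coth π(y + h) without derivatives: 1/(y + h + in) is expanded
    -- geometrically in h, with a remainder summable over n. Six terms are kept because exponent 6
    -- is the coefficient of h⁵.
    shift-bound : Bnd ((# 8 * L.iy ^ 5 + L.iy ^ 7) * h ^ 6) (c y′ p′ - sum (λ j → (- h) ^ j * L.S j) 6)
    shift-bound = Bnd-resp (solve 2 (λ x h → h :* (x :^ 6 :* x) :+ k 2 :* (h :* (k 2 :* x :^ 5 :* k 2)) := (k 8 :* x :^ 5 :+ x :^ 7) :* h) L.iy (h ^ 6)) combine
      (Bnd-+ (Bnd-* bnd-h (Bnd-* (Bnd-refl (nn-^ 6 L.nn-iy)) (Bnd-of L′.nn-iy iy′≤iy)))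
        (Bnd-* (Bnd-refl (nn-# 2)) tail))
      where
      dom : Dom (h ^ 6 * (# 2 * L.iy ^ 5 * # 2)) (λ n → (- h) ^ 6 * rem 6 n)
      dom n = Bnd-mono (≤-trans (*-monoˡ (h ^ 6) (nn-^ 6 h≥0) (≤-trans (*-monoˡ (# 2 * L.iy ^ 5) (nn-* num≤ (nn-^ 5 L.nn-iy)) (ε²≤2δ n)) (≈⇒≤ (sym (*-assoc _ _ _))))) (≈⇒≤ (sym (*-assoc _ _ _))))
        (Bnd-* bnd-h (rem-bound n))
      tail : Bnd (h ^ 6 * (# 2 * L.iy ^ 5 * # 2)) (L′.ΣRe 0 - sum (λ j → (- h) ^ j * L.ΣRe j) 6)
      tail = dom-bound dom (Series-cong (λ n → trans (+-cong (trans (L′.Re-1 n) (expand 6 n)) refl) (solve 2 (λ a b → a :+ b :- a := b) _ ((- h) ^ 6 * rem 6 n)))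
        (Series-- (L′.Re-series 0) (Series-sum 6 λ j → Series-*ˡ ((- h) ^ j) (L.Re-series j))))
      combine : (- h) ^ 6 * (L.iy ^ 6 * L′.iy) + # 2 * (L′.ΣRe 0 - sum (λ j → (- h) ^ j * L.ΣRe j) 6) ≈ c y′ p′ - sum (λ j → (- h) ^ j * L.S j) 6
      combine = begin
        T + # 2 * (L′.ΣRe 0 - V)
          ≈⟨ solve 4 (λ t u r v → t :+ k 2 :* (r :- v) := ((u :+ t) :* k 1 :+ k 2 :* r) :- (u :+ k 2 :* v)) T U (L′.ΣRe 0) V ⟩
        ((U + T) * 1# + # 2 * L′.ΣRe 0) - (U + # 2 * V)
          ≈⟨ +-cong (+-cong (*-cong (sym (iy-expand 6)) refl) refl) (-‿cong (trans (+-cong refl (sym (sum-*ˡ (# 2) (λ j → (- h) ^ j * L.ΣRe j) 6))) (trans (sym (sum-+ (λ j → (- h) ^ j * L.iy ^ suc j) (λ j → # 2 * ((- h) ^ j * L.ΣRe j)) 6)) (sum-cong {f = λ j → (- h) ^ j * L.iy ^ suc j + # 2 * ((- h) ^ j * L.ΣRe j)} {g = λ j → (- h) ^ j * L.S j} 6 λ j → solve 3 (λ x i r → x :* i :+ k 2 :* (x :* r) := x :* (i :+ k 2 :* r)) ((- h) ^ j) (L.iy ^ suc j) (L.ΣRe j))))) ⟩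
        L′.S 0 - sum (λ j → (- h) ^ j * L.S j) 6
          ≈⟨ +-cong L′.S-0 refl ⟩
        c y′ p′ - sum (λ j → (- h) ^ j * L.S j) 6 ∎
        where
        T = (- h) ^ 6 * (L.iy ^ 6 * L′.iy)
        U = sum (λ j → (- h) ^ j * L.iy ^ suc j) 6
        V = sum (λ j → (- h) ^ j * L.ΣRe j) 6

  -- The bound must be global, as it is applied to u = η(n + 1) for all n. For u ≤ 1 it is Taylor's;
  -- for u ≥ 1 the exponential and each of the six terms are at most u⁶.
  E-remainder : ∀ {u} → 0# ≤ u → Bnd ((E 1# + # 7) * u ^ 6) (E (- u) - sum (eterm (- u)) 6)
  E-remainder {u} u≥0 = ≤-cases u 1# (λ q → proj₁ (small q)) (λ q → proj₁ (large q)) , ≤-cases u 1# (λ q → proj₂ (small q)) (λ q → proj₂ (large q))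
    where
    small : u ≤ 1# → Bnd ((E 1# + # 7) * u ^ 6) (E (- u) - sum (eterm (- u)) 6)
    small q = Bnd-mono (by-nn (nn-* (nn-# 7) (nn-^ 6 u≥0)) (solve 2 (λ e x → (e :+ k 7) :* x :- x :* e := k 7 :* x) (E 1#) (u ^ 6))) (E-taylor 6 q (Bnd-neg (Bnd-refl u≥0)))
    large : 1# ≤ u → Bnd ((E 1# + # 7) * u ^ 6) (E (- u) - sum (eterm (- u)) 6)
    large q = Bnd-mono (≤-trans (+-mono-≤ (grow 0 6 ℕ.z≤n) (≈⇒≤ (sum-const (u ^ 6) 6))) (by-nn (nn-* (nn-E 1#) (nn-^ 6 u≥0)) (solve 2 (λ e x → (e :+ k 7) :* x :- (x :+ k 6 :* x) := e :* x) (E 1#) (u ^ 6))))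
      (Bnd-- (Bnd-of (nn-E _) (E≤1 u≥0)) (Bnd-sum< 6 term))
      where
      grow : ∀ i m → i ℕ.≤ m → u ^ i ≤ u ^ m
      grow i       zero    ℕ.z≤n       = ≤-refl
      grow zero    (suc m) ℕ.z≤n       = ≤-trans (≈⇒≤ (sym (*-identityˡ _))) (*-mono num≤ num≤ q (grow 0 m ℕ.z≤n))
      grow (suc i) (suc m) (ℕ.s≤s i≤m) = *-monoˡ u u≥0 (grow i m i≤m)
      eterm≤ : ∀ i → eterm u i ≤ u ^ i
      eterm≤ zero    = ≤-refl
      eterm≤ (suc i) = ≤-trans (*-mono (eterm-nn i u≥0) (nn-* u≥0 (<⇒≤ (ε-pos i))) (eterm≤ i) (≤-trans (*-monoˡ u u≥0 (ε≤1 i)) (≈⇒≤ (*-identityʳ u)))) (≈⇒≤ (*-comm _ _))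
      term : ∀ i → i ℕ.< 6 → Bnd (u ^ 6) (eterm (- u) i)
      term i i<6 = Bnd-mono (≤-trans (eterm≤ i) (grow i 6 (ℕₚ.<⇒≤ i<6))) (eterm-bnd i (Bnd-neg (Bnd-refl u≥0)))

  eterm-* : ∀ x v j → eterm (x * v) j ≈ eterm x j * v ^ j
  eterm-* x v zero    = sym (*-identityˡ _)
  eterm-* x v (suc j) = trans (*-cong (eterm-* x v j) refl) (solve 5 (λ t w x v e → t :* w :* (x :* v :* e) := t :* (x :* e) :* (v :* w)) (eterm x j) (v ^ j) x v (ε j))

  -- The series of kʲ e⁻ʷᵏ over k ≥ 1.
  module QSeries (w : F) (w>0 : 0# < w) where
    term : ℕ → ℕ → F
    term j n = ν n ^ j * E (- (w * ν n))

    term-nn : ∀ j n → 0# ≤ term j n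
    term-nn j n = nn-* (nn-^ j (nn-ν n)) (nn-E _)

    i = inv w w>0

    term≤ : ∀ j n → term j n ≤ # ((2 ℕ.+ j) !) * i ^ (2 ℕ.+ j) * (ε n * ε n)
    term≤ j n = ≤-trans (≈⇒≤ (sym (begin
        (w * v) ^ (2 ℕ.+ j) * e * (i ^ (2 ℕ.+ j) * (ε n * ε n))
          ≈⟨ *-cong (*-cong (*-^ w v (2 ℕ.+ j)) refl) refl ⟩
        w ^ (2 ℕ.+ j) * v ^ (2 ℕ.+ j) * e * (i ^ (2 ℕ.+ j) * (ε n * ε n))
          ≈⟨ solve 6 (λ a v x e b f → a :* (v :* (v :* x)) :* e :* (b :* (f :* f)) := (a :* b) :* ((v :* f) :* (v :* f)) :* (x :* e)) (w ^ (2 ℕ.+ j)) v (v ^ j) e (i ^ (2 ℕ.+ j)) (ε n) ⟩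
        (w ^ (2 ℕ.+ j) * i ^ (2 ℕ.+ j)) * ((v * ε n) * (v * ε n)) * term j n
          ≈⟨ *-cong (*-cong (trans (sym (*-^ w i (2 ℕ.+ j))) (trans (^-cong (2 ℕ.+ j) (inv-r w w>0)) (1^ (2 ℕ.+ j)))) (*-cong (ν*ε n) (ν*ε n))) refl ⟩
        1# * (1# * 1#) * term j n
          ≈⟨ solve 1 (λ t → k 1 :* (k 1 :* k 1) :* t := t) _ ⟩
        term j n ∎)))
      (≤-trans (*-monoʳ _ (nn-* (nn-^ (2 ℕ.+ j) nn-i) (nn-² (ε n))) (^*E-neg (2 ℕ.+ j) (nn-* (<⇒≤ w>0) (nn-ν n)))) (≈⇒≤ (sym (*-assoc _ _ _))))
      where
      v = ν n
      e = E (- (w * ν n))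
      nn-i = <⇒≤ (inv-pos w w>0)
      *-^ : ∀ x y m → (x * y) ^ m ≈ x ^ m * y ^ m
      *-^ x y zero    = sym (*-identityˡ _)
      *-^ x y (suc m) = trans (*-cong refl (*-^ x y m)) (solve 4 (λ x y a b → x :* y :* (a :* b) := x :* a :* (y :* b)) x y (x ^ m) (y ^ m))

    term-dom : ∀ j → Dom (# ((2 ℕ.+ j) !) * i ^ (2 ℕ.+ j) * # 2) (term j)
    term-dom j n = Bnd-of (term-nn j n) (≤-trans (term≤ j n) (≤-trans (*-monoˡ _ (nn-* (nn-# ((2 ℕ.+ j) !)) (nn-^ (2 ℕ.+ j) (<⇒≤ (inv-pos w w>0)))) (ε²≤2δ n)) (≈⇒≤ (sym (*-assoc _ _ _)))))

    abstract
      M : ℕ → F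
      M j = proj₁ (dom-conv (term-dom j))

      M-series : ∀ j → Series (term j) (M j)
      M-series j = proj₂ (dom-conv (term-dom j))

    geometric : M 0 * (1# - E (- w)) ≈ E (- w)
    geometric = begin
      M 0 * (1# - x)        ≈⟨ solve 2 (λ m x → m :* (k 1 :- x) := (m :- x) :- (x :* m) :+ x) (M 0) x ⟩
      (M 0 - x) - x * M 0 + x ≈⟨ +-cong (trans (+-cong (trans (+-cong refl (-‿cong (sym t₀))) (⟶-unique (Series-tail (M-series 0)) (Series-cong step (Series-*ˡ x (M-series 0))))) refl) (-‿inverseʳ _)) refl ⟩
      0# + x                ≈⟨ +-identityˡ x ⟩
      x ∎
      where
      x = E (- w)
      t₀ : term 0 0 ≈ x
      t₀ = trans (*-identityˡ _) (E-cong (solve 1 (λ w → :- (w :* k 1) := :- w) w))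
      step : ∀ n → x * term 0 n ≈ term 0 (suc n)
      step n = trans (solve 2 (λ x e → x :* (k 1 :* e) := k 1 :* (x :* e)) x (E (- (w * ν n)))) (*-cong refl (trans (sym (E-+ _ _)) (E-cong (trans (solve 2 (λ w v → :- w :+ :- (w :* v) := :- (w :* (v :+ k 1))) w (ν n)) (-‿cong (*-cong refl (sym (#-suc (suc n)))))))))

    1-x>0 : 0# < 1# - E (- w)
    1-x>0 = pos-cancel (E-pos w) (<-resp refl (sym (trans (solve 2 (λ a b → a :* (k 1 :- b) := a :- a :* b) (E w) (E (- w))) (+-cong refl (-‿cong (E-neg w)))))
      (pos-sub (<-≤-trans (by-pos w>0 (solve 1 (λ w → k 0 :+ k 1 :+ k 1 :* (w :* k 1) :- k 1 := w) w)) (E≥sum 2 (<⇒≤ w>0)))))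

  q-shift : ∀ w p η (q : 0# ≤ η) → let module Q = QSeries w p in
    Bnd ((E 1# + # 7) * η ^ 6 * Q.M 6) (QSeries.M (w + η) (pos-+-nn p q) 0 - sum (λ j → eterm (- η) j * Q.M j) 6)
  q-shift w p η q = Series-Bnd
      (Series-cong (λ n → trans (+-cong (split n) refl) (solve 2 (λ a b → a :+ b :- a := b) _ _)) (Series-- (QSeries.M-series (w + η) (pos-+-nn p q) 0) (Series-sum 6 λ j → Series-*ˡ (eterm (- η) j) (Q.M-series j))))
      (Series-*ˡ _ (Q.M-series 6)) (λ n → Bnd-mono (≈⇒≤ (trans (*-cong (*-cong refl (*-^6 η (ν n))) refl) (solve 4 (λ c x y e → c :* (x :* y) :* e := c :* x :* (y :* e)) (E 1# + # 7) (η ^ 6) (ν n ^ 6) (E (- (w * ν n)))))) (Bnd-* (E-remainder (nn-* q (nn-ν n))) (Bnd-refl (nn-E (- (w * ν n))))))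
    where
    module Q = QSeries w p
    *-^6 : ∀ x y → (x * y) ^ 6 ≈ x ^ 6 * y ^ 6
    *-^6 = solve 2 λ x y → (x :* y) :^ 6 := x :^ 6 :* y :^ 6
    split : ∀ n → QSeries.term (w + η) (pos-+-nn p q) 0 n ≈ sum (λ j → eterm (- η) j * Q.term j n) 6 + (E (- (η * ν n)) - sum (eterm (- (η * ν n))) 6) * E (- (w * ν n))
    split n = begin
      1# * E (- ((w + η) * ν n))
        ≈⟨ trans (*-identityˡ _) (trans (E-cong (solve 3 (λ w h v → :- ((w :+ h) :* v) := :- (w :* v) :+ :- (h :* v)) w η (ν n))) (E-+ _ _)) ⟩
      Ew * Eη
        ≈⟨ solve 3 (λ a b s → a :* b := s :* a :+ (b :- s) :* a) Ew Eη (sum (eterm (- (η * ν n))) 6) ⟩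
      sum (eterm (- (η * ν n))) 6 * Ew + (Eη - sum (eterm (- (η * ν n))) 6) * Ew
        ≈⟨ +-cong (trans (sym (sum-*ʳ Ew (eterm (- (η * ν n))) 6)) (sum-cong {f = λ j → eterm (- (η * ν n)) j * Ew} {g = λ j → eterm (- η) j * Q.term j n} 6 λ j → trans (*-cong (trans (eterm-cong j (solve 2 (λ h v → :- (h :* v) := (:- h) :* v) η (ν n))) (eterm-* (- η) (ν n) j)) refl) (*-assoc _ _ _))) refl ⟩
      sum (λ j → eterm (- η) j * Q.term j n) 6 + (Eη - sum (eterm (- (η * ν n))) 6) * Ew ∎
      where
      Ew = E (- (w * ν n))
      Eη = E (- (η * ν n))

  module QS (y : F) (p : 0# < y) = QSeries (# 2 * π * y) (*-pos (*-pos num< π-pos) p)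

  c-qseries : ∀ y p → c y p ≈ π * (1# + # 2 * QS.M y p 0)
  c-qseries y p = cancel-≈ (*-pos (E-pos w) (QS.1-x>0 y p)) (begin
    E w * (1# - x) * c y p                  ≈⟨ *-cong lem refl ⟩
    (E w - 1#) * c y p                      ≈⟨ trans (*-comm _ _) (coth y p) ⟩
    π * (E w + 1#)                          ≈⟨ *-cong refl (solve 1 (λ e → e :+ k 1 := e :- k 1 :+ k 2) (E w)) ⟩
    π * (E w - 1# + # 2)                    ≈⟨ *-cong refl (+-cong (sym lem) (trans (solve 0 (k 2 := k 2 :* k 1)) (*-cong refl (sym (E-neg w))))) ⟩
    π * (E w * (1# - x) + # 2 * (E w * x))  ≈⟨ *-cong refl (+-cong refl (*-cong refl (*-cong refl (sym (QS.geometric y p))))) ⟩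
    π * (E w * (1# - x) + # 2 * (E w * (m * (1# - x)))) ≈⟨ solve 4 (λ p e x m → p :* (e :* (k 1 :- x) :+ k 2 :* (e :* (m :* (k 1 :- x)))) := e :* (k 1 :- x) :* (p :* (k 1 :+ k 2 :* m))) π (E w) x m ⟩
    E w * (1# - x) * (π * (1# + # 2 * m)) ∎)
    where
    w = # 2 * π * y
    x = E (- w)
    m = QS.M y p 0
    lem : E w * (1# - x) ≈ E w - 1#
    lem = trans (solve 2 (λ e x → e :* (k 1 :- x) := e :- e :* x) (E w) x) (+-cong refl (-‿cong (E-neg w)))

  module _ (y : F) (p : 0# < y) where
    private
      module L = Lattice y p
      τ = # 2 * π
      -- The coefficients of hʲ in the difference between the two expansions of π coth π(y + h). The
      -- case 0 is separate because the exponential expansion has the extra constant π.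
      coeff : ℕ → F
      coeff zero    = L.S 0 - # 2 * π * (1# * QS.M y p 0) - π
      coeff (suc j) = sgn (suc j) * L.S (suc j) - # 2 * π * (eterm (- τ) (suc j) * QS.M y p (suc j))

      neg-^ : ∀ x j → (- x) ^ j ≈ sgn j * x ^ j
      neg-^ x zero    = sym (*-identityˡ _)
      neg-^ x (suc j) = trans (*-cong refl (neg-^ x j)) (solve 3 (λ x s y → (:- x) :* (s :* y) := (:- k 1) :* s :* (x :* y)) x (sgn j) (x ^ j))

      M-cong : ∀ {v w} (a : 0# < v) (b : 0# < w) → v ≈ w → QSeries.M v a 0 ≈ QSeries.M w b 0
      M-cong a b e = ⟶-unique (Series-cong (λ n → *-cong refl (E-cong (-‿cong (*-cong e refl)))) (QSeries.M-series _ a 0)) (QSeries.M-series _ b 0)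

      coeff-0 : ∀ j → j ℕ.< 6 → coeff j ≈ 0#
      coeff-0 = poly-unique 6 coeff (O-cong (λ n → sym (identity n)) (O-- (# 2 * π * C₂ , λ n → Bnd-resp (sym (*-assoc _ _ _)) refl (Bnd-* (Bnd-refl (<⇒≤ (*-pos num< π-pos))) (o₂ n))) (C₁ , λ n → Shift.shift-bound y p (ε n) (nn-h n))))
        where
        nn-h : ∀ n → 0# ≤ ε n
        nn-h n = <⇒≤ (ε-pos n)
        nn-τ : 0# ≤ τ
        nn-τ = <⇒≤ (*-pos num< π-pos)
        C₁ = # 8 * L.iy ^ 5 + L.iy ^ 7
        C₂ = (E 1# + # 7) * τ ^ 6 * QS.M y p 6
        cc : ℕ → F
        cc n = c (y + ε n) (Shift.p′ y p (ε n) (nn-h n))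
        m : ℕ → F
        m n = QSeries.M (τ * y + τ * ε n) (pos-+-nn (*-pos (*-pos num< π-pos) p) (nn-* nn-τ (nn-h n))) 0
        P : ℕ → F
        P n = sum (λ j → eterm (- (τ * ε n)) j * QS.M y p j) 6
        o₂ : ∀ n → Bnd (C₂ * ε n ^ 6) (m n - P n)
        o₂ n = Bnd-resp (solve 4 (λ e t h M → e :* (t :* h) :^ 6 :* M := e :* t :^ 6 :* M :* h :^ 6) (E 1# + # 7) τ (ε n) (QS.M y p 6)) refl (q-shift (τ * y) _ (τ * ε n) (nn-* nn-τ (nn-h n)))
        c≈ : ∀ n → cc n ≈ π * (1# + # 2 * m n)
        c≈ n = trans (c-qseries (y + ε n) _) (*-cong refl (+-cong refl (*-cong refl (M-cong (*-pos (*-pos num< π-pos) (Shift.p′ y p (ε n) (nn-h n))) (pos-+-nn (*-pos (*-pos num< π-pos) p) (nn-* nn-τ (nn-h n))) (distribˡ τ y (ε n))))))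
        Q : ℕ → F
        Q n = sum (λ j → (- ε n) ^ j * L.S j) 6
        identity : ∀ n → poly coeff 6 (ε n) ≈ # 2 * π * (m n - P n) - (cc n - Q n)
        identity n = begin
          poly coeff 6 (ε n)
            ≈⟨ trans (poly-suc coeff 5 (ε n)) (trans (+-cong (trans (solve 2 (λ x h → x := k 0 :+ x :* h :^ 0) (coeff 0) (ε n)) (solve 4 (λ p h r c → k 0 :+ (r :- c :- p) :* h :^ 0 := (r :- c) :* h :^ 0 :- p) π (ε n) (L.S 0) (# 2 * π * (1# * QS.M y p 0)))) refl) (solve 3 (λ a b c → a :- b :+ c := a :+ c :- b) ((L.S 0 - # 2 * π * (1# * QS.M y p 0)) * ε n ^ 0) π _)) ⟩
          ((L.S 0 - # 2 * π * (1# * QS.M y p 0)) * ε n ^ 0 + ε n * poly (λ j → coeff (suc j)) 5 (ε n)) - π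
            ≈⟨ +-cong (trans (+-cong (*-cong (+-cong (sym (*-identityˡ _)) refl) refl) refl) (trans (+-cong (*-identityʳ _) refl) (sym (poly-suc gen 5 (ε n))))) refl ⟩
          poly gen 6 (ε n) - π
            ≈⟨ +-cong (trans (sum-cong {g = λ j → left n j - τ * right n j} 6 (λ j → trans (solve 5 (λ s r t q h → (s :* r :- t :* q) :* h := s :* h :* r :- t :* (q :* h)) (sgn j) (L.S j) τ (eterm (- τ) j * QS.M y p j) (ε n ^ j))
                 (+-cong (*-cong (sym (neg-^ (ε n) j)) refl) (-‿cong (*-cong refl (trans (solve 3 (λ a b c → a :* b :* c := a :* c :* b) (eterm (- τ) j) (QS.M y p j) (ε n ^ j)) (*-cong (trans (sym (eterm-* (- τ) (ε n) j)) (eterm-cong j (solve 2 (λ t h → (:- t) :* h := :- (t :* h)) τ (ε n)))) refl)))))))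
                 (trans (sum-- (left n) (λ j → τ * right n j) 6) (+-cong refl (-‿cong (sum-*ˡ τ (right n) 6))))) refl ⟩
          Q n - τ * P n - π
            ≈⟨ solve 4 (λ q t p m → q :- k 2 :* t :* p :- t := k 2 :* t :* (m :- p) :- (t :* (k 1 :+ k 2 :* m) :- q)) (Q n) π (P n) (m n) ⟩
          # 2 * π * (m n - P n) - (π * (1# + # 2 * m n) - Q n)
            ≈⟨ +-cong refl (-‿cong (+-cong (sym (c≈ n)) refl)) ⟩
          # 2 * π * (m n - P n) - (cc n - Q n) ∎
          where
          left right : ℕ → ℕ → F
          left n j = (- ε n) ^ j * L.S j
          right n j = eterm (- (τ * ε n)) j * QS.M y p j
          gen : ℕ → F
          gen j = sgn j * L.S j - # 2 * π * (eterm (- τ) j * QS.M y p j)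

      equate : ∀ {a b} → a - b ≈ 0# → a ≈ b
      equate {a} {b} e = trans (solve 2 (λ a b → a := (a :- b) :+ b) a b) (trans (+-cong e refl) (+-identityˡ b))

    -- The factor (2π)ᵏ/(k - 1)! at k = 2; it becomes 8π⁴/3 and 8π⁶/15 at k = 4 and k = 6.
    S₂ : L.S 1 ≈ # 4 * π ^ 2 * QS.M y p 1
    S₂ = trans (solve 1 (λ x → x := :- (:- k 1 :* k 1 :* x)) (L.S 1)) (trans (-‿cong (equate (coeff-0 1 (ℕ.s≤s (ℕ.s≤s ℕ.z≤n)))))
      (solve 2 (λ p m → :- (k 2 :* p :* (k 1 :* (:- (k 2 :* p) :* k 1) :* m)) := k 4 :* p :^ 2 :* m) π (QS.M y p 1)))

    S₄ : L.S 3 ≈ ι (mkℚᵘ (+ 8) 2) * π ^ 4 * QS.M y p 3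
    S₄ = trans (solve 1 (λ x → x := :- ((:- k 1) :^ 3 :* x)) (L.S 3)) (trans (-‿cong (equate (coeff-0 3 (ℕ.s≤s (ℕ.s≤s (ℕ.s≤s (ℕ.s≤s ℕ.z≤n)))))))
      (solve 2 (λ p m → let x = :- (k 2 :* p) in :- (k 2 :* p :* (k 1 :* (x :* k 1) :* (x :* con (mkℚᵘ (+ 1) 1)) :* (x :* con (mkℚᵘ (+ 1) 2)) :* m)) := con (mkℚᵘ (+ 8) 2) :* p :^ 4 :* m) π (QS.M y p 3)))

    S₆ : L.S 5 ≈ ι (mkℚᵘ (+ 8) 14) * π ^ 6 * QS.M y p 5
    S₆ = trans (solve 1 (λ x → x := :- ((:- k 1) :^ 5 :* x)) (L.S 5)) (trans (-‿cong (equate (coeff-0 5 (ℕ.s≤s (ℕ.s≤s (ℕ.s≤s (ℕ.s≤s (ℕ.s≤s (ℕ.s≤s ℕ.z≤n)))))))))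
      (solve 2 (λ p m → let x = :- (k 2 :* p) in :- (k 2 :* p :* (k 1 :* (x :* k 1) :* (x :* con (mkℚᵘ (+ 1) 1)) :* (x :* con (mkℚᵘ (+ 1) 2)) :* (x :* con (mkℚᵘ (+ 1) 3)) :* (x :* con (mkℚᵘ (+ 1) 4)) :* m)) := con (mkℚᵘ (+ 8) 14) :* p :^ 6 :* m) π (QS.M y p 5)))

-- Lambert series and divisor sums.

module DivisorSums (R : RealField) where

  open LipschitzFormula R public
  open import Relation.Binary.Reasoning.Setoid setoid
  open Defs using (σ)

  χ : ∀ {P : Set} → Dec P → F
  χ d = if does d then 1# else 0#

  χ-yes : ∀ {P : Set} (d : Dec P) → P → χ d ≈ 1#
  χ-yes (yes _) p = refl
  χ-yes (no ¬p) p = ⊥-elim (¬p p)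

  χ-no : ∀ {P : Set} (d : Dec P) → ¬ P → χ d ≈ 0#
  χ-no (yes p) ¬p = ⊥-elim (¬p p)
  χ-no (no _)  ¬p = refl

  sum-zero : ∀ {f} n → (∀ i → i ℕ.< n → f i ≈ 0#) → sum f n ≈ 0#
  sum-zero n h = trans (sum-cong< n h) (sum-0 n)

  sum-single : ∀ {f} n j → j ℕ.< n → (∀ i → ¬ (i ≡.≡ j) → f i ≈ 0#) → sum f n ≈ f j
  sum-single (suc n) j p h with ℕₚ.m≤n⇒m<n∨m≡n (ℕ.s≤s⁻¹ p)
  ... | inj₁ q = trans (+-cong (sum-single n j q h) (h n λ e → ℕₚ.<⇒≢ q (≡.sym e))) (+-identityʳ _)
  ... | inj₂ ≡.refl = trans (+-cong (sum-zero n λ i i<n → h i (ℕₚ.<⇒≢ i<n)) refl) (+-identityˡ _)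

  #-^ : ∀ m n → # (m ℕ.^ n) ≈ # m ^ n
  #-^ m zero    = refl
  #-^ m (suc n) = trans (#-* m (m ℕ.^ n)) (*-cong refl (#-^ m n))

  σ-sum : ∀ α n → # σ α n ≈ sum (λ i → ν i ^ α * χ (suc i ∣? n)) n
  σ-sum α n = go suc n
    where
    go : ∀ h l → # (ListAction.sum (map (ℕ._^ α) (filter (_∣? n) (applyUpTo h l)))) ≈ sum (λ i → # (h i) ^ α * χ (h i ∣? n)) l
    go h zero    = refl
    go h (suc l) with h 0 ∣? n
    ... | yes p = trans (#-+ (h 0 ℕ.^ α) _) (trans (+-cong (trans (#-^ (h 0) α) (sym (trans (*-cong refl (χ-yes (h 0 ∣? n) p)) (*-identityʳ _)))) (go (λ i → h (suc i)) l)) (sym (sum-head _ l)))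
    ... | no ¬p = trans (go (λ i → h (suc i)) l) (trans (sym (+-identityˡ _)) (trans (+-cong (sym (trans (*-cong refl (χ-no (h 0 ∣? n) ¬p)) (zeroʳ _))) refl) (sym (sum-head _ l))))

  private
    hit : ℕ → ℕ → ℕ → F
    hit m k n = χ (suc m ℕ.* suc k ℕₚ.≟ suc n)

    cofactor : ∀ N k n → n ℕ.< N → sum (λ m → hit m k n) N ≈ χ (suc k ∣? suc n)
    cofactor N k n n<N = aux (suc k ∣? suc n)
      where
      aux : ∀ d → sum (λ m → hit m k n) N ≈ χ d
      aux (no k∤n) = sum-zero N λ m _ → χ-no (suc m ℕ.* suc k ℕₚ.≟ suc n) λ e → k∤n (divides (suc m) (≡.sym e))
      aux (yes (divides (suc q) e)) = trans (sum-single N q (ℕₚ.≤-trans (ℕₚ.≤-trans (ℕₚ.m≤m*n (suc q) (suc k)) (ℕₚ.≤-reflexive (≡.sym e))) n<N)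
          (λ i i≢q → χ-no (suc i ℕ.* suc k ℕₚ.≟ suc n) λ e′ → i≢q (ℕₚ.suc-injective (ℕₚ.*-cancelʳ-≡ (suc i) (suc q) (suc k) (≡.trans e′ e)))))
        (χ-yes (suc q ℕ.* suc k ℕₚ.≟ suc n) (≡.sym e))

    σ-hits : ∀ α N n → n ℕ.< N → # σ α (suc n) ≈ sum (λ m → sum (λ k → ν k ^ α * hit m k n) N) N
    σ-hits α N n n<N = begin
      # σ α (suc n)
        ≈⟨ σ-sum α (suc n) ⟩
      sum (λ k → ν k ^ α * χ (suc k ∣? suc n)) (suc n)
        ≈⟨ extend (N ℕ.∸ suc n) ⟩
      sum (λ k → ν k ^ α * χ (suc k ∣? suc n)) (N ℕ.∸ suc n ℕ.+ suc n)
        ≈⟨ ≈-reflexive (≡.cong (sum (λ k → ν k ^ α * χ (suc k ∣? suc n))) (ℕₚ.m∸n+n≡m n<N)) ⟩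
      sum (λ k → ν k ^ α * χ (suc k ∣? suc n)) N
        ≈⟨ sum-cong N (λ k → trans (*-cong refl (sym (cofactor N k n n<N))) (sym (sum-*ˡ (ν k ^ α) _ N))) ⟩
      sum (λ k → sum (λ m → ν k ^ α * hit m k n) N) N
        ≈⟨ sum-swap _ N N ⟩
      sum (λ m → sum (λ k → ν k ^ α * hit m k n) N) N ∎
      where
      extend : ∀ d → sum (λ k → ν k ^ α * χ (suc k ∣? suc n)) (suc n) ≈ sum (λ k → ν k ^ α * χ (suc k ∣? suc n)) (d ℕ.+ suc n)
      extend zero    = refl
      extend (suc d) = trans (extend d) (trans (sym (+-identityʳ _)) (+-cong refl (sym (trans (*-cong refl (χ-no (suc (d ℕ.+ suc n) ∣? suc n)
        (λ k∣n → ℕₚ.<⇒≱ (ℕ.s≤s (ℕₚ.m≤n+m (suc n) d)) (∣⇒≤ k∣n)))) (zeroʳ _)))))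

    select : ∀ N m k (g : ℕ → F) → suc m ℕ.* suc k ℕ.≤ N → sum (λ n → hit m k n * g (suc n)) N ≈ g (suc m ℕ.* suc k)
    select N m k g p = trans (sum-single N (k ℕ.+ m ℕ.* suc k) p λ i i≢ → trans (*-cong (χ-no (suc m ℕ.* suc k ℕₚ.≟ suc i) λ e → i≢ (ℕₚ.suc-injective (≡.sym e))) refl) (zeroˡ _))
      (trans (*-cong (χ-yes (suc m ℕ.* suc k ℕₚ.≟ suc m ℕ.* suc k) ≡.refl) refl) (*-identityˡ _))

    miss : ∀ N m k (g : ℕ → F) → N ℕ.< suc m ℕ.* suc k → sum (λ n → hit m k n * g (suc n)) N ≈ 0#
    miss N m k g p = sum-zero N λ n n<N → trans (*-cong (χ-no (suc m ℕ.* suc k ℕₚ.≟ suc n) λ e → ℕₚ.<⇒≱ p (≡.subst (ℕ._≤ N) (≡.sym e) n<N)) refl) (zeroˡ _)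

    regroup : ∀ α (g : ℕ → F) N → sum (λ n → # σ α (suc n) * g (suc n)) N ≈ sum (λ m → sum (λ k → ν k ^ α * sum (λ n → hit m k n * g (suc n)) N) N) N
    regroup α g N = begin
      sum (λ n → # σ α (suc n) * g (suc n)) N
        ≈⟨ sum-cong< N (λ n p → trans (*-cong (σ-hits α N n p) refl) (trans (sym (sum-*ʳ _ _ N)) (sum-cong N λ m → trans (sym (sum-*ʳ _ _ N)) (sum-cong N λ k → *-assoc _ _ _)))) ⟩
      sum (λ n → sum (λ m → sum (λ k → ν k ^ α * (hit m k n * g (suc n))) N) N) N
        ≈⟨ trans (sum-swap _ N N) (sum-cong N λ m → trans (sum-swap _ N N) (sum-cong N λ k → sum-*ˡ _ _ N)) ⟩
      sum (λ m → sum (λ k → ν k ^ α * sum (λ n → hit m k n * g (suc n)) N) N) N ∎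

  *-pow : ∀ x y m → (x * y) ^ m ≈ x ^ m * y ^ m
  *-pow x y zero    = sym (*-identityˡ _)
  *-pow x y (suc m) = trans (*-cong refl (*-pow x y m)) (solve 4 (λ x y a b → x :* y :* (a :* b) := x :* a :* (y :* b)) x y (x ^ m) (y ^ m))

  -- In `^*E-neg` with exponent r + j, the j powers absorb `ν k ^ j` and the other r remain as
  -- decay: r = 2 gives convergence, r = 3 the truncation error.
  pow-exp-bound : ∀ w (w>0 : 0# < w) j r k P → k ℕ.≤ P → let v = ν P in
    ν k ^ j * E (- (w * v)) ≤ # ((r ℕ.+ j) !) * inv w w>0 ^ (r ℕ.+ j) * ε P ^ r
  pow-exp-bound w w>0 j r k P k≤P = ≤-trans (*-monoʳ _ (nn-E _) (^-mono j (nn-ν k) (#-≤ (ℕ.s≤s k≤P)))) (≤-trans (≈⇒≤ (sym (begin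
      (w * v) ^ (r ℕ.+ j) * e * (i ^ (r ℕ.+ j) * ε P ^ r)
        ≈⟨ *-cong (*-cong (trans (*-pow w v (r ℕ.+ j)) (*-cong refl (^-+ v r j))) refl) refl ⟩
      w ^ (r ℕ.+ j) * (v ^ r * v ^ j) * e * (i ^ (r ℕ.+ j) * ε P ^ r)
        ≈⟨ solve 6 (λ a v x e b f → a :* (v :* x) :* e :* (b :* f) := (a :* b) :* (v :* f) :* (x :* e)) (w ^ (r ℕ.+ j)) (v ^ r) (v ^ j) e (i ^ (r ℕ.+ j)) (ε P ^ r) ⟩
      (w ^ (r ℕ.+ j) * i ^ (r ℕ.+ j)) * (v ^ r * ε P ^ r) * (v ^ j * e)
        ≈⟨ *-cong (*-cong (unit (r ℕ.+ j) (inv-r w w>0)) (unit r (ν*ε P))) refl ⟩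
      1# * 1# * (v ^ j * e)
        ≈⟨ solve 1 (λ t → k1 :* k1 :* t := t) (v ^ j * e) ⟩
      v ^ j * e ∎)))
    (≤-trans (*-monoʳ _ (nn-* (nn-^ (r ℕ.+ j) (<⇒≤ (inv-pos w w>0))) (nn-ε^ P r)) (^*E-neg (r ℕ.+ j) (nn-* (<⇒≤ w>0) (nn-ν P)))) (≈⇒≤ (sym (*-assoc _ _ _)))))
    where
    v = ν P
    e = E (- (w * v))
    i = inv w w>0
    k1 : ∀ {n} → Expr n
    k1 = con 1ℚᵘ
    unit : ∀ {x y} m → x * y ≈ 1# → x ^ m * y ^ m ≈ 1#
    unit {x} {y} m e = trans (sym (*-pow x y m)) (trans (^-cong m e) (1^ m))

  -- Lambert series: Σ_m Σ_k kʲ e⁻ʷᵐᵏ = Σ_n σⱼ(n) e⁻ʷⁿ.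
  module Lambert (w : F) (w>0 : 0# < w) (j : ℕ) where
    gterm : ℕ → F
    gterm n = # σ j (suc n) * E (- (w * ν n))

    row-pos : ∀ m → 0# < w * ν m
    row-pos m = *-pos w>0 (pos-# m)

    row : ℕ → F
    row m = QSeries.M (w * ν m) (row-pos m) j

    private
      i = inv w w>0
      f : ℕ → ℕ → F
      f m = QSeries.term (w * ν m) (row-pos m) j
      -- The predecessor of (m + 1)(l + 1), so that `ν (P m l)` is that product by computation.
      P : ℕ → ℕ → ℕ
      P m l = l ℕ.+ m ℕ.* suc l
      C₂ = # ((2 ℕ.+ j) !) * i ^ (2 ℕ.+ j)
      nn-C₂ : 0# ≤ C₂
      nn-C₂ = nn-* (nn-# ((2 ℕ.+ j) !)) (nn-^ (2 ℕ.+ j) (<⇒≤ (inv-pos w w>0)))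
      C₃ = # ((3 ℕ.+ j) !) * i ^ (3 ℕ.+ j)
      nn-C₃ : 0# ≤ C₃
      nn-C₃ = nn-* (nn-# ((3 ℕ.+ j) !)) (nn-^ (3 ℕ.+ j) (<⇒≤ (inv-pos w w>0)))

      f≈ : ∀ m l → f m l ≈ ν l ^ j * E (- (w * ν (P m l)))
      f≈ m l = *-cong refl (E-cong (-‿cong (trans (*-assoc _ _ _) (*-cong refl (sym (#-* (suc m) (suc l)))))))

      ε-P : ∀ m l → ε (P m l) ≈ ε m * ε l
      ε-P m l = cancel-≈ (pos-# (P m l)) (trans (ν*ε (P m l)) (sym (trans (*-cong (#-* (suc m) (suc l)) refl)
        (trans (solve 4 (λ a b x y → a :* b :* (x :* y) := (a :* x) :* (b :* y)) (ν m) (ν l) (ε m) (ε l)) (trans (*-cong (ν*ε m) (ν*ε l)) (*-identityˡ _))))))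

      f-nn : ∀ m l → 0# ≤ f m l
      f-nn m l = QSeries.term-nn (w * ν m) (row-pos m) j l

      f-dom : ∀ m l → Bnd (C₂ * # 4 * δ m * δ l) (f m l)
      f-dom m l = Bnd-of (f-nn m l) (≤-trans (≈⇒≤ (f≈ m l)) (≤-trans (pow-exp-bound w w>0 j 2 l (P m l) (ℕₚ.m≤m+n l (m ℕ.* suc l)))
        (≤-trans (≈⇒≤ (*-cong refl (trans (^-cong 2 (ε-P m l)) (solve 2 (λ a b → (a :* b) :^ 2 := (a :* a) :* (b :* b)) (ε m) (ε l)))))
          (≤-trans (*-monoˡ C₂ nn-C₂ (*-mono (nn-² (ε m)) (nn-² (ε l)) (ε²≤2δ m) (ε²≤2δ l))) (≈⇒≤ (solve 3 (λ c a b → c :* (k 2 :* a :* (k 2 :* b)) := c :* k 4 :* a :* b) C₂ (δ m) (δ l)))))))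

      rows : ∀ m → Series (f m) (row m)
      rows m = QSeries.M-series (w * ν m) (row-pos m) j

      row-dom : Dom (C₂ * # 4) row
      row-dom m = dom-bound (f-dom m) (rows m)

    abstract
      G : F
      G = proj₁ (dom-conv row-dom)

      row-series : Series row G
      row-series = proj₂ (dom-conv row-dom)

    private
      g : ℕ → F
      g p = E (- (w * # p))

      pick : ℕ → ℕ → ℕ → F
      pick N m l = sum (λ n → hit m l n * g (suc n)) N

      -- Within the N × N square, the divisor sum up to N misses exactly the pairs with product
      -- beyond N. Each of them is O(N⁻³), and there are at most N² of them.
      defect : ∀ N m l → Bnd (C₃ * ε N ^ 3) (ν l ^ j * pick N m l - f m l)
      defect N m l = go (suc m ℕ.* suc l ℕₚ.≤? N)
        where
        go : Dec (suc m ℕ.* suc l ℕ.≤ N) → Bnd (C₃ * ε N ^ 3) (ν l ^ j * pick N m l - f m l)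
        go (yes p) = Bnd-mono (nn-* nn-C₃ (nn-ε^ N 3)) (Bnd-resp refl (sym (trans (+-cong (*-cong refl (select N m l g p)) (-‿cong (f≈ m l))) (-‿inverseʳ _))) (Bnd-refl ≤-refl))
        go (no ¬p) = Bnd-mono (*-monoˡ C₃ nn-C₃ (^-mono 3 (<⇒≤ (ε-pos (P m l))) (ε-anti (ℕ.s≤s⁻¹ (ℕₚ.≰⇒> ¬p)))))
          (Bnd-resp refl (sym (trans (+-cong (trans (*-cong refl (miss N m l g (ℕₚ.≰⇒> ¬p))) (zeroʳ _)) refl) (+-identityˡ _)))
            (Bnd-neg (Bnd-of (f-nn m l) (≤-trans (≈⇒≤ (f≈ m l)) (pow-exp-bound w w>0 j 3 l (P m l) (ℕₚ.m≤m+n l (m ℕ.* suc l)))))))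

      Nε≤1 : ∀ N → # N * ε N ≤ 1#
      Nε≤1 N = ≤-trans (*-monoʳ (ε N) (<⇒≤ (ε-pos N)) (#-≤ (ℕₚ.n≤1+n N))) (≈⇒≤ (ν*ε N))

      close : ∀ N → Bnd (C₃ * ε N) (sum gterm N - sum (λ m → sum (f m) N) N)
      close N = Bnd-mono
        (≤-trans (≈⇒≤ (trans (sum-const _ N) (trans (*-cong refl (sum-const _ N)) (solve 3 (λ n c e → n :* (n :* (c :* e :^ 3)) := c :* e :* ((n :* e) :* (n :* e))) (# N) C₃ (ε N)))))
          (≤-trans (*-monoˡ (C₃ * ε N) (nn-* nn-C₃ (<⇒≤ (ε-pos N))) (*-mono (nn-* (nn-# N) (<⇒≤ (ε-pos N))) (nn-* (nn-# N) (<⇒≤ (ε-pos N))) (Nε≤1 N) (Nε≤1 N))) (≈⇒≤ (solve 1 (λ x → x :* (k 1 :* k 1) := x) _))))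
        (Bnd-resp refl (trans (sum-cong N λ m → sum-- (λ l → ν l ^ j * pick N m l) (f m) N) (trans (sum-- _ _ N) (+-cong (sym (regroup j g N)) refl)))
          (Bnd-sum N λ m → Bnd-sum N λ l → defect N m l))

    G-series : Series gterm G
    G-series = ⟶-close C₃ close (⟶-close (C₂ * # 4) (λ N → Bnd-swap (square-rows f f-dom rows N)) row-series)

-- Behaviour of the Eisenstein series under t ↦ 1/t.

module ModularTransformation (R : RealField) where

  open DivisorSums R public
  open import Relation.Binary.Reasoning.Setoid setoid

  2π-pos : ∀ {t} → 0# < t → 0# < # 2 * π * t
  2π-pos p = *-pos (*-pos num< π-pos) p

  G : ℕ → ∀ t → 0# < t → F
  G j t p = Lambert.G (# 2 * π * t) (2π-pos p) j

  M-cong : ∀ j {v w} (a : 0# < v) (b : 0# < w) → v ≈ w → QSeries.M v a j ≈ QSeries.M w b j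
  M-cong j a b e = ⟶-unique (Series-cong (λ n → *-cong refl (E-cong (-‿cong (*-cong e refl)))) (QSeries.M-series _ a j)) (QSeries.M-series _ b j)

  inv-inv : ∀ {x} (p : 0# < x) → inv (inv x p) (inv-pos x p) ≈ x
  inv-inv {x} p = sym (inv-unique (inv-pos x p) (inv-l x p))

  module Rows (t : F) (p : 0# < t) where
    ti : F
    ti = inv t p

    row-pos : ∀ m → 0# < ν m * t
    row-pos m = *-pos (pos-# m) p

    module L m = Lattice (ν m * t) (row-pos m)

    iy≈ : ∀ m → L.iy m ≈ ε m * ti
    iy≈ m = sym (inv-unique (row-pos m) (trans (solve 4 (λ v t e i → v :* t :* (e :* i) := (v :* e) :* (t :* i)) (ν m) t (ε m) ti) (trans (*-cong (ν*ε m) (inv-r t p)) (*-identityˡ _))))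

    V : ℕ → F → F
    V j κ = ½ * (κ * G (suc j) t p - ti ^ suc (suc j) * ζ j)

    V-series : ∀ j κ → (∀ y q → Lattice.S y q (suc j) ≈ κ * QS.M y q (suc j)) → Series (λ m → L.ΣRe m (suc j)) (V j κ)
    V-series j κ h = Series-cong term (Series-*ˡ ½ (Series-- (Series-*ˡ κ (Lambert.row-series (# 2 * π * t) (2π-pos p) (suc j))) (Series-*ˡ (ti ^ suc (suc j)) (ζ-series j))))
      where
      term : ∀ m → ½ * (κ * Lambert.row (# 2 * π * t) (2π-pos p) (suc j) m - ti ^ suc (suc j) * ε m ^ suc (suc j)) ≈ L.ΣRe m (suc j)
      term m = begin
        ½ * (κ * Lambert.row (# 2 * π * t) (2π-pos p) (suc j) m - ti ^ suc (suc j) * ε m ^ suc (suc j))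
          ≈⟨ *-cong refl (+-cong (*-cong refl (M-cong (suc j) (Lambert.row-pos (# 2 * π * t) (2π-pos p) (suc j) m) (2π-pos (row-pos m)) (solve 3 (λ p t v → k 2 :* p :* t :* v := k 2 :* p :* (v :* t)) π t (ν m))))
               (-‿cong (trans (*-comm _ _) (trans (sym (*-pow (ε m) ti (suc (suc j)))) (^-cong (suc (suc j)) (sym (iy≈ m))))))) ⟩
        ½ * (κ * QS.M (ν m * t) (row-pos m) (suc j) - L.iy m ^ suc (suc j))
          ≈⟨ *-cong refl (+-cong (sym (h (ν m * t) (row-pos m))) refl) ⟩
        ½ * (L.iy m ^ suc (suc j) + # 2 * L.ΣRe m (suc j) - L.iy m ^ suc (suc j))
          ≈⟨ solve 2 (λ a b → :½ :* (a :+ k 2 :* b :- a) := b) (L.iy m ^ suc (suc j)) (L.ΣRe m (suc j)) ⟩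
        L.ΣRe m (suc j) ∎

    -- From n² + m²t² ≥ mnt. Its square dominates |mt + in|⁻⁴ by a product of a function of m and
    -- one of n, as `fubini` requires.
    a-bound : ∀ m n → L.a m n ≤ ε m * ε n * ti
    a-bound m n = cancel-≤ (L.M-pos m n) (≤-trans (≈⇒≤ (inv-r _ (L.M-pos m n))) (≤-trans (≈⇒≤ (sym unit))
      (*-monoʳ (ε m * ε n * ti) (nn-* (nn-* (<⇒≤ (ε-pos m)) (<⇒≤ (ε-pos n))) (<⇒≤ (inv-pos t p))) (by-nn (nn-+ (nn-² (ν n - ν m * t)) (nn-* (nn-* (nn-ν m) (nn-ν n)) (<⇒≤ p)))
        (solve 3 (λ n m t → n :* n :+ m :* t :* (m :* t) :- m :* n :* t := (n :- m :* t) :* (n :- m :* t) :+ m :* n :* t) (ν n) (ν m) t)))))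
      where
      unit : ν m * ν n * t * (ε m * ε n * ti) ≈ 1#
      unit = trans (solve 6 (λ m n t e f i → m :* n :* t :* (e :* f :* i) := (m :* e) :* (n :* f) :* (t :* i)) (ν m) (ν n) t (ε m) (ε n) ti)
        (trans (*-cong (*-cong (ν*ε m) (ν*ε n)) (inv-r t p)) (solve 0 (k 1 :* k 1 :* k 1 := k 1)))

    a²-bound : ∀ m n → L.a m n * L.a m n ≤ ti * ti * # 4 * δ m * δ n
    a²-bound m n = ≤-trans (*-mono (L.a-nn m n) (L.a-nn m n) (a-bound m n) (a-bound m n))
      (≤-trans (≈⇒≤ (solve 3 (λ e f i → e :* f :* i :* (e :* f :* i) := i :* i :* (e :* e :* (f :* f))) (ε m) (ε n) ti))
        (≤-trans (*-monoˡ (ti * ti) (nn-² ti) (*-mono (nn-² (ε m)) (nn-² (ε n)) (ε²≤2δ m) (ε²≤2δ n))) (≈⇒≤ (solve 3 (λ i a b → i :* i :* (k 2 :* a :* (k 2 :* b)) := i :* i :* k 4 :* a :* b) ti (δ m) (δ n)))))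

    a≤1 : ∀ m n → L.a m n ≤ 1#
    a≤1 m n = ≤-trans (L.a≤ε² m n) (≤-trans (*-mono (<⇒≤ (ε-pos n)) (<⇒≤ (ε-pos n)) (ε≤1 n) (ε≤1 n)) (≈⇒≤ (*-identityˡ 1#)))

  -- Adds two constructors at a time, so that `Re` and `Im` at `dbl (suc i)` unfold by two
  -- multiplications and `even` is an induction on i.
  dbl : ℕ → ℕ
  dbl zero    = zero
  dbl (suc i) = suc (suc (dbl i))

  module Swap (t : F) (p : 0# < t) where
    module A = Rows t p
    module B = Rows (inv t p) (inv-pos t p)
    open A using (ti)

    private
      a-swap : ∀ m n → B.L.a n m ≈ t * t * A.L.a m n
      a-swap m n = sym (inv-unique (B.L.M-pos n m) (begin
        (ν m * ν m + ν n * ti * (ν n * ti)) * (t * t * a)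
          ≈⟨ solve 5 (λ m n t i a → (m :* m :+ n :* i :* (n :* i)) :* (t :* t :* a) := (n :* n :* ((t :* i) :* (t :* i)) :+ m :* t :* (m :* t)) :* a) (ν m) (ν n) t ti a ⟩
        (ν n * ν n * ((t * ti) * (t * ti)) + ν m * t * (ν m * t)) * a
          ≈⟨ *-cong (+-cong (trans (*-cong refl (trans (*-cong (inv-r t p) (inv-r t p)) (*-identityˡ 1#))) (*-identityʳ _)) refl) refl ⟩
        (ν n * ν n + ν m * t * (ν m * t)) * a
          ≈⟨ inv-r _ (A.L.M-pos m n) ⟩
        1# ∎))
        where a = A.L.a m n

      zr-swap : ∀ m n → B.L.zr n m ≈ - (t * A.L.zi m n)
      zr-swap m n = trans (*-cong refl (a-swap m n)) (trans (solve 4 (λ n t i a → n :* i :* (t :* t :* a) := :- (t :* :- (n :* a)) :* (t :* i)) (ν n) t ti (A.L.a m n)) (trans (*-cong refl (inv-r t p)) (*-identityʳ _)))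

      zi-swap : ∀ m n → B.L.zi n m ≈ - (t * A.L.zr m n)
      zi-swap m n = trans (-‿cong (*-cong refl (a-swap m n))) (solve 3 (λ m t a → :- (m :* (t :* t :* a)) := :- (t :* (m :* t :* a))) (ν m) t (A.L.a m n))

    -- 1/(nt⁻¹ + im) is -it times the conjugate of 1/(mt + in).
    even : ∀ i m n → (B.L.Re n (dbl i) m ≈ (- (t * t)) ^ i * A.L.Re m (dbl i) n) × (B.L.Im n (dbl i) m ≈ - ((- (t * t)) ^ i * A.L.Im m (dbl i) n))
    even zero    m n = sym (*-identityˡ _) , solve 0 (k 0 := :- (k 1 :* k 0))
    even (suc i) m n =
      trans (+-cong (*-cong (zr-swap m n) (+-cong (*-cong (zr-swap m n) h₁) (-‿cong (*-cong (zi-swap m n) h₂)))) (-‿cong (*-cong (zi-swap m n) (+-cong (*-cong (zr-swap m n) h₂) (*-cong (zi-swap m n) h₁)))))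
        (solve 6 (λ t x z r i c → :- (t :* z) :* (:- (t :* z) :* (c :* r) :- :- (t :* x) :* :- (c :* i)) :- :- (t :* x) :* (:- (t :* z) :* :- (c :* i) :+ :- (t :* x) :* (c :* r))
          := :- (t :* t) :* c :* (x :* (x :* r :- z :* i) :- z :* (x :* i :+ z :* r))) t (A.L.zr m n) (A.L.zi m n) (A.L.Re m (dbl i) n) (A.L.Im m (dbl i) n) ((- (t * t)) ^ i)) ,
      trans (+-cong (*-cong (zr-swap m n) (+-cong (*-cong (zr-swap m n) h₂) (*-cong (zi-swap m n) h₁))) (*-cong (zi-swap m n) (+-cong (*-cong (zr-swap m n) h₁) (-‿cong (*-cong (zi-swap m n) h₂)))))
        (solve 6 (λ t x z r i c → :- (t :* z) :* (:- (t :* z) :* :- (c :* i) :+ :- (t :* x) :* (c :* r)) :+ :- (t :* x) :* (:- (t :* z) :* (c :* r) :- :- (t :* x) :* :- (c :* i))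
          := :- (:- (t :* t) :* c :* (x :* (x :* i :+ z :* r) :+ z :* (x :* r :- z :* i)))) t (A.L.zr m n) (A.L.zi m n) (A.L.Re m (dbl i) n) (A.L.Im m (dbl i) n) ((- (t * t)) ^ i))
      where
      h₁ = proj₁ (even i m n)
      h₂ = proj₂ (even i m n)

    unit-pow : ∀ i → (- (ti * ti)) ^ i * (- (t * t)) ^ i ≈ 1#
    unit-pow i = trans (sym (*-pow _ _ i)) (trans (^-cong i (trans (solve 2 (λ t i → :- (i :* i) :* :- (t :* t) := (t :* i) :* (t :* i)) t ti) (trans (*-cong (inv-r t p) (inv-r t p)) (*-identityˡ 1#)))) (1^ i))

    column : ∀ i n → Series (λ m → A.L.Re m (dbl (suc i)) n) ((- (ti * ti)) ^ suc i * B.L.ΣRe n (suc (dbl i)))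
    column i n = Series-cong (λ m → trans (*-cong refl (proj₁ (even (suc i) m n))) (trans (sym (*-assoc _ _ _)) (trans (*-cong (unit-pow (suc i)) refl) (*-identityˡ _))))
      (Series-*ˡ _ (B.L.Re-series n (suc (dbl i))))

    -- Beyond the quadratic case the double series converges absolutely.
    V-swap : ∀ i κ → (∀ y q → Lattice.S y q (suc (suc (suc (dbl i)))) ≈ κ * QS.M y q (suc (suc (suc (dbl i))))) →
      A.V (suc (suc (dbl i))) κ ≈ (- (ti * ti)) ^ suc (suc i) * B.V (suc (suc (dbl i))) κ
    V-swap i κ h = ⟶-unique
      (fubini (λ m n → A.L.Re m (dbl (suc (suc i))) n) dom (λ m → A.L.Re-series m (suc (dbl (suc i)))) (column (suc i)) (A.V-series (suc (suc (dbl i))) κ h))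
      (Series-*ˡ ((- (ti * ti)) ^ suc (suc i)) (B.V-series (suc (suc (dbl i))) κ h))
      where
      pow-dbl : ∀ x i → x ^ dbl i ≈ x ^ i * x ^ i
      pow-dbl x zero    = sym (*-identityˡ 1#)
      pow-dbl x (suc i) = trans (*-cong refl (*-cong refl (pow-dbl x i))) (solve 2 (λ x y → x :* (x :* (y :* y)) := x :* y :* (x :* y)) x (x ^ i))
      dom : ∀ m n → Bnd (ti * ti * # 4 * δ m * δ n) (A.L.Re m (dbl (suc (suc i))) n)
      dom m n = Bnd-mono (≤-trans (≤-trans (≈⇒≤ (sym (*-assoc _ _ _))) (*-monoˡ (a * a) (nn-² a) (≤-trans (^-mono i nn-a (A.a≤1 m n)) (≈⇒≤ (1^ i))))) (≤-trans (≈⇒≤ (*-identityʳ _)) (A.a²-bound m n)))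
        (sq-bound (nn-^ (suc (suc i)) nn-a) (≤-trans (by-nn (nn-² (A.L.Im m (dbl (suc (suc i))) n)) (solve 2 (λ x y → x :+ y :- x := y) _ _)) (≤-trans (≈⇒≤ (A.L.norm-^ m (dbl (suc (suc i))) n)) (≈⇒≤ (pow-dbl a (suc (suc i)))))))
        where
        a = A.L.a m n
        nn-a = A.L.a-nn m n

    private
      s : ℕ → F
      s m = ν m * t * (ν m * t)

      module Ker m = Kernel (s m) (nn-² (ν m * t))

      g : ℕ → ℕ → F
      g m n = K n * Ker.h m n

      g-bound : ∀ m n → Bnd (# 6 * ε n) (g m n)
      g-bound m n = Bnd-of (nn-* nn-K (Ker.h-nn m n)) (≤-trans (*-mono nn-K (Ker.h-nn m n) K≤ν (Ker.h-bound m n))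
        (≈⇒≤ (trans (solve 2 (λ v e → v :* (k 6 :* (e :* e)) := k 6 :* e :* (v :* e)) (ν n) (ε n)) (trans (*-cong refl (ν*ε n)) (*-identityʳ _)))))
        where
        nn-K : 0# ≤ K n
        nn-K = nn-+ (nn-# n) (nn-ι 1 1)
        K≤ν : K n ≤ ν n
        K≤ν = by-nn (nn-ι 1 1) (trans (+-cong (#-suc n) refl) (solve 1 (λ n → n :+ k 1 :- (n :+ :½) := :½) (# n)))

      -- The central difference around x = n + 1 of x/(x² + y²), with y = (m + 1)t. The derivative
      -- (y² - x²)/(x² + y²)² is Re (y + ix)⁻², so `T` imitates the quadratic lattice term and
      -- telescopes in n.
      T : ℕ → ℕ → F
      T m n = g m (suc n) - g m n

      T-row : ∀ m → Series (T m) (- g m 0)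
      T-row m = ⟶-cong (λ n → sym (telescope (g m) n)) (+-identityˡ _) (⟶-- (⟶-0 (# 6) (g-bound m)) (⟶-const (g m 0)))

      K>0 : ∀ n → 0# < K n
      K>0 n = <-≤-trans (num< {q = mkℚᵘ (+ 1) 1}) (by-nn (nn-# n) (solve 1 (λ n → n :+ :½ :- :½ := n) (# n)))

      Y : ℕ → F
      Y n = K n * ti

      Y>0 : ∀ n → 0# < Y n
      Y>0 n = *-pos (K>0 n) (inv-pos t p)

      Γ : ℕ → F
      Γ n = K n * (ti * ti) * A (Y n * Y n) (nn-² (Y n))

      Γ-series : ∀ n → Series (λ m → g m n) (Γ n)
      Γ-series n = Series-cong (λ m → trans (*-assoc (K n) (ti * ti) _) (*-cong refl (term m))) (Series-*ˡ (K n * (ti * ti)) (Kernel.A-series (Y n * Y n) (nn-² (Y n))))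
        where
        term : ∀ m → ti * ti * Kernel.a (Y n * Y n) (nn-² (Y n)) m ≈ Ker.h m n
        term m = inv-unique (Ker.K-pos m n) (begin
          (K n * K n + s m) * (ti * ti * a′)
            ≈⟨ solve 5 (λ x m t i a → (x :* x :+ m :* t :* (m :* t)) :* (i :* i :* a) := (m :* m :* ((t :* i) :* (t :* i)) :+ x :* i :* (x :* i)) :* a) (K n) (ν m) t ti a′ ⟩
          (ν m * ν m * ((t * ti) * (t * ti)) + Y n * Y n) * a′
            ≈⟨ *-cong (+-cong (trans (*-cong refl (trans (*-cong (inv-r t p) (inv-r t p)) (*-identityˡ 1#))) (*-identityʳ _)) refl) refl ⟩
          (ν m * ν m + Y n * Y n) * a′
            ≈⟨ inv-r _ (Kernel.M-pos (Y n * Y n) (nn-² (Y n)) m) ⟩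
          1# ∎)
          where a′ = Kernel.a (Y n * Y n) (nn-² (Y n)) m

      -- Up to the factor 1/(2t), `Γ n` is π coth πY - 1/Y at Y = (n + ½)/t, which tends to π. This
      -- non-zero limit is the source of the anomalous term in the transformation of E₂.
      Γ-limit : Γ ⟶ ½ * π * ti
      Γ-limit = ⟶-close (ti * π * (# 16 * (u * u) * (t * t)) + ½ * ti * (# 2 * t))
          (λ n → Bnd-resp (sym (distribʳ (ε n) _ _)) (sym (gap n)) (Bnd-- (first n) (second n))) (⟶-const (½ * π * ti))
        where
        u = inv (# 2 * π) (*-pos num< π-pos)
        nn-ti = <⇒≤ (inv-pos t p)
        j M : ℕ → F
        j n = inv (Y n) (Y>0 n)
        M n = QS.M (Y n) (Y>0 n) 0
        j≈ : ∀ n → j n ≈ ρ (+ n) * t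
        j≈ n = sym (inv-unique (Y>0 n) (trans (solve 4 (λ x i r t → x :* i :* (r :* t) := (x :* r) :* (t :* i)) (K n) ti (ρ (+ n)) t) (trans (*-cong (K*ρ n) (inv-r t p)) (*-identityˡ 1#))))
        j≤ : ∀ n → ρ (+ n) * t ≤ # 2 * t * ε n
        j≤ n = ≤-trans (*-monoʳ t (<⇒≤ p) (ρ≤2ε n)) (≈⇒≤ (solve 2 (λ e t → k 2 :* e :* t := k 2 :* t :* e) (ε n) t))
        gap : ∀ n → Γ n - ½ * π * ti ≈ ti * π * M n - ½ * ti * (ρ (+ n) * t)
        gap n = begin
          Γ n - ½ * π * ti
            ≈⟨ solve 5 (λ x i a j q → x :* (i :* i) :* a :- :½ :* q :* i := :½ :* i :* ((j :+ k 2 :* (x :* i) :* a) :- j :- q)) (K n) ti (A (Y n * Y n) (nn-² (Y n))) (j n) π ⟩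
          ½ * ti * (c (Y n) (Y>0 n) - j n - π)
            ≈⟨ *-cong refl (+-cong (+-cong (c-qseries (Y n) (Y>0 n)) (-‿cong (j≈ n))) refl) ⟩
          ½ * ti * (π * (1# + # 2 * M n) - ρ (+ n) * t - π)
            ≈⟨ solve 4 (λ i q m r → :½ :* i :* (q :* (k 1 :+ k 2 :* m) :- r :- q) := i :* q :* m :- :½ :* i :* r) ti π (M n) (ρ (+ n) * t) ⟩
          ti * π * M n - ½ * ti * (ρ (+ n) * t) ∎
        first : ∀ n → Bnd (ti * π * (# 16 * (u * u) * (t * t)) * ε n) (ti * π * M n)
        first n = Bnd-resp (sym (*-assoc _ _ _)) refl (Bnd-* (Bnd-refl (nn-* nn-ti π-nn)) (Bnd-mono bound (dom-bound (QSeries.term-dom (# 2 * π * Y n) (2π-pos (Y>0 n)) 0) (QSeries.M-series (# 2 * π * Y n) (2π-pos (Y>0 n)) 0))))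
          where
          bound : # 2 * inv (# 2 * π * Y n) (2π-pos (Y>0 n)) ^ 2 * # 2 ≤ # 16 * (u * u) * (t * t) * ε n
          bound = ≤-trans (≈⇒≤ (trans (*-cong (*-cong refl (^-cong 2 (trans (inv-* (*-pos num< π-pos) (Y>0 n)) (*-cong refl (j≈ n))))) refl) (solve 2 (λ u r → k 2 :* (u :* r) :^ 2 :* k 2 := k 4 :* (u :* u) :* (r :* r)) u (ρ (+ n) * t))))
            (≤-trans (*-monoˡ (# 4 * (u * u)) (nn-* num≤ (nn-² u)) (*-mono (nn-* (ρ-nn n) (<⇒≤ p)) (nn-* (ρ-nn n) (<⇒≤ p)) (j≤ n) (≤-trans (j≤ n) (≤-trans (*-monoˡ (# 2 * t) (nn-* num≤ (<⇒≤ p)) (ε≤1 n)) (≈⇒≤ (*-identityʳ _))))))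
              (≈⇒≤ (solve 3 (λ u t e → k 4 :* (u :* u) :* (k 2 :* t :* e :* (k 2 :* t)) := k 16 :* (u :* u) :* (t :* t) :* e) u t (ε n))))
        second : ∀ n → Bnd (½ * ti * (# 2 * t) * ε n) (½ * ti * (ρ (+ n) * t))
        second n = Bnd-resp (sym (*-assoc _ _ _)) refl (Bnd-* (Bnd-refl (nn-* (nn-ι 1 1) nn-ti)) (Bnd-of (nn-* (ρ-nn n) (<⇒≤ p)) (j≤ n)))

      Γ-telescope : Series (λ n → Γ (suc n) - Γ n) (½ * π * ti - Γ 0)
      Γ-telescope = ⟶-cong (λ n → sym (telescope Γ n)) refl (⟶-- Γ-limit (⟶-const (Γ 0)))

      Δ : ℕ → ℕ → F
      Δ m n = A.L.Re m 2 n - T m n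

      -- Over the common denominator the cubic terms of the numerator in w = |z|² cancel, leaving
      -- `B` = O(w²). The two half-integer denominators are comparable to w, so the difference is
      -- O(|z|⁻⁴), within reach of `a²-bound`.
      Δ-bound : ∀ m n → Bnd (ti * ti * # 48 * δ m * δ n) (Δ m n)
      Δ-bound m n = Bnd-mono
          (≤-trans (*-mono (nn-* num≤ nnH) nnH′ (*-monoˡ (# 3) num≤ H≤) H′≤) (≤-trans (≈⇒≤ (solve 1 (λ d → k 3 :* (k 4 :* d) :* d := k 12 :* (d :* d)) D)) (≤-trans (*-monoˡ (# 12) num≤ (A.a²-bound m n)) (≈⇒≤ (solve 3 (λ i a b → k 12 :* (i :* i :* k 4 :* a :* b) := i :* i :* k 48 :* a :* b) ti (δ m) (δ n))))))
          (Bnd-resp (trans (solve 4 (λ d h h′ w → d :* d :* (h :* h′) :* (k 3 :* (w :* w)) := k 3 :* h :* h′ :* ((w :* d) :* (w :* d))) D H H′ w) (trans (*-cong refl (trans (*-cong wD wD) (*-identityˡ 1#))) (*-identityʳ _)))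
            (sym Δ≈) (Bnd-* (Bnd-refl (nn-* (nn-² D) (nn-* nnH nnH′))) B-bound))
        where
        N = ν n
        y = ν m * t
        σ′ = s m
        D = A.L.a m n
        H = Ker.h m n
        H′ = Ker.h m (suc n)
        w = N * N + σ′
        nnD = A.L.a-nn m n
        nnH = Ker.h-nn m n
        nnH′ = Ker.h-nn m (suc n)
        K₀ = N - ½
        K₁ = N + ½
        wD : w * D ≈ 1#
        wD = inv-r _ (A.L.M-pos m n)
        K₀≈ : K n ≈ K₀
        K₀≈ = trans (solve 1 (λ n → n :+ :½ := n :+ k 1 :- :½) (# n)) (+-cong (sym (#-suc n)) refl)
        e₀ : (K₀ * K₀ + σ′) * H ≈ 1#
        e₀ = trans (*-cong (+-cong (*-cong (sym K₀≈) (sym K₀≈)) refl) refl) (inv-r _ (Ker.K-pos m n))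
        e₁ : (K₁ * K₁ + σ′) * H′ ≈ 1#
        e₁ = inv-r _ (Ker.K-pos m (suc n))
        B = (σ′ - N * N) * ((w + ι (mkℚᵘ (+ 1) 3)) * (w + ι (mkℚᵘ (+ 1) 3)) - N * N) - (σ′ - N * N + ι (mkℚᵘ (+ 1) 3)) * (w * w)
        1* : ∀ {x a} → a ≈ 1# → x ≈ x * a
        1* e = trans (sym (*-identityʳ _)) (*-cong refl (sym e))
        Δ≈ : Δ m n ≈ D * D * (H * H′) * B
        Δ≈ = begin
          A.L.Re m 2 n - (K₁ * H′ - K n * H)
            ≈⟨ +-cong (solve 3 (λ y d v → (y :* d) :* ((y :* d) :* k 1 :- (:- (v :* d)) :* k 0) :- (:- (v :* d)) :* ((y :* d) :* k 0 :+ (:- (v :* d)) :* k 1) := (y :* y :- v :* v) :* (d :* d)) y D N) (-‿cong (+-cong refl (-‿cong (*-cong K₀≈ refl)))) ⟩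
          (y * y - N * N) * (D * D) - (K₁ * H′ - K₀ * H)
            ≈⟨ +-cong (trans (1* e₀) (1* e₁)) (-‿cong (trans (+-cong (1* e₀) (-‿cong (1* e₁))) (trans (1* wD) (1* wD)))) ⟩
          (y * y - N * N) * (D * D) * ((K₀ * K₀ + σ′) * H) * ((K₁ * K₁ + σ′) * H′) - (K₁ * H′ * ((K₀ * K₀ + σ′) * H) - K₀ * H * ((K₁ * K₁ + σ′) * H′)) * (w * D) * (w * D)
            ≈⟨ solve 5 (λ y v d h h′ → let w = v :* v :+ y :* y; a = v :- :½; b = v :+ :½; q = con (mkℚᵘ (+ 1) 3) in
                 (y :* y :- v :* v) :* (d :* d) :* ((a :* a :+ y :* y) :* h) :* ((b :* b :+ y :* y) :* h′) :- (b :* h′ :* ((a :* a :+ y :* y) :* h) :- a :* h :* ((b :* b :+ y :* y) :* h′)) :* (w :* d) :* (w :* d)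
                 := d :* d :* (h :* h′) :* ((y :* y :- v :* v) :* ((w :+ q) :* (w :+ q) :- v :* v) :- (y :* y :- v :* v :+ q) :* (w :* w))) y N D H H′ ⟩
          D * D * (H * H′) * B ∎
        nnσ = nn-² y
        nnN = nn-² N
        1≤N² : 1# ≤ N * N
        1≤N² = ≤-trans (≈⇒≤ (sym (*-identityˡ 1#))) (*-mono num≤ num≤ (1≤ν n) (1≤ν n))
        diff : Bnd w (σ′ - N * N)
        diff = by-nn (nn-+ nnσ nnσ) (solve 2 (λ s v → s :- v :- :- (v :+ s) := s :+ s) σ′ (N * N)) , by-nn (nn-+ nnN nnN) (solve 2 (λ s v → (v :+ s) :- (s :- v) := v :+ v) σ′ (N * N))
        rest : Bnd (# 2 * w) (½ * w + ι (mkℚᵘ (+ 1) 15) - N * N)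
        rest = by-nn (nn-+ (nn-+ (nn-* (nn-ι 3 1) nnN) (nn-* (nn-ι 5 1) nnσ)) (nn-ι 1 15))
                 (solve 2 (λ v s → :½ :* (v :+ s) :+ con (mkℚᵘ (+ 1) 15) :- v :- :- (k 2 :* (v :+ s)) := con (mkℚᵘ (+ 3) 1) :* v :+ con (mkℚᵘ (+ 5) 1) :* s :+ con (mkℚᵘ (+ 1) 15)) (N * N) σ′) ,
               by-nn (nn-+ (nn-+ (nn-sub 1≤N²) (nn-* (nn-ι 3 1) (nn-+ nnN nnσ))) (nn-ι 15 15))
                 (solve 2 (λ v s → k 2 :* (v :+ s) :- (:½ :* (v :+ s) :+ con (mkℚᵘ (+ 1) 15) :- v) := (v :- k 1) :+ con (mkℚᵘ (+ 3) 1) :* (v :+ s) :+ con (mkℚᵘ (+ 15) 15)) (N * N) σ′)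
        B-bound : Bnd (# 3 * (w * w)) B
        B-bound = Bnd-mono (by-nn (nn-* (nn-ι 3 3) (nn-² w)) (solve 1 (λ w → k 3 :* (w :* w) :- (w :* (k 2 :* w) :+ con (mkℚᵘ (+ 1) 3) :* (w :* w)) := con (mkℚᵘ (+ 3) 3) :* (w :* w)) w))
          (Bnd-resp refl (solve 2 (λ v s → let w = v :+ s; q = con (mkℚᵘ (+ 1) 3) in (s :- v) :* (:½ :* w :+ con (mkℚᵘ (+ 1) 15) :- v) :- q :* (w :* w) := (s :- v) :* ((w :+ q) :* (w :+ q) :- v) :- (s :- v :+ q) :* (w :* w)) (N * N) σ′)
            (Bnd-- (Bnd-* diff rest) (Bnd-refl (nn-* (nn-ι 1 3) (nn-² w)))))
        scale : ∀ {Q h c} → Q * h ≈ 1# → 0# ≤ h → w ≤ c * Q → h ≤ c * D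
        scale {Q} {h} {c} e nn le = ≤-trans (≈⇒≤ (trans (1* wD) (solve 3 (λ h w d → h :* (w :* d) := h :* d :* w) h w D)))
          (≤-trans (*-monoˡ (h * D) (nn-* nn nnD) le) (≈⇒≤ (trans (solve 4 (λ h d c q → h :* d :* (c :* q) := c :* d :* (q :* h)) h D c Q) (trans (*-cong refl e) (*-identityʳ _)))))
        N-1 : 0# ≤ N - 1#
        N-1 = nn-sub (1≤ν n)
        H≤ : H ≤ # 4 * D
        H≤ = scale e₀ nnH (by-nn (nn-+ (nn-* (nn-+ (nn-* (nn-# 3) N-1) (nn-# 2)) N-1) (nn-* (nn-# 3) nnσ))
          (solve 2 (λ n s → k 4 :* ((n :- :½) :* (n :- :½) :+ s) :- (n :* n :+ s) := (k 3 :* (n :- k 1) :+ k 2) :* (n :- k 1) :+ k 3 :* s) N σ′))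
        H′≤ : H′ ≤ D
        H′≤ = ≤-trans (scale e₁ nnH′ (by-nn (nn-+ (nn-ν n) (nn-ι 1 3)) (solve 2 (λ n s → k 1 :* ((n :+ :½) :* (n :+ :½) :+ s) :- (n :* n :+ s) := n :+ con (mkℚᵘ (+ 1) 3)) N σ′))) (≈⇒≤ (*-identityˡ D))

    -- The conditionally convergent case: subtracting the telescoping T leaves an absolutely
    -- convergent double series, and the two iterated sums of T differ by π/(2t).
    V₂-swap : (- (ti * ti)) ^ 1 * B.V 0 (# 4 * π ^ 2) ≈ A.V 0 (# 4 * π ^ 2) + ½ * π * ti
    V₂-swap = trans (⟶-unique (Series-*ˡ ((- (ti * ti)) ^ 1) (B.V-series 0 (# 4 * π ^ 2) S₂)) total) (solve 3 (λ v g q → v :- :- g :+ (q :- g) := v :+ q) (A.V 0 (# 4 * π ^ 2)) (Γ 0) (½ * π * ti))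
      where
      col : ℕ → F
      col n = (- (ti * ti)) ^ 1 * B.L.ΣRe n 1
      swapped : Series (λ n → col n - (Γ (suc n) - Γ n)) (A.V 0 (# 4 * π ^ 2) - - Γ 0)
      swapped = fubini Δ Δ-bound (λ m → Series-- (A.L.Re-series m 1) (T-row m))
        (λ n → Series-- (column 0 n) (Series-- (Γ-series (suc n)) (Γ-series n)))
        (Series-- (A.V-series 0 (# 4 * π ^ 2) S₂) (Series-neg (Γ-series 0)))
      total : Series col (A.V 0 (# 4 * π ^ 2) - - Γ 0 + (½ * π * ti - Γ 0))
      total = Series-cong (λ n → solve 2 (λ a b → a :- b :+ b := a) (col n) (Γ (suc n) - Γ n)) (Series-+ swapped Γ-telescope)

  e₂ e₄ e₆ : ∀ t → 0# < t → F
  e₂ t p = 1# - # 24 * G 1 t p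
  e₄ t p = 1# + # 240 * G 3 t p
  e₆ t p = 1# - # 504 * G 5 t p

  module _ (t : F) (p : 0# < t) where
    private
      module S = Swap t p
      t′ = inv t p
      p′ = inv-pos t p
      ti = t′
      back : S.B.ti ≈ t
      back = inv-inv p
      one : ∀ m → ti ^ m * t ^ m ≈ 1#
      one m = trans (sym (*-pow ti t m)) (trans (^-cong m (inv-l t p)) (1^ m))
      ×1 : ∀ {x y} → y ≈ 1# → x ≈ x * y
      ×1 e = trans (sym (*-identityʳ _)) (*-cong refl (sym e))

    -- In the lattice sum, `V` accounts for the points off the axes and 90ζ(4) = π⁴ for those on
    -- them; the inversion swaps the two axes and maps `V` to a multiple of itself. The other
    -- weights follow the same scheme.
    e₄-transform : e₄ t′ p′ ≈ t ^ 4 * e₄ t p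
    e₄-transform = cancel-≈ (pos-^ 4 π-pos) (begin
      π ^ 4 * e₄ t′ p′
        ≈⟨ solve 4 (λ q g z t → q :^ 4 :* (k 1 :+ k 240 :* g) := q :^ 4 :+ k 180 :* (:½ :* (con (mkℚᵘ (+ 8) 2) :* q :^ 4 :* g :- t :^ 4 :* z)) :+ t :^ 4 :* (k 90 :* z)) π g′ (ζ 2) t ⟩
      π ^ 4 + # 180 * (½ * (κ * g′ - t ^ 4 * ζ 2)) + t ^ 4 * (# 90 * ζ 2)
        ≈⟨ +-cong (+-cong refl (*-cong refl v′)) refl ⟩
      π ^ 4 + # 180 * (t ^ 4 * (½ * (κ * g - ti ^ 4 * ζ 2))) + t ^ 4 * (# 90 * ζ 2)
        ≈⟨ solve 5 (λ q g z t i → q :^ 4 :+ k 180 :* (t :^ 4 :* (:½ :* (con (mkℚᵘ (+ 8) 2) :* q :^ 4 :* g :- i :^ 4 :* z))) :+ t :^ 4 :* (k 90 :* z)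
             := q :^ 4 :+ t :^ 4 :* (q :^ 4 :* (k 240 :* g)) :- (i :^ 4 :* t :^ 4) :* (k 90 :* z) :+ t :^ 4 :* (k 90 :* z)) π g (ζ 2) t ti ⟩
      π ^ 4 + t ^ 4 * (π ^ 4 * (# 240 * g)) - (ti ^ 4 * t ^ 4) * (# 90 * ζ 2) + t ^ 4 * (# 90 * ζ 2)
        ≈⟨ +-cong (+-cong refl (-‿cong (*-cong (one 4) ζ4))) (*-cong refl ζ4) ⟩
      π ^ 4 + t ^ 4 * (π ^ 4 * (# 240 * g)) - 1# * π ^ 4 + t ^ 4 * π ^ 4
        ≈⟨ solve 3 (λ q t g → q :+ t :* (q :* (k 240 :* g)) :- k 1 :* q :+ t :* q := q :* (t :* (k 1 :+ k 240 :* g))) (π ^ 4) (t ^ 4) g ⟩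
      π ^ 4 * (t ^ 4 * e₄ t p) ∎)
      where
      g = G 3 t p
      g′ = G 3 t′ p′
      κ = ι (mkℚᵘ (+ 8) 2) * π ^ 4
      v′ : ½ * (κ * g′ - t ^ 4 * ζ 2) ≈ t ^ 4 * (½ * (κ * g - ti ^ 4 * ζ 2))
      v′ = begin
        ½ * (κ * g′ - t ^ 4 * ζ 2)       ≈⟨ *-cong refl (+-cong refl (-‿cong (*-cong (^-cong 4 (sym back)) refl))) ⟩
        S.B.V 2 κ                        ≈⟨ ×1 (one 4) ⟩
        S.B.V 2 κ * (ti ^ 4 * t ^ 4)     ≈⟨ solve 3 (λ v i t → v :* (i :^ 4 :* t :^ 4) := t :^ 4 :* ((:- (i :* i)) :^ 2 :* v)) (S.B.V 2 κ) ti t ⟩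
        t ^ 4 * ((- (ti * ti)) ^ 2 * S.B.V 2 κ) ≈⟨ *-cong refl (sym (S.V-swap 0 κ S₄)) ⟩
        t ^ 4 * S.A.V 2 κ ∎

    e₆-transform : e₆ t′ p′ ≈ - (t ^ 6 * e₆ t p)
    e₆-transform = cancel-≈ (pos-^ 6 π-pos) (begin
      π ^ 6 * e₆ t′ p′
        ≈⟨ solve 4 (λ q g z t → q :^ 6 :* (k 1 :- k 504 :* g) := q :^ 6 :- k 1890 :* (:½ :* (con (mkℚᵘ (+ 8) 14) :* q :^ 6 :* g :- t :^ 6 :* z)) :- t :^ 6 :* (k 945 :* z)) π g′ (ζ 4) t ⟩
      π ^ 6 - # 1890 * (½ * (κ * g′ - t ^ 6 * ζ 4)) - t ^ 6 * (# 945 * ζ 4)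
        ≈⟨ +-cong (+-cong refl (-‿cong (*-cong refl v′))) refl ⟩
      π ^ 6 - # 1890 * - (t ^ 6 * (½ * (κ * g - ti ^ 6 * ζ 4))) - t ^ 6 * (# 945 * ζ 4)
        ≈⟨ solve 5 (λ q g z t i → q :^ 6 :- k 1890 :* :- (t :^ 6 :* (:½ :* (con (mkℚᵘ (+ 8) 14) :* q :^ 6 :* g :- i :^ 6 :* z))) :- t :^ 6 :* (k 945 :* z)
             := q :^ 6 :+ t :^ 6 :* (q :^ 6 :* (k 504 :* g)) :- (i :^ 6 :* t :^ 6) :* (k 945 :* z) :- t :^ 6 :* (k 945 :* z)) π g (ζ 4) t ti ⟩
      π ^ 6 + t ^ 6 * (π ^ 6 * (# 504 * g)) - (ti ^ 6 * t ^ 6) * (# 945 * ζ 4) - t ^ 6 * (# 945 * ζ 4)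
        ≈⟨ +-cong (+-cong refl (-‿cong (*-cong (one 6) ζ6))) (-‿cong (*-cong refl ζ6)) ⟩
      π ^ 6 + t ^ 6 * (π ^ 6 * (# 504 * g)) - 1# * π ^ 6 - t ^ 6 * π ^ 6
        ≈⟨ solve 3 (λ q t g → q :+ t :* (q :* (k 504 :* g)) :- k 1 :* q :- t :* q := q :* :- (t :* (k 1 :- k 504 :* g))) (π ^ 6) (t ^ 6) g ⟩
      π ^ 6 * - (t ^ 6 * e₆ t p) ∎)
      where
      g = G 5 t p
      g′ = G 5 t′ p′
      κ = ι (mkℚᵘ (+ 8) 14) * π ^ 6
      v′ : ½ * (κ * g′ - t ^ 6 * ζ 4) ≈ - (t ^ 6 * (½ * (κ * g - ti ^ 6 * ζ 4)))
      v′ = begin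
        ½ * (κ * g′ - t ^ 6 * ζ 4)       ≈⟨ *-cong refl (+-cong refl (-‿cong (*-cong (^-cong 6 (sym back)) refl))) ⟩
        S.B.V 4 κ                        ≈⟨ ×1 (one 6) ⟩
        S.B.V 4 κ * (ti ^ 6 * t ^ 6)     ≈⟨ solve 3 (λ v i t → v :* (i :^ 6 :* t :^ 6) := :- (t :^ 6 :* ((:- (i :* i)) :^ 3 :* v))) (S.B.V 4 κ) ti t ⟩
        - (t ^ 6 * ((- (ti * ti)) ^ 3 * S.B.V 4 κ)) ≈⟨ -‿cong (*-cong refl (sym (S.V-swap 1 κ S₆))) ⟩
        - (t ^ 6 * S.A.V 4 κ) ∎

    e₂-transform : π * e₂ t′ p′ ≈ # 6 * t - t ^ 2 * (π * e₂ t p)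
    e₂-transform = cancel-≈ π-pos (begin
      π * (π * e₂ t′ p′)
        ≈⟨ solve 4 (λ q g z t → q :* (q :* (k 1 :- k 24 :* g)) := q :* q :- k 12 :* (:½ :* (k 4 :* q :^ 2 :* g :- t :^ 2 :* z)) :- t :^ 2 :* (k 6 :* z)) π g′ (ζ 0) t ⟩
      π * π - # 12 * (½ * (κ * g′ - t ^ 2 * ζ 0)) - t ^ 2 * (# 6 * ζ 0)
        ≈⟨ +-cong (+-cong refl (-‿cong (*-cong refl v′))) refl ⟩
      π * π - # 12 * - (t ^ 2 * (½ * (κ * g - ti ^ 2 * ζ 0) + ½ * π * ti)) - t ^ 2 * (# 6 * ζ 0)
        ≈⟨ solve 5 (λ q g z t i → q :* q :- k 12 :* :- (t :^ 2 :* (:½ :* (k 4 :* q :^ 2 :* g :- i :^ 2 :* z) :+ :½ :* q :* i)) :- t :^ 2 :* (k 6 :* z)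
             := q :* q :+ t :^ 2 :* (q :* q :* (k 24 :* g)) :- (i :^ 2 :* t :^ 2) :* (k 6 :* z) :+ k 6 :* q :* t :* (i :^ 1 :* t :^ 1) :- t :^ 2 :* (k 6 :* z)) π g (ζ 0) t ti ⟩
      π * π + t ^ 2 * (π * π * (# 24 * g)) - (ti ^ 2 * t ^ 2) * (# 6 * ζ 0) + # 6 * π * t * (ti ^ 1 * t ^ 1) - t ^ 2 * (# 6 * ζ 0)
        ≈⟨ +-cong (+-cong (+-cong refl (-‿cong (*-cong (one 2) ζ2))) (*-cong refl (one 1))) (-‿cong (*-cong refl ζ2)) ⟩
      π * π + t ^ 2 * (π * π * (# 24 * g)) - 1# * (π * π) + # 6 * π * t * 1# - t ^ 2 * (π * π)
        ≈⟨ solve 3 (λ q t g → q :* q :+ t :^ 2 :* (q :* q :* (k 24 :* g)) :- k 1 :* (q :* q) :+ k 6 :* q :* t :* k 1 :- t :^ 2 :* (q :* q) := q :* (k 6 :* t :- t :^ 2 :* (q :* (k 1 :- k 24 :* g)))) π t g ⟩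
      π * (# 6 * t - t ^ 2 * (π * e₂ t p)) ∎)
      where
      g = G 1 t p
      g′ = G 1 t′ p′
      κ = # 4 * π ^ 2
      v′ : ½ * (κ * g′ - t ^ 2 * ζ 0) ≈ - (t ^ 2 * (½ * (κ * g - ti ^ 2 * ζ 0) + ½ * π * ti))
      v′ = begin
        ½ * (κ * g′ - t ^ 2 * ζ 0)       ≈⟨ *-cong refl (+-cong refl (-‿cong (*-cong (^-cong 2 (sym back)) refl))) ⟩
        S.B.V 0 κ                        ≈⟨ ×1 (one 2) ⟩
        S.B.V 0 κ * (ti ^ 2 * t ^ 2)     ≈⟨ solve 3 (λ v i t → v :* (i :^ 2 :* t :^ 2) := :- (t :^ 2 :* ((:- (i :* i)) :^ 1 :* v))) (S.B.V 0 κ) ti t ⟩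
        - (t ^ 2 * ((- (ti * ti)) ^ 1 * S.B.V 0 κ)) ≈⟨ -‿cong (*-cong refl S.V₂-swap) ⟩
        - (t ^ 2 * (S.A.V 0 κ + ½ * π * ti)) ∎

-- Two-sided Gaussian sums and their duplication.

module ThetaSeries (R : RealField) where

  open ModularTransformation R public
  open import Relation.Binary.Reasoning.Setoid setoid

  gauss : F → F → F
  gauss u x = E (- (u * (x * x)))

  gauss-cong : ∀ {u v x y} → u ≈ v → x ≈ y → gauss u x ≈ gauss v y
  gauss-cong e f = E-cong (-‿cong (*-cong e (*-cong f f)))

  gauss-nn : ∀ u x → 0# ≤ gauss u x
  gauss-nn u x = nn-E _

  gauss-≤ : ∀ {u v a b d} → v * (a * a) ≤ u * (b * b) + d → gauss u b ≤ E d * gauss v a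
  gauss-≤ {u} {v} {a} {b} {d} h = ≤-trans (E-mono (by-nn (nn-sub h) (solve 3 (λ x y d → (d :+ :- x) :- :- y := (y :+ d) :- x) (v * (a * a)) (u * (b * b)) d))) (≈⇒≤ (E-+ _ _))

  gauss-const : ∀ v → 0# < v → F
  gauss-const v p = E v * (# 2 * inv v p)

  gauss-# : ∀ v (p : 0# < v) i → gauss v (# i) ≤ gauss-const v p * (ε i * ε i)
  gauss-# v p i = ≤-trans (gauss-≤ {v} {½ * v} {ν i} {# i} {v} widen) (≤-trans (*-monoˡ (E v) (nn-E v) decay) (≈⇒≤ (sym (*-assoc _ _ _))))
    where
    widen : ½ * v * (ν i * ν i) ≤ v * (# i * # i) + v
    widen = by-nn (nn-* (nn-* (nn-ι 1 1) (<⇒≤ p)) (nn-² (# i - 1#))) (trans (+-cong refl (-‿cong (*-cong refl (*-cong (#-suc i) (#-suc i)))))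
      (solve 2 (λ v i → v :* (i :* i) :+ v :- :½ :* v :* ((i :+ k 1) :* (i :+ k 1)) := :½ :* v :* ((i :- k 1) :* (i :- k 1))) v (# i)))
    U = ½ * v * (ν i * ν i)
    nn-U : 0# ≤ U
    nn-U = nn-* (nn-* (nn-ι 1 1) (<⇒≤ p)) (nn-² (ν i))
    decay : gauss (½ * v) (ν i) ≤ # 2 * inv v p * (ε i * ε i)
    decay = ≤-trans (≈⇒≤ (trans (sym (*-identityˡ _)) (trans (*-cong (sym unit) refl) (solve 3 (λ c u e → c :* u :* e := c :* (u :* k 1 :* e)) (# 2 * inv v p * (ε i * ε i)) U (E (- U))))))
      (≤-trans (*-monoˡ _ (nn-* (nn-* num≤ (<⇒≤ (inv-pos v p))) (nn-² (ε i))) (≤-trans (*-monoʳ (E (- U)) (nn-E _) (≈⇒≤ refl)) (^*E-neg 1 nn-U))) (≈⇒≤ (*-identityʳ _)))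
      where
      unit : # 2 * inv v p * (ε i * ε i) * U ≈ 1#
      unit = trans (solve 4 (λ v w e n → k 2 :* w :* (e :* e) :* (:½ :* v :* (n :* n)) := (v :* w) :* ((n :* e) :* (n :* e))) v (inv v p) (ε i) (ν i))
        (trans (*-cong (inv-r v p) (*-cong (ν*ε i) (ν*ε i))) (solve 0 (k 1 :* (k 1 :* k 1) := k 1)))

  nn-gauss-const : ∀ v p → 0# ≤ gauss-const v p
  nn-gauss-const v p = nn-* (nn-E v) (nn-* num≤ (<⇒≤ (inv-pos v p)))

  half>0 : ∀ {v} → 0# < v → 0# < ½ * v
  half>0 p = *-pos num< p

  -- Decay along a translate, from (a+b)² ≥ a²/2 - b².
  gauss-shift : ∀ u (p : 0# < u) x i a → # i * # i ≤ a * a → gauss u (a + x) ≤ E (u * (x * x)) * (gauss-const (½ * u) (half>0 p) * (ε i * ε i))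
  gauss-shift u p x i a h = ≤-trans (gauss-≤ {u} {½ * u} {# i} {a + x} {u * (x * x)} (by-nn
      (nn-* (nn-* (nn-ι 1 1) (<⇒≤ p)) (nn-+ (nn-sub h) (nn-² (a + # 2 * x))))
      (solve 4 (λ u a x i → u :* ((a :+ x) :* (a :+ x)) :+ u :* (x :* x) :- :½ :* u :* (i :* i) := :½ :* u :* ((a :* a :- i :* i) :+ (a :+ k 2 :* x) :* (a :+ k 2 :* x))) u a x (# i))))
    (*-monoˡ _ (nn-E _) (gauss-# (½ * u) (half>0 p) i))

  sq-neg : ∀ i → # i * # i ≤ (- # suc i) * (- # suc i)
  sq-neg i = by-nn (nn-+ (nn-* (nn-# 2) (nn-# i)) (nn-# 1)) (trans (+-cong (*-cong (-‿cong (#-suc i)) (-‿cong (#-suc i))) refl) (solve 1 (λ i → :- (i :+ k 1) :* :- (i :+ k 1) :- i :* i := k 2 :* i :+ k 1) (# i)))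

  -- Stands for a sign. Its square being 1, ηⁿ makes sense for negative n as η to the power |n|, and
  -- one proof serves θ₂, θ₃ (η = 1) and θ₄ (η = -1).
  Unit : F → Set
  Unit η = (η * η ≈ 1#)

  Unit-Bnd : ∀ {η} → Unit η → ∀ i → Bnd 1# (η ^ i)
  Unit-Bnd {η} e i = Bnd-resp (1^ i) refl (Bnd-^ i (sq-bound num≤ (≈⇒≤ (trans e (sym (*-identityˡ 1#))))))

  unit-1 : Unit 1#
  unit-1 = *-identityˡ 1#

  unit-neg : Unit (- 1#)
  unit-neg = solve 0 (:- k 1 :* :- k 1 := k 1)

  -- The terms n = i and n = -1-i of Σ ηⁿ e^{-u(n+x)²}.
  W : F → F → F → ℕ → F
  W η u x i = η ^ i * gauss u (# i + x) + η ^ suc i * gauss u (- # suc i + x)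

  module _ {η : F} (η² : Unit η) {u : F} (p : 0# < u) where

    private
      const : F → F
      const x = E (u * (x * x)) * gauss-const (½ * u) (half>0 p)

      nn-const : ∀ x → 0# ≤ const x
      nn-const x = nn-* (nn-E _) (nn-gauss-const _ _)

      term-bound : ∀ x m i a → # i * # i ≤ a * a → Bnd (const x * (ε i * ε i)) (η ^ m * gauss u (a + x))
      term-bound x m i a h = Bnd-mono (≤-trans (≈⇒≤ (*-identityˡ _)) (≤-trans (gauss-shift u p x i a h) (≈⇒≤ (sym (*-assoc _ _ _))))) (Bnd-* (Unit-Bnd η² m) (Bnd-refl (gauss-nn u (a + x))))

    W-bound : ∀ x i → Bnd (# 2 * const x * (ε i * ε i)) (W η u x i)
    W-bound x i = Bnd-resp (solve 2 (λ c e → c :* e :+ c :* e := k 2 :* c :* e) (const x) (ε i * ε i)) refl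
      (Bnd-+ (term-bound x i i (# i) ≤-refl) (term-bound x (suc i) i (- # suc i) (sq-neg i)))

    W-dom : ∀ x → Dom (# 2 * const x * # 2) (W η u x)
    W-dom x i = Bnd-mono (≤-trans (*-monoˡ _ (nn-* num≤ (nn-const x)) (ε²≤2δ i)) (≈⇒≤ (sym (*-assoc _ _ _)))) (W-bound x i)

    abstract
      P : F → F
      P x = proj₁ (dom-conv (W-dom x))

      P-series : ∀ x → Series (W η u x) (P x)
      P-series x = proj₂ (dom-conv (W-dom x))

    -- `P` sums the wings in pairs, whereas `Σℤ` in the statement asks each wing to converge by
    -- itself.
    P-two-sided : ∀ x → Σ[ a ∈ F ] Σ[ b ∈ F ] (Series (λ i → η ^ i * gauss u (# i + x)) a × Series (λ i → η ^ suc i * gauss u (- # suc i + x)) b × P x ≈ a + b)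
    P-two-sided x = proj₁ right , proj₁ left , proj₂ right , proj₂ left , ⟶-unique (P-series x) (Series-+ (proj₂ right) (proj₂ left))
      where
      wing : ∀ {f} → (∀ i → Bnd (const x * (ε i * ε i)) (f i)) → Σ[ s ∈ F ] Series f s
      wing h = dom-conv {const x * # 2} λ i → Bnd-mono (≤-trans (*-monoˡ (const x) (nn-const x) (ε²≤2δ i)) (≈⇒≤ (sym (*-assoc _ _ _)))) (h i)
      right = wing λ i → term-bound x i i (# i) ≤-refl
      left  = wing λ i → term-bound x (suc i) i (- # suc i) (sq-neg i)

    private
      η-step : ∀ i y → η ^ i * y ≈ η * (η ^ suc i * y)
      η-step i y = trans (*-cong (sym (*-identityˡ _)) refl) (trans (*-cong (*-cong (sym η²) refl) refl) (solve 3 (λ e f y → e :* e :* f :* y := e :* (e :* f :* y)) η (η ^ i) y))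

      shifted : ∀ x N → sum (W η u (x + 1#)) N ≈ η * (sum (W η u x) N + (η ^ N * gauss u (# N + x) - η ^ N * gauss u (- # N + x)))
      shifted x zero    = trans (solve 2 (λ e a → k 0 := e :* (k 0 :+ (k 1 :* a :- k 1 :* a))) η (gauss u (# 0 + x))) (*-cong refl (+-cong refl (+-cong refl (-‿cong (*-cong refl (gauss-cong refl (solve 1 (λ x → k 0 :+ x := :- k 0 :+ x) x)))))))
      shifted x (suc N) = trans (+-cong (shifted x N) (+-cong
          (trans (η-step N _) (*-cong refl (*-cong refl (gauss-cong refl (trans (solve 2 (λ n x → n :+ (x :+ k 1) := (n :+ k 1) :+ x) (# N) x) (+-cong (sym (#-suc N)) refl))))))
          (trans (*-assoc _ _ _) (*-cong refl (*-cong refl (gauss-cong refl (trans (+-cong (-‿cong (#-suc N)) refl) (solve 2 (λ n x → :- (n :+ k 1) :+ (x :+ k 1) := :- n :+ x) (# N) x))))))))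
        (trans (solve 6 (λ e s f a b c → e :* (s :+ (f :* a :- f :* b)) :+ (e :* (e :* f :* c) :+ e :* (f :* b)) := e :* (s :+ f :* a :+ e :* f :* c)) η (sum (W η u x) N) (η ^ N) (gauss u (# N + x)) (gauss u (- # N + x)) (gauss u (# suc N + x)))
          (*-cong refl (solve 5 (λ s f e c d → s :+ f :+ e :* c := (s :+ (f :+ e :* d)) :+ (e :* c :- e :* d)) (sum (W η u x) N) (η ^ N * gauss u (# N + x)) (η ^ suc N) (gauss u (# suc N + x)) (gauss u (- # suc N + x)))))

      edge : ∀ x → (λ N → η ^ N * gauss u (# N + x) - η ^ N * gauss u (- # N + x)) ⟶ 0#
      edge x = ⟶-0 (# 2 * const x) λ N → Bnd-mono
        (≤-trans (≈⇒≤ (solve 2 (λ c e → c :* (e :* e) :+ c :* (e :* e) := k 2 :* c :* e :* e) (const x) (ε N))) (≤-trans (*-monoˡ _ (nn-* (nn-* num≤ (nn-const x)) (<⇒≤ (ε-pos N))) (ε≤1 N)) (≈⇒≤ (*-identityʳ _))))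
        (Bnd-- (term-bound x N N (# N) ≤-refl) (term-bound x N N (- # N) (≈⇒≤ (solve 1 (λ n → n :* n := :- n :* :- n) (# N)))))

    P-suc : ∀ x → P (x + 1#) ≈ η * P x
    P-suc x = ⟶-unique (P-series (x + 1#)) (⟶-cong (λ N → sym (shifted x N)) (*-cong refl (+-identityʳ _)) (⟶-*ˡ η (⟶-+ (P-series x) (edge x))))

    P-cong : ∀ {x y} → x ≈ y → P x ≈ P y
    P-cong {x} {y} e = ⟶-unique (Series-cong (λ i → +-cong (*-cong refl (gauss-cong refl (+-cong refl e))) (*-cong refl (gauss-cong refl (+-cong refl e)))) (P-series x)) (P-series y)

    P-shift : ∀ x b → P (x + # b) ≈ η ^ b * P x
    P-shift x zero    = trans (P-cong (+-identityʳ x)) (sym (*-identityˡ _))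
    P-shift x (suc b) = trans (P-cong (trans (+-cong refl (#-suc b)) (sym (+-assoc _ _ _)))) (trans (P-suc (x + # b)) (trans (*-cong refl (P-shift x b)) (sym (*-assoc _ _ _))))

    P-unshift : ∀ x b → P (x - # b) ≈ η ^ b * P x
    P-unshift x b = begin
      P (x - # b)                      ≈⟨ trans (sym (*-identityˡ _)) (*-cong (sym (unit b)) refl) ⟩
      η ^ b * η ^ b * P (x - # b)      ≈⟨ *-assoc _ _ _ ⟩
      η ^ b * (η ^ b * P (x - # b))    ≈⟨ *-cong refl (sym (P-shift (x - # b) b)) ⟩
      η ^ b * P (x - # b + # b)        ≈⟨ *-cong refl (P-cong (solve 2 (λ x b → x :- b :+ b := x) x (# b))) ⟩
      η ^ b * P x ∎
      where
      unit : ∀ b → η ^ b * η ^ b ≈ 1#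
      unit b = trans (sym (*-pow η η b)) (trans (^-cong b η²) (1^ b))

  -- Substituting m = n + d and summing over the parity classes of d.
  module Landen {η : F} (η² : Unit η) {u : F} (p : 0# < u) (s : F) where
    private
      2u>0 : 0# < # 2 * u
      2u>0 = *-pos num< p

      kernel : F → F → F
      kernel D x = gauss u x * gauss u (D + x)

      -- Completing the square: x² + (D + x)² = 2(D/2)² + 2(x + D/2)². For fixed D the sum over x is
      -- again a theta series, at 2u.
      kernel≈ : ∀ D x → kernel D x ≈ gauss (# 2 * u) (½ * D) * gauss (# 2 * u) (x + ½ * D)
      kernel≈ D x = trans (sym (E-+ _ _)) (trans (E-cong (solve 3 (λ u d x → :- (u :* (x :* x)) :+ :- (u :* ((d :+ x) :* (d :+ x))) := :- (k 2 :* u :* (:½ :* d :* (:½ :* d))) :+ :- (k 2 :* u :* ((x :+ :½ :* d) :* (x :+ :½ :* d)))) u D x)) (E-+ _ _))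

      third : F
      third = ι (mkℚᵘ (+ 1) 2) * u

      third>0 : 0# < third
      third>0 = *-pos num< p

      C₁ C₂ : F
      C₁ = gauss-const third third>0
      C₂ = E (third * (s * s)) * gauss-const (½ * third) (half>0 third>0)

      nn-C₁ : 0# ≤ C₁
      nn-C₁ = nn-gauss-const _ _

      nn-C₂ : 0# ≤ C₂
      nn-C₂ = nn-* (nn-E _) (nn-gauss-const _ _)

      -- The form x² + (D + x)² is at least (D² + x²)/3, which decouples the two variables; hence
      -- the constant `third`.
      kernel-bound : ∀ D a i j → # i * # i ≤ D * D → # j * # j ≤ a * a → kernel D (a + s) ≤ C₁ * (ε i * ε i) * (C₂ * (ε j * ε j))
      kernel-bound D a i j hi hj = ≤-trans (≈⇒≤ (sym (E-+ _ _))) (≤-trans (E-mono split) (≤-trans (≈⇒≤ (E-+ _ _))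
          (*-mono (gauss-nn third (# i)) (gauss-nn third (a + s)) (gauss-# third third>0 i) (≤-trans (gauss-shift third third>0 s j a hj) (≈⇒≤ (sym (*-assoc _ _ _)))))))
        where
        x = a + s
        q : ∀ {n} → Expr n
        q = con (mkℚᵘ (+ 1) 2)
        split : - (u * (x * x)) + - (u * ((D + x) * (D + x))) ≤ - (third * (# i * # i)) + - (third * (x * x))
        split = by-nn (nn-* (<⇒≤ third>0) (nn-+ (nn-sub hi) (nn-+ (nn-* (nn-ι 1 1) (nn-² (# 2 * D + # 3 * x))) (nn-* (nn-ι 1 1) (nn-² x)))))
          (solve 4 (λ u d x i → :- (q :* u :* (i :* i)) :+ :- (q :* u :* (x :* x)) :- (:- (u :* (x :* x)) :+ :- (u :* ((d :+ x) :* (d :+ x)))) := q :* u :* ((d :* d :- i :* i) :+ (:½ :* ((k 2 :* d :+ k 3 :* x) :* (k 2 :* d :+ k 3 :* x)) :+ :½ :* (x :* x)))) u D x (# i))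

      inner : F → ℕ → F
      inner D j = kernel D (# j + s) + kernel D (- # suc j + s)

      inner-bound : ∀ D i j → # i * # i ≤ D * D → Bnd (# 2 * (C₁ * (ε i * ε i) * (C₂ * (ε j * ε j)))) (inner D j)
      inner-bound D i j h = Bnd-resp (solve 1 (λ x → x :+ x := k 2 :* x) _) refl (Bnd-+ (one (# j) ≤-refl) (one (- # suc j) (sq-neg j)))
        where
        one : ∀ a → # j * # j ≤ a * a → Bnd (C₁ * (ε i * ε i) * (C₂ * (ε j * ε j))) (kernel D (a + s))
        one a h′ = Bnd-of (nn-* (gauss-nn _ _) (gauss-nn _ _)) (kernel-bound D a i j h h′)

      Φ : ℕ → ℕ → F
      Φ i j = η ^ i * inner (# i) j + η ^ suc i * inner (- # suc i) j

      Φ-bound : ∀ i j → Bnd (# 16 * C₁ * C₂ * δ i * δ j) (Φ i j)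
      Φ-bound i j = Bnd-mono (≤-trans (≈⇒≤ (solve 4 (λ a b e f → k 1 :* (k 2 :* (a :* e :* (b :* f))) :+ k 1 :* (k 2 :* (a :* e :* (b :* f))) := k 4 :* a :* b :* (e :* f)) C₁ C₂ (ε i * ε i) (ε j * ε j)))
          (≤-trans (*-monoˡ (# 4 * C₁ * C₂) (nn-* (nn-* num≤ nn-C₁) nn-C₂) (*-mono (nn-² (ε i)) (nn-² (ε j)) (ε²≤2δ i) (ε²≤2δ j))) (≈⇒≤ (solve 4 (λ a b e f → k 4 :* a :* b :* (k 2 :* e :* (k 2 :* f)) := k 16 :* a :* b :* e :* f) C₁ C₂ (δ i) (δ j)))))
        (Bnd-+ (Bnd-* (Unit-Bnd η² i) (inner-bound (# i) i j ≤-refl)) (Bnd-* (Unit-Bnd η² (suc i)) (inner-bound (- # suc i) i j (sq-neg i))))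

      rowsum : F → F
      rowsum D = gauss (# 2 * u) (½ * D) * P unit-1 2u>0 (s + ½ * D)

      rowsum-series : ∀ D → Series (inner D) (rowsum D)
      rowsum-series D = Series-cong (λ j → trans (distribˡ _ _ _) (+-cong (step j (# j)) (step (suc j) (- # suc j)))) (Series-*ˡ (gauss (# 2 * u) (½ * D)) (P-series unit-1 2u>0 (s + ½ * D)))
        where
        step : ∀ m a → gauss (# 2 * u) (½ * D) * (1# ^ m * gauss (# 2 * u) (a + (s + ½ * D))) ≈ kernel D (a + s)
        step m a = trans (*-cong refl (trans (*-cong (1^ m) refl) (trans (*-identityˡ _) (gauss-cong refl (sym (+-assoc a s _)))))) (sym (kernel≈ D (a + s)))

      row : ℕ → F
      row i = η ^ i * rowsum (# i) + η ^ suc i * rowsum (- # suc i)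

      row-series : ∀ i → Series (Φ i) (row i)
      row-series i = Series-+ (Series-*ˡ _ (rowsum-series (# i))) (Series-*ˡ _ (rowsum-series (- # suc i)))

      Pη = P η² p s

      column-series : ∀ j → Series (λ i → Φ i j) (Pη * W η u s j)
      column-series j = ⟶-cong (λ N → sum-cong N λ i → solve 8 (λ a b g h x y z w → g :* (a :* x :+ b :* y) :+ h :* (a :* z :+ b :* w) := a :* (g :* x :+ h :* z) :+ b :* (g :* y :+ h :* w)) (η ^ i) (η ^ suc i) (gauss u (# j + s)) (gauss u (- # suc j + s)) (gauss u (# i + (# j + s))) (gauss u (- # suc i + (# j + s))) (gauss u (# i + (- # suc j + s))) (gauss u (- # suc i + (- # suc j + s))))
        (trans (+-cong (*-cong refl (trans (P-cong η² p (+-comm _ _)) (P-shift η² p s j))) (*-cong refl (trans (P-cong η² p (+-comm _ _)) (P-unshift η² p s (suc j)))))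
          (solve 5 (λ g h a b q → g :* (a :* q) :+ h :* (b :* q) := q :* (a :* g :+ b :* h)) (gauss u (# j + s)) (gauss u (- # suc j + s)) (η ^ j) (η ^ suc j) Pη))
        (Series-+ (Series-*ˡ (gauss u (# j + s)) (P-series η² p (# j + s))) (Series-*ˡ (gauss u (- # suc j + s)) (P-series η² p (- # suc j + s))))

      row-bound : ∀ i → Bnd (# 16 * C₁ * C₂ * ε i) (row i)
      row-bound i = Bnd-mono (*-monoˡ (# 16 * C₁ * C₂) (nn-* (nn-* num≤ nn-C₁) nn-C₂) (≤-trans (*-monoˡ (ε i) (<⇒≤ (ε-pos i)) (ε≤1 (suc i))) (≈⇒≤ (*-identityʳ _)))) (dom-bound (Φ-bound i) (row-series i))

      η-even : ∀ b → η ^ (b ℕ.+ b) ≈ 1#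
      η-even b = trans (^-+ η b b) (trans (sym (*-pow η η b)) (trans (^-cong b η²) (1^ b)))

      P₂ : F → F
      P₂ = P unit-1 2u>0

      pair : ∀ b → P₂ s * W 1# (# 2 * u) 0# b + η * P₂ (s + ½) * W 1# (# 2 * u) ½ b ≈ row (b ℕ.+ b) + row (suc (b ℕ.+ b))
      pair b = sym (begin
        row (b ℕ.+ b) + row (suc (b ℕ.+ b))
          ≈⟨ +-cong (+-cong (*-cong (η-even b) r₀) (*-cong (*-cong refl (η-even b)) r₁′)) (+-cong (*-cong (*-cong refl (η-even b)) r₁) (*-cong (trans (sym (*-assoc _ _ _)) (trans (*-cong η² (η-even b)) (*-identityˡ 1#))) r₀′)) ⟩
        (1# * (x * P₂ s) + η * 1# * (w * P₂ (s + ½))) + (η * 1# * (z * P₂ (s + ½)) + 1# * (y * P₂ s))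
          ≈⟨ solve 7 (λ x y z w p q e → (k 1 :* (x :* p) :+ e :* k 1 :* (w :* q)) :+ (e :* k 1 :* (z :* q) :+ k 1 :* (y :* p)) := p :* (k 1 :* x :+ k 1 :* y) :+ e :* q :* (k 1 :* z :+ k 1 :* w)) x y z w (P₂ s) (P₂ (s + ½)) η ⟩
        P₂ s * (1# * x + 1# * y) + η * P₂ (s + ½) * (1# * z + 1# * w)
          ≈⟨ +-cong (*-cong refl (+-cong (*-cong (sym (1^ b)) refl) (*-cong (sym (1^ (suc b))) refl))) (*-cong refl (+-cong (*-cong (sym (1^ b)) refl) (*-cong (sym (1^ (suc b))) refl))) ⟩
        P₂ s * W 1# (# 2 * u) 0# b + η * P₂ (s + ½) * W 1# (# 2 * u) ½ b ∎)
        where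
        x = gauss (# 2 * u) (# b + 0#)
        y = gauss (# 2 * u) (- # suc b + 0#)
        z = gauss (# 2 * u) (# b + ½)
        w = gauss (# 2 * u) (- # suc b + ½)
        2b : # (b ℕ.+ b) ≈ # 2 * # b
        2b = trans (#-+ b b) (solve 1 (λ b → b :+ b := k 2 :* b) (# b))
        to : ∀ {v} c → P₂ (v + # c) ≈ P₂ v
        to {v} c = trans (P-shift unit-1 2u>0 v c) (trans (*-cong (1^ c) refl) (*-identityˡ _))
        fro : ∀ {v} c → P₂ (v - # c) ≈ P₂ v
        fro {v} c = trans (P-unshift unit-1 2u>0 v c) (trans (*-cong (1^ c) refl) (*-identityˡ _))
        r₀ : rowsum (# (b ℕ.+ b)) ≈ x * P₂ s
        r₀ = *-cong (gauss-cong refl (trans (*-cong refl 2b) (solve 1 (λ b → :½ :* (k 2 :* b) := b :+ k 0) (# b))))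
          (trans (P-cong unit-1 2u>0 (+-cong refl (trans (*-cong refl 2b) (solve 1 (λ b → :½ :* (k 2 :* b) := b) (# b))))) (to b))
        r₁ : rowsum (# suc (b ℕ.+ b)) ≈ z * P₂ (s + ½)
        r₁ = *-cong (gauss-cong refl (trans (*-cong refl (#-double b)) (solve 1 (λ b → :½ :* (b :+ b :+ k 1) := b :+ :½) (# b))))
          (trans (P-cong unit-1 2u>0 (trans (+-cong refl (*-cong refl (#-double b))) (solve 2 (λ s b → s :+ :½ :* (b :+ b :+ k 1) := s :+ :½ :+ b) s (# b)))) (to b))
        r₁′ : rowsum (- # suc (b ℕ.+ b)) ≈ w * P₂ (s + ½)
        r₁′ = *-cong (gauss-cong refl (trans (*-cong refl (-‿cong (#-double b))) (trans (solve 1 (λ b → :½ :* :- (b :+ b :+ k 1) := :- (b :+ k 1) :+ :½) (# b)) (+-cong (-‿cong (sym (#-suc b))) refl))))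
          (trans (P-cong unit-1 2u>0 (trans (+-cong refl (*-cong refl (-‿cong (#-double b)))) (trans (solve 2 (λ s b → s :+ :½ :* :- (b :+ b :+ k 1) := s :+ :½ :- (b :+ k 1)) s (# b)) (+-cong refl (-‿cong (sym (#-suc b))))))) (fro (suc b)))
        r₀′ : rowsum (- # suc (suc (b ℕ.+ b))) ≈ y * P₂ s
        r₀′ = *-cong (gauss-cong refl (trans half (sym (+-identityʳ _))))
          (trans (P-cong unit-1 2u>0 (+-cong refl half)) (fro (suc b)))
          where
          half : ½ * - # suc (suc (b ℕ.+ b)) ≈ - # suc b
          half = trans (*-cong refl (-‿cong (trans (#-suc (suc (b ℕ.+ b))) (+-cong (#-double b) refl)))) (trans (solve 1 (λ b → :½ :* :- (b :+ b :+ k 1 :+ k 1) := :- (b :+ k 1)) (# b)) (-‿cong (sym (#-suc b))))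

    landen : P η² p s * P η² p s ≈ P unit-1 2u>0 s * P unit-1 2u>0 0# + η * P unit-1 2u>0 (s + ½) * P unit-1 2u>0 ½
    landen = ⟶-unique (Series-*ˡ Pη (P-series η² p s)) (fubini Φ Φ-bound row-series column-series
      (Series-unpair row-bound (Series-cong pair (Series-+ (Series-*ˡ (P₂ s) (P-series unit-1 2u>0 0#)) (Series-*ˡ (η * P₂ (s + ½)) (P-series unit-1 2u>0 ½))))))

-- Verified power series arithmetic with error terms.

module TaylorModels (R : RealField) where

  open ThetaSeries R public
  open import Relation.Binary.Reasoning.Setoid setoid

  -- Taylor models: an integer polynomial and a natural number c bounding the
  -- error by c q¹⁰, on the range q ≤ 1/(z+1).

  Model : Set
  Model = List ℤ × ℕ

  order : ℕ
  order = 10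

  module Arithmetic (z : ℕ) where
    -- An upper bound for m q when q ≤ 1/(z + 1), rounded up so that all bookkeeping stays within
    -- natural numbers.
    ceil : ℕ → ℕ
    ceil m = (m ℕ.+ z) DivMod./ suc z

    ceils : ℕ → ℕ → ℕ
    ceils zero    m = m
    ceils (suc k) m = ceil (ceils k m)

    size : List ℤ → ℕ
    size []      = 0
    size (a ∷ p) = ℤ.∣ a ∣ ℕ.+ ceil (size p)

    scale : ℤ → List ℤ → List ℤ
    scale a []      = []
    scale a (b ∷ p) = a ℤ.* b ∷ scale a p

    plus : List ℤ → List ℤ → List ℤ
    plus []      q       = q
    plus (a ∷ p) []      = a ∷ p
    plus (a ∷ p) (b ∷ q) = a ℤ.+ b ∷ plus p q

    times : List ℤ → List ℤ → List ℤ
    times []      q = []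
    times (a ∷ p) q = plus (scale a q) (+ 0 ∷ times p q)

    add sub mul : Model → Model → Model
    add (p , c) (q , d) = plus p q , c ℕ.+ d
    sub (p , c) (q , d) = plus p (scale -[1+ 0 ] q) , c ℕ.+ d
    -- Three errors: the coefficients cut off at order 10, the first polynomial times the second
    -- error, and the first error times the full second factor, whose own error d q¹⁰ is rounded to
    -- a number.
    mul (p , c) (q , d) = take order r , (size (drop order r) ℕ.+ size p ℕ.* d) ℕ.+ c ℕ.* (size q ℕ.+ ceils order d)
      where r = times p q

    infixl 6 _⊞_ _⊟_
    infixl 7 _⊠_

    -- Models are assembled as syntax alongside the soundness proof; computation happens only when
    -- `run` is evaluated for a final `dominates`.
    data Term : Set where
      leaf        : Model → Term
      _⊞_ _⊟_ _⊠_ : Term → Term → Term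
      power       : Term → ℕ → Term

    const : ℕ → Term
    const n = leaf (+ n ∷ [] , 0)

    pow : Model → ℕ → Model
    pow m zero    = + 1 ∷ [] , 0
    pow m (suc n) = mul m (pow m n)

    run : Term → Model
    run (leaf m)    = m
    run (a ⊞ b)     = add (run a) (run b)
    run (a ⊟ b)     = sub (run a) (run b)
    run (a ⊠ b)     = mul (run a) (run b)
    run (power a n) = pow (run a) n

    withError : ℕ → ℕ → List ℤ → List ℤ
    withError zero    c p       = ℤ.- + c ∷ []
    withError (suc n) c []      = + 0 ∷ withError n c []
    withError (suc n) c (a ∷ p) = a ∷ withError n c p

    -- A lower bound valid for all 0 ≤ q ≤ 1/(z + 1), in Horner form: a non-negative tail is
    -- dropped, a negative one is charged at the largest q.
    low : List ℤ → ℤ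
    low []      = + 0
    low (a ∷ p) with low p
    ... | + _      = a
    ... | -[1+ n ] = a ℤ.- + ceil (suc n)

    isPos : ℤ → Bool
    isPos (+ suc _) = true
    isPos _         = false

    isZero : ℤ → Bool
    isZero (+ 0) = true
    isZero _     = false

    vanishes : ℕ → List ℤ → Bool
    vanishes zero    p       = true
    vanishes (suc k) []      = true
    vanishes (suc k) (a ∷ p) = isZero a ∧ vanishes k p

    -- Certifies qᵏ ≤ x for every x that the model describes: coefficients below k vanish exactly,
    -- and what follows has a positive integer, hence at least 1, as lower bound. All uncertainty is
    -- first moved into a negative coefficient at order 10.
    dominates : ℕ → Model → Bool
    dominates k (p , c) = vanishes k w ∧ isPos (low (drop k w))
      where w = withError order (c ℕ.+ size (drop order p)) p

    module Sound (q : F) (q≥0 : 0# ≤ q) (small : # suc z * q ≤ 1#) where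

      infix 4 _⊨_

      ⟪_⟫ : ℤ → F
      ⟪ a ⟫ = ι (mkℚᵘ a 0)

      ⟪+⟫ : ∀ a b → ⟪ a ℤ.+ b ⟫ ≈ ⟪ a ⟫ + ⟪ b ⟫
      ⟪+⟫ a b = trans (ι-cong (*≡* (≡.cong (ℤ._* + 1) (≡.sym (≡.cong₂ ℤ._+_ (ℤₚ.*-identityʳ a) (ℤₚ.*-identityʳ b)))))) (ι-+ _ _)

      ⟪*⟫ : ∀ a b → ⟪ a ℤ.* b ⟫ ≈ ⟪ a ⟫ * ⟪ b ⟫
      ⟪*⟫ a b = trans (ι-cong (*≡* ≡.refl)) (ι-* _ _)

      ⟪-⟫ : ∀ a → ⟪ ℤ.- a ⟫ ≈ - ⟪ a ⟫
      ⟪-⟫ a = trans (ι-cong (*≡* ≡.refl)) (ι-neg _)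

      horner : List ℤ → F
      horner []      = 0#
      horner (a ∷ p) = ⟪ a ⟫ + q * horner p

      Within : Model → F → Set
      Within m x = Bnd (# proj₂ m * q ^ order) (x - horner (proj₁ m))

      record _⊨_ (m : Term) (x : F) : Set where
        constructor model
        field within : Within (run m) x

      ceil-bound : ∀ m → # m * q ≤ # ceil m
      ceil-bound m = ≤-trans (*-monoʳ q q≥0 (≤-trans (#-≤ m≤) (≈⇒≤ (#-* (ceil m) (suc z))))) (≤-trans (≈⇒≤ (*-assoc _ _ _)) (≤-trans (*-monoˡ _ (nn-# (ceil m)) small) (≈⇒≤ (*-identityʳ _))))
        where
        m≤ : m ℕ.≤ ceil m ℕ.* suc z
        m≤ = ℕₚ.+-cancelʳ-≤ z m _ (ℕₚ.≤-trans (ℕₚ.≤-reflexive (DivMod.m≡m%n+[m/n]*n (m ℕ.+ z) (suc z)))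
          (ℕₚ.≤-trans (ℕₚ.≤-reflexive (ℕₚ.+-comm ((m ℕ.+ z) DivMod.% suc z) _)) (ℕₚ.+-monoʳ-≤ (ceil m ℕ.* suc z) (ℕ.s≤s⁻¹ (DivMod.m%n<n (m ℕ.+ z) (suc z))))))

      ceils-bound : ∀ k m → # m * q ^ k ≤ # ceils k m
      ceils-bound zero    m = ≈⇒≤ (*-identityʳ _)
      ceils-bound (suc k) m = ≤-trans (≈⇒≤ (solve 3 (λ m q x → m :* (q :* x) := m :* x :* q) (# m) q (q ^ k))) (≤-trans (*-monoʳ q q≥0 (ceils-bound k m)) (ceil-bound (ceils k m)))

      abs-bound : ∀ a → Bnd (# ℤ.∣ a ∣) ⟪ a ⟫
      abs-bound (+ n)    = Bnd-refl (nn-# n)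
      abs-bound -[1+ n ] = Bnd-resp refl (sym (⟪-⟫ (+ suc n))) (Bnd-neg (Bnd-refl (nn-# (suc n))))

      size-bound : ∀ p → Bnd (# size p) (horner p)
      size-bound []      = Bnd-refl ≤-refl
      size-bound (a ∷ p) = Bnd-resp (sym (#-+ ℤ.∣ a ∣ (ceil (size p)))) refl (Bnd-+ (abs-bound a)
        (Bnd-mono (≤-trans (≈⇒≤ (*-comm _ _)) (ceil-bound (size p))) (Bnd-* (Bnd-refl q≥0) (size-bound p))))

      plus-sound : ∀ p r → horner (plus p r) ≈ horner p + horner r
      plus-sound []      r       = sym (+-identityˡ _)
      plus-sound (a ∷ p) []      = sym (+-identityʳ _)
      plus-sound (a ∷ p) (b ∷ r) = trans (+-cong (⟪+⟫ a b) (*-cong refl (plus-sound p r))) (solve 5 (λ a b q x y → a :+ b :+ q :* (x :+ y) := a :+ q :* x :+ (b :+ q :* y)) ⟪ a ⟫ ⟪ b ⟫ q (horner p) (horner r))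

      scale-sound : ∀ a p → horner (scale a p) ≈ ⟪ a ⟫ * horner p
      scale-sound a []      = sym (zeroʳ _)
      scale-sound a (b ∷ p) = trans (+-cong (⟪*⟫ a b) (*-cong refl (scale-sound a p))) (solve 4 (λ a b q x → a :* b :+ q :* (a :* x) := a :* (b :+ q :* x)) ⟪ a ⟫ ⟪ b ⟫ q (horner p))

      times-sound : ∀ p r → horner (times p r) ≈ horner p * horner r
      times-sound []      r = sym (zeroˡ _)
      times-sound (a ∷ p) r = trans (plus-sound (scale a r) (+ 0 ∷ times p r)) (trans (+-cong (scale-sound a r) (+-cong refl (*-cong refl (times-sound p r))))
        (solve 4 (λ a q x y → a :* y :+ (k 0 :+ q :* (x :* y)) := (a :+ q :* x) :* y) ⟪ a ⟫ q (horner p) (horner r)))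

      split-sound : ∀ k p → horner p ≈ horner (take k p) + q ^ k * horner (drop k p)
      split-sound zero    p       = solve 1 (λ x → x := k 0 :+ k 1 :* x) (horner p)
      split-sound (suc n) []      = solve 1 (λ x → k 0 := k 0 :+ x :* k 0) (q ^ suc n)
      split-sound (suc n) (a ∷ p) = trans (+-cong refl (*-cong refl (split-sound n p))) (solve 5 (λ a q x y w → a :+ q :* (x :+ y :* w) := a :+ q :* x :+ q :* y :* w) ⟪ a ⟫ q (horner (take n p)) (q ^ n) (horner (drop n p)))

      nn-err : 0# ≤ q ^ order
      nn-err = nn-^ order q≥0

      ⊨-const : ∀ n → const n ⊨ # n
      ⊨-const n = model (Bnd-resp (sym (zeroˡ _)) (solve 2 (λ n q → k 0 := n :- (n :+ q :* k 0)) (# n) q) (Bnd-refl ≤-refl))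

      add-sound : ∀ m n {x y} → Within m x → Within n y → Within (add m n) (x + y)
      add-sound (p , c) (r , d) {x} {y} a b = (Bnd-resp (trans (sym (distribʳ _ _ _)) (*-cong (sym (#-+ c d)) refl))
        (trans (solve 4 (λ x y p r → x :- p :+ (y :- r) := x :+ y :- (p :+ r)) x y (horner p) (horner r)) (+-cong refl (-‿cong (sym (plus-sound p r))))) (Bnd-+ a b))

      sub-sound : ∀ m n {x y} → Within m x → Within n y → Within (sub m n) (x - y)
      sub-sound (p , c) (r , d) {x} {y} a b = (Bnd-resp (trans (sym (distribʳ _ _ _)) (*-cong (sym (#-+ c d)) refl))
        (trans (solve 4 (λ x y p r → x :- p :- (y :- r) := x :- y :- (p :+ (:- k 1) :* r)) x y (horner p) (horner r)) (+-cong refl (-‿cong (sym (trans (plus-sound p _) (+-cong refl (trans (scale-sound -[1+ 0 ] r) (*-cong (⟪-⟫ (+ 1)) refl)))))))) (Bnd-- a b))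

      mul-sound : ∀ m n {x y} → Within m x → Within n y → Within (mul m n) (x * y)
      mul-sound (p , c) (r , d) {x} {y} a b = (Bnd-resp
          (trans (solve 6 (λ w s t d c u → w :* s :+ t :* (d :* w) :+ c :* w :* u := (s :+ t :* d :+ c :* u) :* w) Q (# size hi) (# size p) (# d) (# c) (# size r + # ceils order d)) (*-cong (sym total) refl))
          (sym gap)
          (Bnd-+ (Bnd-+ (Bnd-* (Bnd-refl nn-err) (size-bound hi)) (Bnd-* (size-bound p) b)) (Bnd-* a y-bound)))
        where
        Q = q ^ order
        hi = drop order (times p r)
        lo = take order (times p r)
        y-bound : Bnd (# size r + # ceils order d) y
        y-bound = Bnd-resp refl (solve 2 (λ r y → r :+ (y :- r) := y) (horner r) y) (Bnd-+ (size-bound r) (Bnd-mono (ceils-bound order d) b))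
        gap : x * y - horner lo ≈ Q * horner hi + horner p * (y - horner r) + (x - horner p) * y
        gap = trans (solve 3 (λ x y l → x :* y :- l := x :* y :- l) x y (horner lo)) (trans (+-cong refl (-‿cong (trans (solve 3 (λ l q h → l := l :+ q :* h :- q :* h) (horner lo) Q (horner hi)) (+-cong (trans (sym (split-sound order (times p r))) (times-sound p r)) refl))))
          (solve 6 (λ x y p r q h → x :* y :- (p :* r :- q :* h) := q :* h :+ p :* (y :- r) :+ (x :- p) :* y) x y (horner p) (horner r) Q (horner hi)))
        total : # ((size hi ℕ.+ size p ℕ.* d) ℕ.+ c ℕ.* (size r ℕ.+ ceils order d)) ≈ # size hi + # size p * # d + # c * (# size r + # ceils order d)
        total = trans (#-+ (size hi ℕ.+ size p ℕ.* d) _) (+-cong (trans (#-+ (size hi) (size p ℕ.* d)) (+-cong refl (#-* (size p) d))) (trans (#-* c _) (*-cong refl (#-+ (size r) (ceils order d)))))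

      pow-sound : ∀ m n {x} → Within m x → Within (pow m n) (x ^ n)
      pow-sound m zero    a = _⊨_.within (⊨-const 1)
      pow-sound m (suc n) a = mul-sound m (pow m n) a (pow-sound m n a)

      ⊨-+ : ∀ {m n x y} → m ⊨ x → n ⊨ y → m ⊞ n ⊨ x + y
      ⊨-+ {m} {n} (model a) (model b) = model (add-sound (run m) (run n) a b)

      ⊨-- : ∀ {m n x y} → m ⊨ x → n ⊨ y → m ⊟ n ⊨ x - y
      ⊨-- {m} {n} (model a) (model b) = model (sub-sound (run m) (run n) a b)

      ⊨-* : ∀ {m n x y} → m ⊨ x → n ⊨ y → m ⊠ n ⊨ x * y
      ⊨-* {m} {n} (model a) (model b) = model (mul-sound (run m) (run n) a b)

      ⊨-^ : ∀ {m x} n → m ⊨ x → power m n ⊨ x ^ n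
      ⊨-^ {m} n (model a) = model (pow-sound (run m) n a)

      withError-sound : ∀ n c p → horner (withError n c p) ≈ horner (take n p) - # c * q ^ n
      withError-sound zero    c p       = trans (+-cong (⟪-⟫ (+ c)) refl) (solve 2 (λ c q → :- c :+ q :* k 0 := k 0 :- c :* k 1) (# c) q)
      withError-sound (suc n) c []      = trans (+-cong refl (*-cong refl (withError-sound n c []))) (trans (+-cong refl (*-cong refl (+-cong (take-[] n) refl))) (solve 3 (λ q c x → k 0 :+ q :* (k 0 :- c :* x) := k 0 :- c :* (q :* x)) q (# c) (q ^ n)))
        where
        take-[] : ∀ n → horner (take n []) ≈ 0#
        take-[] zero    = refl
        take-[] (suc n) = refl
      withError-sound (suc n) c (a ∷ p) = trans (+-cong refl (*-cong refl (withError-sound n c p))) (solve 5 (λ a q t c x → a :+ q :* (t :- c :* x) := a :+ q :* t :- c :* (q :* x)) ⟪ a ⟫ q (horner (take n p)) (# c) (q ^ n))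

      low-sound : ∀ p → ⟪ low p ⟫ ≤ horner p
      low-sound []      = ≤-refl
      low-sound (a ∷ p) with low p | low-sound p
      ... | + n      | h = by-nn (nn-* q≥0 (≤-trans (nn-# n) h)) (solve 3 (λ a q x → a :+ q :* x :- a := q :* x) ⟪ a ⟫ q (horner p))
      ... | -[1+ n ] | h = ≤-trans (≈⇒≤ (trans (⟪+⟫ a (ℤ.- + ceil (suc n))) (+-cong refl (⟪-⟫ (+ ceil (suc n)))))) (+-mono-≤ ≤-refl
        (≤-trans (neg-mono (ceil-bound (suc n))) (≤-trans (≈⇒≤ (solve 2 (λ m q → :- (m :* q) := q :* :- m) (# suc n) q)) (*-monoˡ q q≥0 (≤-trans (≈⇒≤ (sym (⟪-⟫ (+ suc n)))) h)))))

      vanishes-sound : ∀ k p → Bool.T (vanishes k p) → horner p ≈ q ^ k * horner (drop k p)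
      vanishes-sound zero    p             t = sym (*-identityˡ _)
      vanishes-sound (suc k) []            t = sym (zeroʳ _)
      vanishes-sound (suc n) (+ zero ∷ p)  t = trans (+-cong refl (*-cong refl (vanishes-sound n p t))) (solve 3 (λ q x y → k 0 :+ q :* (x :* y) := q :* x :* y) q (q ^ n) (horner (drop n p)))

      dominates-sound : ∀ k m {x} → Bool.T (dominates k m) → Within m x → q ^ k ≤ x
      dominates-sound k (p , c) {x} t (lower , _) = ≤-trans (≤-trans (≈⇒≤ (sym (*-identityʳ _))) (*-monoˡ _ (nn-^ k q≥0) (≤-trans (one≤ (low (drop k w)) (∧-right (vanishes k w) t)) (low-sound (drop k w)))))
        (≤-trans (≈⇒≤ (sym (vanishes-sound k w (∧-left (vanishes k w) t)))) (≤-trans (≈⇒≤ (withError-sound order e p)) below))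
        where
        tail = size (drop order p)
        e = c ℕ.+ tail
        w = withError order e p
        ∧-left : ∀ a {b} → Bool.T (a ∧ b) → Bool.T a
        ∧-left true _ = _
        ∧-right : ∀ a {b} → Bool.T (a ∧ b) → Bool.T b
        ∧-right true t = t
        one≤ : ∀ a → Bool.T (isPos a) → 1# ≤ ⟪ a ⟫
        one≤ (+ suc n) _ = #-≤ (ℕ.s≤s ℕ.z≤n)
        below : horner (take order p) - # e * q ^ order ≤ x
        below = by-nn (nn-+ (nn-sub lower) (nn-* nn-err (nn-sub (proj₁ (size-bound (drop order p))))))
          (trans (+-cong refl (-‿cong (+-cong refl (-‿cong (*-cong (#-+ c tail) refl)))))
            (trans (solve 6 (λ x h c s Q d → x :- (h :- (c :+ s) :* Q) := x :- (h :+ Q :* d) :- :- (c :* Q) :+ Q :* (d :- :- s)) x (horner (take order p)) (# c) (# tail) (q ^ order) (horner (drop order p)))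
              (+-cong (+-cong (+-cong refl (-‿cong (sym (split-sound order p)))) refl) refl)))

-- Theta constants: estimates, duplication, Jacobi's identity.

module ThetaBounds (R : RealField) where

  open TaylorModels R public
  open import Relation.Binary.Reasoning.Setoid setoid
  open Defs using (σ)

  halving-sum : ∀ {f s} → (∀ i → 0# ≤ f i) → (∀ i → f (suc i) ≤ ½ * f i) → Series f s → s ≤ # 2 * f 0
  halving-sum {f} {s} nn h p = ⟶-≤ p (⟶-const _) λ n → ≤-trans (by-nn (nn-* num≤ (nn n)) (solve 2 (λ a b → a :+ k 2 :* b :- a := k 2 :* b) (sum f n) (f n))) (partial n)
    where
    partial : ∀ n → sum f n + # 2 * f n ≤ # 2 * f 0
    partial zero    = ≈⇒≤ (+-identityˡ _)
    partial (suc n) = ≤-trans (by-nn (nn-* num≤ (nn-sub (h n))) (solve 3 (λ s a b → s :+ k 2 :* a :- (s :+ a :+ k 2 :* b) := k 2 :* (:½ :* a :- b)) (sum f n) (f n) (f (suc n)))) (partial n)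

  halving-tail : ∀ {f s} N → (∀ i → 0# ≤ f i) → (∀ i → f (suc i) ≤ ½ * f i) → Series f s → Bnd (# 2 * f N) (s - sum f N)
  halving-tail {f} {s} N nn h p = Bnd-of (Series-nn (Series-drop N p) (λ i → nn (N ℕ.+ i)))
    (≡.subst (λ m → s - sum f N ≤ # 2 * f m) (ℕₚ.+-identityʳ N) (halving-sum (λ i → nn (N ℕ.+ i)) (λ i → ≡.subst (λ m → f m ≤ ½ * f (N ℕ.+ i)) (≡.sym (ℕₚ.+-suc N i)) (h (N ℕ.+ i))) (Series-drop N p)))

  σ-bound : ∀ j n → # σ j (suc n) ≤ ν n ^ suc j
  σ-bound j n = ≤-trans (≈⇒≤ (σ-sum j (suc n))) (≤-trans (proj₂ (Bnd-sum< {g = λ _ → ν n ^ j} (suc n) term)) (≈⇒≤ (sum-const _ (suc n))))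
    where
    χ≤1 : ∀ {P : Set} (d : Dec P) → Bnd 1# (χ d)
    χ≤1 (yes _) = Bnd-refl num≤
    χ≤1 (no _)  = Bnd-of ≤-refl num≤
    term : ∀ i → i ℕ.< suc n → Bnd (ν n ^ j) (ν i ^ j * χ (suc i ∣? suc n))
    term i p = Bnd-resp (*-identityʳ _) refl (Bnd-* (Bnd-of (nn-^ j (nn-ν i)) (^-mono j (nn-ν i) (#-≤ p))) (χ≤1 (suc i ∣? suc n)))

  x^≤1 : ∀ {x} n → 0# ≤ x → x ≤ 1# → x ^ n ≤ 1#
  x^≤1 n p q = ≤-trans (^-mono n p q) (≈⇒≤ (1^ n))

  module Thetas (u : F) (u>0 : 0# < u) where
    q : F
    q = E (- u)

    q>0 : 0# < q
    q>0 = E-pos _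

    nn-q : 0# ≤ q
    nn-q = <⇒≤ q>0

    -- `χ₂` is `θ₂` divided by 2q^{1/4}, which makes it a power series in q, the sum of q^{i(i+1)}.
    θ₃ θ₄ θ₂ χ₂ : F
    θ₃ = P unit-1 u>0 0#
    θ₄ = P unit-neg u>0 0#
    θ₂ = P unit-1 u>0 ½
    χ₂ = ½ * E (ι (mkℚᵘ (+ 1) 3) * u) * θ₂

    gauss-pow : ∀ i a → a * a ≈ # i * # i → gauss u (a + 0#) ≈ q ^ (i ℕ.* i)
    gauss-pow i a e = trans (E-cong (trans (-‿cong (*-cong refl (trans (*-cong (+-identityʳ a) (+-identityʳ a)) (trans e (sym (#-* i i)))))) (solve 2 (λ u n → :- (u :* n) := n :* :- u) u (# (i ℕ.* i))))) (E-nat (i ℕ.* i) (- u))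

    W-pow : ∀ η i → W η u 0# i ≈ η ^ i * q ^ (i ℕ.* i) + η ^ suc i * q ^ (suc i ℕ.* suc i)
    W-pow η i = +-cong (*-cong refl (gauss-pow i (# i) refl)) (*-cong refl (gauss-pow (suc i) (- # suc i) (solve 1 (λ n → :- n :* :- n := n :* n) (# suc i))))

    θ₃-term : ℕ → F
    θ₃-term i = q ^ (i ℕ.* i) + q ^ (suc i ℕ.* suc i)

    θ₃-term-nn : ∀ i → 0# ≤ θ₃-term i
    θ₃-term-nn i = nn-+ (nn-^ (i ℕ.* i) nn-q) (nn-^ (suc i ℕ.* suc i) nn-q)

    θ₃-series : Series θ₃-term θ₃
    θ₃-series = Series-cong (λ i → trans (W-pow 1# i) (+-cong (trans (*-cong (1^ i) refl) (*-identityˡ _)) (trans (*-cong (1^ (suc i)) refl) (*-identityˡ _)))) (P-series unit-1 u>0 0#)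

    θ₄-term : ℕ → F
    θ₄-term i = sgn i * q ^ (i ℕ.* i) + sgn (suc i) * q ^ (suc i ℕ.* suc i)

    θ₄-series : Series θ₄-term θ₄
    θ₄-series = Series-cong (W-pow (- 1#)) (P-series unit-neg u>0 0#)

    θ₄-term-bound : ∀ i → Bnd (θ₃-term i) (θ₄-term i)
    θ₄-term-bound i = Bnd-resp (+-cong (*-identityˡ _) (*-identityˡ _)) refl (Bnd-+ (Bnd-* (Bnd-sgn i) (Bnd-refl (nn-^ (i ℕ.* i) nn-q))) (Bnd-* (Bnd-sgn (suc i)) (Bnd-refl (nn-^ (suc i ℕ.* suc i) nn-q))))

    module _ (q≤½ : q ≤ ½) where
      q≤1 : q ≤ 1#
      q≤1 = ≤-trans q≤½ (num≤ {mkℚᵘ (+ 1) 1} {1ℚᵘ})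

      pow-drop : ∀ m n → q ^ (suc n ℕ.+ m) ≤ ½ * q ^ m
      pow-drop m n = *-mono nn-q (nn-^ (n ℕ.+ m) nn-q) q≤½ (≤-trans (≈⇒≤ (^-+ q n m)) (≤-trans (*-monoʳ _ (nn-^ m nn-q) (x^≤1 n nn-q q≤1)) (≈⇒≤ (*-identityˡ _))))

      sq-drop : ∀ i → q ^ (suc i ℕ.* suc i) ≤ ½ * q ^ (i ℕ.* i)
      sq-drop i = ≡.subst (λ m → q ^ m ≤ ½ * q ^ (i ℕ.* i)) (≡.cong suc (≡.trans (ℕₚ.+-assoc i i (i ℕ.* i)) (≡.cong (i ℕ.+_) (≡.sym (ℕₚ.*-suc i i))))) (pow-drop (i ℕ.* i) (i ℕ.+ i))

      θ₃-term-drop : ∀ i → θ₃-term (suc i) ≤ ½ * θ₃-term i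
      θ₃-term-drop i = ≤-trans (+-mono-≤ (sq-drop i) (sq-drop (suc i))) (≈⇒≤ (sym (distribˡ _ _ _)))

      θ₃-tail : ∀ N → Bnd (# 2 * θ₃-term N) (θ₃ - sum θ₃-term N)
      θ₃-tail N = halving-tail N θ₃-term-nn θ₃-term-drop θ₃-series

      θ₄-tail : ∀ N → Bnd (# 2 * θ₃-term N) (θ₄ - sum θ₄-term N)
      θ₄-tail N = Bnd-mono (proj₂ (θ₃-tail N)) (Series-Bnd (Series-drop N θ₄-series) (Series-drop N θ₃-series) (λ i → θ₄-term-bound (N ℕ.+ i)))

      q¹⁶≤ : q ^ 16 ≤ ½ * q ^ 9
      q¹⁶≤ = pow-drop 9 6

      θ₃-upper : θ₃ ≤ 1# + # 2 * q + # 2 * q ^ 4 + # 4 * q ^ 9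
      θ₃-upper = ≤-trans (by-nn (nn-sub (proj₂ (θ₃-tail 3))) (solve 3 (λ t s b → s :+ b :- t := b :- (t :- s)) θ₃ (sum θ₃-term 3) (# 2 * θ₃-term 3)))
        (by-nn (nn-* num≤ (nn-sub q¹⁶≤)) (solve 1 (λ q → k 1 :+ k 2 :* q :+ k 2 :* q :^ 4 :+ k 4 :* q :^ 9 :- ((k 0 :+ (q :^ 0 :+ q :^ 1) :+ (q :^ 1 :+ q :^ 4) :+ (q :^ 4 :+ q :^ 9)) :+ k 2 :* (q :^ 9 :+ q :^ 16)) := k 2 :* (:½ :* q :^ 9 :- q :^ 16)) q))

      θ₄-lower : 1# - # 2 * q ≤ θ₄
      θ₄-lower = ≤-trans (by-nn (nn-+ (nn-+ (nn-* num≤ (nn-sub q¹⁶≤)) (nn-* (nn-# 4) (nn-sub q⁹≤))) (nn-* (nn-# 0) (nn-^ 4 nn-q)))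
          (solve 1 (λ q → (k 0 :+ (k 1 :* q :^ 0 :+ :- k 1 :* k 1 :* q :^ 1) :+ (:- k 1 :* k 1 :* q :^ 1 :+ :- k 1 :* (:- k 1 :* k 1) :* q :^ 4) :+ (:- k 1 :* (:- k 1 :* k 1) :* q :^ 4 :+ :- k 1 :* (:- k 1 :* (:- k 1 :* k 1)) :* q :^ 9)) :- k 2 :* (q :^ 9 :+ q :^ 16) :- (k 1 :- k 2 :* q)
            := k 2 :* (:½ :* q :^ 9 :- q :^ 16) :+ k 4 :* (:½ :* q :^ 4 :- q :^ 9) :+ k 0 :* q :^ 4) q))
        (by-nn (nn-sub (proj₁ (θ₄-tail 3))) (solve 3 (λ t s b → t :- (s :- b) := t :- s :- :- b) θ₄ (sum θ₄-term 3) (# 2 * θ₃-term 3)))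
        where
        q⁹≤ : q ^ 9 ≤ ½ * q ^ 4
        q⁹≤ = pow-drop 4 4

    χ-term : ℕ → F
    χ-term i = q ^ (i ℕ.* suc i)

    χ-series : Series χ-term χ₂
    χ-series = Series-cong (λ i → trans (*-cong refl (trans (+-cong (trans (*-cong (1^ i) refl) (*-identityˡ _)) (trans (*-cong (1^ (suc i)) refl) (*-identityˡ _))) (trans (+-cong (piece i (# i + ½) (solve 1 (λ i → (i :+ :½) :* (i :+ :½) := i :* (i :+ k 1) :+ q₄) (# i)))
          (piece i (- # suc i + ½) (trans (*-cong (+-cong (-‿cong (#-suc i)) refl) (+-cong (-‿cong (#-suc i)) refl)) (solve 1 (λ i → (:- (i :+ k 1) :+ :½) :* (:- (i :+ k 1) :+ :½) := i :* (i :+ k 1) :+ q₄) (# i))))) refl)))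
        (trans (solve 3 (λ e x t → :½ :* e :* (x :* t :+ x :* t) := (e :* x) :* t) (E (ι (mkℚᵘ (+ 1) 3) * u)) (E (- (ι (mkℚᵘ (+ 1) 3) * u))) (χ-term i)) (trans (*-cong (E-neg _) refl) (*-identityˡ _))))
      (Series-*ˡ (½ * E (ι (mkℚᵘ (+ 1) 3) * u)) (P-series unit-1 u>0 ½))
      where
      q₄ : ∀ {n} → Expr n
      q₄ = con (mkℚᵘ (+ 1) 3)
      piece : ∀ i a → a * a ≈ # i * (# i + 1#) + ι (mkℚᵘ (+ 1) 3) → gauss u a ≈ E (- (ι (mkℚᵘ (+ 1) 3) * u)) * χ-term i
      piece i a e = trans (E-cong (trans (-‿cong (*-cong refl (trans e (+-cong (trans (*-cong refl (sym (#-suc i))) (sym (#-* i (suc i)))) refl)))) (solve 2 (λ u n → :- (u :* (n :+ q₄)) := :- (q₄ :* u) :+ n :* :- u) u (# (i ℕ.* suc i)))))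
        (trans (E-+ _ _) (*-cong refl (E-nat (i ℕ.* suc i) (- u))))

    θ₂⁴ : θ₂ ^ 4 ≈ # 16 * q * χ₂ ^ 4
    θ₂⁴ = sym (begin
      # 16 * q * χ₂ ^ 4
        ≈⟨ solve 3 (λ q e t → k 16 :* q :* (:½ :* e :* t) :^ 4 := (q :* e :^ 4) :* t :^ 4) q (E (ι (mkℚᵘ (+ 1) 3) * u)) θ₂ ⟩
      (q * E (ι (mkℚᵘ (+ 1) 3) * u) ^ 4) * θ₂ ^ 4
        ≈⟨ *-cong (trans (*-cong refl (trans (sym (E-nat 4 _)) (E-cong (solve 1 (λ u → k 4 :* (con (mkℚᵘ (+ 1) 3) :* u) := u) u)))) (trans (*-comm _ _) (E-neg u))) refl ⟩
      1# * θ₂ ^ 4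
        ≈⟨ *-identityˡ _ ⟩
      θ₂ ^ 4 ∎)

    θ₂>0 : 0# < θ₂
    θ₂>0 = pos-cancel {½ * E (ι (mkℚᵘ (+ 1) 3) * u)} (*-pos num< (E-pos _)) (<-≤-trans (num< {0ℚᵘ} {1ℚᵘ}) (≤-trans (≈⇒≤ (solve 0 (k 1 := k 0 :+ k 1))) (≤-Series (λ i → nn-^ (i ℕ.* suc i) nn-q) χ-series 1)))

    θ₃≥1 : 1# ≤ θ₃
    θ₃≥1 = ≤-trans (by-nn nn-q (solve 1 (λ q → k 0 :+ (q :^ 0 :+ q :^ 1) :- k 1 := q) q)) (≤-Series θ₃-term-nn θ₃-series 1)

  module Doubling (u : F) (u>0 : 0# < u) where
    2u>0 : 0# < # 2 * u
    2u>0 = *-pos num< u>0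

    private
      module T = Thetas u u>0
      module D = Thetas (# 2 * u) 2u>0

      at-½ : P unit-1 2u>0 (0# + ½) ≈ D.θ₂
      at-½ = P-cong unit-1 2u>0 (+-identityˡ ½)

      at-1 : P unit-1 2u>0 (½ + ½) ≈ D.θ₃
      at-1 = trans (P-cong unit-1 2u>0 (solve 0 (:½ :+ :½ := k 0 :+ k 1))) (trans (P-suc unit-1 2u>0 0#) (*-identityˡ _))

    θ₃² : T.θ₃ * T.θ₃ ≈ D.θ₃ * D.θ₃ + D.θ₂ * D.θ₂
    θ₃² = trans (Landen.landen unit-1 u>0 0#) (+-cong refl (*-cong (trans (*-identityˡ _) at-½) refl))

    θ₄² : T.θ₄ * T.θ₄ ≈ D.θ₃ * D.θ₃ - D.θ₂ * D.θ₂
    θ₄² = trans (Landen.landen unit-neg u>0 0#) (+-cong refl (trans (*-cong (*-cong refl at-½) refl) (solve 1 (λ x → :- k 1 :* x :* x := :- (x :* x)) D.θ₂)))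

    θ₂² : T.θ₂ * T.θ₂ ≈ # 2 * D.θ₂ * D.θ₃
    θ₂² = trans (Landen.landen unit-1 u>0 ½) (trans (+-cong refl (*-cong (trans (*-identityˡ _) at-1) refl)) (solve 2 (λ a b → a :* b :+ b :* a := k 2 :* a :* b) D.θ₂ D.θ₃))

    -- With a and b the squares of θ₃ and θ₂ at 2u, duplication turns the three fourth powers into
    -- 4ab, (a - b)² and (a + b)².
    jacobi : T.θ₂ ^ 4 + T.θ₄ ^ 4 ≈ T.θ₃ ^ 4
    jacobi = begin
      T.θ₂ ^ 4 + T.θ₄ ^ 4
        ≈⟨ solve 2 (λ a b → a :^ 4 :+ b :^ 4 := (a :* a) :* (a :* a) :+ (b :* b) :* (b :* b)) T.θ₂ T.θ₄ ⟩
      (T.θ₂ * T.θ₂) * (T.θ₂ * T.θ₂) + (T.θ₄ * T.θ₄) * (T.θ₄ * T.θ₄)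
        ≈⟨ +-cong (*-cong θ₂² θ₂²) (*-cong θ₄² θ₄²) ⟩
      (# 2 * D.θ₂ * D.θ₃) * (# 2 * D.θ₂ * D.θ₃) + (D.θ₃ * D.θ₃ - D.θ₂ * D.θ₂) * (D.θ₃ * D.θ₃ - D.θ₂ * D.θ₂)
        ≈⟨ solve 2 (λ a b → (k 2 :* b :* a) :* (k 2 :* b :* a) :+ (a :* a :- b :* b) :* (a :* a :- b :* b) := (a :* a :+ b :* b) :* (a :* a :+ b :* b)) D.θ₃ D.θ₂ ⟩
      (D.θ₃ * D.θ₃ + D.θ₂ * D.θ₂) * (D.θ₃ * D.θ₃ + D.θ₂ * D.θ₂)
        ≈⟨ *-cong (sym θ₃²) (sym θ₃²) ⟩
      (T.θ₃ * T.θ₃) * (T.θ₃ * T.θ₃)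
        ≈⟨ solve 1 (λ a → (a :* a) :* (a :* a) := a :^ 4) T.θ₃ ⟩
      T.θ₃ ^ 4 ∎

  abstract
    jacobi : ∀ u u>0 → let open Thetas u u>0 in θ₂ ^ 4 + θ₄ ^ 4 ≈ θ₃ ^ 4
    jacobi u u>0 = Doubling.jacobi u u>0

  module _ (u : F) (u>0 : 0# < u) where
    private
      module T = Thetas u u>0
      module D = Thetas (# 2 * u) (Doubling.2u>0 u u>0)

      abs≤ : ∀ {a b} → 0# ≤ a → 0# ≤ b → a ^ 4 ≤ b ^ 4 → a * a ≤ b * b
      abs≤ {a} {b} p r h = proj₂ (sq-bound (nn-² b) (≤-trans (≈⇒≤ (solve 1 (λ a → a :* a :* (a :* a) := a :^ 4) a)) (≤-trans h (≈⇒≤ (solve 1 (λ a → a :^ 4 := a :* a :* (a :* a)) b)))))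

      θ₂²≤θ₃² : D.θ₂ * D.θ₂ ≤ D.θ₃ * D.θ₃
      θ₂²≤θ₃² = abs≤ (<⇒≤ D.θ₂>0) (≤-trans num≤ D.θ₃≥1) (≤-trans (by-nn (nn-² (D.θ₄ * D.θ₄)) (solve 2 (λ a b → a :+ b :^ 4 :- a := b :* b :* (b :* b)) (D.θ₂ ^ 4) D.θ₄)) (≈⇒≤ (jacobi (# 2 * u) (Doubling.2u>0 u u>0))))

    θ₃⁴-double : T.θ₃ ^ 4 ≤ # 4 * D.θ₃ ^ 4
    θ₃⁴-double = ≤-trans (≈⇒≤ (trans (solve 1 (λ a → a :^ 4 := (a :* a) :* (a :* a)) T.θ₃) (*-cong (Doubling.θ₃² u u>0) (Doubling.θ₃² u u>0))))
      (≤-trans (*-mono nn nn le le) (≈⇒≤ (solve 1 (λ a → k 2 :* (a :* a) :* (k 2 :* (a :* a)) := k 4 :* a :^ 4) D.θ₃)))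
      where
      nn : 0# ≤ D.θ₃ * D.θ₃ + D.θ₂ * D.θ₂
      nn = nn-+ (nn-² _) (nn-² _)
      le : D.θ₃ * D.θ₃ + D.θ₂ * D.θ₂ ≤ # 2 * (D.θ₃ * D.θ₃)
      le = by-nn (nn-sub θ₂²≤θ₃²) (solve 2 (λ a b → k 2 :* a :- (a :+ b) := a :- b) (D.θ₃ * D.θ₃) (D.θ₂ * D.θ₂))

    θ₃θ₄-double : (T.θ₃ * T.θ₃) * (T.θ₄ * T.θ₄) ≈ D.θ₄ ^ 4
    θ₃θ₄-double = trans (*-cong (Doubling.θ₃² u u>0) (Doubling.θ₄² u u>0)) (trans (solve 2 (λ a b → (a :* a :+ b :* b) :* (a :* a :- b :* b) := a :^ 4 :- b :^ 4) D.θ₃ D.θ₂)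
      (trans (+-cong (sym (jacobi (# 2 * u) (Doubling.2u>0 u u>0))) refl) (solve 2 (λ a b → a :+ b :- a := b) (D.θ₂ ^ 4) (D.θ₄ ^ 4))))

-- Lower bounds for ψ_I when πt ≤ 3.002.

module BelowThree (R : RealField) where

  open ThetaBounds R public
  open import Relation.Binary.Reasoning.Setoid setoid

  value : Expr 0 → ℚᵘ
  valuePow : Expr 0 → ℕ → ℚᵘ
  value (con c)  = c
  value (a :+ b) = value a ℚᵘ.+ value b
  value (a :* b) = value a ℚᵘ.* value b
  value (:- a)   = ℚᵘ.- value a
  value (a :^ n) = valuePow a n
  valuePow a zero    = 1ℚᵘ
  valuePow a (suc n) = value a ℚᵘ.* valuePow a n

  value-sound : ∀ e → ι (value e) ≈ ⟦ e ⟧ []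
  valuePow-sound : ∀ e n → ι (valuePow e n) ≈ ⟦ e ⟧ [] ^ n
  value-sound (con c)  = refl
  value-sound (a :+ b) = trans (ι-+ _ _) (+-cong (value-sound a) (value-sound b))
  value-sound (a :* b) = trans (ι-* _ _) (*-cong (value-sound a) (value-sound b))
  value-sound (:- a)   = trans (ι-neg _) (-‿cong (value-sound a))
  value-sound (a :^ n) = valuePow-sound a n
  valuePow-sound a zero    = refl
  valuePow-sound a (suc n) = trans (ι-* _ _) (*-cong (value-sound a) (valuePow-sound a n))

  numeric : ∀ (a b : Expr 0) {_ : True (value a ℚᵘₚ.≤? value b)} → ⟦ a ⟧ [] ≤ ⟦ b ⟧ []
  numeric a b {t} = ≤-resp (value-sound a) (value-sound b) (ι-≤ (toWitness t))

  :E₅ : ∀ {n} → Expr n → Expr n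
  :E₅ r = k 0 :+ k 1 :+ t₁ :+ t₂ :+ t₃ :+ t₄
    where
    t₁ = k 1 :* (r :* con (mkℚᵘ (+ 1) 0))
    t₂ = t₁ :* (r :* con (mkℚᵘ (+ 1) 1))
    t₃ = t₂ :* (r :* con (mkℚᵘ (+ 1) 2))
    t₄ = t₃ :* (r :* con (mkℚᵘ (+ 1) 3))

  E≥pow : ∀ m n d {x} → # m * ι (mkℚᵘ (+ n) d) ≤ x → ⟦ :E₅ (con (mkℚᵘ (+ n) d)) :^ m ⟧ [] ≤ E x
  E≥pow m n d h = ≤-trans (^-mono m (nn-sum 5 (λ i → eterm-nn i (nn-ι n d))) (E≥sum 5 (nn-ι n d))) (≤-trans (≈⇒≤ (sym (E-nat m (ι (mkℚᵘ (+ n) d))))) (E-mono h))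

  -- Bounds eˣ from below by the m-th power of five Taylor terms of eʳ, with r = n/(d + 1) and mr ≤
  -- x. A larger m keeps r small and the truncation harmless.
  E-upper : ∀ m n d a b {_ : True (1ℚᵘ ℚᵘₚ.≤? value (con (mkℚᵘ (+ a) b) :* :E₅ (con (mkℚᵘ (+ n) d)) :^ m))} →
    ∀ {x} → # m * ι (mkℚᵘ (+ n) d) ≤ x → E (- x) ≤ ι (mkℚᵘ (+ a) b)
  E-upper m n d a b {t} {x} h = ≤-trans (≤-trans (≈⇒≤ (sym (*-identityˡ _))) (*-monoʳ _ (nn-E (- x)) (≤-trans (numeric (k 1) (con (mkℚᵘ (+ a) b) :* :E₅ (con (mkℚᵘ (+ n) d)) :^ m) {t}) (*-monoˡ _ (nn-ι a b) (E≥pow m n d h)))))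
    (≈⇒≤ (trans (*-assoc _ _ _) (trans (*-cong refl (E-neg x)) (*-identityʳ _))))

  17/5 197/10 173/10 : F
  17/5   = ι (mkℚᵘ (+ 17) 4)
  197/10 = ι (mkℚᵘ (+ 197) 9)
  173/10 = ι (mkℚᵘ (+ 173) 9)

  module Region (x : F) (x>0 : 0# < x) where
    open Thetas x x>0 public

    ix : F
    ix = inv x x>0

    κ : F
    κ = E (- (17/5 * ix))

    T₂ T₄ T₃ : F
    T₂ = θ₂ ^ 4
    T₄ = θ₄ ^ 4
    T₃ = θ₃ ^ 4

    T₂+T₄≈T₃ : T₂ + T₄ ≈ T₃
    T₂+T₄≈T₃ = jacobi x x>0

    nn-T₂ : 0# ≤ T₂
    nn-T₂ = nn-^ 4 (<⇒≤ θ₂>0)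

    nn-T₄ : 0# ≤ T₄
    nn-T₄ = ≤-trans (nn-² (θ₄ * θ₄)) (≈⇒≤ (solve 1 (λ a → a :* a :* (a :* a) := a :^ 4) θ₄))

    T₃>0 : 0# < T₃
    T₃>0 = pos-^ 4 (<-≤-trans (num< {0ℚᵘ} {1ℚᵘ}) θ₃≥1)

    -- This is θ₂⁸θ₃⁸ψ_I/128 after θ₃⁴ has been eliminated by Jacobi's identity; in this form it is
    -- visibly positive.
    rhs : F
    rhs = T₄ * (# 5 * T₂ ^ 2 + # 5 * T₂ * T₄ + # 2 * T₄ ^ 2)

    div-bound : ∀ {c r b} → 0# ≤ r → x ≤ b → r * b ≤ c → r ≤ c * ix
    div-bound {c} {r} {b} r≥0 x≤b h = cancel-≤ x>0 (≤-trans (≈⇒≤ (*-comm x r)) (≤-trans (*-monoˡ r r≥0 x≤b) (≤-trans h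
      (≈⇒≤ (sym (trans (solve 3 (λ x c i → x :* (c :* i) := c :* (x :* i)) x c ix) (trans (*-cong refl (inv-r x x>0)) (*-identityʳ c))))))))

    -- `P₁` and `P₂` are chosen to pass from 2x to x, and so reach every small x. `P₃` is the bound
    -- on ψ_I that is wanted, cleared of denominators; its constant is 594594/36, slightly above the
    -- 594000/36 that `φ-bound` leads to.
    P₁ P₂ P₃ : Set
    P₁ = # 4 * (κ * κ) * (θ₃ * θ₃) ≤ θ₄ * θ₄
    P₂ = x * x * T₃ ≤ 173/10
    P₃ = ι (mkℚᵘ (+ 33033) 1) * (x * x * E (- (197/10 * ix))) * (T₂ ^ 2 * T₃ ^ 2) ≤ # 128 * rhs

    -- With r = T₄/T₃ the quotient rhs/(T₃T₂²) is (5r - 5r² + 2r³)/(1 - r)², whose power series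
    -- starts 5r + 5r² + 7r³ + 9r⁴. The remainder, multiplied out, is T₄⁵(11T₂ + 2T₄).
    rhs-lower : ∀ μ → 0# ≤ μ → μ * T₃ ≤ T₄ → (# 5 * μ + # 5 * μ ^ 2 + # 7 * μ ^ 3 + # 9 * μ ^ 4) * T₃ * T₂ ^ 2 ≤ rhs
    rhs-lower μ μ≥0 h = cancel-≤ {z = T₃ ^ 3} (pos-^ 3 T₃>0) (≤-trans
        (≤-trans (≈⇒≤ (solve 3 (λ m w x → w :^ 3 :* ((k 5 :* m :+ k 5 :* m :^ 2 :+ k 7 :* m :^ 3 :+ k 9 :* m :^ 4) :* w :* x) := (k 5 :* (m :* w) :* w :^ 3 :+ k 5 :* (m :* w) :^ 2 :* w :^ 2 :+ k 7 :* (m :* w) :^ 3 :* w :+ k 9 :* (m :* w) :^ 4) :* x) μ T₃ (T₂ ^ 2)))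
          (*-monoʳ (T₂ ^ 2) (nn-^ 2 nn-T₂) (+-mono-≤ (+-mono-≤ (+-mono-≤ (*-monoʳ _ (nn-^ 3 nn-T₃) (*-monoˡ (# 5) num≤ h)) (*-monoʳ _ (nn-^ 2 nn-T₃) (*-monoˡ (# 5) num≤ (^-mono 2 nn-μW h)))) (*-monoʳ _ nn-T₃ (*-monoˡ (# 7) num≤ (^-mono 3 nn-μW h)))) (*-monoˡ (# 9) num≤ (^-mono 4 nn-μW h)))))
        (≤-trans (≈⇒≤ (*-cong (+-cong (+-cong (+-cong (*-cong refl (^-cong 3 (sym T₂+T₄≈T₃))) (*-cong refl (^-cong 2 (sym T₂+T₄≈T₃)))) (*-cong refl (sym T₂+T₄≈T₃))) refl) refl))
          (≤-trans (by-nn (nn-* (nn-^ 5 nn-T₄) (nn-+ (nn-* (nn-# 11) nn-T₂) (nn-* (nn-# 2) nn-T₄)))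
            (solve 2 (λ x y → (x :+ y) :^ 3 :* (y :* (k 5 :* x :^ 2 :+ k 5 :* x :* y :+ k 2 :* y :^ 2)) :- (k 5 :* y :* (x :+ y) :^ 3 :+ k 5 :* y :^ 2 :* (x :+ y) :^ 2 :+ k 7 :* y :^ 3 :* (x :+ y) :+ k 9 :* y :^ 4) :* x :^ 2 := y :^ 5 :* (k 11 :* x :+ k 2 :* y)) T₂ T₄))
            (≈⇒≤ (*-cong (^-cong 3 T₂+T₄≈T₃) refl)))))
      where
      nn-T₃ = <⇒≤ T₃>0
      nn-μW : 0# ≤ μ * T₃
      nn-μW = nn-* μ≥0 nn-T₃

    module Row (a b q₀ w₀ U μ k₀ ρ₀ : ℚᵘ)
      (q₀≥0 : 0# ≤ ι q₀) (w₀≥0 : 0# ≤ ι w₀) (U≥0 : 0# ≤ ι U) (μ≥0 : 0# ≤ ι μ) (ρ₀≥0 : 0# ≤ ι ρ₀) (q₀≤½ : ι q₀ ≤ ½)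
      (Eq : E (- ι a) ≤ ι q₀) (Ek : κ ≤ ι k₀) (Eρ : E (- (197/10 * ix)) ≤ ι ρ₀)
      (w-ok : ι w₀ ≤ 1# - # 2 * ι q₀) (U-ok : 1# + # 2 * ι q₀ + # 2 * ι q₀ ^ 4 + # 4 * ι q₀ ^ 9 ≤ ι U) (μ-ok : ι μ * ι U ^ 4 ≤ ι w₀ ^ 4)
      (ok₁ : # 2 * ι k₀ * ι U ≤ ι w₀) (ok₂ : ι b * ι b * ι U ^ 4 ≤ 173/10)
      (ok₃ : ι (mkℚᵘ (+ 33033) 1) * (ι b * ι b * ι ρ₀) * ι U ^ 4 ≤ # 128 * (# 5 * ι μ + # 5 * ι μ ^ 2 + # 7 * ι μ ^ 3 + # 9 * ι μ ^ 4))
      (a≤x : ι a ≤ x) (x≤b : x ≤ ι b) where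

      private
        nn-x = <⇒≤ x>0
        q≤ : q ≤ ι q₀
        q≤ = ≤-trans (E-mono (neg-mono a≤x)) Eq
        q≤½ = ≤-trans q≤ q₀≤½
        θ₃≤ : θ₃ ≤ ι U
        θ₃≤ = ≤-trans (θ₃-upper q≤½) (≤-trans (+-mono-≤ (+-mono-≤ (+-mono-≤ ≤-refl (*-monoˡ (# 2) num≤ q≤)) (*-monoˡ (# 2) num≤ (^-mono 4 nn-q q≤))) (*-monoˡ (# 4) num≤ (^-mono 9 nn-q q≤))) U-ok)
        w≤θ₄ : ι w₀ ≤ θ₄
        w≤θ₄ = ≤-trans w-ok (≤-trans (+-mono-≤ ≤-refl (neg-mono (*-monoˡ (# 2) num≤ q≤))) (θ₄-lower q≤½))
        nn-θ₃ : 0# ≤ θ₃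
        nn-θ₃ = ≤-trans num≤ θ₃≥1
        T₃≤ : T₃ ≤ ι U ^ 4
        T₃≤ = ^-mono 4 nn-θ₃ θ₃≤
        μ≤ : ι μ * T₃ ≤ T₄
        μ≤ = ≤-trans (*-monoˡ (ι μ) μ≥0 T₃≤) (≤-trans μ-ok (^-mono 4 w₀≥0 w≤θ₄))
        κ≤ : κ ≤ ι k₀
        κ≤ = Ek

      row₁ : P₁
      row₁ = ≤-trans (≈⇒≤ (solve 2 (λ c t → k 4 :* (c :* c) :* (t :* t) := k 2 :* c :* t :* (k 2 :* c :* t)) κ θ₃)) (*-mono nn nn le le)
        where
        nn : 0# ≤ # 2 * κ * θ₃
        nn = nn-* (nn-* num≤ (nn-E _)) nn-θ₃
        le : # 2 * κ * θ₃ ≤ θ₄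
        le = ≤-trans (*-mono (nn-* num≤ (nn-E _)) nn-θ₃ (*-monoˡ (# 2) num≤ κ≤) θ₃≤) (≤-trans ok₁ w≤θ₄)

      row₂ : P₂
      row₂ = ≤-trans (*-mono (nn-² x) (<⇒≤ T₃>0) (*-mono nn-x nn-x x≤b x≤b) T₃≤) ok₂

      row₃ : P₃
      row₃ = ≤-trans (≈⇒≤ (solve 3 (λ c t w → c :* (t :* w :^ 2) := c :* w :* (w :* t)) (ι (mkℚᵘ (+ 33033) 1) * (x * x * E (- (197/10 * ix)))) (T₂ ^ 2) T₃))
        (≤-trans (*-monoʳ (T₃ * T₂ ^ 2) (nn-* (<⇒≤ T₃>0) (nn-^ 2 nn-T₂)) (≤-trans (*-mono (nn-* num≤ (nn-* (nn-² x) (nn-E _))) (<⇒≤ T₃>0) (*-monoˡ _ num≤ (*-mono (nn-² x) (nn-E _) (*-mono nn-x nn-x x≤b x≤b) Eρ)) T₃≤) ok₃))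
          (≤-trans (≈⇒≤ (trans (*-assoc _ _ _) (*-cong refl (sym (*-assoc _ T₃ (T₂ ^ 2)))))) (*-monoˡ (# 128) num≤ (rhs-lower (ι μ) μ≥0 μ≤))))

    -- The doubling estimates suffice below 3/2.
    small-x : P₁ → P₂ → x ≤ ι (mkℚᵘ (+ 1501) 999) → P₃
    small-x p₁ p₂ x≤ = ≤-trans (≈⇒≤ (solve 5 (λ x c t w e → c :* (x :* x :* e) :* (t :* w :^ 2) := c :* (x :* x :* w) :* e :* (w :* t)) x (ι (mkℚᵘ (+ 33033) 1)) (T₂ ^ 2) T₃ (E (- (197/10 * ix)))))
      (≤-trans (*-monoʳ (T₃ * T₂ ^ 2) nn-WX (*-mono (nn-* num≤ (nn-* (nn-² x) (<⇒≤ T₃>0))) (nn-E _) (*-monoˡ _ num≤ p₂) e≤))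
        (≤-trans (*-monoʳ (T₃ * T₂ ^ 2) nn-WX (≤-trans (≈⇒≤ (sym (*-assoc _ _ _))) (≤-trans (*-monoʳ (κ ^ 4) (nn-^ 4 (nn-E _)) (numeric (con (mkℚᵘ (+ 33033) 1) :* con (mkℚᵘ (+ 173) 9) :* con (mkℚᵘ (+ 1) 29)) (k 10240))) ≤-refl)))
          (≤-trans (≈⇒≤ (solve 3 (λ c w t → k 10240 :* c :^ 4 :* (w :* t) := k 640 :* (k 16 :* c :^ 4 :* w) :* t) κ T₃ (T₂ ^ 2)))
            (≤-trans (*-monoʳ (T₂ ^ 2) (nn-^ 2 nn-T₂) (*-monoˡ (# 640) num≤ y≥))
              (by-nn (nn-* (nn-* (nn-# 128) nn-T₄) (nn-+ (nn-* (nn-* (nn-# 5) nn-T₂) nn-T₄) (nn-* (nn-# 2) (nn-^ 2 nn-T₄))))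
                (solve 2 (λ x y → k 128 :* (y :* (k 5 :* x :^ 2 :+ k 5 :* x :* y :+ k 2 :* y :^ 2)) :- k 640 :* y :* x :^ 2 := k 128 :* y :* (k 5 :* x :* y :+ k 2 :* y :^ 2)) T₂ T₄))))))
      where
      nn-WX : 0# ≤ T₃ * T₂ ^ 2
      nn-WX = nn-* (<⇒≤ T₃>0) (nn-^ 2 nn-T₂)
      y≥ : # 16 * κ ^ 4 * T₃ ≤ T₄
      y≥ = ≤-trans (≈⇒≤ (solve 2 (λ c t → k 16 :* c :^ 4 :* t :^ 4 := k 4 :* (c :* c) :* (t :* t) :* (k 4 :* (c :* c) :* (t :* t))) κ θ₃))
        (≤-trans (*-mono nn nn p₁ p₁) (≈⇒≤ (solve 1 (λ a → a :* a :* (a :* a) := a :^ 4) θ₄)))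
        where
        nn : 0# ≤ # 4 * (κ * κ) * (θ₃ * θ₃)
        nn = nn-* (nn-* num≤ (nn-² κ)) (nn-² θ₃)
      e≤ : E (- (197/10 * ix)) ≤ ι (mkℚᵘ (+ 1) 29) * κ ^ 4
      e≤ = ≤-trans (≈⇒≤ (trans (E-cong (solve 1 (λ i → :- (con (mkℚᵘ (+ 197) 9) :* i) := :- (con (mkℚᵘ (+ 61) 9) :* i) :+ k 4 :* :- (con (mkℚᵘ (+ 17) 4) :* i)) ix)) (trans (E-+ _ _) (*-cong refl (E-nat 4 _)))))
        (*-monoʳ (κ ^ 4) (nn-^ 4 (nn-E _)) (E-upper 8 5079 9999 1 29 over-x))
        where
        over-x : # 8 * ι (mkℚᵘ (+ 5079) 9999) ≤ ι (mkℚᵘ (+ 61) 9) * ix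
        over-x = div-bound (nn-* num≤ num≤) x≤ (numeric (k 8 :* con (mkℚᵘ (+ 5079) 9999) :* con (mkℚᵘ (+ 1501) 999)) (con (mkℚᵘ (+ 61) 9)))

  row-1 : ∀ x (p : 0# < x) → ι (mkℚᵘ (+ 1501) 999) ≤ x → x ≤ ι (mkℚᵘ (+ 1960) 999) → let open Region x p in P₁ × P₂ × P₃
  row-1 x p l u = row₁ , row₂ , row₃
    where
    open Region x p
    open Row (mkℚᵘ (+ 1501) 999) (mkℚᵘ (+ 1960) 999) (mkℚᵘ (+ 2232) 9999) (mkℚᵘ (+ 5536) 9999)
      (mkℚᵘ (+ 14516) 9999) (mkℚᵘ (+ 210) 9999) (mkℚᵘ (+ 178) 999) (mkℚᵘ (+ 44) 999999)
      num≤ num≤ num≤ num≤ num≤ num≤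
      (E-upper 8 1876 9999 2232 9999 (numeric (k 8 :* con (mkℚᵘ (+ 1876) 9999)) (con (mkℚᵘ (+ 1501) 999))))
      (E-upper 8 2168 9999 178 999 (div-bound (nn-* num≤ num≤) u (numeric (k 8 :* con (mkℚᵘ (+ 2168) 9999) :* con (mkℚᵘ (+ 1960) 999)) (con (mkℚᵘ (+ 17) 4)))))
      (E-upper 24 4187 9999 44 999999 (div-bound (nn-* num≤ num≤) u (numeric (k 24 :* con (mkℚᵘ (+ 4187) 9999) :* con (mkℚᵘ (+ 1960) 999)) (con (mkℚᵘ (+ 197) 9)))))
      (numeric (con (mkℚᵘ (+ 5536) 9999)) (k 1 :- k 2 :* con (mkℚᵘ (+ 2232) 9999)))
      (numeric (k 1 :+ k 2 :* con (mkℚᵘ (+ 2232) 9999) :+ k 2 :* con (mkℚᵘ (+ 2232) 9999) :^ 4 :+ k 4 :* con (mkℚᵘ (+ 2232) 9999) :^ 9) (con (mkℚᵘ (+ 14516) 9999)))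
      (numeric (con (mkℚᵘ (+ 210) 9999) :* con (mkℚᵘ (+ 14516) 9999) :^ 4) (con (mkℚᵘ (+ 5536) 9999) :^ 4))
      (numeric (k 2 :* con (mkℚᵘ (+ 178) 999) :* con (mkℚᵘ (+ 14516) 9999)) (con (mkℚᵘ (+ 5536) 9999)))
      (numeric (con (mkℚᵘ (+ 1960) 999) :* con (mkℚᵘ (+ 1960) 999) :* con (mkℚᵘ (+ 14516) 9999) :^ 4) (con (mkℚᵘ (+ 173) 9)))
      (numeric (con (mkℚᵘ (+ 33033) 1) :* (con (mkℚᵘ (+ 1960) 999) :* con (mkℚᵘ (+ 1960) 999) :* con (mkℚᵘ (+ 44) 999999)) :* con (mkℚᵘ (+ 14516) 9999) :^ 4)
        (k 128 :* (k 5 :* con (mkℚᵘ (+ 210) 9999) :+ k 5 :* con (mkℚᵘ (+ 210) 9999) :^ 2 :+ k 7 :* con (mkℚᵘ (+ 210) 9999) :^ 3 :+ k 9 :* con (mkℚᵘ (+ 210) 9999) :^ 4)))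
      l u

  row-2 : ∀ x (p : 0# < x) → ι (mkℚᵘ (+ 1960) 999) ≤ x → x ≤ ι (mkℚᵘ (+ 2385) 999) → let open Region x p in P₁ × P₂ × P₃
  row-2 x p l u = row₁ , row₂ , row₃
    where
    open Region x p
    open Row (mkℚᵘ (+ 1960) 999) (mkℚᵘ (+ 2385) 999) (mkℚᵘ (+ 1410) 9999) (mkℚᵘ (+ 7180) 9999)
      (mkℚᵘ (+ 12830) 9999) (mkℚᵘ (+ 980) 9999) (mkℚᵘ (+ 242) 999) (mkℚᵘ (+ 260) 999999)
      num≤ num≤ num≤ num≤ num≤ num≤
      (E-upper 8 2450 9999 1410 9999 (numeric (k 8 :* con (mkℚᵘ (+ 2450) 9999)) (con (mkℚᵘ (+ 1960) 999))))
      (E-upper 8 1781 9999 242 999 (div-bound (nn-* num≤ num≤) u (numeric (k 8 :* con (mkℚᵘ (+ 1781) 9999) :* con (mkℚᵘ (+ 2385) 999)) (con (mkℚᵘ (+ 17) 4)))))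
      (E-upper 24 3441 9999 260 999999 (div-bound (nn-* num≤ num≤) u (numeric (k 24 :* con (mkℚᵘ (+ 3441) 9999) :* con (mkℚᵘ (+ 2385) 999)) (con (mkℚᵘ (+ 197) 9)))))
      (numeric (con (mkℚᵘ (+ 7180) 9999)) (k 1 :- k 2 :* con (mkℚᵘ (+ 1410) 9999)))
      (numeric (k 1 :+ k 2 :* con (mkℚᵘ (+ 1410) 9999) :+ k 2 :* con (mkℚᵘ (+ 1410) 9999) :^ 4 :+ k 4 :* con (mkℚᵘ (+ 1410) 9999) :^ 9) (con (mkℚᵘ (+ 12830) 9999)))
      (numeric (con (mkℚᵘ (+ 980) 9999) :* con (mkℚᵘ (+ 12830) 9999) :^ 4) (con (mkℚᵘ (+ 7180) 9999) :^ 4))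
      (numeric (k 2 :* con (mkℚᵘ (+ 242) 999) :* con (mkℚᵘ (+ 12830) 9999)) (con (mkℚᵘ (+ 7180) 9999)))
      (numeric (con (mkℚᵘ (+ 2385) 999) :* con (mkℚᵘ (+ 2385) 999) :* con (mkℚᵘ (+ 12830) 9999) :^ 4) (con (mkℚᵘ (+ 173) 9)))
      (numeric (con (mkℚᵘ (+ 33033) 1) :* (con (mkℚᵘ (+ 2385) 999) :* con (mkℚᵘ (+ 2385) 999) :* con (mkℚᵘ (+ 260) 999999)) :* con (mkℚᵘ (+ 12830) 9999) :^ 4)
        (k 128 :* (k 5 :* con (mkℚᵘ (+ 980) 9999) :+ k 5 :* con (mkℚᵘ (+ 980) 9999) :^ 2 :+ k 7 :* con (mkℚᵘ (+ 980) 9999) :^ 3 :+ k 9 :* con (mkℚᵘ (+ 980) 9999) :^ 4)))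
      l u

  row-3 : ∀ x (p : 0# < x) → ι (mkℚᵘ (+ 2385) 999) ≤ x → x ≤ ι (mkℚᵘ (+ 2740) 999) → let open Region x p in P₁ × P₂ × P₃
  row-3 x p l u = row₁ , row₂ , row₃
    where
    open Region x p
    open Row (mkℚᵘ (+ 2385) 999) (mkℚᵘ (+ 2740) 999) (mkℚᵘ (+ 922) 9999) (mkℚᵘ (+ 8156) 9999)
      (mkℚᵘ (+ 11847) 9999) (mkℚᵘ (+ 2245) 9999) (mkℚᵘ (+ 291) 999) (mkℚᵘ (+ 757) 999999)
      num≤ num≤ num≤ num≤ num≤ num≤
      (E-upper 8 2981 9999 922 9999 (numeric (k 8 :* con (mkℚᵘ (+ 2981) 9999)) (con (mkℚᵘ (+ 2385) 999))))
      (E-upper 8 1551 9999 291 999 (div-bound (nn-* num≤ num≤) u (numeric (k 8 :* con (mkℚᵘ (+ 1551) 9999) :* con (mkℚᵘ (+ 2740) 999)) (con (mkℚᵘ (+ 17) 4)))))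
      (E-upper 24 2995 9999 757 999999 (div-bound (nn-* num≤ num≤) u (numeric (k 24 :* con (mkℚᵘ (+ 2995) 9999) :* con (mkℚᵘ (+ 2740) 999)) (con (mkℚᵘ (+ 197) 9)))))
      (numeric (con (mkℚᵘ (+ 8156) 9999)) (k 1 :- k 2 :* con (mkℚᵘ (+ 922) 9999)))
      (numeric (k 1 :+ k 2 :* con (mkℚᵘ (+ 922) 9999) :+ k 2 :* con (mkℚᵘ (+ 922) 9999) :^ 4 :+ k 4 :* con (mkℚᵘ (+ 922) 9999) :^ 9) (con (mkℚᵘ (+ 11847) 9999)))
      (numeric (con (mkℚᵘ (+ 2245) 9999) :* con (mkℚᵘ (+ 11847) 9999) :^ 4) (con (mkℚᵘ (+ 8156) 9999) :^ 4))
      (numeric (k 2 :* con (mkℚᵘ (+ 291) 999) :* con (mkℚᵘ (+ 11847) 9999)) (con (mkℚᵘ (+ 8156) 9999)))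
      (numeric (con (mkℚᵘ (+ 2740) 999) :* con (mkℚᵘ (+ 2740) 999) :* con (mkℚᵘ (+ 11847) 9999) :^ 4) (con (mkℚᵘ (+ 173) 9)))
      (numeric (con (mkℚᵘ (+ 33033) 1) :* (con (mkℚᵘ (+ 2740) 999) :* con (mkℚᵘ (+ 2740) 999) :* con (mkℚᵘ (+ 757) 999999)) :* con (mkℚᵘ (+ 11847) 9999) :^ 4)
        (k 128 :* (k 5 :* con (mkℚᵘ (+ 2245) 9999) :+ k 5 :* con (mkℚᵘ (+ 2245) 9999) :^ 2 :+ k 7 :* con (mkℚᵘ (+ 2245) 9999) :^ 3 :+ k 9 :* con (mkℚᵘ (+ 2245) 9999) :^ 4)))
      l u

  row-4 : ∀ x (p : 0# < x) → ι (mkℚᵘ (+ 2740) 999) ≤ x → x ≤ ι (mkℚᵘ (+ 3002) 999) → let open Region x p in P₁ × P₂ × P₃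
  row-4 x p l u = row₁ , row₂ , row₃
    where
    open Region x p
    open Row (mkℚᵘ (+ 2740) 999) (mkℚᵘ (+ 3002) 999) (mkℚᵘ (+ 647) 9999) (mkℚᵘ (+ 8706) 9999)
      (mkℚᵘ (+ 11295) 9999) (mkℚᵘ (+ 3525) 9999) (mkℚᵘ (+ 324) 999) (mkℚᵘ (+ 1418) 999999)
      num≤ num≤ num≤ num≤ num≤ num≤
      (E-upper 8 3425 9999 647 9999 (numeric (k 8 :* con (mkℚᵘ (+ 3425) 9999)) (con (mkℚᵘ (+ 2740) 999))))
      (E-upper 8 1415 9999 324 999 (div-bound (nn-* num≤ num≤) u (numeric (k 8 :* con (mkℚᵘ (+ 1415) 9999) :* con (mkℚᵘ (+ 3002) 999)) (con (mkℚᵘ (+ 17) 4)))))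
      (E-upper 24 2734 9999 1418 999999 (div-bound (nn-* num≤ num≤) u (numeric (k 24 :* con (mkℚᵘ (+ 2734) 9999) :* con (mkℚᵘ (+ 3002) 999)) (con (mkℚᵘ (+ 197) 9)))))
      (numeric (con (mkℚᵘ (+ 8706) 9999)) (k 1 :- k 2 :* con (mkℚᵘ (+ 647) 9999)))
      (numeric (k 1 :+ k 2 :* con (mkℚᵘ (+ 647) 9999) :+ k 2 :* con (mkℚᵘ (+ 647) 9999) :^ 4 :+ k 4 :* con (mkℚᵘ (+ 647) 9999) :^ 9) (con (mkℚᵘ (+ 11295) 9999)))
      (numeric (con (mkℚᵘ (+ 3525) 9999) :* con (mkℚᵘ (+ 11295) 9999) :^ 4) (con (mkℚᵘ (+ 8706) 9999) :^ 4))
      (numeric (k 2 :* con (mkℚᵘ (+ 324) 999) :* con (mkℚᵘ (+ 11295) 9999)) (con (mkℚᵘ (+ 8706) 9999)))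
      (numeric (con (mkℚᵘ (+ 3002) 999) :* con (mkℚᵘ (+ 3002) 999) :* con (mkℚᵘ (+ 11295) 9999) :^ 4) (con (mkℚᵘ (+ 173) 9)))
      (numeric (con (mkℚᵘ (+ 33033) 1) :* (con (mkℚᵘ (+ 3002) 999) :* con (mkℚᵘ (+ 3002) 999) :* con (mkℚᵘ (+ 1418) 999999)) :* con (mkℚᵘ (+ 11295) 9999) :^ 4)
        (k 128 :* (k 5 :* con (mkℚᵘ (+ 3525) 9999) :+ k 5 :* con (mkℚᵘ (+ 3525) 9999) :^ 2 :+ k 7 :* con (mkℚᵘ (+ 3525) 9999) :^ 3 :+ k 9 :* con (mkℚᵘ (+ 3525) 9999) :^ 4)))
      l u

  private
    -- The last endpoint is twice the first, so repeated doubling of a smaller x cannot jump over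
    -- the four intervals.
    b₀ b₁ b₂ b₃ b₄ : F
    b₀ = ι (mkℚᵘ (+ 1501) 999)
    b₁ = ι (mkℚᵘ (+ 1960) 999)
    b₂ = ι (mkℚᵘ (+ 2385) 999)
    b₃ = ι (mkℚᵘ (+ 2740) 999)
    b₄ = ι (mkℚᵘ (+ 3002) 999)

    split : ∀ {u v} x (p : 0# < x) → b₀ ≤ x → x ≤ b₄ → (let open Region x p in P₁ × P₂ × P₃ → u ≤ v) → u ≤ v
    split x p l u f = ≤-cases x b₁ (λ h → f (row-1 x p l h)) λ h₁ → ≤-cases x b₂ (λ h → f (row-2 x p h₁ h)) λ h₂ →
      ≤-cases x b₃ (λ h → f (row-3 x p h₂ h)) λ h₃ → f (row-4 x p h₃ u)

  module _ (x : F) (p : 0# < x) where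
    private
      module A = Region x p
      module B = Region (# 2 * x) (*-pos num< p)

      κ₂ : B.κ * B.κ ≈ A.κ
      κ₂ = trans (sym (E-+ _ _)) (E-cong (trans (solve 1 (λ i → :- (con (mkℚᵘ (+ 17) 4) :* i) :+ :- (con (mkℚᵘ (+ 17) 4) :* i) := :- (con (mkℚᵘ (+ 17) 4) :* (k 2 :* i))) B.ix)
        (-‿cong (*-cong refl (inv-unique p (trans (solve 2 (λ x i → x :* (k 2 :* i) := k 2 :* x :* i) x B.ix) (inv-r _ _)))))))

    -- Squared, the bound at 2x reads 16κ(2x)⁴θ₃(2x)⁴ ≤ θ₄(2x)⁴, whose right side is θ₃(x)²θ₄(x)².
    -- On the left κ(2x)² = κ(x) and 4θ₃(2x)⁴ ≥ θ₃(x)⁴, and one factor θ₃(x)² cancels.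
    double₁ : B.P₁ → A.P₁
    double₁ h = cancel-≤ {z = A.θ₃ * A.θ₃} (*-pos θ₃>0 θ₃>0) (≤-trans
        (≤-trans (≈⇒≤ (solve 2 (λ c t → t :* t :* (k 4 :* (c :* c) :* (t :* t)) := k 4 :* (c :* c) :* t :^ 4) A.κ A.θ₃)) (≤-trans (*-monoˡ _ (nn-* num≤ (nn-² _)) (θ₃⁴-double x p))
          (≈⇒≤ (trans (*-cong (*-cong refl (*-cong (sym κ₂) (sym κ₂))) refl) (solve 2 (λ c t → k 4 :* (c :* c :* (c :* c)) :* (k 4 :* t :^ 4) := k 4 :* (c :* c) :* (t :* t) :* (k 4 :* (c :* c) :* (t :* t))) B.κ B.θ₃)))))
        (≤-trans (*-mono nn nn h h) (≈⇒≤ (trans (solve 1 (λ a → a :* a :* (a :* a) := a :^ 4) B.θ₄) (sym (θ₃θ₄-double x p))))))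
      where
      θ₃>0 : 0# < A.θ₃
      θ₃>0 = <-≤-trans (num< {0ℚᵘ} {1ℚᵘ}) A.θ₃≥1
      nn : 0# ≤ # 4 * (B.κ * B.κ) * (B.θ₃ * B.θ₃)
      nn = nn-* (nn-* num≤ (nn-² B.κ)) (nn-² B.θ₃)

    double₂ : B.P₂ → A.P₂
    double₂ h = ≤-trans (*-monoˡ (x * x) (nn-² x) (θ₃⁴-double x p)) (≤-trans (≈⇒≤ (solve 2 (λ x t → x :* x :* (k 4 :* t) := k 2 :* x :* (k 2 :* x) :* t) x B.T₃)) h)

  private
    -- At most n doublings lead into the four intervals. A classical case split needs a goal of the
    -- form v ≤ w, which is why the two components are proved one at a time.
    descend : ∀ n x (p : 0# < x) → b₀ ≤ # 2 ^ n * x → x ≤ b₄ → Region.P₁ x p × Region.P₂ x p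
    descend n x p l u = base-or proj₁ (λ h → proj₁ (below n l h)) , base-or (λ t → proj₁ (proj₂ t)) (λ h → proj₂ (below n l h))
      where
      base-or : ∀ {v w} → (let open Region x p in P₁ × P₂ × P₃ → v ≤ w) → (x ≤ b₀ → v ≤ w) → v ≤ w
      base-or f g = ≤-cases b₀ x (λ h → split x p h u f) g
      below : ∀ n → b₀ ≤ # 2 ^ n * x → x ≤ b₀ → Region.P₁ x p × Region.P₂ x p
      below zero    l h = split x p (≤-trans l (≈⇒≤ (*-identityˡ x))) u proj₁ , split x p (≤-trans l (≈⇒≤ (*-identityˡ x))) u (λ t → proj₁ (proj₂ t))
      below (suc n) l h = double₁ x p (proj₁ ih) , double₂ x p (proj₂ ih)
        where
        ih = descend n (# 2 * x) (*-pos num< p) (≤-trans l (≈⇒≤ (solve 2 (λ a x → k 2 :* a :* x := a :* (k 2 :* x)) (# 2 ^ n) x)))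
          (≤-trans (*-monoˡ (# 2) num≤ h) (numeric (k 2 :* con (mkℚᵘ (+ 1501) 999)) (con (mkℚᵘ (+ 3002) 999))))

    height : ∀ x → 0# < x → ∃[ n ] b₀ ≤ # 2 ^ n * x
    height x p = m , ≤-trans (≈⇒≤ (trans (sym (*-identityʳ b₀)) (trans (*-cong refl (sym (inv-l x p))) (sym (*-assoc _ _ _))))) (*-monoʳ x (<⇒≤ p) (≤-trans (<⇒≤ (proj₂ a)) (grow m)))
      where
      a = archimedean (b₀ * inv x p)
      m = proj₁ a
      grow : ∀ n → # n ≤ # 2 ^ n
      grow zero    = num≤
      grow (suc n) = ≤-trans (≈⇒≤ (#-suc n)) (≤-trans (+-mono-≤ (grow n) (≤-trans (≈⇒≤ (sym (1^ n))) (^-mono n num≤ num≤))) (≈⇒≤ (solve 1 (λ a → a :+ a := k 2 :* a) (# 2 ^ n))))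

  below-three₁ : ∀ x p → x ≤ ι (mkℚᵘ (+ 3002) 999) → Region.P₁ x p
  below-three₁ x p u = proj₁ (descend (proj₁ (height x p)) x p (proj₂ (height x p)) u)

  below-three₃ : ∀ x p → x ≤ ι (mkℚᵘ (+ 3002) 999) → Region.P₃ x p
  below-three₃ x p u = ≤-cases b₀ x (λ h → split x p h u (λ t → proj₂ (proj₂ t)))
    (λ h → Region.small-x x p (proj₁ d) (proj₂ d) h)
    where d = descend (proj₁ (height x p)) x p (proj₂ (height x p)) u

-- Power series models of the Eisenstein series and theta constants.

module EisensteinModels (R : RealField) where

  open BelowThree R public
  open import Relation.Binary.Reasoning.Setoid setoid
  open Defs using (σ)

  -- The tail dominates the telescoping series of `δ`, whose sum from N on is `ε N`. Adding it makes
  -- fourteen terms enough for π² ≥ 9.85.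
  ζ-lower : ∀ N → sum (λ n → ε n ^ 2) N + ε N ≤ ζ 0
  ζ-lower N = by-nn (nn-sub tail) (solve 3 (λ z s e → z :- (s :+ e) := z :- s :- e) (ζ 0) (sum (λ n → ε n ^ 2) N) (ε N))
    where
    δ≤ : ∀ i → δ (N ℕ.+ i) ≤ ε (N ℕ.+ i) ^ 2
    δ≤ i = ≤-trans (*-monoˡ _ (<⇒≤ (ε-pos (N ℕ.+ i))) (ε-anti (ℕₚ.n≤1+n (N ℕ.+ i)))) (≈⇒≤ (*-cong refl (sym (*-identityʳ _))))
    δ-series : Series δ 1#
    δ-series = ⟶-close 1# (λ n → Bnd-resp refl (trans (solve 1 (λ e → :- e := k 1 :- e :- k 1) (ε n)) (+-cong (sym (sum-δ n)) refl)) (Bnd-neg (Bnd-resp (sym (*-identityˡ _)) refl (Bnd-refl (<⇒≤ (ε-pos n)))))) (⟶-const 1#)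
    tail : ε N ≤ ζ 0 - sum (λ n → ε n ^ 2) N
    tail = ≤-trans (≈⇒≤ (trans (solve 1 (λ e → e := k 1 :- (k 1 :- e)) (ε N)) (+-cong refl (-‿cong (sym (sum-δ N)))))) (Series-mono (Series-drop N δ-series) (Series-drop N (ζ-series 0)) δ≤)

  private
    :Σε² : ℕ → Expr 0
    :Σε² zero    = k 0
    :Σε² (suc n) = :Σε² n :+ con (mkℚᵘ (+ 1) n) :^ 2

  π²-lower : ι (mkℚᵘ (+ 197) 19) ≤ π * π
  π²-lower = ≤-trans (≤-trans (numeric (con (mkℚᵘ (+ 197) 19)) (k 6 :* (:Σε² 14 :+ con (mkℚᵘ (+ 1) 14)))) (*-monoˡ (# 6) num≤ (ζ-lower 14))) (≈⇒≤ ζ2)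

  module Eisenstein (τ : F) (p : 0# < τ) where
    open Thetas (π * τ) (*-pos π-pos p) public

    D Δ : F
    D = e₂ τ p * e₄ τ p - e₆ τ p
    Δ = e₄ τ p ^ 3 - e₆ τ p ^ 2

    private
      w = # 2 * π * τ

      E-pow : ∀ n → E (- (w * ν n)) ≈ (q * q) ^ suc n
      E-pow n = trans (E-cong (solve 3 (λ a t n → :- (k 2 :* a :* t :* n) := n :* (:- (a :* t) :+ :- (a :* t))) π τ (ν n))) (trans (E-nat (suc n) _) (^-cong (suc n) (E-+ _ _)))

    G≥0 : ∀ j → 0# ≤ G j τ p
    G≥0 j = Series-nn (Lambert.G-series w (2π-pos p) j) (λ n → nn-* (nn-# (σ j (suc n))) (nn-E _))

    e₄≥1 : 1# ≤ e₄ τ p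
    e₄≥1 = by-nn (nn-* (nn-# 240) (G≥0 3)) (solve 1 (λ g → k 1 :+ k 240 :* g :- k 1 := k 240 :* g) (G 3 τ p))

    -- `z` sharpens only the rounding inside the certificates; the tail estimates of all models use
    -- q ≤ 1/20.
    module Modelled (z : ℕ) (q≤ : # suc z * q ≤ 1#) (q≤20 : # 20 * q ≤ 1#) where
      open Arithmetic z public
      open Sound q nn-q q≤ public

      q≤½ : q ≤ ½
      q≤½ = cancel-≤ {z = # 20} num< (≤-trans q≤20 (numeric (k 1) (k 20 :* :½)))

      G-term : ∀ j → j ℕ.≤ 5 → ∀ n → ν (suc n) ^ suc j * (q * q) ≤ ½ * ν n ^ suc j
      G-term j j≤5 n = ≤-trans (*-monoʳ (q * q) (nn-² q) (≤-trans (^-mono (suc j) (nn-ν (suc n)) twice) (≈⇒≤ (*-pow (# 2) (ν n) (suc j)))))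
        (≤-trans (≈⇒≤ (solve 3 (λ a b c → a :* b :* c := a :* c :* b) (# 2 ^ suc j) (ν n ^ suc j) (q * q))) (*-monoʳ (ν n ^ suc j) (nn-^ (suc j) (nn-ν n)) (≤-trans (*-monoʳ (q * q) (nn-² q) (two-pow (ℕ.s≤s j≤5))) q²≤)))
        where
        twice : ν (suc n) ≤ # 2 * ν n
        twice = by-nn (nn-# n) (trans (+-cong (*-cong refl (#-suc n)) (-‿cong (trans (#-suc (suc n)) (+-cong (#-suc n) refl)))) (solve 1 (λ n → k 2 :* (n :+ k 1) :- (n :+ k 1 :+ k 1) := n) (# n)))
        two-pow : ∀ {i m} → i ℕ.≤ m → # 2 ^ i ≤ # 2 ^ m
        two-pow {m = zero}  ℕ.z≤n   = ≤-refl
        two-pow {m = suc m} ℕ.z≤n   = ≤-trans (≈⇒≤ (sym (*-identityˡ 1#))) (*-mono num≤ num≤ num≤ (two-pow {m = m} ℕ.z≤n))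
        two-pow (ℕ.s≤s h)           = *-monoˡ (# 2) num≤ (two-pow h)
        q²≤ : # 2 ^ 6 * (q * q) ≤ ½
        q²≤ = cancel-≤ {z = # 400} num< (≤-trans (≈⇒≤ (solve 1 (λ q → k 400 :* (k 2 :^ 6 :* (q :* q)) := k 64 :* ((k 20 :* q) :* (k 20 :* q))) q))
          (≤-trans (*-monoˡ (# 64) num≤ (*-mono (nn-* num≤ nn-q) (nn-* num≤ nn-q) q≤20 q≤20)) (numeric (k 64 :* (k 1 :* k 1)) (k 400 :* :½))))

      -- The series runs over q²ⁿ. Since σⱼ(n) ≤ n^{j+1}, the term n = 5 is at most 5^{j+1}q¹⁰, and
      -- the majorant at least halves from each term to the next, whence the error 2 · 5^{j+1}.
      G-model : ℕ → Term
      G-model j = leaf (+ 0 ∷ + 0 ∷ + σ j 1 ∷ + 0 ∷ + σ j 2 ∷ + 0 ∷ + σ j 3 ∷ + 0 ∷ + σ j 4 ∷ [] , 2 ℕ.* 5 ℕ.^ suc j)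

      G-models : ∀ j → j ℕ.≤ 5 → G-model j ⊨ G j τ p
      G-models j j≤5 = model (Bnd-mono tail-size (Bnd-resp refl (+-cong refl (-‿cong poly-value)) tail))
        where
        f g : ℕ → F
        f n = # σ j (suc n) * (q * q) ^ suc n
        g n = ν n ^ suc j * (q * q) ^ suc n
        f-series : Series f (G j τ p)
        f-series = Series-cong (λ n → *-cong refl (E-pow n)) (Lambert.G-series w (2π-pos p) j)
        nn-g : ∀ n → 0# ≤ g n
        nn-g n = nn-* (nn-^ (suc j) (nn-ν n)) (nn-^ (suc n) (nn-² q))
        g-drop : ∀ n → g (suc n) ≤ ½ * g n
        g-drop n = ≤-trans (≈⇒≤ (sym (*-assoc _ _ _))) (≤-trans (*-monoʳ _ (nn-^ (suc n) (nn-² q)) (G-term j j≤5 n)) (≈⇒≤ (*-assoc _ _ _)))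
        f≤g : ∀ n → Bnd (g n) (f n)
        f≤g n = Bnd-of (nn-* (nn-# (σ j (suc n))) (nn-^ (suc n) (nn-² q))) (*-monoʳ _ (nn-^ (suc n) (nn-² q)) (σ-bound j n))
        g-sum : Σ[ s ∈ F ] Series g s
        g-sum = dom-conv {C = # 64 * # 3} λ n → Bnd-mono (≤-trans (*-monoˡ (# 64) num≤ (½^≤3δ n)) (≈⇒≤ (sym (*-assoc _ _ _)))) (Bnd-of (nn-g n) (geo n))
          where
          geo : ∀ n → g n ≤ # 64 * ½ ^ n
          geo zero    = ≤-trans (≈⇒≤ (trans (*-cong (1^ (suc j)) refl) (*-identityˡ _))) (≤-trans (x^≤1 1 (nn-² q) (≤-trans (*-mono nn-q nn-q (q≤1 q≤½) (q≤1 q≤½)) (≈⇒≤ (*-identityˡ 1#)))) (numeric (k 1) (k 64 :* k 1)))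
          geo (suc n) = ≤-trans (g-drop n) (≤-trans (*-monoˡ ½ num≤ (geo n)) (≈⇒≤ (solve 1 (λ x → :½ :* (k 64 :* x) := k 64 :* (:½ :* x)) (½ ^ n))))
        tail : Bnd (# 2 * g 4) (G j τ p - sum f 4)
        tail = Bnd-mono (proj₂ (halving-tail 4 nn-g g-drop (proj₂ g-sum))) (Series-Bnd (Series-drop 4 f-series) (Series-drop 4 (proj₂ g-sum)) (λ i → f≤g (4 ℕ.+ i)))
        tail-size : # 2 * g 4 ≤ # (2 ℕ.* 5 ℕ.^ suc j) * q ^ order
        tail-size = ≈⇒≤ (sym (trans (*-cong (trans (#-* 2 (5 ℕ.^ suc j)) (*-cong refl (#-^ 5 (suc j)))) refl) (solve 2 (λ a q → k 2 :* a :* q :^ 10 := k 2 :* (a :* (q :* q) :^ 5)) (# 5 ^ suc j) q)))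
        poly-value : sum f 4 ≈ horner (proj₁ (run (G-model j)))
        poly-value = solve 5 (λ q a b c d → k 0 :+ a :* (q :* q) :^ 1 :+ b :* (q :* q) :^ 2 :+ c :* (q :* q) :^ 3 :+ d :* (q :* q) :^ 4
          := k 0 :+ q :* (k 0 :+ q :* (a :+ q :* (k 0 :+ q :* (b :+ q :* (k 0 :+ q :* (c :+ q :* (k 0 :+ q :* (d :+ q :* k 0))))))))) q (# σ j 1) (# σ j 2) (# σ j 3) (# σ j 4)

      m₂ m₄ m₆ mD mΔ mq : Term
      m₂ = const 1 ⊟ const 24 ⊠ G-model 1
      m₄ = const 1 ⊞ const 240 ⊠ G-model 3
      m₆ = const 1 ⊟ const 504 ⊠ G-model 5
      mD = m₂ ⊠ m₄ ⊟ m₆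
      mΔ = power m₄ 3 ⊟ power m₆ 2
      mq = leaf (+ 0 ∷ + 1 ∷ [] , 0)

      e₂-models : m₂ ⊨ e₂ τ p
      e₂-models = ⊨-- (⊨-const 1) (⊨-* (⊨-const 24) (G-models 1 (ℕ.s≤s ℕ.z≤n)))

      e₄-models : m₄ ⊨ e₄ τ p
      e₄-models = ⊨-+ (⊨-const 1) (⊨-* (⊨-const 240) (G-models 3 (ℕ.s≤s (ℕ.s≤s (ℕ.s≤s ℕ.z≤n)))))

      e₆-models : m₆ ⊨ e₆ τ p
      e₆-models = ⊨-- (⊨-const 1) (⊨-* (⊨-const 504) (G-models 5 ℕₚ.≤-refl))

      D-models : mD ⊨ D
      D-models = ⊨-- (⊨-* e₂-models e₄-models) e₆-models

      Δ-models : mΔ ⊨ Δ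
      Δ-models = ⊨-- (⊨-^ 3 e₄-models) (⊨-^ 2 e₆-models)

      q-models : mq ⊨ q
      q-models = model (Bnd-resp (sym (zeroˡ _)) (solve 1 (λ q → k 0 := q :- (k 0 :+ q :* (k 1 :+ q :* k 0))) q) (Bnd-refl ≤-refl))

      private
        q²⁵≤ : q ^ 25 ≤ ½ * q ^ 16
        q²⁵≤ = pow-drop q≤½ 16 8
        five-q¹⁶ : # 5 * q ^ 16 ≤ # 1 * q ^ 10
        five-q¹⁶ = ≤-trans (≈⇒≤ (solve 1 (λ q → k 5 :* q :^ 16 := con (mkℚᵘ (+ 1) 3) :* (k 20 :* q) :* q :^ 5 :* q :^ 10) q))
          (*-monoʳ (q ^ 10) (nn-^ 10 nn-q) (≤-trans (*-mono (nn-* num≤ (nn-* num≤ nn-q)) (nn-^ 5 nn-q) (*-monoˡ (ι (mkℚᵘ (+ 1) 3)) num≤ q≤20) (x^≤1 5 nn-q (q≤1 q≤½))) (numeric (con (mkℚᵘ (+ 1) 3) :* k 1 :* k 1) (k 1))))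

      t₃ t₄ tχ : Term
      t₃ = leaf (+ 1 ∷ + 2 ∷ + 0 ∷ + 0 ∷ + 2 ∷ + 0 ∷ + 0 ∷ + 0 ∷ + 0 ∷ + 2 ∷ [] , 1)
      t₄ = leaf (+ 1 ∷ -[1+ 1 ] ∷ + 0 ∷ + 0 ∷ + 2 ∷ + 0 ∷ + 0 ∷ + 0 ∷ + 0 ∷ -[1+ 1 ] ∷ [] , 1)
      tχ = leaf (+ 1 ∷ + 0 ∷ + 1 ∷ + 0 ∷ + 0 ∷ + 0 ∷ + 1 ∷ [] , 1)

      θ₃-models : t₃ ⊨ θ₃
      θ₃-models = model (Bnd-mono (≤-trans near five-q¹⁶) (Bnd-resp refl
          (solve 2 (λ q t → t :- (k 0 :+ (q :^ 0 :+ q :^ 1) :+ (q :^ 1 :+ q :^ 4) :+ (q :^ 4 :+ q :^ 9) :+ (q :^ 9 :+ q :^ 16)) :+ q :^ 16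
            := t :- (k 1 :+ q :* (k 2 :+ q :* (k 0 :+ q :* (k 0 :+ q :* (k 2 :+ q :* (k 0 :+ q :* (k 0 :+ q :* (k 0 :+ q :* (k 0 :+ q :* (k 2 :+ q :* k 0))))))))))) q θ₃)
          (Bnd-+ (θ₃-tail q≤½ 4) (Bnd-refl (nn-^ 16 nn-q)))))
        where
        near : # 2 * (q ^ 16 + q ^ 25) + q ^ 16 ≤ # 5 * q ^ 16
        near = by-nn (nn-+ (nn-* (nn-# 2) (nn-sub q²⁵≤)) (nn-^ 16 nn-q)) (solve 2 (λ x y → k 5 :* x :- (k 2 :* (x :+ y) :+ x) := k 2 :* (:½ :* x :- y) :+ x) (q ^ 16) (q ^ 25))

      θ₄-models : t₄ ⊨ θ₄
      θ₄-models = model (Bnd-mono (≤-trans near five-q¹⁶) (Bnd-resp refl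
          (solve 2 (λ q t →
            t :- (k 0 :+ (:sgn 0 :* q :^ 0 :+ :sgn 1 :* q :^ 1) :+ (:sgn 1 :* q :^ 1 :+ :sgn 2 :* q :^ 4) :+ (:sgn 2 :* q :^ 4 :+ :sgn 3 :* q :^ 9) :+ (:sgn 3 :* q :^ 9 :+ :sgn 4 :* q :^ 16)) :+ q :^ 16
            := t :- (k 1 :+ q :* (con (mkℚᵘ -[1+ 1 ] 0) :+ q :* (k 0 :+ q :* (k 0 :+ q :* (k 2 :+ q :* (k 0 :+ q :* (k 0 :+ q :* (k 0 :+ q :* (k 0 :+ q :* (con (mkℚᵘ -[1+ 1 ] 0) :+ q :* k 0))))))))))) q θ₄)
          (Bnd-+ (θ₄-tail q≤½ 4) (Bnd-refl (nn-^ 16 nn-q)))))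
        where
        :sgn : ∀ {n} → ℕ → Expr n
        :sgn m = (:- k 1) :^ m
        near : # 2 * (q ^ 16 + q ^ 25) + q ^ 16 ≤ # 5 * q ^ 16
        near = by-nn (nn-+ (nn-* (nn-# 2) (nn-sub q²⁵≤)) (nn-^ 16 nn-q)) (solve 2 (λ x y → k 5 :* x :- (k 2 :* (x :+ y) :+ x) := k 2 :* (:½ :* x :- y) :+ x) (q ^ 16) (q ^ 25))

      χ-models : tχ ⊨ χ₂
      χ-models = model (Bnd-mono near (Bnd-resp refl
          (solve 2 (λ q t → t :- (k 0 :+ q :^ 0 :+ q :^ 2 :+ q :^ 6) := t :- (k 1 :+ q :* (k 0 :+ q :* (k 1 :+ q :* (k 0 :+ q :* (k 0 :+ q :* (k 0 :+ q :* (k 1 :+ q :* k 0)))))))) q χ₂)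
          (halving-tail 3 (λ i → nn-^ (i ℕ.* suc i) nn-q) drop-χ χ-series)))
        where
        drop-χ : ∀ i → χ-term (suc i) ≤ ½ * χ-term i
        drop-χ i = ≡.subst (λ m → q ^ m ≤ ½ * χ-term i) (expo i) (pow-drop q≤½ (i ℕ.* suc i) (suc (i ℕ.+ i)))
          where
          open import Data.Nat.Solver using (module +-*-Solver)
          expo : ∀ i → suc (suc (i ℕ.+ i)) ℕ.+ i ℕ.* suc i ≡.≡ suc i ℕ.* suc (suc i)
          expo = S.solve 1 (λ i → S.con 2 S.:+ (i S.:+ i) S.:+ i S.:* (S.con 1 S.:+ i) S.:= (S.con 1 S.:+ i) S.:* (S.con 2 S.:+ i)) ≡.refl
            where module S = +-*-Solver
        near : # 2 * q ^ 12 ≤ # 1 * q ^ 10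
        near = ≤-trans (≈⇒≤ (solve 1 (λ q → k 2 :* q :^ 12 := con (mkℚᵘ (+ 1) 9) :* (k 20 :* q) :* q :* q :^ 10) q))
          (*-monoʳ (q ^ 10) (nn-^ 10 nn-q) (≤-trans (*-mono (nn-* num≤ (nn-* num≤ nn-q)) nn-q (*-monoˡ (ι (mkℚᵘ (+ 1) 9)) num≤ q≤20) (q≤1 q≤½)) (numeric (con (mkℚᵘ (+ 1) 9) :* k 1 :* k 1) (k 1))))

-- The comparison of φ₀ and ψ_I.

module Inequality (R : RealField) where

  open EisensteinModels R public
  open import Relation.Binary.Reasoning.Setoid setoid

  module Near (τ : F) (p : 0# < τ) (q≤20 : # 20 * Eisenstein.q τ p ≤ 1#) where
    open Eisenstein τ p
    open Modelled 19 q≤20 q≤20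

    Δ-lower : q ^ 2 ≤ Δ
    Δ-lower = dominates-sound 2 (run mΔ) _ (_⊨_.within Δ-models)

    D-lower : q ^ 2 ≤ D
    D-lower = dominates-sound 2 (run mD) _ (_⊨_.within D-models)

    D-upper : q ^ 2 ≤ # 800 * q ^ 2 - D
    D-upper = dominates-sound 2 (run (const 800 ⊠ power mq 2 ⊟ mD)) _ (_⊨_.within (⊨-- (⊨-* (⊨-const 800) (⊨-^ 2 q-models)) D-models))

    X₁ Y₁ Z₁ : F
    X₁ = # 16 * q * χ₂ ^ 4
    Y₁ = θ₄ ^ 4
    Z₁ = θ₃ ^ 4

    -- The two products agree up to order q³, namely 3456q² + 55296q³, which reflects the common
    -- pole of both sides; the certificate therefore starts at q⁴. Here 2E₄ - D is a third of 6E₄ -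
    -- xD at the boundary value x = 3.
    key : q ^ 4 ≤ Y₁ * (# 5 * X₁ ^ 2 + # 5 * X₁ * Y₁ + # 2 * Y₁ ^ 2) * Δ - # 864 * q ^ 2 * (# 2 * e₄ τ p - D) ^ 2 * χ₂ ^ 8 * Z₁ ^ 2
    key = dominates-sound 4 (run (mY ⊠ (const 5 ⊠ power mX 2 ⊞ const 5 ⊠ mX ⊠ mY ⊞ const 2 ⊠ power mY 2) ⊠ mΔ ⊟ const 864 ⊠ power mq 2 ⊠ power (const 2 ⊠ m₄ ⊟ mD) 2 ⊠ power tχ 8 ⊠ power (power t₃ 4) 2)) _
      (_⊨_.within (⊨-- (⊨-* (⊨-* Y-models (⊨-+ (⊨-+ (⊨-* (⊨-const 5) (⊨-^ 2 X-models)) (⊨-* (⊨-* (⊨-const 5) X-models) Y-models)) (⊨-* (⊨-const 2) (⊨-^ 2 Y-models)))) Δ-models)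
        (⊨-* (⊨-* (⊨-* (⊨-* (⊨-const 864) (⊨-^ 2 q-models)) (⊨-^ 2 (⊨-- (⊨-* (⊨-const 2) e₄-models) D-models))) (⊨-^ 8 χ-models)) (⊨-^ 2 (⊨-^ 4 θ₃-models)))))
      where
      mX mY : Term
      mX = const 16 ⊠ mq ⊠ power tχ 4
      mY = power t₄ 4
      X-models : mX ⊨ X₁
      X-models = ⊨-* (⊨-* (⊨-const 16) q-models) (⊨-^ 4 χ-models)
      Y-models : mY ⊨ Y₁
      Y-models = ⊨-^ 4 θ₄-models

  -- As q → 0, D ~ 720q² and Δ ~ 1728q², so the sharp constant in the limit is 720² = 518400; 594000
  -- covers q up to 1/26.
  φ-bound : ∀ τ (p : 0# < τ) → let open Eisenstein τ p in # 26 * q ≤ 1# → # 20 * q ≤ 1# → # 1728 * D ^ 2 ≤ # 594000 * q ^ 2 * Δ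
  φ-bound τ p q≤26 q≤20 = by-nn (≤-trans (nn-^ 4 nn-q) (dominates-sound 4 (run (const 594000 ⊠ power mq 2 ⊠ mΔ ⊟ const 1728 ⊠ power mD 2)) _
      (_⊨_.within (⊨-- (⊨-* (⊨-* (⊨-const 594000) (⊨-^ 2 q-models)) Δ-models) (⊨-* (⊨-const 1728) (⊨-^ 2 D-models)))))) refl
    where
    open Eisenstein τ p
    open Modelled 25 q≤26 q≤20

  module Main (t : F) (p : 0# < t) where
    ti : F
    ti = inv t p

    p′ : 0# < ti
    p′ = inv-pos t p

    x : F
    x = π * t

    x>0 : 0# < x
    x>0 = *-pos π-pos p

    open Region x x>0

    module E₀ = Eisenstein t p
    module E₁ = Eisenstein ti p′

    -- The positivity of Δ and of ψ and the final gap are strict, so they need a genuine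
    -- disjunction, which only overlapping ranges supply.
    three : 0# < x → # 3 < x ⊎ x < ι (mkℚᵘ (+ 3002) 999)
    three _ = <-cotrans (num< {mkℚᵘ (+ 3) 0} {mkℚᵘ (+ 3002) 999}) x

    D-transform : π * E₁.D ≈ t ^ 5 * (# 6 * e₄ t p - x * E₀.D)
    D-transform = begin
      π * (e₂ ti p′ * e₄ ti p′ - e₆ ti p′)
        ≈⟨ solve 4 (λ a b c d → a :* (b :* c :- d) := (a :* b) :* c :- a :* d) π (e₂ ti p′) (e₄ ti p′) (e₆ ti p′) ⟩
      (π * e₂ ti p′) * e₄ ti p′ - π * e₆ ti p′
        ≈⟨ +-cong (*-cong (e₂-transform t p) (e₄-transform t p)) (-‿cong (*-cong refl (e₆-transform t p))) ⟩
      (# 6 * t - t ^ 2 * (π * e₂ t p)) * (t ^ 4 * e₄ t p) - π * - (t ^ 6 * e₆ t p)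
        ≈⟨ solve 5 (λ a t b c d → (k 6 :* t :- t :^ 2 :* (a :* b)) :* (t :^ 4 :* c) :- a :* :- (t :^ 6 :* d) := t :^ 5 :* (k 6 :* c :- a :* t :* (b :* c :- d))) π t (e₂ t p) (e₄ t p) (e₆ t p) ⟩
      t ^ 5 * (# 6 * e₄ t p - x * E₀.D) ∎

    Δ-transform : E₁.Δ ≈ t ^ 12 * E₀.Δ
    Δ-transform = trans (+-cong (^-cong 3 (e₄-transform t p)) (-‿cong (^-cong 2 (e₆-transform t p))))
      (solve 3 (λ t a b → (t :^ 4 :* a) :^ 3 :- (:- (t :^ 6 :* b)) :^ 2 := t :^ 12 :* (a :^ 3 :- b :^ 2)) t (e₄ t p) (e₆ t p))

    module Large (3≤x : # 3 ≤ x) where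
      q≤20 : # 20 * q ≤ 1#
      q≤20 = ≤-trans (*-monoˡ (# 20) num≤ (E-upper 12 1 3 1 19 (≤-trans (numeric (k 12 :* con (mkℚᵘ (+ 1) 3)) (k 3)) 3≤x))) (numeric (k 20 :* con (mkℚᵘ (+ 1) 19)) (k 1))

      open Near t p q≤20 public

      Δ>0 : 0# < E₀.Δ
      Δ>0 = <-≤-trans (pos-^ 2 q>0) Δ-lower

      θ₄>0 : 0# < θ₄
      θ₄>0 = <-≤-trans (num< {0ℚᵘ} {mkℚᵘ (+ 9) 9}) (≤-trans (by-nn (nn-* (nn-ι 1 9) (nn-sub q≤20)) (solve 1 (λ q → k 1 :- k 2 :* q :- con (mkℚᵘ (+ 9) 9) := con (mkℚᵘ (+ 1) 9) :* (k 1 :- k 20 :* q)) q))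
        (θ₄-lower (cancel-≤ {z = # 20} num< (≤-trans q≤20 (numeric (k 1) (k 20 :* :½))))))

      v : F
      v = # 6 * e₄ t p - x * E₀.D

      private
        y = x - # 3
        nn-y : 0# ≤ y
        nn-y = nn-sub 3≤x

      xq² : x * q ^ 2 ≤ ι (mkℚᵘ (+ 3) 399)
      xq² = cancel-≤ {z = E y * E y} (*-pos (E-pos y) (E-pos y)) (≤-trans (≈⇒≤ split)
          (≤-trans (*-mono (<⇒≤ x>0) (nn-² _) x≤ (*-mono (nn-E _) (nn-E _) e³ e³)) (≈⇒≤ (solve 1 (λ e → k 3 :* (e :* e) :* (con (mkℚᵘ (+ 1) 19) :* con (mkℚᵘ (+ 1) 19)) := e :* e :* con (mkℚᵘ (+ 3) 399)) (E y)))))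
        where
        e³ : E (- # 3) ≤ ι (mkℚᵘ (+ 1) 19)
        e³ = E-upper 12 1 3 1 19 (numeric (k 12 :* con (mkℚᵘ (+ 1) 3)) (k 3))
        split : E y * E y * (x * q ^ 2) ≈ x * (E (- # 3) * E (- # 3))
        split = trans (solve 3 (λ e x q → e :* e :* (x :* q :^ 2) := x :* ((e :* q) :* (e :* q))) (E y) x q) (*-cong refl (*-cong one one))
          where
          one : E y * q ≈ E (- # 3)
          one = trans (sym (E-+ _ _)) (E-cong (solve 1 (λ x → x :- k 3 :+ :- x := :- k 3) x))
        x≤ : x ≤ # 3 * (E y * E y)
        x≤ = ≤-trans (by-nn (nn-* (nn-# 2) nn-y) (solve 1 (λ x → k 3 :* (k 1 :+ (x :- k 3)) :- x := k 2 :* (x :- k 3)) x))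
          (*-monoˡ (# 3) num≤ (≤-trans (≤-trans (by-nn {e = 0#} ≤-refl (solve 1 (λ y → k 0 :+ k 1 :+ k 1 :* (y :* k 1) :- (k 1 :+ y) := k 0) y)) (E≥sum 2 nn-y)) (≤-trans (≈⇒≤ (sym (*-identityˡ _))) (*-monoʳ (E y) (nn-E y) (1≤E nn-y)))))

      -- Replaces x by 3 in 6E₄ - xD: this can only enlarge it because D ≥ 0, and xD ≤ 6E₄ keeps it
      -- non-negative. The explicit t disappears, leaving power series in q alone.
      v-bound : v ^ 2 ≤ # 9 * (# 2 * e₄ t p - E₀.D) ^ 2
      v-bound = ≤-trans (^2≤ (sq-mono v-bnd)) (≈⇒≤ (solve 2 (λ a d → (k 3 :* (k 2 :* a :- d)) :^ 2 := k 9 :* (k 2 :* a :- d) :^ 2) (e₄ t p) E₀.D))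
        where
        B = # 3 * (# 2 * e₄ t p - E₀.D)
        nn-D : 0# ≤ E₀.D
        nn-D = ≤-trans (nn-^ 2 nn-q) D-lower
        D≤ : E₀.D ≤ # 800 * q ^ 2
        D≤ = by-nn (≤-trans (nn-^ 2 nn-q) D-upper) refl
        xD : x * E₀.D ≤ # 6 * e₄ t p
        xD = ≤-trans (*-monoˡ x (<⇒≤ x>0) D≤) (≤-trans (≈⇒≤ (solve 2 (λ x q → x :* (k 800 :* q) := k 800 :* (x :* q)) x (q ^ 2)))
          (≤-trans (*-monoˡ (# 800) num≤ xq²) (≤-trans (numeric (k 800 :* con (mkℚᵘ (+ 3) 399)) (k 6 :* k 1)) (*-monoˡ (# 6) num≤ E₀.e₄≥1))))
        v-bnd : Bnd B v
        v-bnd = by-nn (nn-+ (nn-* (nn-# 2) (nn-sub xD)) (nn-* nn-y nn-D)) (solve 3 (λ a x d → k 6 :* a :- x :* d :- :- (k 3 :* (k 2 :* a :- d)) := k 2 :* (k 6 :* a :- x :* d) :+ (x :- k 3) :* d) (e₄ t p) x E₀.D) ,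
          by-nn (nn-* nn-y nn-D) (solve 3 (λ a x d → k 3 :* (k 2 :* a :- d) :- (k 6 :* a :- x :* d) := (x :- k 3) :* d) (e₄ t p) x E₀.D)
        sq-mono : ∀ {b z} → Bnd b z → z * z ≤ b * b
        sq-mono b = proj₂ (Bnd-* b b)
        ^2≤ : ∀ {a b} → a * a ≤ b * b → a ^ 2 ≤ b ^ 2
        ^2≤ {a} {b} h = ≤-trans (≈⇒≤ (solve 1 (λ a → a :^ 2 := a :* a) a)) (≤-trans h (≈⇒≤ (solve 1 (λ a → a :* a := a :^ 2) b)))

    module Small (x≤ : x ≤ ι (mkℚᵘ (+ 3002) 999)) where
      far : # 12 * ι (mkℚᵘ (+ 2733) 9999) ≤ π * ti
      far = cancel-≤ x>0 (≤-trans (≈⇒≤ (*-comm x _)) (≤-trans (*-monoˡ _ (nn-* num≤ num≤) x≤) (≤-trans (numeric (k 12 :* con (mkℚᵘ (+ 2733) 9999) :* con (mkℚᵘ (+ 3002) 999)) (con (mkℚᵘ (+ 197) 19)))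
        (≤-trans π²-lower (≈⇒≤ (sym (trans (solve 3 (λ a t i → a :* t :* (a :* i) := a :* a :* (t :* i)) π t ti) (trans (*-cong refl (inv-r t p)) (*-identityʳ _)))))))))

      r≤26 : # 26 * E₁.q ≤ 1#
      r≤26 = ≤-trans (*-monoˡ (# 26) num≤ (E-upper 12 2733 9999 1 25 far)) (numeric (k 26 :* con (mkℚᵘ (+ 1) 25)) (k 1))

      r≤20 : # 20 * E₁.q ≤ 1#
      r≤20 = ≤-trans (*-monoʳ _ E₁.nn-q num≤) r≤26

      Δ′-pos : 0# < E₁.Δ
      Δ′-pos = <-≤-trans (pos-^ 2 E₁.q>0) (Near.Δ-lower ti p′ r≤20)

      r²≤ : E₁.q ^ 2 ≤ E (- (197/10 * ix))
      r²≤ = ≤-trans (≈⇒≤ (trans (solve 1 (λ q → q :^ 2 := q :* q) E₁.q) (sym (E-+ _ _)))) (E-mono (≤-trans (≈⇒≤ (solve 1 (λ y → :- y :+ :- y := :- (k 2 :* y)) (π * ti))) (neg-mono (cancel-≤ x>0 (≤-trans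
        (≤-trans (≈⇒≤ (trans (solve 3 (λ x c i → x :* (c :* i) := c :* (x :* i)) x 197/10 ix) (trans (*-cong refl (inv-r x x>0)) (*-identityʳ _)))) (≤-trans (numeric (con (mkℚᵘ (+ 197) 9)) (k 2 :* con (mkℚᵘ (+ 197) 19))) (*-monoˡ (# 2) num≤ π²-lower)))
        (≈⇒≤ (sym (trans (solve 3 (λ a t i → a :* t :* (k 2 :* (a :* i)) := k 2 :* (a :* a) :* (t :* i)) π t ti) (trans (*-cong refl (inv-r t p)) (*-identityʳ _))))))))))

    Δ′>0 : 0# < E₁.Δ
    Δ′>0 = [ (λ h → <-resp refl (sym Δ-transform) (*-pos (pos-^ 12 p) (Large.Δ>0 (<⇒≤ h)))) , (λ h → Small.Δ′-pos (<⇒≤ h)) ]′ (three x>0)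

    T₄>0 : 0# < T₄
    T₄>0 = [ (λ h → pos-^ 4 (Large.θ₄>0 (<⇒≤ h))) , (λ h → <-resp refl (solve 1 (λ a → a :* a :* (a :* a) := a :^ 4) θ₄) (*-pos (sq h) (sq h))) ]′ (three x>0)
      where
      θ₃>0 : 0# < θ₃
      θ₃>0 = <-≤-trans (num< {0ℚᵘ} {1ℚᵘ}) θ₃≥1
      sq : x < ι (mkℚᵘ (+ 3002) 999) → 0# < θ₄ * θ₄
      sq h = <-≤-trans (*-pos (*-pos num< (*-pos (E-pos _) (E-pos _))) (*-pos θ₃>0 θ₃>0)) (below-three₁ x x>0 (<⇒≤ h))

    θ₂⁸>0 : 0# < θ₂ ^ 8
    θ₂⁸>0 = pos-^ 8 θ₂>0

    θ₃⁸>0 : 0# < θ₃ ^ 8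
    θ₃⁸>0 = pos-^ 8 (<-≤-trans (num< {0ℚᵘ} {1ℚᵘ}) θ₃≥1)

    ψ φ : F
    ψ = # 128 * ((T₃ + T₄) * inv (θ₂ ^ 8) θ₂⁸>0 + (T₄ - T₂) * inv (θ₃ ^ 8) θ₃⁸>0)
    φ = # 1728 * (E₁.D ^ 2 * inv E₁.Δ Δ′>0)

    private
      M : F
      M = θ₂ ^ 8 * θ₃ ^ 8

      M>0 : 0# < M
      M>0 = *-pos θ₂⁸>0 θ₃⁸>0

      M≈ : T₂ ^ 2 * T₃ ^ 2 ≈ M
      M≈ = solve 2 (λ a b → (a :^ 4) :^ 2 :* (b :^ 4) :^ 2 := a :^ 8 :* b :^ 8) θ₂ θ₃

      ψ-mult : M * ψ ≈ # 128 * rhs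
      ψ-mult = begin
        θ₂ ^ 8 * θ₃ ^ 8 * ψ
          ≈⟨ solve 7 (λ a b i j x y w → a :* b :* (k 128 :* ((w :+ y) :* i :+ (y :- x) :* j)) := k 128 :* ((w :+ y) :* b :* (a :* i) :+ (y :- x) :* a :* (b :* j))) (θ₂ ^ 8) (θ₃ ^ 8) (inv (θ₂ ^ 8) θ₂⁸>0) (inv (θ₃ ^ 8) θ₃⁸>0) T₂ T₄ T₃ ⟩
        # 128 * ((T₃ + T₄) * θ₃ ^ 8 * (θ₂ ^ 8 * inv (θ₂ ^ 8) θ₂⁸>0) + (T₄ - T₂) * θ₂ ^ 8 * (θ₃ ^ 8 * inv (θ₃ ^ 8) θ₃⁸>0))
          ≈⟨ *-cong refl (+-cong (*-cong (*-cong refl (pow8 θ₃)) (inv-r _ θ₂⁸>0)) (*-cong (*-cong refl (pow8 θ₂)) (inv-r _ θ₃⁸>0))) ⟩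
        # 128 * ((T₃ + T₄) * (T₃ * T₃) * 1# + (T₄ - T₂) * (T₂ * T₂) * 1#)
          ≈⟨ *-cong refl (+-cong (*-cong (*-cong (+-cong (sym T₂+T₄≈T₃) refl) (*-cong (sym T₂+T₄≈T₃) (sym T₂+T₄≈T₃))) refl) refl) ⟩
        # 128 * ((T₂ + T₄ + T₄) * ((T₂ + T₄) * (T₂ + T₄)) * 1# + (T₄ - T₂) * (T₂ * T₂) * 1#)
          ≈⟨ solve 2 (λ x y → k 128 :* ((x :+ y :+ y) :* ((x :+ y) :* (x :+ y)) :* k 1 :+ (y :- x) :* (x :* x) :* k 1) := k 128 :* (y :* (k 5 :* x :^ 2 :+ k 5 :* x :* y :+ k 2 :* y :^ 2))) T₂ T₄ ⟩
        # 128 * rhs ∎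
        where
        pow8 : ∀ a → a ^ 8 ≈ a ^ 4 * a ^ 4
        pow8 = solve 1 (λ a → a :^ 8 := a :^ 4 :* a :^ 4)

    ψ>0 : 0# < ψ
    ψ>0 = pos-cancel M>0 (<-resp refl (sym ψ-mult) (*-pos num< (*-pos T₄>0 (<-≤-trans (*-pos num< (pos-^ 2 T₄>0))
      (by-nn (nn-+ (nn-* (nn-# 5) (nn-^ 2 nn-T₂)) (nn-* (nn-* (nn-# 5) nn-T₂) nn-T₄)) (solve 2 (λ x y → k 5 :* x :^ 2 :+ k 5 :* x :* y :+ k 2 :* y :^ 2 :- k 2 :* y :^ 2 := k 5 :* x :^ 2 :+ k 5 :* x :* y) T₂ T₄))))))

    φ≥0 : 0# ≤ φ
    φ≥0 = nn-* num≤ (nn-* (≤-trans (nn-² E₁.D) (≈⇒≤ (*-cong refl (sym (*-identityʳ _))))) (<⇒≤ (inv-pos _ Δ′>0)))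

    private
      -- Multiplied by `M` and Δ, the gap is 4608 times the right side of `key` plus 1728 `M` times
      -- the slack of `v-bound`. The constants match as 4608 = 36 · 128 and 4608 · 864 = 1728 · 9 ·
      -- 16², the 16² coming from θ₂⁸ = (16qχ₂⁴)².
      gap-large : # 3 ≤ x → 0# < # 36 * ψ - π * π * (t ^ 2 * φ)
      gap-large h = pos-cancel (*-pos M>0 Δ>0) (<-≤-trans (*-pos num< (pos-^ 4 q>0)) (≤-trans (*-monoˡ (# 4608) num≤ key)
          (by-nn (nn-* (nn-* num≤ (<⇒≤ M>0)) (nn-sub v-bound)) (begin
            M * E₀.Δ * (# 36 * ψ - π * π * (t ^ 2 * φ)) - # 4608 * (Y₁ * (# 5 * X₁ ^ 2 + # 5 * X₁ * Y₁ + # 2 * Y₁ ^ 2) * E₀.Δ - # 864 * q ^ 2 * g ^ 2 * χ₂ ^ 8 * Z₁ ^ 2)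
              ≈⟨ +-cong (solve 4 (λ m d s f → m :* d :* (k 36 :* s :- f) := k 36 :* (m :* s) :* d :- m :* (f :* d)) M E₀.Δ ψ (π * π * (t ^ 2 * φ)))
                   (-‿cong (*-cong refl (+-cong (*-cong (*-cong refl (+-cong (+-cong (*-cong refl (^-cong 2 (sym θ₂⁴))) (*-cong (*-cong refl (sym θ₂⁴)) refl)) refl)) refl) refl))) ⟩
            # 36 * (M * ψ) * E₀.Δ - M * (π * π * (t ^ 2 * φ) * E₀.Δ) - # 4608 * (rhs * E₀.Δ - # 864 * q ^ 2 * g ^ 2 * χ₂ ^ 8 * Z₁ ^ 2)
              ≈⟨ +-cong (+-cong (*-cong (*-cong refl ψ-mult) refl) (-‿cong (*-cong refl φ-mult))) refl ⟩
            # 36 * (# 128 * rhs) * E₀.Δ - M * (# 1728 * v ^ 2) - # 4608 * (rhs * E₀.Δ - # 864 * q ^ 2 * g ^ 2 * χ₂ ^ 8 * Z₁ ^ 2)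
              ≈⟨ solve 8 (λ s d m v q g c z → k 36 :* (k 128 :* s) :* d :- m :* (k 1728 :* v :^ 2) :- k 4608 :* (s :* d :- k 864 :* q :^ 2 :* g :^ 2 :* c :^ 8 :* z :^ 2) := k 15552 :* ((k 16 :* q :* c :^ 4) :^ 2 :* z :^ 2) :* g :^ 2 :- m :* (k 1728 :* v :^ 2)) rhs E₀.Δ M v q g χ₂ Z₁ ⟩
            # 15552 * (X₁ ^ 2 * Z₁ ^ 2) * g ^ 2 - M * (# 1728 * v ^ 2)
              ≈⟨ +-cong (*-cong (*-cong refl (trans (*-cong (^-cong 2 (sym θ₂⁴)) refl) M≈)) refl) refl ⟩
            # 15552 * M * g ^ 2 - M * (# 1728 * v ^ 2)
              ≈⟨ solve 3 (λ m v g → k 15552 :* m :* g :^ 2 :- m :* (k 1728 :* v :^ 2) := k 1728 :* m :* (k 9 :* g :^ 2 :- v :^ 2)) M v g ⟩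
            # 1728 * M * (# 9 * g ^ 2 - v ^ 2) ∎))))
        where
        open Large h
        g = # 2 * e₄ t p - E₀.D
        φ-mult : π * π * (t ^ 2 * φ) * E₀.Δ ≈ # 1728 * v ^ 2
        φ-mult = begin
          π * π * (t ^ 2 * (# 1728 * (E₁.D ^ 2 * inv E₁.Δ Δ′>0))) * E₀.Δ
            ≈⟨ solve 5 (λ a t d i e → a :* a :* (t :^ 2 :* (k 1728 :* (d :^ 2 :* i))) :* e := k 1728 :* t :^ 2 :* (a :* d) :^ 2 :* i :* e) π t E₁.D (inv E₁.Δ Δ′>0) E₀.Δ ⟩
          # 1728 * t ^ 2 * (π * E₁.D) ^ 2 * inv E₁.Δ Δ′>0 * E₀.Δ
            ≈⟨ *-cong (*-cong (*-cong refl (^-cong 2 D-transform)) refl) refl ⟩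
          # 1728 * t ^ 2 * (t ^ 5 * v) ^ 2 * inv E₁.Δ Δ′>0 * E₀.Δ
            ≈⟨ solve 4 (λ t v i e → k 1728 :* t :^ 2 :* (t :^ 5 :* v) :^ 2 :* i :* e := k 1728 :* v :^ 2 :* ((t :^ 12 :* e) :* i)) t v (inv E₁.Δ Δ′>0) E₀.Δ ⟩
          # 1728 * v ^ 2 * ((t ^ 12 * E₀.Δ) * inv E₁.Δ Δ′>0)
            ≈⟨ *-cong refl (trans (*-cong (sym Δ-transform) refl) (inv-r _ Δ′>0)) ⟩
          # 1728 * v ^ 2 * 1#
            ≈⟨ *-identityʳ _ ⟩
          # 1728 * v ^ 2 ∎

      gap-small : x ≤ ι (mkℚᵘ (+ 3002) 999) → 0# < # 36 * ψ - π * π * (t ^ 2 * φ)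
      gap-small h = <-≤-trans (*-pos (num< {0ℚᵘ} {mkℚᵘ (+ 594) 0}) (*-pos (*-pos x>0 x>0) (E-pos _))) (by-nn (nn-+ (nn-* (nn-# 36) (nn-sub ψ≥)) (nn-* (nn-² x) (nn-sub φ≤)))
          (solve 5 (λ s a t f e → k 36 :* s :- a :* a :* (t :^ 2 :* f) :- k 594 :* (a :* t :* (a :* t) :* e) := k 36 :* (s :- con (mkℚᵘ (+ 33033) 1) :* (a :* t :* (a :* t) :* e)) :+ a :* t :* (a :* t) :* (k 594000 :* e :- f)) ψ π t φ e))
        where
        open Small h
        e = E (- (197/10 * ix))
        ψ≥ : ι (mkℚᵘ (+ 33033) 1) * (x * x * e) ≤ ψ
        ψ≥ = cancel-≤ M>0 (≤-trans (≈⇒≤ (trans (*-comm M _) (*-cong refl (sym M≈)))) (≤-trans (below-three₃ x x>0 h) (≈⇒≤ (sym ψ-mult))))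
        φ≤ : φ ≤ # 594000 * e
        φ≤ = cancel-≤ Δ′>0 (≤-trans (≈⇒≤ (trans (solve 3 (λ d n i → d :* (k 1728 :* (n :* i)) := k 1728 :* n :* (d :* i)) E₁.Δ (E₁.D ^ 2) (inv E₁.Δ Δ′>0)) (trans (*-cong refl (inv-r _ Δ′>0)) (*-identityʳ _))))
          (≤-trans (φ-bound ti p′ r≤26 r≤20) (≤-trans (*-monoʳ E₁.Δ (<⇒≤ Δ′>0) (*-monoˡ (# 594000) num≤ r²≤)) (≈⇒≤ (*-comm _ _)))))

    gap : 0# < # 36 * ψ - π * π * (t ^ 2 * φ)
    gap = [ (λ h → gap-large (<⇒≤ h)) , (λ h → gap-small (<⇒≤ h)) ]′ (three x>0)

-- The Cauchy reals form a complete ordered field.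

module ConstructiveReals where

  open Defs hiding (A; B)

  fromℚᵘ-mono-< : ∀ {p q} → p ℚᵘ.< q → fromℚᵘ p ℚ.< fromℚᵘ q
  fromℚᵘ-mono-< {p} {q} p<q = ℚₚ.toℚᵘ-cancel-< (ℚᵘₚ.<-respˡ-≃ (ℚᵘₚ.≃-sym (ℚₚ.toℚᵘ-fromℚᵘ p)) (ℚᵘₚ.<-respʳ-≃ (ℚᵘₚ.≃-sym (ℚₚ.toℚᵘ-fromℚᵘ q)) p<q))

  fromℚᵘ-+ : ∀ p q → fromℚᵘ (p ℚᵘ.+ q) ≡ fromℚᵘ p ℚ.+ fromℚᵘ q
  fromℚᵘ-+ p q = ℚₚ.toℚᵘ-injective (ℚᵘₚ.≃-trans (ℚₚ.toℚᵘ-fromℚᵘ _) (ℚᵘₚ.≃-sym (ℚᵘₚ.≃-trans (ℚₚ.toℚᵘ-homo-+ (fromℚᵘ p) (fromℚᵘ q)) (ℚᵘₚ.+-cong (ℚₚ.toℚᵘ-fromℚᵘ p) (ℚₚ.toℚᵘ-fromℚᵘ q)))))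

  fromℚᵘ-* : ∀ p q → fromℚᵘ (p ℚᵘ.* q) ≡ fromℚᵘ p ℚ.* fromℚᵘ q
  fromℚᵘ-* p q = ℚₚ.toℚᵘ-injective (ℚᵘₚ.≃-trans (ℚₚ.toℚᵘ-fromℚᵘ _) (ℚᵘₚ.≃-sym (ℚᵘₚ.≃-trans (ℚₚ.toℚᵘ-homo-* (fromℚᵘ p) (fromℚᵘ q)) (ℚᵘₚ.*-cong (ℚₚ.toℚᵘ-fromℚᵘ p) (ℚₚ.toℚᵘ-fromℚᵘ q)))))

  fromℚᵘ-neg : ∀ p → fromℚᵘ (ℚᵘ.- p) ≡ ℚ.- fromℚᵘ p
  fromℚᵘ-neg p = ℚₚ.toℚᵘ-injective (ℚᵘₚ.≃-trans (ℚₚ.toℚᵘ-fromℚᵘ _) (ℚᵘₚ.≃-sym (ℚᵘₚ.≃-trans (ℚₚ.toℚᵘ-homo‿- (fromℚᵘ p)) (ℚᵘₚ.-‿cong (ℚₚ.toℚᵘ-fromℚᵘ p)))))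

  -- With the rationals as an instance, the order lemmas and `solve` also serve for termwise
  -- estimates of Cauchy sequences.
  ℚ-field : OrderedField
  ℚ-field = record
    { F = ℚ ; _≈_ = _≡_ ; _<_ = ℚ._<_ ; _+_ = ℚ._+_ ; _*_ = ℚ._*_ ; -_ = ℚ.-_ ; ι = fromℚᵘ
    ; isCommutativeRing = ℚₚ.+-*-isCommutativeRing
    ; <-resp = λ { ≡.refl ≡.refl p → p }
    ; <-irrefl = ℚₚ.<-irrefl ≡.refl
    ; <-cotrans = cotrans
    ; <-trans = ℚₚ.<-trans
    ; +-mono-<ˡ = λ z → ℚₚ.+-monoʳ-< z
    ; *-pos = *-pos
    ; tight = λ p q → ℚₚ.≤-antisym (ℚₚ.≮⇒≥ q) (ℚₚ.≮⇒≥ p)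
    ; inv = λ x p → inverse x (positive p)
    ; inv-r = λ x p → ℚₚ.*-inverseʳ x {{ℚₚ.pos⇒nonZero x {{positive p}}}}
    ; inv-pos = λ x p → ℚₚ.positive⁻¹ _ {{ℚₚ.1/pos⇒pos x {{positive p}}}}
    ; ι-cong = ℚₚ.fromℚᵘ-cong
    ; ι-+ = fromℚᵘ-+ ; ι-* = fromℚᵘ-* ; ι-neg = fromℚᵘ-neg ; ι-< = fromℚᵘ-mono-<
    ; archimedean = archimedean
    }
    where
    cotrans : ∀ {x y} → x ℚ.< y → ∀ z → x ℚ.< z ⊎ z ℚ.< y
    cotrans {x} {y} p z with x ℚₚ.<? z
    ... | yes q = inj₁ q
    ... | no  q = inj₂ (ℚₚ.≤-<-trans (ℚₚ.≮⇒≥ q) p)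
    *-pos : ∀ {x y} → 0ℚ ℚ.< x → 0ℚ ℚ.< y → 0ℚ ℚ.< x ℚ.* y
    *-pos {x} {y} p q = ℚₚ.positive⁻¹ _ {{ℚₚ.pos*pos⇒pos x {{positive p}} y {{positive q}}}}
    inverse : ∀ x → ℚ.Positive x → ℚ
    inverse x p = (ℚ.1/ x) {{ℚₚ.pos⇒nonZero x {{p}}}}
    archimedean : ∀ x → ∃[ n ] x ℚ.< fromℚᵘ (mkℚᵘ (+ n) 0)
    archimedean x@(ℚ.mkℚ a b _) = suc ℤ.∣ a ∣ , ℚₚ.toℚᵘ-cancel-< (ℚᵘₚ.<-respʳ-≃ (ℚᵘₚ.≃-sym (ℚₚ.toℚᵘ-fromℚᵘ (mkℚᵘ (+ suc ℤ.∣ a ∣) 0)))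
      (*<* (ℤₚ.≤-<-trans (ℤₚ.≤-trans (ℤₚ.≤-reflexive (ℤₚ.*-identityʳ a)) (i≤∣i∣ a)) (ℤ.+<+ (ℕₚ.m≤m*n (suc ℤ.∣ a ∣) (suc b))))))
      where
      i≤∣i∣ : ∀ i → i ℤ.≤ + ℤ.∣ i ∣
      i≤∣i∣ (+ n)    = ℤₚ.≤-refl
      i≤∣i∣ -[1+ n ] = ℤ.-≤+

  module Q = Order ℚ-field
  open Q using (Bnd; k; :½; _:+_; _:*_; _:-_; :-_; _:=_; solve; con)

  Eventually : (ℕ → Set) → Set
  Eventually P = ∃[ N ] (∀ n → N ℕ.≤ n → P n)

  both : ∀ {P S T : ℕ → Set} → Eventually P → Eventually S → (∀ n → P n → S n → T n) → Eventually T
  both (M , p) (N , s) f = M ℕ.⊔ N , λ n h → f n (p n (ℕₚ.m⊔n≤o⇒m≤o M N h)) (s n (ℕₚ.m⊔n≤o⇒n≤o M N h))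

  absurd : ∀ {P : ℕ → Set} {A : Set} → Eventually P → (∀ n → ¬ P n) → A
  absurd (N , p) f = ⊥-elim (f N (p N ℕₚ.≤-refl))

  to≤ : ∀ {p q} → p Q.≤ q → p ℚ.≤ q
  to≤ = ℚₚ.≮⇒≥

  from≤ : ∀ {p q} → p ℚ.≤ q → p Q.≤ q
  from≤ p≤q q<p = ℚₚ.<-irrefl ≡.refl (ℚₚ.≤-<-trans p≤q q<p)

  abs⇒Bnd : ∀ {x ε} → ℚ.∣ x ∣ ℚ.< ε → Bnd ε x
  abs⇒Bnd {x} {ε} h = Q.≤-resp ≡.refl (solve 1 (λ x → :- :- x := x) x) (Q.neg-mono (from≤ (ℚₚ.≤-trans (ℚₚ.≤-trans (p≤ (ℚ.- x)) (ℚₚ.≤-reflexive (ℚₚ.∣-p∣≡∣p∣ x))) (ℚₚ.<⇒≤ h)))) ,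
    from≤ (ℚₚ.≤-trans (p≤ x) (ℚₚ.<⇒≤ h))
    where
    p≤ : ∀ x → x ℚ.≤ ℚ.∣ x ∣
    p≤ x with ℚₚ.≤-total 0ℚ x
    ... | inj₁ h = ℚₚ.≤-reflexive (≡.sym (ℚₚ.0≤p⇒∣p∣≡p h))
    ... | inj₂ h = ℚₚ.≤-trans h (ℚₚ.0≤∣p∣ x)

  half< : ∀ {ε} → 0ℚ ℚ.< ε → Q.½ ℚ.* ε ℚ.< ε
  half< {ε} p = Q.by-pos (Q.*-pos {Q.½} (Q.num< {0ℚᵘ} {mkℚᵘ (+ 1) 1}) p) (solve 1 (λ e → e :- :½ :* e := :½ :* e) ε)

  half-pos : ∀ {ε} → 0ℚ ℚ.< ε → 0ℚ ℚ.< Q.½ ℚ.* ε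
  half-pos p = Q.*-pos {Q.½} (Q.num< {0ℚᵘ} {mkℚᵘ (+ 1) 1}) p

  Bnd⇒abs : ∀ {x ε} → 0ℚ ℚ.< ε → Bnd (Q.½ ℚ.* ε) x → ℚ.∣ x ∣ ℚ.< ε
  Bnd⇒abs {x} {ε} p (l , u) with ℚₚ.∣p∣≡p∨∣p∣≡-p x
  ... | inj₁ e = ≡.subst (ℚ._< ε) (≡.sym e) (Q.≤-<-trans u (half< p))
  ... | inj₂ e = ≡.subst (ℚ._< ε) (≡.sym e) (Q.≤-<-trans (Q.≤-resp ≡.refl (solve 1 (λ x → :- :- x := x) _) (Q.neg-mono l)) (half< p))

  near : ∀ x {ε} → 0ℚ ℚ.< ε → ∃[ N ] (∀ m n → N ℕ.≤ m → N ℕ.≤ n → Bnd ε (seq x m ℚ.- seq x n))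
  near x p = proj₁ c , λ m n hm hn → abs⇒Bnd (proj₂ c m n hm hn)
    where c = cauchy x _ p

  isCauchy : ∀ {s : ℕ → ℚ} → (∀ {ε} → 0ℚ ℚ.< ε → ∃[ N ] (∀ m n → N ℕ.≤ m → N ℕ.≤ n → Bnd ε (s m ℚ.- s n))) → IsCauchy s
  isCauchy h ε p = proj₁ c , λ m n hm hn → Bnd⇒abs p (proj₂ c m n hm hn)
    where c = h (half-pos p)

  -- A positive, sequencewise description of the negated order; the next two lemmas show it
  -- equivalent to ¬ (y <ℝ x).
  _≲_ : ℝ → ℝ → Set
  x ≲ y = ∀ {ε} → 0ℚ ℚ.< ε → Eventually λ n → seq x n Q.≤ seq y n ℚ.+ ε

  ≮⇒≲ : ∀ {x y} → ¬ (y <ℝ x) → x ≲ y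
  ≮⇒≲ {x} {y} h {ε} p = N , λ n hn y+ε<x → h (Q.½ ℚ.* ε , half-pos p , N , λ m hm → to≤
      (Q.by-nn (Q.nn-+ (Q.nn-+ (Q.nn-sub (proj₂ (proj₂ cy m n (ℕₚ.m⊔n≤o⇒n≤o M M′ hm) (ℕₚ.m⊔n≤o⇒n≤o M M′ hn)))) (Q.nn-sub (proj₁ (proj₂ cx m n (ℕₚ.m⊔n≤o⇒m≤o M M′ hm) (ℕₚ.m⊔n≤o⇒m≤o M M′ hn))))) (Q.nn-sub (Q.<⇒≤ y+ε<x)))
        (solve 5 (λ xm ym xn yn e → xm :- (ym :+ :½ :* e) := (:½ :* (:½ :* e) :- (ym :- yn)) :+ (xm :- xn :- :- (:½ :* (:½ :* e))) :+ (xn :- (yn :+ e))) (seq x m) (seq y m) (seq x n) (seq y n) ε)))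
    where
    cx = near x (half-pos (half-pos p))
    cy = near y (half-pos (half-pos p))
    M = proj₁ cx
    M′ = proj₁ cy
    N = M ℕ.⊔ M′

  ≲⇒≮ : ∀ {x y} → x ≲ y → ¬ (y <ℝ x)
  ≲⇒≮ {x} {y} h (ε , p , lt) = absurd (both lt (h (half-pos p)) (λ _ a b → a , b)) (λ n (a , b) → Q.≤-trans (from≤ a) b (Q.by-pos (half-pos p)
      (solve 2 (λ y e → y :+ e :- (y :+ :½ :* e) := :½ :* e) (seq y n) ε)))

  ≈-by : ∀ {x y} → (∀ {ε} → 0ℚ ℚ.< ε → Eventually λ n → Bnd ε (seq x n ℚ.- seq y n)) → x ≈ℝ y
  ≈-by h ε p = proj₁ c , λ n hn → Bnd⇒abs p (proj₂ c n hn)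
    where c = h (half-pos p)

  ≈-out : ∀ {x y ε} → x ≈ℝ y → 0ℚ ℚ.< ε → Eventually λ n → Bnd ε (seq x n ℚ.- seq y n)
  ≈-out {ε = ε} h p = proj₁ c , λ n hn → abs⇒Bnd (proj₂ c n hn)
    where c = h ε p

  pointwise : ∀ {x y} → (∀ n → seq x n ≡ seq y n) → x ≈ℝ y
  pointwise {x} {y} h = ≈-by {x} {y} λ p → 0 , λ n _ → Q.Bnd-mono (Q.<⇒≤ p) (Q.Bnd-resp ≡.refl (≡.sym (≡.trans (≡.cong (ℚ._- seq y n) (h n)) (ℚₚ.+-inverseʳ (seq y n)))) (Q.Bnd-refl Q.≤-refl))

  ℝ-sym : ∀ {x y} → x ≈ℝ y → y ≈ℝ x
  ℝ-sym {x} {y} h = ≈-by {y} {x} λ p → proj₁ (≈-out {x} {y} h p) , λ n hn → Q.Bnd-swap {x = seq x n} {y = seq y n} (proj₂ (≈-out {x} {y} h p) n hn)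

  ℝ-trans : ∀ {x y z} → x ≈ℝ y → y ≈ℝ z → x ≈ℝ z
  ℝ-trans {x} {y} {z} h g = ≈-by {x} {z} λ {ε} p → both (≈-out {x} {y} h (half-pos p)) (≈-out {y} {z} g (half-pos p)) λ n a b →
    Q.Bnd-resp (solve 1 (λ e → :½ :* e :+ :½ :* e := e) ε) (solve 3 (λ x y z → x :- y :+ (y :- z) := x :- z) (seq x n) (seq y n) (seq z n)) (Q.Bnd-+ a b)

  ℝ-+-cong : ∀ {x y u v} → x ≈ℝ y → u ≈ℝ v → x +ℝ u ≈ℝ y +ℝ v
  ℝ-+-cong {x} {y} {u} {v} h g = ≈-by {x +ℝ u} {y +ℝ v} λ {ε} p → both (≈-out {x} {y} h (half-pos p)) (≈-out {u} {v} g (half-pos p)) λ n a b →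
    Q.Bnd-resp (solve 1 (λ e → :½ :* e :+ :½ :* e := e) ε) (solve 4 (λ x y u v → x :- y :+ (u :- v) := x :+ u :- (y :+ v)) (seq x n) (seq y n) (seq u n) (seq v n)) (Q.Bnd-+ a b)

  ℝ-neg-cong : ∀ {x y} → x ≈ℝ y → -ℝ x ≈ℝ -ℝ y
  ℝ-neg-cong {x} {y} h = ≈-by { -ℝ x} { -ℝ y} λ p → proj₁ (≈-out {x} {y} h p) , λ n hn →
    Q.Bnd-resp ≡.refl (solve 2 (λ x y → :- (x :- y) := :- x :- :- y) (seq x n) (seq y n)) (Q.Bnd-neg (proj₂ (≈-out {x} {y} h p) n hn))

  eventuallyBounded : ∀ x → ∃[ m ] Eventually λ n → Bnd (Q.# m) (seq x n)
  eventuallyBounded x = m ℕ.+ 1 , N , λ n hn → Q.Bnd-resp (≡.sym (Q.#-+ m 1)) (solve 2 (λ a b → b :+ (a :- b) := a) (seq x n) (seq x N)) (Q.Bnd-+ (proj₂ b) (proj₂ c n N hn ℕₚ.≤-refl))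
    where
    c = near x (Q.num< {0ℚᵘ} {1ℚᵘ})
    N = proj₁ c
    b = Q.absBound (seq x N)
    m = proj₁ b

  ℝ-*-cong : ∀ {x y u v} → x ≈ℝ y → u ≈ℝ v → x *ℝ u ≈ℝ y *ℝ v
  ℝ-*-cong {x} {y} {u} {v} h g = ≈-by {x *ℝ u} {y *ℝ v} go
    where
    B = proj₁ (eventuallyBounded y)
    C = proj₁ (eventuallyBounded u)
    S = Q.# suc (B ℕ.+ C)
    S>0 = Q.pos-# (B ℕ.+ C)
    go : ∀ {ε} → 0ℚ ℚ.< ε → Eventually λ n → Bnd ε (seq (x *ℝ u) n ℚ.- seq (y *ℝ v) n)
    go {ε} p = both (both (≈-out {x} {y} h η>0) (≈-out {u} {v} g η>0) (λ _ a b → a , b)) (both (proj₂ (eventuallyBounded y)) (proj₂ (eventuallyBounded u)) (λ _ a b → a , b)) λ n (a , b) (c , d) →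
        Q.Bnd-mono (Q.≤-trans (Q.≈⇒≤ (≡.trans (solve 3 (λ e b c → e :* c :+ b :* e := e :* (b :+ c)) η (Q.# B) (Q.# C)) (≡.cong (η ℚ.*_) (≡.sym (Q.#-+ B C))))) (Q.≤-trans (Q.*-monoˡ η (Q.<⇒≤ η>0) (Q.#-≤ (ℕₚ.n≤1+n (B ℕ.+ C)))) (Q.≈⇒≤ ηS)))
          (Q.Bnd-resp ≡.refl (solve 4 (λ x y u v → (x :- y) :* u :+ y :* (u :- v) := x :* u :- y :* v) (seq x n) (seq y n) (seq u n) (seq v n)) (Q.Bnd-+ (Q.Bnd-* a d) (Q.Bnd-* c b)))
      where
      η = ε ℚ.* Q.inv S S>0
      η>0 : 0ℚ ℚ.< η
      η>0 = Q.*-pos p (Q.inv-pos S S>0)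
      ηS : η ℚ.* S ≡ ε
      ηS = ≡.trans (ℚₚ.*-assoc ε _ S) (≡.trans (≡.cong (ε ℚ.*_) (Q.inv-l S S>0)) (ℚₚ.*-identityʳ ε))

  ιℝ : ℚᵘ → ℝ
  ιℝ p = fromℚ (fromℚᵘ p)

  ℝ-isCommutativeRing : IsCommutativeRing _≈ℝ_ _+ℝ_ _*ℝ_ -ℝ_ (ιℝ 0ℚᵘ) (ιℝ 1ℚᵘ)
  ℝ-isCommutativeRing = record
    { isRing = record
      { +-isAbelianGroup = record
        { isGroup = record
          { isMonoid = record
            { isSemigroup = record
              { isMagma = record { isEquivalence = record { refl = λ {x} → pointwise {x} {x} λ _ → ≡.refl ; sym = λ {x} {y} → ℝ-sym {x} {y} ; trans = λ {x} {y} {z} → ℝ-trans {x} {y} {z} } ; ∙-cong = λ {x} {y} {u} {v} → ℝ-+-cong {x} {y} {u} {v} }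
              ; assoc = λ x y z → pointwise {(x +ℝ y) +ℝ z} {x +ℝ (y +ℝ z)} λ n → ℚₚ.+-assoc (seq x n) (seq y n) (seq z n) }
            ; identity = (λ x → pointwise {ιℝ 0ℚᵘ +ℝ x} {x} λ n → ℚₚ.+-identityˡ (seq x n)) , (λ x → pointwise {x +ℝ ιℝ 0ℚᵘ} {x} λ n → ℚₚ.+-identityʳ (seq x n)) }
          ; inverse = (λ x → pointwise {(-ℝ x) +ℝ x} {ιℝ 0ℚᵘ} λ n → ℚₚ.+-inverseˡ (seq x n)) , (λ x → pointwise {x +ℝ (-ℝ x)} {ιℝ 0ℚᵘ} λ n → ℚₚ.+-inverseʳ (seq x n))
          ; ⁻¹-cong = λ {x} {y} → ℝ-neg-cong {x} {y} }
        ; comm = λ x y → pointwise {x +ℝ y} {y +ℝ x} λ n → ℚₚ.+-comm (seq x n) (seq y n) }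
      ; *-cong = λ {x} {y} {u} {v} → ℝ-*-cong {x} {y} {u} {v}
      ; *-assoc = λ x y z → pointwise {(x *ℝ y) *ℝ z} {x *ℝ (y *ℝ z)} λ n → ℚₚ.*-assoc (seq x n) (seq y n) (seq z n)
      ; *-identity = (λ x → pointwise {ιℝ 1ℚᵘ *ℝ x} {x} λ n → ℚₚ.*-identityˡ (seq x n)) , (λ x → pointwise {x *ℝ ιℝ 1ℚᵘ} {x} λ n → ℚₚ.*-identityʳ (seq x n))
      ; distrib = (λ x y z → pointwise {x *ℝ (y +ℝ z)} {x *ℝ y +ℝ x *ℝ z} λ n → ℚₚ.*-distribˡ-+ (seq x n) (seq y n) (seq z n)) , (λ x y z → pointwise {(y +ℝ z) *ℝ x} {y *ℝ x +ℝ z *ℝ x} λ n → ℚₚ.*-distribʳ-+ (seq x n) (seq y n) (seq z n)) }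
    ; *-comm = λ x y → pointwise {x *ℝ y} {y *ℝ x} λ n → ℚₚ.*-comm (seq x n) (seq y n) }

  <ℝ-by : ∀ {x y ε} → 0ℚ ℚ.< ε → Eventually (λ n → seq x n ℚ.+ ε Q.≤ seq y n) → x <ℝ y
  <ℝ-by p (N , h) = _ , p , N , λ n hn → to≤ (h n hn)

  <ℝ-resp : ∀ {x y u v} → x ≈ℝ u → y ≈ℝ v → x <ℝ y → u <ℝ v
  <ℝ-resp {x} {y} {u} {v} h g (ε , p , lt) = <ℝ-by {u} {v} (half-pos p) (both (both (≈-out {x} {u} h q) (≈-out {y} {v} g q) (λ _ a b → a , b)) lt λ n (a , b) c →
      Q.by-nn (Q.nn-+ (Q.nn-+ (Q.nn-sub (proj₁ a)) (Q.nn-sub (proj₂ b))) (Q.nn-sub (from≤ c)))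
        (solve 5 (λ x y u v e → v :- (u :+ :½ :* e) := (x :- u :- :- (:½ :* (:½ :* e))) :+ (:½ :* (:½ :* e) :- (y :- v)) :+ (y :- (x :+ e))) (seq x n) (seq y n) (seq u n) (seq v n) ε))
    where
    q = half-pos (half-pos p)

  <ℝ-cotrans : ∀ {x y} → x <ℝ y → ∀ z → x <ℝ z ⊎ z <ℝ y
  <ℝ-cotrans {x} {y} (ε , p , L , lt) z = go (seq x N ℚ.+ Q.½ ℚ.* ε ℚₚ.≤? seq z N)
    where
    η = Q.½ ℚ.* (Q.½ ℚ.* (Q.½ ℚ.* ε))
    η>0 = half-pos (half-pos (half-pos p))
    cx = near x η>0
    cz = near z η>0
    N = proj₁ cx ℕ.⊔ (proj₁ cz ℕ.⊔ L)
    Nx : ∀ {n} → N ℕ.≤ n → proj₁ cx ℕ.≤ n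
    Nx = ℕₚ.m⊔n≤o⇒m≤o (proj₁ cx) _
    Nz : ∀ {n} → N ℕ.≤ n → proj₁ cz ℕ.≤ n
    Nz h = ℕₚ.m⊔n≤o⇒m≤o (proj₁ cz) L (ℕₚ.m⊔n≤o⇒n≤o (proj₁ cx) _ h)
    NL : ∀ {n} → N ℕ.≤ n → L ℕ.≤ n
    NL h = ℕₚ.m⊔n≤o⇒n≤o (proj₁ cz) L (ℕₚ.m⊔n≤o⇒n≤o (proj₁ cx) _ h)
    :η : ∀ {n} → Q.Expr n → Q.Expr n
    :η e = :½ :* (:½ :* (:½ :* e))
    go : _ → x <ℝ z ⊎ z <ℝ y
    go (yes h) = inj₁ (<ℝ-by {x} {z} (half-pos (half-pos p)) (N , λ n hn →
      Q.by-nn (Q.nn-+ (Q.nn-+ (Q.nn-sub (proj₂ (proj₂ cx n N (Nx hn) (Nx ℕₚ.≤-refl)))) (Q.nn-sub (proj₁ (proj₂ cz n N (Nz hn) (Nz ℕₚ.≤-refl))))) (Q.nn-sub (from≤ h)))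
        (solve 5 (λ x z a c e → z :- (x :+ :½ :* (:½ :* e)) := (:η e :- (x :- a)) :+ (z :- c :- :- :η e) :+ (c :- (a :+ :½ :* e))) (seq x n) (seq z n) (seq x N) (seq z N) ε)))
    go (no h) = inj₂ (<ℝ-by {z} {y} (half-pos (half-pos p)) (N , λ n hn →
      Q.by-nn (Q.nn-+ (Q.nn-+ (Q.nn-+ (Q.nn-sub (proj₁ (proj₂ cx n N (Nx hn) (Nx ℕₚ.≤-refl)))) (Q.nn-sub (proj₂ (proj₂ cz n N (Nz hn) (Nz ℕₚ.≤-refl))))) (Q.nn-sub (Q.<⇒≤ (ℚₚ.≰⇒> h)))) (Q.nn-sub (from≤ (lt n (NL hn)))))
        (solve 6 (λ x y z a c e → y :- (z :+ :½ :* (:½ :* e)) := (x :- a :- :- :η e) :+ (:η e :- (z :- c)) :+ (a :+ :½ :* e :- c) :+ (y :- (x :+ e))) (seq x n) (seq y n) (seq z n) (seq x N) (seq z N) ε)))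

  module Inverse (x : ℝ) (x>0 : ιℝ 0ℚᵘ <ℝ x) where
    ε : ℚ
    ε = proj₁ x>0
    p : 0ℚ ℚ.< ε
    p = proj₁ (proj₂ x>0)
    N : ℕ
    N = proj₁ (proj₂ (proj₂ x>0))

    low : ∀ n → N ℕ.≤ n → ε ℚ.≤ seq x n
    low n h = ≡.subst (ℚ._≤ seq x n) (ℚₚ.+-identityˡ ε) (proj₂ (proj₂ (proj₂ x>0)) n h)

    pos : ∀ n → 0ℚ ℚ.< seq x n ℚ.⊔ ε
    pos n = ℚₚ.<-≤-trans p (ℚₚ.p≤q⊔p (seq x n) ε)

    -- The maximum with the lower bound ε makes every entry invertible and alters only entries
    -- before N.
    i : ℕ → ℚ
    i n = Q.inv (seq x n ℚ.⊔ ε) (pos n)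

    i-inv : ∀ n → N ℕ.≤ n → seq x n ℚ.* i n ≡ 1ℚ
    i-inv n h = ≡.trans (≡.cong (ℚ._* i n) (≡.sym (ℚₚ.p≥q⇒p⊔q≡p (low n h)))) (Q.inv-r _ (pos n))

    i-bound : ∀ n → Bnd (Q.inv ε p) (i n)
    i-bound n = Q.Bnd-of (Q.<⇒≤ (Q.inv-pos _ (pos n))) (Q.inv-anti p (pos n) (from≤ (ℚₚ.p≤q⊔p (seq x n) ε)))

    i-cauchy : IsCauchy i
    i-cauchy = isCauchy {i} λ {η} q → let c = near x (*-pos (*-pos q p) p) in N ℕ.⊔ proj₁ c , λ m n hm hn →
      Q.Bnd-resp (≡.trans (solve 3 (λ j e h → j :* j :* (h :* e :* e) := h :* ((e :* j) :* (e :* j))) (Q.inv ε p) ε η) (≡.trans (≡.cong (λ z → η ℚ.* (z ℚ.* z)) (Q.inv-r ε p)) (ℚₚ.*-identityʳ η)))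
        (≡.trans (solve 4 (λ a b j l → j :* l :* (b :- a) := (b :* l) :* j :- (a :* j) :* l) (seq x m) (seq x n) (i m) (i n))
          (≡.trans (≡.cong₂ (λ u v → u ℚ.* i m ℚ.- v ℚ.* i n) (i-inv n (ℕₚ.m⊔n≤o⇒m≤o N _ hn)) (i-inv m (ℕₚ.m⊔n≤o⇒m≤o N _ hm))) (≡.cong₂ ℚ._-_ (ℚₚ.*-identityˡ (i m)) (ℚₚ.*-identityˡ (i n)))))
        (Q.Bnd-* (Q.Bnd-* (i-bound m) (i-bound n)) (proj₂ c n m (ℕₚ.m⊔n≤o⇒n≤o N _ hn) (ℕₚ.m⊔n≤o⇒n≤o N _ hm)))
      where
      *-pos : ∀ {x y} → 0ℚ ℚ.< x → 0ℚ ℚ.< y → 0ℚ ℚ.< x ℚ.* y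
      *-pos = Q.*-pos

    inverse : ℝ
    inverse = mkℝ i i-cauchy

    inverse-r : x *ℝ inverse ≈ℝ ιℝ 1ℚᵘ
    inverse-r = ≈-by {x *ℝ inverse} {ιℝ 1ℚᵘ} λ q → N , λ n h → Q.Bnd-mono (Q.<⇒≤ q) (Q.Bnd-resp ≡.refl (≡.sym (≡.trans (≡.cong (ℚ._- 1ℚ) (i-inv n h)) (ℚₚ.+-inverseʳ 1ℚ))) (Q.Bnd-refl Q.≤-refl))

    inverse-pos : ιℝ 0ℚᵘ <ℝ inverse
    inverse-pos = <ℝ-by {ιℝ 0ℚᵘ} {inverse} (Q.inv-pos B B>0) (both (proj₂ b) (N , λ _ h → h) λ n c h →
      Q.≤-resp (≡.sym (ℚₚ.+-identityˡ _)) ≡.refl (Q.inv-anti (pos n) B>0 (Q.≤-trans (Q.≈⇒≤ (ℚₚ.p≥q⇒p⊔q≡p (low n h))) (Q.≤-trans (proj₂ c) (Q.#-≤ (ℕₚ.n≤1+n (proj₁ b)))))))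
      where
      b = eventuallyBounded x
      B = Q.# suc (proj₁ b)
      B>0 = Q.pos-# (proj₁ b)

  ℝ-ordered : OrderedField
  ℝ-ordered = record
    { F = ℝ ; _≈_ = _≈ℝ_ ; _<_ = _<ℝ_ ; _+_ = _+ℝ_ ; _*_ = _*ℝ_ ; -_ = -ℝ_ ; ι = ιℝ
    ; isCommutativeRing = ℝ-isCommutativeRing
    ; <-resp = λ {x} {y} {u} {v} → <ℝ-resp {x} {y} {u} {v}
    ; <-irrefl = λ {x} (ε , p , lt) → absurd {λ n → seq x n ℚ.+ ε ℚ.≤ seq x n} lt λ n h → from≤ h (Q.by-pos p (solve 2 (λ x e → x :+ e :- x := e) (seq x n) ε))
    ; <-cotrans = λ {x} {y} → <ℝ-cotrans {x} {y}
    ; <-trans = λ {x} {y} {z} (ε , p , lt) (η , q , lt′) → <ℝ-by {x} {z} p (both lt lt′ λ n a b →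
        Q.by-nn (Q.nn-+ (Q.nn-+ (Q.nn-sub (from≤ a)) (Q.nn-sub (from≤ b))) (Q.<⇒≤ q)) (solve 5 (λ x y z e h → z :- (x :+ e) := (y :- (x :+ e)) :+ (z :- (y :+ h)) :+ h) (seq x n) (seq y n) (seq z n) ε η))
    ; +-mono-<ˡ = λ {x} {y} z (ε , p , lt) → <ℝ-by {z +ℝ x} {z +ℝ y} p (proj₁ lt , λ n h →
        Q.by-nn (Q.nn-sub (from≤ (proj₂ lt n h))) (solve 4 (λ x y z e → z :+ y :- (z :+ x :+ e) := y :- (x :+ e)) (seq x n) (seq y n) (seq z n) ε))
    ; *-pos = λ {x} {y} (ε , p , lt) (η , q , lt′) → <ℝ-by {ιℝ 0ℚᵘ} {x *ℝ y} (Q.*-pos p q) (both lt lt′ λ n a b →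
        Q.≤-resp (≡.sym (ℚₚ.+-identityˡ _)) ≡.refl (Q.*-mono (Q.<⇒≤ p) (Q.<⇒≤ q) (Q.≤-trans (Q.≈⇒≤ (≡.sym (ℚₚ.+-identityˡ ε))) (from≤ a)) (Q.≤-trans (Q.≈⇒≤ (≡.sym (ℚₚ.+-identityˡ η))) (from≤ b))))
    ; tight = λ {x} {y} p q → ≈-by {x} {y} λ {ε} h → both (≮⇒≲ {x} {y} q h) (≮⇒≲ {y} {x} p h) λ n a b →
        Q.by-nn (Q.nn-sub b) (solve 3 (λ x y e → x :- y :- :- e := x :+ e :- y) (seq x n) (seq y n) ε) ,
        Q.by-nn (Q.nn-sub a) (solve 3 (λ x y e → e :- (x :- y) := y :+ e :- x) (seq x n) (seq y n) ε)
    ; inv = Inverse.inverse ; inv-r = Inverse.inverse-r ; inv-pos = Inverse.inverse-pos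
    ; ι-cong = λ {p} {q} e → pointwise {ιℝ p} {ιℝ q} λ _ → ℚₚ.fromℚᵘ-cong e
    ; ι-+ = λ p q → pointwise {ιℝ (p ℚᵘ.+ q)} {ιℝ p +ℝ ιℝ q} λ _ → fromℚᵘ-+ p q
    ; ι-* = λ p q → pointwise {ιℝ (p ℚᵘ.* q)} {ιℝ p *ℝ ιℝ q} λ _ → fromℚᵘ-* p q
    ; ι-neg = λ p → pointwise {ιℝ (ℚᵘ.- p)} { -ℝ ιℝ p} λ _ → fromℚᵘ-neg p
    ; ι-< = λ {p} {q} h → <ℝ-by {ιℝ p} {ιℝ q} (Q.pos-sub (fromℚᵘ-mono-< h)) (0 , λ _ _ → Q.≈⇒≤ (solve 2 (λ a b → a :+ (b :- a) := b) (fromℚᵘ p) (fromℚᵘ q)))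
    ; archimedean = λ x → let b = eventuallyBounded x in suc (proj₁ b) , <ℝ-by {x} {ιℝ (mkℚᵘ (+ suc (proj₁ b)) 0)} (Q.num< {0ℚᵘ} {1ℚᵘ}) (proj₁ (proj₂ b) , λ n h →
        Q.≤-trans (Q.+-mono-≤ (proj₂ (proj₂ (proj₂ b) n h)) Q.≤-refl) (Q.≈⇒≤ (≡.sym (Q.#-suc (proj₁ b)))))
    }

  module Completeness (s : ℕ → ℝ) (C : ℝ)
    (h : ∀ m n → n ℕ.≤ m → OrderedField.Bnd ℝ-ordered C (OrderedField.ν ℝ-ordered n *ℝ (s m +ℝ -ℝ s n))) where

    K : ℕ
    K = proj₁ (eventuallyBounded C)

    -- `K` bounds C. One unit pays for the slack of `≲`, and one each for replacing s m and s n by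
    -- their approximants.
    L : ℚ
    L = Q.# (K ℕ.+ 3)

    modulus : ∀ n → ∃[ N ] (∀ i j → N ℕ.≤ i → N ℕ.≤ j → Bnd (Q.ε n) (seq (s n) i ℚ.- seq (s n) j))
    modulus n = near (s n) (Q.ε-pos n)

    -- A diagonal sequence: the entry of s n at which its later variation is already within 1/(n +
    -- 1).
    l : ℕ → ℚ
    l n = seq (s n) (proj₁ (modulus n))

    l-near : ∀ n → Eventually λ j → Bnd (Q.ε n) (seq (s n) j ℚ.- l n)
    l-near n = proj₁ (modulus n) , λ j hj → proj₂ (modulus n) j _ hj ℕₚ.≤-refl

    s-near : ∀ m n → n ℕ.≤ m → Eventually λ j → Bnd (Q.# (K ℕ.+ 1)) (Q.ν n ℚ.* (seq (s m) j ℚ.- seq (s n) j))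
    s-near m n n≤m = both (proj₂ (eventuallyBounded C)) (both (≮⇒≲ {lo} {mid} (proj₁ (h m n n≤m)) one>0) (≮⇒≲ {mid} {C} (proj₂ (h m n n≤m)) one>0) (λ _ a b → a , b)) λ j (_ , c) (a , b) →
      Q.by-nn (Q.nn-+ (Q.nn-sub a) (Q.nn-sub c)) (≡.trans (≡.cong (λ z → seq mid j ℚ.- ℚ.- z) (Q.#-+ K 1)) (solve 3 (λ x c k′ → x :- :- (k′ :+ k 1) := x :+ k 1 :- :- c :+ (k′ :- c)) (seq mid j) (seq C j) (Q.# K))) ,
      Q.by-nn (Q.nn-+ (Q.nn-sub b) (Q.nn-sub c)) (≡.trans (≡.cong (λ z → z ℚ.- seq mid j) (Q.#-+ K 1)) (solve 3 (λ x c k′ → (k′ :+ k 1) :- x := c :+ k 1 :- x :+ (k′ :- c)) (seq mid j) (seq C j) (Q.# K)))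
      where
      mid = OrderedField.ν ℝ-ordered n *ℝ (s m +ℝ -ℝ s n)
      lo = -ℝ C
      one>0 : 0ℚ ℚ.< 1ℚ
      one>0 = Q.num< {0ℚᵘ} {1ℚᵘ}

    l-fast : ∀ m n → n ℕ.≤ m → Bnd L (Q.ν n ℚ.* (l m ℚ.- l n))
    l-fast m n n≤m = at (both (s-near m n n≤m) (both (l-near m) (l-near n) (λ _ a b → a , b)) (λ _ a b → a , b))
      where
      at : (Eventually λ j → Bnd (Q.# (K ℕ.+ 1)) (Q.ν n ℚ.* (seq (s m) j ℚ.- seq (s n) j)) × Bnd (Q.ε m) (seq (s m) j ℚ.- l m) × Bnd (Q.ε n) (seq (s n) j ℚ.- l n)) → Bnd L (Q.ν n ℚ.* (l m ℚ.- l n))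
      at (J , f) = Q.Bnd-resp (≡.trans (≡.cong₂ ℚ._+_ (Q.#-+ K 1) (≡.trans (≡.cong₂ ℚ._+_ (Q.ν*ε n) (Q.ν*ε n)) ≡.refl)) (≡.trans (solve 1 (λ a → a :+ k 1 :+ (k 1 :+ k 1) := a :+ k 3) (Q.# K)) (≡.sym (Q.#-+ K 3))))
        (solve 5 (λ v sm sn lm ln → v :* (sm :- sn) :+ (v :* (sn :- ln) :- v :* (sm :- lm)) := v :* (lm :- ln)) (Q.ν n) (seq (s m) J) (seq (s n) J) (l m) (l n))
        (Q.Bnd-+ (proj₁ g) (Q.Bnd-- (Q.Bnd-* v (proj₂ (proj₂ g))) (Q.Bnd-* v (Q.Bnd-mono (Q.ε-anti n≤m) (proj₁ (proj₂ g))))))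
        where
        g = f J ℕₚ.≤-refl
        v = Q.Bnd-refl (Q.nn-ν n)

    l-cauchy : IsCauchy l
    l-cauchy = isCauchy {l} λ {η} p → let a = Q.archimedean ((L ℚ.+ L) ℚ.* Q.inv η p) ; N = proj₁ a in N , λ m n hm hn →
      Q.Bnd-mono (small p N (proj₂ a)) (Q.Bnd-resp (≡.sym (ℚₚ.*-distribʳ-+ (Q.ε N) L L)) (solve 3 (λ a b c → a :- c :- (b :- c) := a :- b) (l m) (l n) (l N)) (Q.Bnd-- (Q.unrate N (l-fast m N hm)) (Q.unrate N (l-fast n N hn))))
      where
      small : ∀ {η} (p : 0ℚ ℚ.< η) N → (L ℚ.+ L) ℚ.* Q.inv η p ℚ.< Q.# N → (L ℚ.+ L) ℚ.* Q.ε N Q.≤ η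
      small {η} p N a = Q.≤-trans (Q.≤-resp (solve 2 (λ m e → e :* m := m :* e) (L ℚ.+ L) (Q.ε N)) refl′ (Q.*-monoˡ (Q.ε N) (Q.<⇒≤ (Q.ε-pos N)) le))
        (Q.≈⇒≤ (≡.trans (solve 3 (λ e v h → e :* (v :* h) := (v :* e) :* h) (Q.ε N) (Q.ν N) η) (≡.trans (≡.cong (ℚ._* η) (Q.ν*ε N)) (ℚₚ.*-identityˡ η))))
        where
        refl′ : Q.ε N ℚ.* (Q.ν N ℚ.* η) ≡ Q.ε N ℚ.* (Q.ν N ℚ.* η)
        refl′ = ≡.refl
        le : L ℚ.+ L Q.≤ Q.ν N ℚ.* η
        le = Q.≤-trans (Q.≈⇒≤ (≡.sym (≡.trans (ℚₚ.*-assoc (L ℚ.+ L) _ η) (≡.trans (≡.cong ((L ℚ.+ L) ℚ.*_) (Q.inv-l η p)) (ℚₚ.*-identityʳ (L ℚ.+ L))))))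
          (Q.*-monoʳ η (Q.<⇒≤ p) (Q.≤-trans (Q.<⇒≤ a) (Q.#-≤ (ℕₚ.n≤1+n N))))

    limit : ℝ
    limit = mkℝ l l-cauchy

    D : ℕ
    D = 1 ℕ.+ (K ℕ.+ 3)

    close : ∀ n → OrderedField.Bnd ℝ-ordered (ιℝ (mkℚᵘ (+ D) 0)) (OrderedField.ν ℝ-ordered n *ℝ (s n +ℝ -ℝ limit))
    close n = ≲⇒≮ {lo} {mid} (λ p → J , λ j hj → Q.≤-trans (proj₁ (bound j hj)) (slack p)) ,
              ≲⇒≮ {mid} {hi} (λ p → J , λ j hj → Q.≤-trans (proj₂ (bound j hj)) (slack p))
      where
      hi = ιℝ (mkℚᵘ (+ D) 0)
      lo = -ℝ hi
      mid = OrderedField.ν ℝ-ordered n *ℝ (s n +ℝ -ℝ limit)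
      J = proj₁ (l-near n) ℕ.⊔ n
      slack : ∀ {x e} → 0ℚ ℚ.< e → x Q.≤ x ℚ.+ e
      slack {x} {e} p = Q.by-nn (Q.<⇒≤ p) (solve 2 (λ x e → x :+ e :- x := e) x e)
      bound : ∀ j → J ℕ.≤ j → Bnd (Q.# D) (seq mid j)
      bound j hj = Q.Bnd-resp (≡.trans (≡.cong (ℚ._+ L) (Q.ν*ε n)) (≡.sym (Q.#-+ 1 (K ℕ.+ 3))))
        (solve 4 (λ v a b c → v :* (a :- b) :- v :* (c :- b) := v :* (a :- c)) (Q.ν n) (seq (s n) j) (l n) (l j))
        (Q.Bnd-- (Q.Bnd-* (Q.Bnd-refl (Q.nn-ν n)) (proj₂ (l-near n) j (ℕₚ.m⊔n≤o⇒m≤o _ n hj))) (l-fast j n (ℕₚ.m⊔n≤o⇒n≤o (proj₁ (l-near n)) n hj)))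

  ℝ-field : RealField
  ℝ-field = record { orderedField = ℝ-ordered ; complete = λ s C h → let open Completeness s C h in limit , ιℝ (mkℚᵘ (+ D) 0) , close }

-- Values of the partial expressions in the statement.

open Defs using (ℝ; Partialℂ; real; rat; nat; 𝕚; Σ₀; Σ₁; Σℤ; _⊕_; _⊗_; _⊘_; ⊖_; _⊖_; _↑_; q^)
open ConstructiveReals using (ℝ-field; ιℝ; fromℚᵘ-+; fromℚᵘ-*)

-- The rules by which expressions acquire values; the carrier is kept abstract so that
-- checking their use never unfolds Cauchy sequences.
record Evaluation (R : RealField) : Set₁ where
  open Limits R
  field
    _⇓⟨_,_⟩ : Partialℂ → F → F → Set
    toℝ     : F → ℝ
    real-value : ∀ t → real (toℝ t) ⇓⟨ t , 0# ⟩
    rat-value  : ∀ p → rat (fromℚᵘ p) ⇓⟨ ι p , 0# ⟩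
    𝕚-value    : 𝕚 ⇓⟨ 0# , 1# ⟩
    ⊕-value : ∀ {P Q x y u v a b} → P ⇓⟨ x , y ⟩ → Q ⇓⟨ u , v ⟩ → a ≈ x + u → b ≈ y + v → (P ⊕ Q) ⇓⟨ a , b ⟩
    ⊗-value : ∀ {P Q x y u v a b} → P ⇓⟨ x , y ⟩ → Q ⇓⟨ u , v ⟩ → a ≈ x * u - y * v → b ≈ x * v + y * u → (P ⊗ Q) ⇓⟨ a , b ⟩
    ⊖-value : ∀ {P x y a b} → P ⇓⟨ x , y ⟩ → a ≈ - x → b ≈ - y → (⊖ P) ⇓⟨ a , b ⟩
    -- The equations are the real and imaginary parts of `w *ℂ v` left unsimplified, so that they
    -- instantiate to the definition of `⊘` verbatim.
    ⊘-value : ∀ {P Q x y d a b} → P ⇓⟨ x , y ⟩ → Q ⇓⟨ d , 0# ⟩ → 0# < d → a * d - b * 0# ≈ x → a * 0# + b * d ≈ y → (P ⊘ Q) ⇓⟨ a , b ⟩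
    Σ₀-value : ∀ {P f x} → (∀ n → P n ⇓⟨ f n , 0# ⟩) → Series f x → Σ₀ P ⇓⟨ x , 0# ⟩

module Values (R : RealField) (V : Evaluation R) where
  open Inequality R
  open Evaluation V

  infix 4 _⇓_ _⇓ᵢ_

  _⇓_ _⇓ᵢ_ : Partialℂ → F → Set
  P ⇓ x  = P ⇓⟨ x , 0# ⟩
  P ⇓ᵢ y = P ⇓⟨ 0# , y ⟩

  _⇓⊕_ : ∀ {P Q x u} → P ⇓ x → Q ⇓ u → P ⊕ Q ⇓ x + u
  p ⇓⊕ q = ⊕-value p q refl (solve 0 (k 0 := k 0 :+ k 0))

  _⇓⊗_ : ∀ {P Q x u} → P ⇓ x → Q ⇓ u → P ⊗ Q ⇓ x * u
  _⇓⊗_ {x = x} {u} p q = ⊗-value p q (solve 2 (λ x u → x :* u := x :* u :- k 0 :* k 0) x u) (solve 2 (λ x u → k 0 := x :* k 0 :+ k 0 :* u) x u)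

  ⇓⊖ : ∀ {P x} → P ⇓ x → ⊖ P ⇓ - x
  ⇓⊖ p = ⊖-value p refl (solve 0 (k 0 := :- k 0))

  _⇓⊝_ : ∀ {P Q x u} → P ⇓ x → Q ⇓ u → P ⊖ Q ⇓ x - u
  p ⇓⊝ q = p ⇓⊕ ⇓⊖ q

  ⇓⊘ : ∀ {P Q x d} → P ⇓ x → Q ⇓ d → (d>0 : 0# < d) → P ⊘ Q ⇓ x * inv d d>0
  ⇓⊘ {x = x} {d} p q d>0 = ⊘-value p q d>0
    (trans (solve 3 (λ x d i → x :* i :* d :- k 0 :* k 0 := x :* (d :* i)) x d (inv d d>0)) (trans (*-cong refl (inv-r d d>0)) (*-identityʳ x)))
    (solve 2 (λ x d → x :* k 0 :+ k 0 :* d := k 0) (x * inv d d>0) d)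

  nat⇓ : ∀ n → nat n ⇓ # n
  nat⇓ n = rat-value (mkℚᵘ (+ n) 0)

  _⇓↑_ : ∀ {P x} → P ⇓ x → ∀ n → P ↑ n ⇓ x ^ n
  p ⇓↑ zero  = nat⇓ 1
  p ⇓↑ suc n = p ⇓⊗ (p ⇓↑ n)

  Σ₀⇓ : ∀ {P f g x} → (∀ n → P n ⇓ f n) → (∀ n → f n ≈ g n) → Series g x → Σ₀ P ⇓ x
  Σ₀⇓ {f = f} {g} p e s = Σ₀-value p (Series-cong {g} {f} (λ n → sym (e n)) s)

  rat⇓ : ∀ {r} p → fromℚᵘ p ≡ r → rat r ⇓ ι p
  rat⇓ p ≡.refl = rat-value p

  private
    -- A factorial does not reduce to a successor; abstracting over it together with its `NonZero`
    -- instance allows the match.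
    1/n : ∀ n {{nz : ℕ.NonZero n}} → Σ[ p ∈ ℚᵘ ] fromℚᵘ p ≡ (+ 1 ℚ./ n) × # n * ι p ≈ 1#
    1/n (suc n) = mkℚᵘ (+ 1) n , ≡.refl , ν*ε n

  exp⇓ : ∀ {P x} → P ⇓ x → Defs.exp P ⇓ E x
  exp⇓ {x = x} p = Σ₀⇓ (λ n → let i = 1/n (n !) {{n ℕₚ.!≢0}} in rat⇓ (proj₁ i) (proj₁ (proj₂ i)) ⇓⊗ (p ⇓↑ n))
    (λ n → let i = 1/n (n !) {{n ℕₚ.!≢0}} in trans (*-cong refl (sym (eterm-^ x n)))
      (trans (solve 3 (λ i m e → i :* (m :* e) := m :* i :* e) (ι (proj₁ i)) (# (n !)) (eterm x n)) (trans (*-cong (proj₂ (proj₂ i)) refl) (*-identityˡ _))))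
    (E-series x)

  π⇓ : Defs.π ⇓ π
  π⇓ = nat⇓ 4 ⇓⊗ Σ₀⇓ (λ n → (⇓⊖ (nat⇓ 1) ⇓↑ n) ⇓⊗ rat-value (mkℚᵘ (+ 1) (2 ℕ.* n)))
    (λ n → *-cong refl (≈-reflexive (≡.cong ε (≡.cong (n ℕ.+_) (ℕₚ.+-identityʳ n))))) leibniz-series

  module _ {z : Partialℂ} {s : F} (z⇓ : z ⇓ᵢ s) where

    q^⇓ : ∀ {r c} → rat r ⇓ c → q^ r z ⇓ E (- (π * c * s))
    q^⇓ {r} {c} h = exp⇓ (⊗-value πir z⇓ (solve 2 (λ y s → :- (y :* s) := k 0 :* k 0 :- y :* s) (π * c) s) (solve 2 (λ y s → k 0 := k 0 :* s :+ y :* k 0) (π * c) s))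
      where
      πi : Defs.π ⊗ 𝕚 ⇓ᵢ π
      πi = ⊗-value π⇓ 𝕚-value (solve 1 (λ y → k 0 := y :* k 0 :- k 0 :* k 1) π) (solve 1 (λ y → y := y :* k 1 :+ k 0 :* k 0) π)
      πir : Defs.π ⊗ 𝕚 ⊗ rat r ⇓ᵢ π * c
      πir = ⊗-value πi h (solve 2 (λ y c → k 0 := k 0 :* c :- y :* k 0) π c) (solve 2 (λ y c → y :* c := k 0 :* k 0 :+ y :* c) π c)

    module _ (s>0 : 0# < s) where

      G⇓ : ∀ j → Σ₁ (λ n → nat (Defs.σ j n) ⊗ q^ (+ (2 ℕ.* n) ℚ./ 1) z) ⇓ G j s s>0
      G⇓ j = Σ₀⇓ (λ n → nat⇓ (Defs.σ j (suc n)) ⇓⊗ q^⇓ (nat⇓ (2 ℕ.* suc n)))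
        (λ n → *-cong refl (E-cong (-‿cong (trans (*-cong (*-cong refl (#-* 2 (suc n))) refl) (solve 4 (λ p c n s → p :* (c :* n) :* s := c :* p :* s :* n) π (# 2) (ν n) s)))))
        (Lambert.G-series _ _ j)

      E₂⇓ : Defs.E₂ z ⇓ e₂ s s>0
      E₂⇓ = nat⇓ 1 ⇓⊝ (nat⇓ 24 ⇓⊗ G⇓ 1)

      E₄⇓ : Defs.E₄ z ⇓ e₄ s s>0
      E₄⇓ = nat⇓ 1 ⇓⊕ (nat⇓ 240 ⇓⊗ G⇓ 3)

      E₆⇓ : Defs.E₆ z ⇓ e₆ s s>0
      E₆⇓ = nat⇓ 1 ⇓⊝ (nat⇓ 504 ⇓⊗ G⇓ 5)

      open Thetas (π * s) (*-pos π-pos s>0)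

      private
        u = π * s

        two-sided : ∀ {η x} (T : ℤ → Partialℂ) (f : ℤ → F) (η² : Unit η) → (∀ n → T n ⇓ f n) → (∀ i → f (+ i) ≈ η ^ i * gauss u (# i + x)) →
          (∀ i → f -[1+ i ] ≈ η ^ suc i * gauss u (- # suc i + x)) → Σℤ T ⇓ P η² (*-pos π-pos s>0) x
        two-sided {x = x} T f η² h right left = let (_ , _ , r , l , e) = P-two-sided η² (*-pos π-pos s>0) x in
          ⊕-value (Σ₀⇓ (λ i → h (+ i)) right r) (Σ₀⇓ (λ i → h -[1+ i ]) left l) e (solve 0 (k 0 := k 0 :+ k 0))

        E≈gauss : ∀ {c v} → c ≈ v * v → E (- (π * c * s)) ≈ gauss u v
        E≈gauss {c} {v} e = E-cong (-‿cong (trans (*-cong (*-cong refl e) refl) (solve 3 (λ p s v → p :* (v :* v) :* s := p :* s :* (v :* v)) π s v)))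

        int : ℤ → F
        int n = ι (mkℚᵘ n 0)

        neg-int : ∀ i → int -[1+ i ] ≈ - # suc i
        neg-int i = ι-neg (mkℚᵘ (+ suc i) 0)

        square : ∀ n {v} → int n ≈ v → int (n ℤ.* n) ≈ v * v
        square n e = trans (ι-* (mkℚᵘ n 0) (mkℚᵘ n 0)) (*-cong e e)

        half : ℤ → ℚᵘ
        half n = mkℚᵘ n 0 ℚᵘ.+ mkℚᵘ (+ 1) 1

        q^n² q^half² : ℤ → F
        q^n² n = E (- (π * int (n ℤ.* n) * s))
        q^half² n = E (- (π * ι (half n ℚᵘ.* half n) * s))

        +0 : ∀ {a b} → a ≈ b → a ≈ b + 0#
        +0 e = trans e (sym (+-identityʳ _))

        1^* : ∀ i {a b} → a ≈ b → a ≈ 1# ^ i * b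
        1^* i e = trans e (sym (trans (*-cong (1^ i) refl) (*-identityˡ _)))

        half-square : ∀ n {v} → int n ≈ v → ι (half n ℚᵘ.* half n) ≈ (v + ½) * (v + ½)
        half-square n e = trans (ι-* (half n) (half n)) (*-cong h h)
          where h = trans (ι-+ (mkℚᵘ n 0) (mkℚᵘ (+ 1) 1)) (+-cong e refl)

        q^n²⇓ : ∀ n → q^ ((n ℤ.* n) ℚ./ 1) z ⇓ q^n² n
        q^n²⇓ n = q^⇓ (rat-value (mkℚᵘ (n ℤ.* n) 0))

        q^half²⇓ : ∀ n → q^ ((n ℚ./ 1 ℚ.+ ℚ.½) ℚ.* (n ℚ./ 1 ℚ.+ ℚ.½)) z ⇓ q^half² n
        q^half²⇓ n = q^⇓ (rat⇓ (half n ℚᵘ.* half n) (≡.trans (fromℚᵘ-* (half n) (half n)) (≡.cong₂ ℚ._*_ h h)))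
          where h = fromℚᵘ-+ (mkℚᵘ n 0) (mkℚᵘ (+ 1) 1)

      θ₃⇓ : Defs.θ₃ z ⇓ θ₃
      θ₃⇓ = two-sided _ q^n² unit-1 q^n²⇓
        (λ i → 1^* i (E≈gauss (square (+ i) (+0 refl)))) (λ i → 1^* (suc i) (E≈gauss (square -[1+ i ] (+0 (neg-int i)))))

      θ₄⇓ : Defs.θ₄ z ⇓ θ₄
      θ₄⇓ = two-sided _ (λ n → (- 1#) ^ ℤ.∣ n ∣ * q^n² n) unit-neg (λ n → (⇓⊖ (nat⇓ 1) ⇓↑ ℤ.∣ n ∣) ⇓⊗ q^n²⇓ n)
        (λ i → *-cong refl (E≈gauss (square (+ i) (+0 refl)))) (λ i → *-cong refl (E≈gauss (square -[1+ i ] (+0 (neg-int i)))))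

      θ₂⇓ : Defs.θ₂ z ⇓ θ₂
      θ₂⇓ = two-sided _ q^half² unit-1 q^half²⇓
        (λ i → 1^* i (E≈gauss (half-square (+ i) refl))) (λ i → 1^* (suc i) (E≈gauss (half-square -[1+ i ] (neg-int i))))

  module _ (t : F) (t>0 : 0# < t) where
    open Main t t>0

    private
      it : 𝕚 ⊗ real (toℝ t) ⇓ᵢ t
      it = ⊗-value 𝕚-value (real-value t) (solve 1 (λ t → k 0 := k 0 :* t :- k 1 :* k 0) t) (solve 1 (λ t → t := k 0 :* k 0 :+ k 1 :* t) t)

      i/t : 𝕚 ⊘ real (toℝ t) ⇓ᵢ ti
      i/t = ⊘-value 𝕚-value (real-value t) t>0 (solve 2 (λ t i → k 0 :* t :- i :* k 0 := k 0) t ti)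
        (trans (solve 2 (λ t i → k 0 :* k 0 :+ i :* t := t :* i) t ti) (inv-r t t>0))

      φ⇓ : Defs.φ₀ (𝕚 ⊘ real (toℝ t)) ⇓ φ
      φ⇓ = nat⇓ 1728 ⇓⊗ ⇓⊘ (((E₂⇓ i/t p′ ⇓⊗ E₄⇓ i/t p′) ⇓⊝ E₆⇓ i/t p′) ⇓↑ 2) ((E₄⇓ i/t p′ ⇓↑ 3) ⇓⊝ (E₆⇓ i/t p′ ⇓↑ 2)) Δ′>0

      ψ⇓ : Defs.ψI (𝕚 ⊗ real (toℝ t)) ⇓ ψ
      ψ⇓ = nat⇓ 128 ⇓⊗ (⇓⊘ ((θ₃⇓ it t>0 ⇓↑ 4) ⇓⊕ (θ₄⇓ it t>0 ⇓↑ 4)) (θ₂⇓ it t>0 ⇓↑ 8) θ₂⁸>0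
                    ⇓⊕ ⇓⊘ ((θ₄⇓ it t>0 ⇓↑ 4) ⇓⊝ (θ₂⇓ it t>0 ⇓↑ 4)) (θ₃⇓ it t>0 ⇓↑ 8) θ₃⁸>0)

      π²>0 : 0# < π ^ 2
      π²>0 = pos-^ 2 π-pos

      36/π² ψ-term φ-term : F
      36/π² = # 36 * inv (π ^ 2) π²>0
      ψ-term = 36/π² * ψ
      φ-term = t ^ 2 * φ

      φ-term⇓ : ⊖ (real (toℝ t) ↑ 2 ⊗ Defs.φ₀ (𝕚 ⊘ real (toℝ t))) ⇓ - φ-term
      φ-term⇓ = ⇓⊖ ((real-value t ⇓↑ 2) ⇓⊗ φ⇓)

      ψ-term⇓ : nat 36 ⊘ Defs.π ↑ 2 ⊗ Defs.ψI (𝕚 ⊗ real (toℝ t)) ⇓ ψ-term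
      ψ-term⇓ = ⇓⊘ (nat⇓ 36) (π⇓ ⇓↑ 2) π²>0 ⇓⊗ ψ⇓

      ψ-term>0 : 0# < ψ-term
      ψ-term>0 = *-pos (*-pos num< (inv-pos _ π²>0)) ψ>0

    A-negative : Σ[ a ∈ F ] (Defs.A (toℝ t) ⇓ a × a < 0#)
    A-negative = _ , φ-term⇓ ⇓⊝ ψ-term⇓ , by-pos (pos-+-nn ψ-term>0 (nn-* (nn-^ 2 (<⇒≤ t>0)) φ≥0))
      (solve 2 (λ f s → k 0 :- (:- f :- s) := s :+ f) φ-term ψ-term)

    B-positive : Σ[ b ∈ F ] (Defs.B (toℝ t) ⇓ b × 0# < b)
    B-positive = _ , φ-term⇓ ⇓⊕ ψ-term⇓ , pos-cancel π²>0 (<-resp refl (begin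
      # 36 * ψ - π * π * φ-term
        ≈⟨ +-cong (sym (trans (*-cong refl (inv-r _ π²>0)) (*-identityʳ _))) refl ⟩
      # 36 * ψ * (π ^ 2 * inv (π ^ 2) π²>0) - π * π * φ-term
        ≈⟨ solve 4 (λ p i s f → k 36 :* s :* (p :^ 2 :* i) :- p :* p :* f := p :^ 2 :* (:- f :+ k 36 :* i :* s)) π (inv (π ^ 2) π²>0) ψ φ-term ⟩
      π ^ 2 * (- φ-term + ψ-term) ∎) gap)
      where open import Relation.Binary.Reasoning.Setoid setoid

-- The evaluation rules for Cauchy reals, and the conclusion.

open import Defs

private
  module L = Limits ℝ-field

  -- The imaginary part stays a literal sum of zeros, equal to zero only up to `_≈ℝ_`; `hasSum`
  -- therefore needs a limit for it as well.
  real-partialSum : ∀ f n → partialSum (λ i → f i +i 0ℝ) n ≡ L.sum f n +i L.sum (λ _ → 0ℝ) n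
  real-partialSum f zero    = ≡.refl
  real-partialSum f (suc n) = ≡.cong (_+ℂ (f n +i 0ℝ)) (real-partialSum f n)

  hasSum : ∀ {f x} → L.Series f x → HasSum (λ n → f n +i 0ℝ) (x +i 0ℝ)
  hasSum {f} {x} s ε p = N , λ n hn → ≡.subst (λ z → (∣ re z - x ∣< ε) × (∣ im z - 0ℝ ∣< ε)) (≡.sym (real-partialSum f n))
      (proj₂ a n (ℕₚ.m⊔n≤o⇒m≤o (proj₁ a) (proj₁ b) hn) , proj₂ b n (ℕₚ.m⊔n≤o⇒n≤o (proj₁ a) (proj₁ b) hn))
    where
    0<ε : 0ℝ <ℝ fromℚ ε
    0<ε = ε , p , 0 , λ _ _ → ℚₚ.≤-reflexive (ℚₚ.+-identityˡ ε)
    a = L.⟶-eventually {L.sum f} {x} {fromℚ ε} s 0<ε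
    zeros : L.Series (λ _ → 0ℝ) 0ℝ
    zeros = L.⟶-cong {λ _ → 0ℝ} {L.sum (λ _ → 0ℝ)} {0ℝ} {0ℝ} (λ n → L.sym {L.sum (λ _ → 0ℝ) n} {0ℝ} (L.sum-0 n)) (L.refl {0ℝ}) (L.⟶-const 0ℝ)
    b = L.⟶-eventually {L.sum (λ _ → 0ℝ)} {0ℝ} {fromℚ ε} zeros 0<ε
    N = proj₁ a ℕ.⊔ proj₁ b

evaluation : Evaluation ℝ-field
evaluation = record
  { _⇓⟨_,_⟩ = λ P x y → P (x +i y)
  ; toℝ = λ t → t
  ; real-value = λ t → L.refl {t} , L.refl {0ℝ}
  ; rat-value = λ p → L.refl {ιℝ p} , L.refl {0ℝ}
  ; 𝕚-value = L.refl {0ℝ} , L.refl {L.1#}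
  ; ⊕-value = λ p q a b → _ , _ , p , q , a , b
  ; ⊗-value = λ p q a b → _ , _ , p , q , a , b
  ; ⊖-value = λ p a b → _ , p , a , b
  ; ⊘-value = λ p q d>0 a b → _ , _ , p , q , inj₁ (inj₂ d>0) , a , b
  ; Σ₀-value = λ {P} {f} {x} p s → (λ n → f n +i 0ℝ) , p , hasSum {f} {x} s
  }

theorem1 : (t : ℝ) → 0ℝ <ℝ t →
    (Σ[ a ∈ ℝ ] (A t ⇓ a × a <ℝ 0ℝ)) × (Σ[ b ∈ ℝ ] (B t ⇓ b × 0ℝ <ℝ b))
theorem1 t t>0 = A-negative t t>0 , B-positive t t>0
  where open Values ℝ-field evaluation
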